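{- Let $\varepsilon > 0$ be a constant and consider the random graph process $\{G_i\}_{i=0}^{\binom{n}{2}}$ on $n$ vertices. Then with high probability (as $n\to\infty$) the following holds simultaneously for every integer $m$ with $\frac{1+\varepsilon}{6}\, n\log n \le m \le \binom{n}{2}$: the giant (largest connected component) of $G_m$ is $(1/2-\varepsilon)$-resilient with respect to connectivity.
   Context: Random graph process: $G_0$ is the empty graph on $n$ vertices; for each $i\in\{1,\dots,\binom n2\}$, $G_i$ is obtained from $G_{i-1}$ by adding an edge $e\notin E(G_{i-1})$ chosen uniformly at random among the missing edges. Thus $\{G_i\}$ is a random nested sequence ending in the complete graph. With high probability: with probability tending to $1$ as $n\to\infty$. $\log$ is the natural logarithm. The giant of a graph is its largest connected component (regarded as a graph on its own vertex set). $\alpha$-resilience: Let $G=(V,E)$ be a graph, $\mathcal P$ a monotone increasing graph property, and $\alpha$ a real constant. $G$ is $\alpha$-resilient with respect to $\mathcal P$ if for every spanning subgraph $H\subseteq G$ satisfying $\deg_H(v)\le \alpha\deg_G(v)$ for all $v\in V$, we have $G-H\in\mathcal P$, where $G-H$ is the graph on $V$ with edge set $E(G)\setminus E(H)$. -}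

module Defs where

import Algebra.Definitions.RawSemiring
open import Data.Bool.Base using (Bool; true; false; T; not; _∧_; _∨_; if_then_else_)
open import Data.Bool.Properties as Bool using (∧-comm; ∨-comm)
open import Data.Empty using (⊥-elim)
open import Data.Fin.Base as Fin using (Fin; zero; suc)
open import Data.Fin.Properties as Fin using (_≟_; _<?_)
open import Data.Fin.Subset using (Subset; Nonempty; inside; outside; _∈_; ∣_∣)
open import Data.Integer.Base as ℤ using (+_)
import Data.Integer.Properties as ℤ
open import Data.List.Base as List using (List; []; _∷_; allFin; concatMap; filter; foldr; length)
open import Data.Nat.Base as ℕ using (ℕ; zero; suc)
import Data.Nat.Properties as ℕ
open import Data.Product.Base using (Σ-syntax; ∃-syntax; _×_; _,_; proj₁; proj₂)
open import Data.Rational.Base as ℚ using (ℚ; 0ℚ; 1ℚ; ½; _/_; mkℚ; Positive)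
import Data.Rational.Properties as ℚ
open import Data.Rational.Solver using (module +-*-Solver)
open import Data.Rational.Unnormalised.Base as ℚᵘ using (mkℚᵘ)
import Data.Rational.Unnormalised.Properties as ℚᵘ
open import Data.Sum.Base using (_⊎_; inj₁; inj₂)
open import Data.Vec.Base as Vec using (Vec; []; _∷_; _∷ʳ_; last; tabulate)
open import Function.Bundles using (_⇔_)
open import Relation.Binary.Construct.Closure.ReflexiveTransitive as Star using (Star)
open import Relation.Binary.PropositionalEquality
  using (_≡_; refl; sym; trans; cong; cong₂; subst; subst₂; module ≡-Reasoning)
open import Relation.Nullary using (does; yes; no)

Cauchy : (ℕ → ℚ) → Set
Cauchy x = ∀ ε → 0ℚ ℚ.< ε →
           ∃[ N ] (∀ m n → N ℕ.≤ m → N ℕ.≤ n → ℚ.∣ x m ℚ.- x n ∣ ℚ.≤ ε)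

-- Distinct sequences may represent the same real; only _≤ᴿ_ and _<ᴿ_ are used
-- to compare reals.
record ℝ : Set where
  constructor mkℝ
  field
    seq    : ℕ → ℚ
    cauchy : Cauchy seq

open ℝ public

infix 4 _≤ᴿ_ _<ᴿ_
infixl 6 _+ᴿ_ _-ᴿ_
infixl 7 _*ᴿ_

_≤ᴿ_ : ℝ → ℝ → Set
x ≤ᴿ y = ∀ ε → 0ℚ ℚ.< ε → ∃[ N ] (∀ n → N ℕ.≤ n → seq x n ℚ.≤ seq y n ℚ.+ ε)

_<ᴿ_ : ℝ → ℝ → Set
x <ᴿ y = ∃[ ε ] (0ℚ ℚ.< ε × ∃[ N ] (∀ n → N ℕ.≤ n → seq x n ℚ.+ ε ℚ.≤ seq y n))

private
  open +-*-Solver using (solve; _:=_; _:+_; _:*_; :-_; _:-_; con)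

  0<½* : ∀ {ε} → 0ℚ ℚ.< ε → 0ℚ ℚ.< ½ ℚ.* ε
  0<½* {ε} 0<ε = ℚ.positive⁻¹ _ {{ℚ.pos*pos⇒pos ½ ε {{ℚ.positive 0<ε}}}}

  halves : ∀ ε → ½ ℚ.* ε ℚ.+ ½ ℚ.* ε ≡ ε
  halves ε = trans (sym (ℚ.*-distribʳ-+ ε ½ ½)) (ℚ.*-identityˡ ε)

  *-mono-nonNeg : ∀ {a b c d} → 0ℚ ℚ.≤ b → 0ℚ ℚ.≤ c →
                  a ℚ.≤ c → b ℚ.≤ d → a ℚ.* b ℚ.≤ c ℚ.* d
  *-mono-nonNeg {a} {b} {c} {d} 0≤b 0≤c a≤c b≤d = ℚ.≤-trans
    (ℚ.*-monoʳ-≤-nonNeg b {{ℚ.nonNegative 0≤b}} a≤c)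
    (ℚ.*-monoˡ-≤-nonNeg c {{ℚ.nonNegative 0≤c}} b≤d)

  +-cauchy : ∀ {x y} → Cauchy x → Cauchy y → Cauchy (λ n → x n ℚ.+ y n)
  +-cauchy {x} {y} cx cy ε 0<ε = M ℕ.⊔ N , λ m n p q → begin
    ℚ.∣ (x m ℚ.+ y m) ℚ.- (x n ℚ.+ y n) ∣
      ≡⟨ cong ℚ.∣_∣ (solve 4 (λ a b c d → (a :+ b) :- (c :+ d) := (a :- c) :+ (b :- d))
                       refl (x m) (y m) (x n) (y n)) ⟩
    ℚ.∣ (x m ℚ.- x n) ℚ.+ (y m ℚ.- y n) ∣
      ≤⟨ ℚ.∣p+q∣≤∣p∣+∣q∣ (x m ℚ.- x n) (y m ℚ.- y n) ⟩
    ℚ.∣ x m ℚ.- x n ∣ ℚ.+ ℚ.∣ y m ℚ.- y n ∣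
      ≤⟨ ℚ.+-mono-≤ (hM m n (ℕ.m⊔n≤o⇒m≤o M N p) (ℕ.m⊔n≤o⇒m≤o M N q))
                    (hN m n (ℕ.m⊔n≤o⇒n≤o M N p) (ℕ.m⊔n≤o⇒n≤o M N q)) ⟩
    ½ ℚ.* ε ℚ.+ ½ ℚ.* ε ≡⟨ halves ε ⟩
    ε ∎
    where
    open ℚ.≤-Reasoning
    M  = proj₁ (cx (½ ℚ.* ε) (0<½* 0<ε))
    hM = proj₂ (cx (½ ℚ.* ε) (0<½* 0<ε))
    N  = proj₁ (cy (½ ℚ.* ε) (0<½* 0<ε))
    hN = proj₂ (cy (½ ℚ.* ε) (0<½* 0<ε))

  neg-cauchy : ∀ {x} → Cauchy x → Cauchy (λ n → ℚ.- x n)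
  neg-cauchy {x} cx ε 0<ε = proj₁ (cx ε 0<ε) , λ m n p q →
    subst (λ z → ℚ.∣ z ∣ ℚ.≤ ε)
      (solve 2 (λ a b → b :- a := (:- a) :- (:- b)) refl (x m) (x n))
      (proj₂ (cx ε 0<ε) n m q p)

  const-cauchy : ∀ q → Cauchy (λ _ → q)
  const-cauchy q ε 0<ε = 0 , λ _ _ _ _ →
    subst (λ z → ℚ.∣ z ∣ ℚ.≤ ε) (sym (ℚ.+-inverseʳ q)) (ℚ.<⇒≤ 0<ε)

  0<1 : 0ℚ ℚ.< 1ℚ
  0<1 = ℚ.positive⁻¹ 1ℚ

  bounded : ∀ {x} → Cauchy x →
            ∃[ N ] ∃[ B ] (0ℚ ℚ.≤ B × (∀ n → N ℕ.≤ n → ℚ.∣ x n ∣ ℚ.≤ B))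
  bounded {x} cx = N , 1ℚ ℚ.+ ℚ.∣ x N ∣ ,
    ℚ.+-mono-≤ (ℚ.<⇒≤ 0<1) (ℚ.0≤∣p∣ (x N)) , λ n p → begin
      ℚ.∣ x n ∣
        ≡⟨ cong ℚ.∣_∣ (solve 2 (λ a b → a := (a :- b) :+ b) refl (x n) (x N)) ⟩
      ℚ.∣ (x n ℚ.- x N) ℚ.+ x N ∣
        ≤⟨ ℚ.∣p+q∣≤∣p∣+∣q∣ (x n ℚ.- x N) (x N) ⟩
      ℚ.∣ x n ℚ.- x N ∣ ℚ.+ ℚ.∣ x N ∣
        ≤⟨ ℚ.+-monoˡ-≤ ℚ.∣ x N ∣ (proj₂ (cx 1ℚ 0<1) n N p ℕ.≤-refl) ⟩
      1ℚ ℚ.+ ℚ.∣ x N ∣ ∎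
    where
    open ℚ.≤-Reasoning
    N = proj₁ (cx 1ℚ 0<1)

  shrink : ∀ {C ε} → 0ℚ ℚ.≤ C → 0ℚ ℚ.< ε → ∃[ δ ] (0ℚ ℚ.< δ × C ℚ.* δ ℚ.≤ ε)
  shrink {C} {ε} 0≤C 0<ε = ℚ.1/ D ℚ.* ε , ℚ.positive⁻¹ (ℚ.1/ D ℚ.* ε) {{δ⁺}} , (begin
    C ℚ.* (ℚ.1/ D ℚ.* ε)   ≤⟨ ℚ.*-monoʳ-≤-nonNeg (ℚ.1/ D ℚ.* ε) {{ℚ.pos⇒nonNeg (ℚ.1/ D ℚ.* ε) {{δ⁺}}}} C≤D ⟩
    D ℚ.* (ℚ.1/ D ℚ.* ε)   ≡⟨ ℚ.*-assoc D (ℚ.1/ D) ε ⟨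
    (D ℚ.* ℚ.1/ D) ℚ.* ε   ≡⟨ cong (ℚ._* ε) (ℚ.*-inverseʳ D) ⟩
    1ℚ ℚ.* ε               ≡⟨ ℚ.*-identityˡ ε ⟩
    ε                      ∎)
    where
    open ℚ.≤-Reasoning
    D : ℚ
    D = 1ℚ ℚ.+ C
    D⁺ : Positive D
    D⁺ = ℚ.pos+nonNeg⇒pos 1ℚ C {{ℚ.nonNegative 0≤C}}
    instance
      D≠0 : ℚ.NonZero D
      D≠0 = ℚ.pos⇒nonZero D {{D⁺}}
    δ⁺ : Positive (ℚ.1/ D ℚ.* ε)
    δ⁺ = ℚ.pos*pos⇒pos (ℚ.1/ D) {{ℚ.1/pos⇒pos D {{D⁺}}}} ε {{ℚ.positive 0<ε}}
    C≤D : C ℚ.≤ D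
    C≤D = subst (ℚ._≤ D) (ℚ.+-identityˡ C) (ℚ.+-monoˡ-≤ C (ℚ.<⇒≤ 0<1))

  *-diff : ∀ {A B δ} a b c d → 0ℚ ℚ.≤ A → 0ℚ ℚ.≤ B →
           ℚ.∣ a ∣ ℚ.≤ A → ℚ.∣ d ∣ ℚ.≤ B → ℚ.∣ a ℚ.- c ∣ ℚ.≤ δ → ℚ.∣ b ℚ.- d ∣ ℚ.≤ δ →
           ℚ.∣ a ℚ.* b ℚ.- c ℚ.* d ∣ ℚ.≤ (A ℚ.+ B) ℚ.* δ
  *-diff {A} {B} {δ} a b c d 0≤A 0≤B hA hB hX hY = begin
    ℚ.∣ a ℚ.* b ℚ.- c ℚ.* d ∣
      ≡⟨ cong ℚ.∣_∣ (solve 4 (λ a b c d → a :* b :- c :* d := a :* (b :- d) :+ d :* (a :- c))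
                       refl a b c d) ⟩
    ℚ.∣ a ℚ.* (b ℚ.- d) ℚ.+ d ℚ.* (a ℚ.- c) ∣
      ≤⟨ ℚ.∣p+q∣≤∣p∣+∣q∣ (a ℚ.* (b ℚ.- d)) (d ℚ.* (a ℚ.- c)) ⟩
    ℚ.∣ a ℚ.* (b ℚ.- d) ∣ ℚ.+ ℚ.∣ d ℚ.* (a ℚ.- c) ∣
      ≡⟨ cong₂ ℚ._+_ (ℚ.∣p*q∣≡∣p∣*∣q∣ a (b ℚ.- d)) (ℚ.∣p*q∣≡∣p∣*∣q∣ d (a ℚ.- c)) ⟩
    ℚ.∣ a ∣ ℚ.* ℚ.∣ b ℚ.- d ∣ ℚ.+ ℚ.∣ d ∣ ℚ.* ℚ.∣ a ℚ.- c ∣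
      ≤⟨ ℚ.+-mono-≤ (*-mono-nonNeg (ℚ.0≤∣p∣ (b ℚ.- d)) 0≤A hA hY)
                    (*-mono-nonNeg (ℚ.0≤∣p∣ (a ℚ.- c)) 0≤B hB hX) ⟩
    A ℚ.* δ ℚ.+ B ℚ.* δ
      ≡⟨ ℚ.*-distribʳ-+ δ A B ⟨
    (A ℚ.+ B) ℚ.* δ ∎
    where open ℚ.≤-Reasoning

  ⊔-split : ∀ M N {k} → M ℕ.⊔ N ℕ.≤ k → M ℕ.≤ k × N ℕ.≤ k
  ⊔-split M N p = ℕ.m⊔n≤o⇒m≤o M N p , ℕ.m⊔n≤o⇒n≤o M N p

  *-cauchy : ∀ {x y} → Cauchy x → Cauchy y → Cauchy (λ n → x n ℚ.* y n)
  *-cauchy {x} {y} cx cy ε 0<ε =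
    let M , A , 0≤A , hA = bounded cx
        N , B , 0≤B , hB = bounded cy
        δ , 0<δ , hδ     = shrink {A ℚ.+ B} {ε} (ℚ.+-mono-≤ {0ℚ} {A} {0ℚ} {B} 0≤A 0≤B) 0<ε
        X , hX           = cx δ 0<δ
        Y , hY           = cy δ 0<δ
    in (M ℕ.⊔ N) ℕ.⊔ (X ℕ.⊔ Y) , λ m n p q →
      let MNm , XYm = ⊔-split (M ℕ.⊔ N) (X ℕ.⊔ Y) p
          MNn , XYn = ⊔-split (M ℕ.⊔ N) (X ℕ.⊔ Y) q
          Mm  , _   = ⊔-split M N MNm
          _   , Nn  = ⊔-split M N MNn
          Xm  , Ym  = ⊔-split X Y XYm
          Xn  , Yn  = ⊔-split X Y XYn
      in ℚ.≤-trans
        (*-diff {A} {B} {δ} (x m) (y m) (x n) (y n) 0≤A 0≤B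
          (hA m Mm) (hB n Nn) (hX m n Xm Xn) (hY m n Ym Yn))
        hδ

fromℚ : ℚ → ℝ
fromℚ q = mkℝ (λ _ → q) (const-cauchy q)

fromℕ : ℕ → ℝ
fromℕ n = fromℚ (+ n / 1)

_+ᴿ_ _-ᴿ_ _*ᴿ_ : ℝ → ℝ → ℝ
x +ᴿ y = mkℝ (λ n → seq x n ℚ.+ seq y n) (+-cauchy {seq x} {seq y} (cauchy x) (cauchy y))
x -ᴿ y = mkℝ (λ n → seq x n ℚ.+ ℚ.- seq y n) (+-cauchy {seq x} {λ n → ℚ.- seq y n} (cauchy x) (neg-cauchy {seq y} (cauchy y)))
x *ᴿ y = mkℝ (λ n → seq x n ℚ.* seq y n) (*-cauchy {seq x} {seq y} (cauchy x) (cauchy y))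

open Algebra.Definitions.RawSemiring ℚ.+-*-rawSemiring using (_^_)

mercator : ℚ → ℕ → ℚ
mercator t zero    = 0ℚ
mercator t (suc k) = mercator t k ℚ.+ t ^ suc k ℚ.* (+ 1 / suc k)

private
  toℚᵘ-/ : ∀ a k → ℚ.toℚᵘ (+ a / suc k) ℚᵘ.≃ mkℚᵘ (+ a) k
  toℚᵘ-/ a k = ℚ.toℚᵘ-fromℚᵘ (mkℚᵘ (+ a) k)

  /-mono : ∀ a b k l → a ℕ.* suc l ℕ.≤ b ℕ.* suc k → + a / suc k ℚ.≤ + b / suc l
  /-mono a b k l h = ℚ.toℚᵘ-cancel-≤ (begin
    ℚ.toℚᵘ (+ a / suc k) ≃⟨ toℚᵘ-/ a k ⟩
    mkℚᵘ (+ a) k         ≤⟨ ℚᵘ.*≤* (subst₂ ℤ._≤_ (ℤ.pos-* a (suc l)) (ℤ.pos-* b (suc k)) (ℤ.+≤+ h)) ⟩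
    mkℚᵘ (+ b) l         ≃⟨ toℚᵘ-/ b l ⟨
    ℚ.toℚᵘ (+ b / suc l) ∎)
    where open ℚᵘ.≤-Reasoning

  /-def : ∀ a k → (+ a / 1) ℚ.* (+ 1 / suc k) ≡ + a / suc k
  /-def a k = ℚ.toℚᵘ-injective (begin
    ℚ.toℚᵘ ((+ a / 1) ℚ.* (+ 1 / suc k))
      ≈⟨ ℚ.toℚᵘ-homo-* (+ a / 1) (+ 1 / suc k) ⟩
    ℚ.toℚᵘ (+ a / 1) ℚᵘ.* ℚ.toℚᵘ (+ 1 / suc k)
      ≈⟨ ℚᵘ.*-cong (toℚᵘ-/ a 0) (toℚᵘ-/ 1 k) ⟩
    mkℚᵘ (+ a) 0 ℚᵘ.* mkℚᵘ (+ 1) k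
      ≈⟨ ℚᵘ.*≡* (cong₂ ℤ._*_ (ℤ.*-identityʳ (+ a)) (cong (λ z → + suc z) (sym (ℕ.+-identityʳ k)))) ⟩
    mkℚᵘ (+ a) k
      ≈⟨ toℚᵘ-/ a k ⟨
    ℚ.toℚᵘ (+ a / suc k) ∎)
    where open import Relation.Binary.Reasoning.Setoid ℚᵘ.≃-setoid

  module Mercator (p : ℕ) where
    n t : ℚ
    n = + suc p / 1
    t = 1ℚ ℚ.- + 1 / suc p

    R : ℕ → ℚ
    R k = + 1 / suc k

    R≥0 : ∀ k → 0ℚ ℚ.≤ R k
    R≥0 k = /-mono 0 1 0 k ℕ.z≤n

    n≥0 : 0ℚ ℚ.≤ n
    n≥0 = /-mono 0 (suc p) 0 0 ℕ.z≤n

    t≥0 : 0ℚ ℚ.≤ t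
    t≥0 = subst (ℚ._≤ t) (ℚ.+-inverseʳ (R p))
      (ℚ.+-monoˡ-≤ (ℚ.- R p) (/-mono 1 1 p 0 (ℕ.s≤s ℕ.z≤n)))

    t≤1 : t ℚ.≤ 1ℚ
    t≤1 = subst (t ℚ.≤_) (ℚ.+-identityʳ 1ℚ) (ℚ.+-monoʳ-≤ 1ℚ (ℚ.neg-antimono-≤ (R≥0 p)))

    pow≥0 : ∀ k → 0ℚ ℚ.≤ t ^ k
    pow≥0 zero    = ℚ.<⇒≤ 0<1
    pow≥0 (suc k) = subst (ℚ._≤ t ℚ.* t ^ k) (ℚ.*-zeroˡ 0ℚ)
      (*-mono-nonNeg ℚ.≤-refl t≥0 t≥0 (pow≥0 k))

    pow≤1 : ∀ k → t ^ k ℚ.≤ 1ℚ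
    pow≤1 zero    = ℚ.≤-refl
    pow≤1 (suc k) = *-mono-nonNeg (pow≥0 k) (ℚ.<⇒≤ 0<1) t≤1 (pow≤1 k)

    nR≡1 : n ℚ.* R p ≡ 1ℚ
    nR≡1 = trans (/-def (suc p) p)
      (ℚ.≤-antisym (/-mono (suc p) 1 p 0 (ℕ.≤-reflexive (ℕ.*-comm (suc p) 1)))
                   (/-mono 1 (suc p) 0 p (ℕ.≤-reflexive (ℕ.*-comm 1 (suc p)))))

    1+nt≡n : 1ℚ ℚ.+ n ℚ.* t ≡ n
    1+nt≡n = begin
      1ℚ ℚ.+ n ℚ.* (1ℚ ℚ.- R p)
        ≡⟨ cong (1ℚ ℚ.+_) (ℚ.*-distribˡ-+ n 1ℚ (ℚ.- R p)) ⟩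
      1ℚ ℚ.+ (n ℚ.* 1ℚ ℚ.+ n ℚ.* ℚ.- R p)
        ≡⟨ cong₂ (λ a b → 1ℚ ℚ.+ (a ℚ.+ b)) (ℚ.*-identityʳ n)
             (trans (sym (ℚ.neg-distribʳ-* n (R p))) (cong ℚ.-_ nR≡1)) ⟩
      1ℚ ℚ.+ (n ℚ.- 1ℚ)
        ≡⟨ solve 2 (λ a b → a :+ (b :- a) := b) refl 1ℚ n ⟩
      n ∎
      where open ≡-Reasoning

    S U : ℕ → ℚ
    S k = mercator t k
    U k = S k ℚ.+ n ℚ.* (t ^ suc k ℚ.* R k)

    term≥0 : ∀ a k → 0ℚ ℚ.≤ t ^ a ℚ.* R k
    term≥0 a k = subst (ℚ._≤ t ^ a ℚ.* R k) (ℚ.*-zeroˡ 0ℚ)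
      (*-mono-nonNeg {0ℚ} {0ℚ} {t ^ a} {R k} ℚ.≤-refl (pow≥0 a) (pow≥0 a) (R≥0 k))

    S-step : ∀ k → S k ℚ.≤ S (suc k)
    S-step k = subst (ℚ._≤ S (suc k)) (ℚ.+-identityʳ (S k))
      (ℚ.+-monoʳ-≤ (S k) (term≥0 (suc k) k))

    U-step : ∀ k → U (suc k) ℚ.≤ U k
    U-step k = begin
      (S k ℚ.+ w ℚ.* R k) ℚ.+ n ℚ.* ((t ℚ.* w) ℚ.* R (suc k))
        ≤⟨ ℚ.+-monoʳ-≤ (S k ℚ.+ w ℚ.* R k)
             (ℚ.*-monoˡ-≤-nonNeg n {{ℚ.nonNegative n≥0}}
               (ℚ.*-monoˡ-≤-nonNeg (t ℚ.* w) {{ℚ.nonNegative (pow≥0 (suc (suc k)))}}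
                 (/-mono 1 1 (suc k) k (ℕ.*-monoʳ-≤ 1 (ℕ.n≤1+n (suc k)))))) ⟩
      (S k ℚ.+ w ℚ.* R k) ℚ.+ n ℚ.* ((t ℚ.* w) ℚ.* R k)
        ≡⟨ lemma (S k) w (R k) n t ⟩
      S k ℚ.+ (1ℚ ℚ.+ n ℚ.* t) ℚ.* (w ℚ.* R k)
        ≡⟨ cong (λ z → S k ℚ.+ z ℚ.* (w ℚ.* R k)) 1+nt≡n ⟩
      S k ℚ.+ n ℚ.* (w ℚ.* R k) ∎
      where
      open ℚ.≤-Reasoning
      w : ℚ
      w = t ^ suc k
      lemma : ∀ s w r n t → (s ℚ.+ w ℚ.* r) ℚ.+ n ℚ.* ((t ℚ.* w) ℚ.* r)
                          ≡ s ℚ.+ (1ℚ ℚ.+ n ℚ.* t) ℚ.* (w ℚ.* r)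
      lemma = solve 5 (λ s w r n t → (s :+ w :* r) :+ n :* ((t :* w) :* r)
                                  := s :+ (con 1ℚ :+ n :* t) :* (w :* r)) refl

    S≤U : ∀ k → S k ℚ.≤ U k
    S≤U k = subst (ℚ._≤ U k) (ℚ.+-identityʳ (S k)) (ℚ.+-monoʳ-≤ (S k)
      (subst (ℚ._≤ n ℚ.* (t ^ suc k ℚ.* R k)) (ℚ.*-zeroʳ n)
        (ℚ.*-monoˡ-≤-nonNeg n {{ℚ.nonNegative n≥0}} (term≥0 (suc k) k))))

    S-mono : ∀ {k l} → k ℕ.≤′ l → S k ℚ.≤ S l
    S-mono ℕ.≤′-refl            = ℚ.≤-refl
    S-mono (ℕ.≤′-step {n = l} h) = ℚ.≤-trans (S-mono h) (S-step l)

    U-anti : ∀ {k l} → k ℕ.≤′ l → U l ℚ.≤ U k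
    U-anti ℕ.≤′-refl            = ℚ.≤-refl
    U-anti (ℕ.≤′-step {n = l} h) = ℚ.≤-trans (U-step l) (U-anti h)

    width : ∀ k → n ℚ.* (t ^ suc k ℚ.* R k) ℚ.≤ + suc p / suc k
    width k = begin
      n ℚ.* (t ^ suc k ℚ.* R k)
        ≤⟨ ℚ.*-monoˡ-≤-nonNeg n {{ℚ.nonNegative n≥0}}
             (ℚ.*-monoʳ-≤-nonNeg (R k) {{ℚ.nonNegative (R≥0 k)}} (pow≤1 (suc k))) ⟩
      n ℚ.* (1ℚ ℚ.* R k) ≡⟨ cong (n ℚ.*_) (ℚ.*-identityˡ (R k)) ⟩
      n ℚ.* R k          ≡⟨ /-def (suc p) k ⟩
      + suc p / suc k    ∎
      where open ℚ.≤-Reasoning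

    near : ∀ {k l} → k ℕ.≤ l → ℚ.∣ S l ℚ.- S k ∣ ℚ.≤ + suc p / suc k
    near {k} {l} k≤l = begin
      ℚ.∣ S l ℚ.- S k ∣
        ≡⟨ ℚ.0≤p⇒∣p∣≡p (subst (ℚ._≤ S l ℚ.- S k) (ℚ.+-inverseʳ (S k))
             (ℚ.+-monoˡ-≤ (ℚ.- S k) (S-mono (ℕ.≤⇒≤′ k≤l)))) ⟩
      S l ℚ.- S k
        ≤⟨ ℚ.+-monoˡ-≤ (ℚ.- S k) (ℚ.≤-trans (S≤U l) (U-anti (ℕ.≤⇒≤′ k≤l))) ⟩
      U k ℚ.- S k
        ≡⟨ solve 2 (λ s u → (s :+ u) :- s := u) refl (S k) (n ℚ.* (t ^ suc k ℚ.* R k)) ⟩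
      n ℚ.* (t ^ suc k ℚ.* R k)
        ≤⟨ width k ⟩
      + suc p / suc k ∎
      where open ℚ.≤-Reasoning

    archimedean : ∀ ε → 0ℚ ℚ.< ε → ∃[ N ] (∀ k → N ℕ.≤ k → + suc p / suc k ℚ.≤ ε)
    archimedean ε@(mkℚ (+ suc a) d _) _ = suc p ℕ.* suc d , λ k h →
      subst (+ suc p / suc k ℚ.≤_) (ℚ.↥p/↧p≡p ε)
        (/-mono (suc p) (suc a) k d
          (ℕ.≤-trans h (ℕ.≤-trans (ℕ.n≤1+n k) (ℕ.m≤m+n (suc k) (a ℕ.* suc k)))))
    archimedean (mkℚ (+ zero) d _)     0<ε = ⊥-elim (ℤ.<-irrefl refl (ℚ.drop-*<* 0<ε))
    archimedean (mkℚ ℤ.-[1+ a ] d _)   0<ε with ℚ.drop-*<* 0<ε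
    ... | ()

    isCauchy : Cauchy S
    isCauchy ε 0<ε = let N , h = archimedean ε 0<ε in N , λ k l N≤k N≤l → go h k l N≤k N≤l (ℕ.≤-total k l)
      where
      go : ∀ {N} → (∀ k → N ℕ.≤ k → + suc p / suc k ℚ.≤ ε) →
           ∀ k l → N ℕ.≤ k → N ℕ.≤ l → k ℕ.≤ l ⊎ l ℕ.≤ k → ℚ.∣ S k ℚ.- S l ∣ ℚ.≤ ε
      go h k l N≤k N≤l (inj₁ k≤l) = subst (ℚ._≤ ε)
        (trans (sym (ℚ.∣-p∣≡∣p∣ (S l ℚ.- S k)))
          (cong ℚ.∣_∣ (solve 2 (λ a b → :- (b :- a) := a :- b) refl (S k) (S l))))
        (ℚ.≤-trans (near k≤l) (h k N≤k))
      go h k l N≤k N≤l (inj₂ l≤k) = ℚ.≤-trans (near l≤k) (h l N≤l)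

-- For n ≥ 1, log n = − log (1 − t) = Σ_{k ≥ 1} tᵏ / k with t = 1 − 1/n.
-- The value at n = 0 is a convention.
log : ℕ → ℝ
log zero    = fromℚ 0ℚ
log (suc p) = mkℝ (mercator (1ℚ ℚ.- + 1 / suc p)) (Mercator.isCauchy p)

record Graph (n : ℕ) : Set where
  field
    adj         : Fin n → Fin n → Bool
    symmetric   : ∀ u v → adj u v ≡ adj v u
    irreflexive : ∀ v → adj v v ≡ false

open Graph public

Adj : ∀ {n} → Graph n → Fin n → Fin n → Set
Adj G u v = T (adj G u v)

deg : ∀ {n} → Graph n → Fin n → ℕ
deg G v = ∣ tabulate (adj G v) ∣

infix 4 _⊆ᴳ_
infixl 6 _∖_

_⊆ᴳ_ : ∀ {n} → Graph n → Graph n → Set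
H ⊆ᴳ G = ∀ u v → Adj H u v → Adj G u v

_∖_ : ∀ {n} → Graph n → Graph n → Graph n
G ∖ H = record
  { adj         = λ u v → adj G u v ∧ not (adj H u v)
  ; symmetric   = λ u v → cong₂ (λ a b → a ∧ not b) (symmetric G u v) (symmetric H u v)
  ; irreflexive = λ v → cong (_∧ not (adj H v v)) (irreflexive G v)
  }

Reachable : ∀ {n} → Graph n → Fin n → Fin n → Set
Reachable G = Star (Adj G)

-- A monotone increasing property of graphs on a fixed vertex set.
record MonotoneProperty (n : ℕ) : Set₁ where
  field
    Holds    : Graph n → Set
    monotone : ∀ G H → G ⊆ᴳ H → Holds G → Holds H

open MonotoneProperty public

connectivity : ∀ {n} → MonotoneProperty n
connectivity = record
  { Holds    = λ G → ∀ u v → Reachable G u v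
  ; monotone = λ G H G⊆H c u v → Star.map (λ {a} {b} → G⊆H a b) (c u v)
  }

Resilient : ∀ {n} → ℝ → MonotoneProperty n → Graph n → Set
Resilient {n} α P G =
  (H : Graph n) → H ⊆ᴳ G →
  (∀ v → fromℕ (deg H v) ≤ᴿ α *ᴿ fromℕ (deg G v)) →
  Holds P (G ∖ H)

IsComponent : ∀ {n} → Graph n → Subset n → Set
IsComponent G C = Nonempty C × (∀ u → u ∈ C → ∀ v → v ∈ C ⇔ Reachable G u v)

-- Holds of every component of maximum size, so ties are not broken.
IsGiant : ∀ {n} → Graph n → Subset n → Set
IsGiant G C = IsComponent G C × (∀ D → IsComponent G D → ∣ D ∣ ℕ.≤ ∣ C ∣)

element : ∀ {n} (C : Subset n) → Fin ∣ C ∣ → Fin n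
element (inside  ∷ C) zero    = zero
element (inside  ∷ C) (suc i) = suc (element C i)
element (outside ∷ C) i       = suc (element C i)

-- The induced subgraph, its vertices relabelled in increasing order by
-- 0 , … , ∣ C ∣ − 1.
induced : ∀ {n} → Graph n → (C : Subset n) → Graph ∣ C ∣
induced G C = record
  { adj         = λ i j → adj G (element C i) (element C j)
  ; symmetric   = λ i j → symmetric G (element C i) (element C j)
  ; irreflexive = λ i → irreflexive G (element C i)
  }

Edge : ℕ → Set
Edge n = Σ[ (a , b) ∈ Fin n × Fin n ] a Fin.< b

edges : ∀ n → List (Edge n)
edges n = concatMap (λ a → concatMap (edge a) (allFin n)) (allFin n)
  where
  edge : ∀ a b → List (Edge n)
  edge a b with a <? b
  ... | yes a<b = ((a , b) , a<b) ∷ []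
  ... | no  _   = []

missing : ∀ {n} → Graph n → List (Edge n)
missing {n} G = filter (λ ((a , b) , _) → adj G a b Bool.≟ false) (edges n)

empty : ∀ n → Graph n
empty n = record
  { adj = λ _ _ → false ; symmetric = λ _ _ → refl ; irreflexive = λ _ → refl }

addEdge : ∀ {n} → Graph n → Edge n → Graph n
addEdge {n} G ((a , b) , a<b) = record
  { adj         = λ u v → adj G u v ∨ (is a u ∧ is b v ∨ is b u ∧ is a v)
  ; symmetric   = λ u v → cong₂ _∨_ (symmetric G u v)
      (trans (∨-comm (is a u ∧ is b v) (is b u ∧ is a v))
        (cong₂ _∨_ (∧-comm (is b u) (is a v)) (∧-comm (is a u) (is b v))))
  ; irreflexive = λ v → cong₂ _∨_ (irreflexive G v) (cong₂ _∨_ (not-both v)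
      (trans (∧-comm (is b v) (is a v)) (not-both v)))
  }
  where
  is : Fin n → Fin n → Bool
  is x y = does (x ≟ y)
  not-both : ∀ v → is a v ∧ is b v ≡ false
  not-both v with a ≟ v | b ≟ v
  ... | no _    | _        = refl
  ... | yes _   | no _     = refl
  ... | yes a≡v | yes b≡v  = ⊥-elim (Fin.<⇒≢ a<b (trans a≡v (sym b≡v)))

-- A finite list of (weight , outcome) pairs; outcomes may repeat.
Dist : Set → Set
Dist A = List (ℚ × A)

point : ∀ {A} → A → Dist A
point a = (1ℚ , a) ∷ []

infixl 1 _>>=_
_>>=_ : ∀ {A B} → Dist A → (A → Dist B) → Dist B
μ >>= f = concatMap (λ (p , a) → List.map (λ (q , b) → p ℚ.* q , b) (f a)) μ

-- The empty list, on which no uniform distribution exists, gets total mass 0.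
uniform : ∀ {A : Set} → List A → Dist A
uniform []       = []
uniform (x ∷ xs) = List.map (λ y → + 1 / length (x ∷ xs) , y) (x ∷ xs)

mass : ∀ {A} → Dist A → (A → Bool) → ℚ
mass μ S = foldr (λ (p , a) q → (if S a then p else 0ℚ) ℚ.+ q) 0ℚ μ

-- P(E) ≥ p.  An event defined through inequalities between reals need not be
-- decidable, so the bound is witnessed by a decidable event contained in E.
-- On a finite distribution this is classically the usual P(E) ≥ p.
ProbAtLeast : ∀ {A} → Dist A → (A → Set) → ℚ → Set
ProbAtLeast μ E p = ∃[ S ] ((∀ a → T (S a) → E a) × p ℚ.≤ mass μ S)

-- P(Eₙ) → 1; rational δ suffice by density.
WithHighProbability : {A : ℕ → Set} → (∀ n → Dist (A n)) → (∀ n → A n → Set) → Set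
WithHighProbability μ E =
  ∀ δ → 0ℚ ℚ.< δ →
  ∃[ N ] (∀ n → N ℕ.≤ n → ProbAtLeast (μ n) (E n) (1ℚ ℚ.- δ))

open import Data.Nat.Combinatorics using (_C_)

-- The law of (G₀ , … , Gᵢ); it has total mass 1 as long as i ≤ n C 2.
processUpTo : ∀ n i → Dist (Vec (Graph n) (suc i))
processUpTo n zero    = point (empty n ∷ [])
processUpTo n (suc i) =
  processUpTo n i             >>= λ Gs →
  uniform (missing (last Gs)) >>= λ e →
  point (Gs ∷ʳ addEdge (last Gs) e)

process : ∀ n → Dist (Vec (Graph n) (suc (n C 2)))
process n = processUpTo n (n C 2)

module Submission where

-- The random part rests on one potential.  If F is a set of f pairs and k steps remain while
-- r pairs are missing, then λ^(edges in F) · c^(missing pairs in F) with c = 1 + (λ − 1) k / r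
-- is a supermartingale; this is the tangent inequality (w + 1) a b^w ≤ a^(w+1) + w b^(w+1).
-- Hence E λ^(edges of G_m in F) ≤ (1 + (λ − 1) m / N)^f with N = n C 2, a Chernoff bound valid
-- for all m ≤ N.  It is summed over all bad configurations, and every bound is made explicit by
-- taking N-th roots.
--
-- With n ≈ b^(3 q⁴ D), b = 1 + 1/q², the hypothesis on m reads m ≥ m₀ ≈ (q² + 5 q) n D / 2.
-- With high probability no three vertices of degree at most D in G_m₀ have a common neighbour
-- in G_m₁ (m₁ = K n D), nor does such a vertex have two such neighbours; degrees in G_m are
-- at least m / (K n) for m ≥ m₁; and for all m ≥ m₀, sets of size at most n / Γ are sparse in
-- G_m, while larger sets of size at most n / 2 span at most about half as many edges as they
-- send out.
--
-- If G[V] − H were disconnected, then for some S ⊆ V both S and V ∖ S are nonempty and each of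
-- their vertices sends fewer than half of its edges to the other side.  If S is small, its
-- vertices of high degree induce too many edges, unless there are none; then an edge leaving S
-- starts at a vertex of low degree with two neighbours of low degree.  So both sets are large,
-- and the smaller one contradicts expansion.

import Algebra.Definitions.RawSemiring
import Algebra.Properties.CommutativeSemiring.Exp
open import Data.Bool.Base using (Bool; true; false; T; _∧_; if_then_else_; not; _xor_; _∨_)
import Data.Bool.Properties as Bool
open import Data.Empty using (⊥; ⊥-elim)
import Data.Fin.Base as Fin
import Data.Fin.Properties as Fin
import Data.Integer.Base as ℤ
import Data.Integer.Properties as ℤ
import Data.List.Base as List
import Data.List.Relation.Unary.All as All
import Data.List.Relation.Unary.All.Properties as All
import Data.Nat.Base as ℕ
import Data.Nat.Properties as ℕ
import Data.Nat.Tactic.RingSolver as ℕ-Solver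
open import Data.Product.Base using (_×_; _,_; Σ-syntax; proj₁; proj₂; ∃-syntax)
import Data.Rational.Base as ℚ
import Data.Rational.Properties as ℚ
import Data.Rational.Unnormalised.Base as ℚᵘ
import Data.Rational.Unnormalised.Properties as ℚᵘ
open import Data.Sum.Base using (_⊎_; inj₁; inj₂; [_,_]′)
open import Data.Unit.Base using (⊤; tt)
open import Function.Base using (_∘_; id)
open import Function.Bundles using (Equivalence)
open import Relation.Binary.Definitions using (tri<; tri≈; tri>)
open import Relation.Binary.PropositionalEquality
open import Relation.Nullary using (yes; no; contradiction; does; Dec; ¬_; ¬?)
open import Relation.Nullary.Decidable
  using (dec⇒maybe; dec-true; dec-false; _×-dec_; _→-dec_; T?; from-yes)

-- Origin of `1/6`: at m = n log n / 6 the mean degree is log n / 3, so a vertex has tiny degree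
-- with probability about n^(-1/3), and three given vertices all do with probability about 1/n. The
-- n⁴ choices of them with a common neighbour, each using three edges of probability of order (log
-- n)/n, leave a power of log n. The factor 1 + ε gains n^(-2/q) over that.
--
-- This gain is too small for a union over the times between m₀ and m₁, yet the claim concerns all m
-- at once. So low degree is tested only at m₀ and adjacency only at m₁, each where it is most
-- likely; by nesting, one event then covers the whole interval. It joins a decreasing condition to
-- an increasing one at another time, which is why a product of two potentials is carried along the
-- process. From m₁ on, small degrees are so unlikely that a union over vertices and times works.
--
-- D stands for log n / (3 q²): n is bracketed by consecutive powers of b^(3 q⁴), so no logarithm
-- enters the probability estimates.

-- Powers and inequalities over the rationals.

module Rationals where

  open import Data.Integer.Base using (+_)
  open import Data.Nat.Base using (ℕ; zero; suc)
  open import Data.Rational.Base using (ℚ; 0ℚ; 1ℚ; _/_; _+_; _*_; _-_; -_; _≤_; _<_; toℚᵘ)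
  open import Data.Rational.Unnormalised.Base using (mkℚᵘ)
  open import Tactic.RingSolver using (solve-∀)
  open import Tactic.RingSolver.Core.AlmostCommutativeRing
    using (AlmostCommutativeRing; fromCommutativeRing)
  open import Algebra.Bundles using (CommutativeRing)
  open Algebra.Definitions.RawSemiring ℚ.+-*-rawSemiring using (_^_) public
  open Algebra.Properties.CommutativeSemiring.Exp (CommutativeRing.commutativeSemiring ℚ.+-*-commutativeRing) public
    using (^-homo-*; ^-assocʳ; ^-distrib-*)

  ring : AlmostCommutativeRing _ _
  ring = fromCommutativeRing ℚ.+-*-commutativeRing λ x → dec⇒maybe (0ℚ ℚ.≟ x)

  0≤1 : 0ℚ ≤ 1ℚ
  0≤1 = ℚ.<⇒≤ (ℚ.positive⁻¹ 1ℚ)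

  ≤-by : ∀ {a b} c → 0ℚ ≤ c → a + c ≡ b → a ≤ b
  ≤-by {a} c 0≤c eq = subst₂ _≤_ (ℚ.+-identityʳ a) eq (ℚ.+-monoʳ-≤ a 0≤c)

  0≤-diff : ∀ {a b} → a ≤ b → 0ℚ ≤ b - a
  0≤-diff {a} {b} a≤b = subst (_≤ b - a) (ℚ.+-inverseʳ a) (ℚ.+-monoˡ-≤ (- a) a≤b)

  diff-0≤ : ∀ {a b} → 0ℚ ≤ b - a → a ≤ b
  diff-0≤ {a} {b} h = ≤-by (b - a) h (lem a b)
    where
    lem : ∀ a b → a + (b - a) ≡ b
    lem = solve-∀ ring

  0≤+ : ∀ {a b} → 0ℚ ≤ a → 0ℚ ≤ b → 0ℚ ≤ a + b
  0≤+ = ℚ.+-mono-≤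

  *-monoˡ : ∀ {a b} c → 0ℚ ≤ c → a ≤ b → c * a ≤ c * b
  *-monoˡ c 0≤c = ℚ.*-monoˡ-≤-nonNeg c {{ℚ.nonNegative 0≤c}}

  *-monoʳ : ∀ {a b} c → 0ℚ ≤ c → a ≤ b → a * c ≤ b * c
  *-monoʳ c 0≤c = ℚ.*-monoʳ-≤-nonNeg c {{ℚ.nonNegative 0≤c}}

  0≤* : ∀ {a b} → 0ℚ ≤ a → 0ℚ ≤ b → 0ℚ ≤ a * b
  0≤* {a} {b} 0≤a 0≤b = subst (_≤ a * b) (ℚ.*-zeroʳ a) (*-monoˡ a 0≤a 0≤b)

  *-mono : ∀ {a b c d} → 0ℚ ≤ b → 0ℚ ≤ c → a ≤ c → b ≤ d → a * b ≤ c * d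
  *-mono {b = b} {c} 0≤b 0≤c a≤c b≤d = ℚ.≤-trans (*-monoʳ b 0≤b a≤c) (*-monoˡ c 0≤c b≤d)

  0≤^ : ∀ {a} n → 0ℚ ≤ a → 0ℚ ≤ a ^ n
  0≤^ zero    _   = 0≤1
  0≤^ (suc n) 0≤a = 0≤* 0≤a (0≤^ n 0≤a)

  ^-mono : ∀ {a b} n → 0ℚ ≤ a → a ≤ b → a ^ n ≤ b ^ n
  ^-mono zero    _   _   = ℚ.≤-refl
  ^-mono (suc n) 0≤a a≤b = *-mono (0≤^ n 0≤a) (ℚ.≤-trans 0≤a a≤b) a≤b (^-mono n 0≤a a≤b)

  1^ : ∀ n → 1ℚ ^ n ≡ 1ℚ
  1^ zero    = refl
  1^ (suc n) = trans (ℚ.*-identityˡ (1ℚ ^ n)) (1^ n)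

  1≤^ : ∀ {a} n → 1ℚ ≤ a → 1ℚ ≤ a ^ n
  1≤^ {a} n 1≤a = subst (_≤ a ^ n) (1^ n) (^-mono n 0≤1 1≤a)

  ^≤1 : ∀ {a} n → 0ℚ ≤ a → a ≤ 1ℚ → a ^ n ≤ 1ℚ
  ^≤1 {a} n 0≤a a≤1 = subst (a ^ n ≤_) (1^ n) (^-mono n 0≤a a≤1)

  ^-mono-exp : ∀ {a m n} → 1ℚ ≤ a → m ℕ.≤ n → a ^ m ≤ a ^ n
  ^-mono-exp {a} {m} {n} 1≤a m≤n = begin
    a ^ m                    ≡⟨ ℚ.*-identityʳ _ ⟨
    a ^ m * 1ℚ               ≤⟨ *-monoˡ (a ^ m) (ℚ.≤-trans 0≤1 (1≤^ m 1≤a)) (1≤^ (n ℕ.∸ m) 1≤a) ⟩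
    a ^ m * a ^ (n ℕ.∸ m)    ≡⟨ ^-homo-* a m (n ℕ.∸ m) ⟨
    a ^ (m ℕ.+ (n ℕ.∸ m))    ≡⟨ cong (a ^_) (ℕ.m+[n∸m]≡n m≤n) ⟩
    a ^ n                    ∎
    where open ℚ.≤-Reasoning

  ^-anti-exp : ∀ {a m n} → 0ℚ ≤ a → a ≤ 1ℚ → m ℕ.≤ n → a ^ n ≤ a ^ m
  ^-anti-exp {a} {m} {n} 0≤a a≤1 m≤n = begin
    a ^ n                    ≡⟨ cong (a ^_) (ℕ.m+[n∸m]≡n m≤n) ⟨
    a ^ (m ℕ.+ (n ℕ.∸ m))    ≡⟨ ^-homo-* a m (n ℕ.∸ m) ⟩
    a ^ m * a ^ (n ℕ.∸ m)    ≤⟨ *-monoˡ (a ^ m) (0≤^ m 0≤a) (^≤1 (n ℕ.∸ m) 0≤a a≤1) ⟩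
    a ^ m * 1ℚ               ≡⟨ ℚ.*-identityʳ _ ⟩
    a ^ m                    ∎
    where open ℚ.≤-Reasoning

  ^-mono-< : ∀ {a b} n → 0ℚ ≤ a → a < b → a ^ suc n < b ^ suc n
  ^-mono-< {a} {b} zero 0≤a a<b = subst₂ _<_ (sym (ℚ.*-identityʳ a)) (sym (ℚ.*-identityʳ b)) a<b
  ^-mono-< {a} {b} (suc n) 0≤a a<b = ℚ.≤-<-trans
    (*-monoʳ (a ^ suc n) (0≤^ (suc n) 0≤a) (ℚ.<⇒≤ a<b))
    (ℚ.*-monoʳ-<-pos b {{ℚ.positive (ℚ.≤-<-trans 0≤a a<b)}} (^-mono-< n 0≤a a<b))

  ^-cancel-≤ : ∀ {a b} n → 0ℚ ≤ b → a ^ suc n ≤ b ^ suc n → a ≤ b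
  ^-cancel-≤ {a} {b} n 0≤b h with a ℚ.≤? b
  ... | yes a≤b = a≤b
  ... | no  a≰b = contradiction (ℚ.<-≤-trans (^-mono-< n 0≤b (ℚ.≰⇒> a≰b)) h) (ℚ.<-irrefl refl)

  # : ℕ → ℚ
  # n = + n / 1

  private
    toℚᵘ-# : ∀ n → toℚᵘ (# n) ℚᵘ.≃ mkℚᵘ (+ n) 0
    toℚᵘ-# n = ℚ.toℚᵘ-fromℚᵘ (mkℚᵘ (+ n) 0)

  #-+ : ∀ m n → # (m ℕ.+ n) ≡ # m + # n
  #-+ m n = ℚ.toℚᵘ-injective (begin
    toℚᵘ (# (m ℕ.+ n))            ≈⟨ toℚᵘ-# (m ℕ.+ n) ⟩
    mkℚᵘ (+ (m ℕ.+ n)) 0          ≈⟨ ℚᵘ.*≡* (cong (ℤ._* + 1) (trans (ℤ.pos-+ m n)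
                                       (sym (cong₂ ℤ._+_ (ℤ.*-identityʳ (+ m)) (ℤ.*-identityʳ (+ n)))))) ⟩
    mkℚᵘ (+ m) 0 ℚᵘ.+ mkℚᵘ (+ n) 0 ≈⟨ ℚᵘ.+-cong (toℚᵘ-# m) (toℚᵘ-# n) ⟨
    toℚᵘ (# m) ℚᵘ.+ toℚᵘ (# n)    ≈⟨ ℚ.toℚᵘ-homo-+ (# m) (# n) ⟨
    toℚᵘ (# m + # n)              ∎)
    where open import Relation.Binary.Reasoning.Setoid ℚᵘ.≃-setoid

  #-* : ∀ m n → # (m ℕ.* n) ≡ # m * # n
  #-* m n = ℚ.toℚᵘ-injective (begin
    toℚᵘ (# (m ℕ.* n))            ≈⟨ toℚᵘ-# (m ℕ.* n) ⟩
    mkℚᵘ (+ (m ℕ.* n)) 0          ≈⟨ ℚᵘ.*≡* (cong (ℤ._* + 1) (ℤ.pos-* m n)) ⟩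
    mkℚᵘ (+ m) 0 ℚᵘ.* mkℚᵘ (+ n) 0 ≈⟨ ℚᵘ.*-cong (toℚᵘ-# m) (toℚᵘ-# n) ⟨
    toℚᵘ (# m) ℚᵘ.* toℚᵘ (# n)    ≈⟨ ℚ.toℚᵘ-homo-* (# m) (# n) ⟨
    toℚᵘ (# m * # n)              ∎)
    where open import Relation.Binary.Reasoning.Setoid ℚᵘ.≃-setoid

  #-mono : ∀ {m n} → m ℕ.≤ n → # m ≤ # n
  #-mono {m} {n} m≤n = ℚ.toℚᵘ-cancel-≤ (begin
    toℚᵘ (# m)   ≃⟨ toℚᵘ-# m ⟩
    mkℚᵘ (+ m) 0 ≤⟨ ℚᵘ.*≤* (ℤ.*-monoʳ-≤-nonNeg (+ 1) (ℤ.+≤+ m≤n)) ⟩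
    mkℚᵘ (+ n) 0 ≃⟨ toℚᵘ-# n ⟨
    toℚᵘ (# n)   ∎)
    where open ℚᵘ.≤-Reasoning

  #-mono-< : ∀ {m n} → m ℕ.< n → # m < # n
  #-mono-< {m} {n} m<n = ℚ.<-≤-trans
    (subst₂ _<_ (ℚ.+-identityʳ (# m)) refl (ℚ.+-monoʳ-< (# m) (ℚ.positive⁻¹ 1ℚ)))
    (subst (_≤ # n) (trans (cong # (ℕ.+-comm 1 m)) (#-+ m 1)) (#-mono m<n))

  #-cancel : ∀ {m n} → # m ≤ # n → m ℕ.≤ n
  #-cancel {m} {n} h with m ℕ.≤? n
  ... | yes p = p
  ... | no ¬p = contradiction (ℚ.<-≤-trans (#-mono-< (ℕ.≰⇒> ¬p)) h) (ℚ.<-irrefl refl)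

  #-cancel-< : ∀ {m n} → # m < # n → m ℕ.< n
  #-cancel-< {m} {n} h with m ℕ.<? n
  ... | yes p = p
  ... | no ¬p = contradiction (ℚ.<-≤-trans h (#-mono (ℕ.≮⇒≥ ¬p))) (ℚ.<-irrefl refl)

  0≤# : ∀ n → 0ℚ ≤ # n
  0≤# n = #-mono {0} {n} ℕ.z≤n

  0<# : ∀ n → 0ℚ < # (suc n)
  0<# n = #-mono-< {0} {suc n} (ℕ.s≤s ℕ.z≤n)

  0<#′ : ∀ {k} → 1 ℕ.≤ k → 0ℚ < # k
  0<#′ {suc k} _ = 0<# k

  1≤# : ∀ n → 1ℚ ≤ # (suc n)
  1≤# n = #-mono {1} {suc n} (ℕ.s≤s ℕ.z≤n)

  #-suc : ∀ n → # (suc n) ≡ 1ℚ + # n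
  #-suc n = #-+ 1 n

  #-^ : ∀ m n → # (m ℕ.^ n) ≡ # m ^ n
  #-^ m zero    = refl
  #-^ m (suc n) = trans (#-* m (m ℕ.^ n)) (cong (# m *_) (#-^ m n))

  #-∸ : ∀ {m n} → n ℕ.≤ m → # (m ℕ.∸ n) ≡ # m - # n
  #-∸ {m} {n} n≤m = trans (lem (# (m ℕ.∸ n)) (# n))
    (cong (_- # n) (trans (sym (#-+ (m ℕ.∸ n) n)) (cong # (ℕ.m∸n+n≡m n≤m))))
    where
    lem : ∀ a b → a ≡ (a + b) - b
    lem = solve-∀ ring

  *-cancelˡ : ∀ {a b} c → 0ℚ < c → c * a ≤ c * b → a ≤ b
  *-cancelˡ c 0<c = ℚ.*-cancelˡ-≤-pos c {{ℚ.positive 0<c}}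

  -- The junk value inv 0 = 0 lets the identities below hold at 0.
  inv : ℕ → ℚ
  inv zero    = 0ℚ
  inv (suc n) = + 1 / suc n

  0≤inv : ∀ n → 0ℚ ≤ inv n
  0≤inv zero    = ℚ.≤-refl
  0≤inv (suc n) = ℚ.nonNegative⁻¹ (+ 1 / suc n) {{ℚ.normalize-nonNeg 1 (suc n)}}

  #*inv : ∀ n → # (suc n) * inv (suc n) ≡ 1ℚ
  #*inv n = ℚ.toℚᵘ-injective (begin
    toℚᵘ (# (suc n) * inv (suc n))
      ≈⟨ ℚ.toℚᵘ-homo-* (# (suc n)) (inv (suc n)) ⟩
    toℚᵘ (# (suc n)) ℚᵘ.* toℚᵘ (inv (suc n))
      ≈⟨ ℚᵘ.*-cong (toℚᵘ-# (suc n)) (ℚ.toℚᵘ-fromℚᵘ (mkℚᵘ (+ 1) n)) ⟩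
    mkℚᵘ (+ suc n) 0 ℚᵘ.* mkℚᵘ (+ 1) n
      ≈⟨ ℚᵘ.*≡* (trans (ℤ.*-identityʳ _) (trans (ℤ.*-identityʳ (+ suc n))
           (sym (trans (ℤ.*-identityˡ _) (cong (λ z → + suc z) (ℕ.+-identityʳ n)))))) ⟩
    toℚᵘ 1ℚ ∎)
    where open import Relation.Binary.Reasoning.Setoid ℚᵘ.≃-setoid

  #*inv′ : ∀ {n} → 1 ℕ.≤ n → # n * inv n ≡ 1ℚ
  #*inv′ {suc n} _ = #*inv n

  -- The graph of `x ^ suc w` lies above its tangent at `b`. In the induction step the slack is
  -- `(a - b) * (a ^ suc w - b ^ suc w)`, whose factors have the same sign.
  ^-tangent : ∀ {a b} w → 0ℚ ≤ a → 0ℚ ≤ b →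
              # (suc w) * a * b ^ w ≤ a ^ suc w + # w * b ^ suc w
  ^-tangent {a} {b} zero 0≤a 0≤b = ℚ.≤-reflexive (lem a b)
    where
    lem : ∀ a b → 1ℚ * a * 1ℚ ≡ a * 1ℚ + 0ℚ * (b * 1ℚ)
    lem = solve-∀ ring
  ^-tangent {a} {b} (suc w) 0≤a 0≤b = begin
    # (suc (suc w)) * a * b ^ suc w
      ≡⟨ cong (λ z → z * a * b ^ suc w) (#-suc (suc w)) ⟩
    (1ℚ + # (suc w)) * a * (b * b ^ w)
      ≡⟨ lem₁ (# (suc w)) a b (b ^ w) ⟩
    b * (# (suc w) * a * b ^ w) + a * (b * b ^ w)
      ≤⟨ ℚ.+-monoˡ-≤ _ (*-monoˡ b 0≤b (^-tangent w 0≤a 0≤b)) ⟩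
    b * (a ^ suc w + # w * b ^ suc w) + a * b ^ suc w
      ≤⟨ ≤-by _ (chebyshev (ℚ.≤-total a b)) (lem₂ a b (a ^ suc w) (b ^ suc w) (# w)) ⟩
    a ^ suc (suc w) + (1ℚ + # w) * b ^ suc (suc w)
      ≡⟨ cong (λ z → a ^ suc (suc w) + z * b ^ suc (suc w)) (#-suc w) ⟨
    a ^ suc (suc w) + # (suc w) * b ^ suc (suc w) ∎
    where
    open ℚ.≤-Reasoning
    lem₁ : ∀ n a b p → (1ℚ + n) * a * (b * p) ≡ b * (n * a * p) + a * (b * p)
    lem₁ = solve-∀ ring
    lem₂ : ∀ a b p q n → b * (p + n * q) + a * q + (a - b) * (p - q) ≡ a * p + (1ℚ + n) * (b * q)
    lem₂ = solve-∀ ring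
    swap : ∀ a b p q → (b - a) * (q - p) ≡ (a - b) * (p - q)
    swap = solve-∀ ring
    chebyshev : a ≤ b ⊎ b ≤ a → 0ℚ ≤ (a - b) * (a ^ suc w - b ^ suc w)
    chebyshev (inj₁ a≤b) = subst (0ℚ ≤_) (swap a b (a ^ suc w) (b ^ suc w))
      (0≤* (0≤-diff a≤b) (0≤-diff (^-mono (suc w) 0≤a a≤b)))
    chebyshev (inj₂ b≤a) = 0≤* (0≤-diff b≤a) (0≤-diff (^-mono (suc w) 0≤b b≤a))

  -- Tangency at `1`. Only `1 + x` has to be nonnegative, so that negative `x` is allowed.
  bernoulli : ∀ {x} n → 0ℚ ≤ 1ℚ + x → 1ℚ + # n * x ≤ (1ℚ + x) ^ n
  bernoulli {x} zero _ = ℚ.≤-reflexive (lem x)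
    where
    lem : ∀ x → 1ℚ + 0ℚ * x ≡ 1ℚ
    lem = solve-∀ ring
  bernoulli {x} (suc n) h = begin
    1ℚ + # (suc n) * x                                ≡⟨ cong (λ z → 1ℚ + z * x) (#-suc n) ⟩
    1ℚ + (1ℚ + # n) * x                               ≡⟨ lem₁ (# n) x ⟩
    (1ℚ + (1ℚ + # n) * x + # n) - # n                 ≡⟨ lem₂ (# n) x (1ℚ) ⟩
    (1ℚ + # n) * (1ℚ + x) * 1ℚ - # n * 1ℚ             ≡⟨ cong₂ (λ u v → u * (1ℚ + x) * v - # n * v) (sym (#-suc n)) (sym (1^ n)) ⟩
    # (suc n) * (1ℚ + x) * 1ℚ ^ n - # n * 1ℚ ^ n      ≡⟨ cong (λ z → # (suc n) * (1ℚ + x) * 1ℚ ^ n - # n * z) (sym (ℚ.*-identityˡ (1ℚ ^ n))) ⟩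
    # (suc n) * (1ℚ + x) * 1ℚ ^ n - # n * 1ℚ ^ suc n  ≤⟨ ℚ.+-monoˡ-≤ _ (^-tangent n h 0≤1) ⟩
    (1ℚ + x) ^ suc n + # n * 1ℚ ^ suc n - # n * 1ℚ ^ suc n ≡⟨ lem₃ _ (# n * 1ℚ ^ suc n) ⟩
    (1ℚ + x) ^ suc n ∎
    where
    open ℚ.≤-Reasoning
    lem₁ : ∀ n x → 1ℚ + (1ℚ + n) * x ≡ (1ℚ + (1ℚ + n) * x + n) - n
    lem₁ = solve-∀ ring
    lem₂ : ∀ n x o → (1ℚ + (1ℚ + n) * x + n) - n ≡ (1ℚ + n) * (1ℚ + x) * 1ℚ - n * 1ℚ
    lem₂ = solve-∀ ring
    lem₃ : ∀ a b → a + b - b ≡ a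
    lem₃ = solve-∀ ring

  -- AM-GM for N factors 1 + m x / N and m factors 1 − x, by induction on m.
  compound : ∀ {N x y} m → 1 ℕ.≤ N → x ≡ # N * y → x ≤ 1ℚ →
             (∀ k → k ℕ.≤ m → 0ℚ ≤ 1ℚ + # k * y) →
             (1ℚ + # m * y) ^ N * (1ℚ - x) ^ m ≤ 1ℚ
  compound {N} {x} {y} zero _ _ _ _ = ℚ.≤-reflexive (begin
    (1ℚ + 0ℚ * y) ^ N * 1ℚ ≡⟨ cong (λ z → z ^ N * 1ℚ) (lem y) ⟩
    1ℚ ^ N * 1ℚ            ≡⟨ ℚ.*-identityʳ (1ℚ ^ N) ⟩
    1ℚ ^ N                 ≡⟨ 1^ N ⟩
    1ℚ                     ∎)
    where
    open ≡-Reasoning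
    lem : ∀ y → 1ℚ + 0ℚ * y ≡ 1ℚ
    lem = solve-∀ ring
  compound {suc N} {x} {y} (suc m) 1≤N eq x≤1 h = begin
    B ^ suc N * (1ℚ - x) ^ suc m
      ≡⟨ lem₁ (B ^ suc N) (1ℚ - x) ((1ℚ - x) ^ m) ⟩
    (B ^ suc N * (1ℚ - x)) * (1ℚ - x) ^ m
      ≤⟨ *-monoʳ _ (0≤^ m (0≤-diff x≤1)) step ⟩
    A ^ suc N * (1ℚ - x) ^ m
      ≤⟨ compound m 1≤N eq x≤1 (λ k k≤m → h k (ℕ.m≤n⇒m≤1+n k≤m)) ⟩
    1ℚ ∎
    where
    open ℚ.≤-Reasoning
    A B : ℚ
    A = 1ℚ + # m * y
    B = 1ℚ + # (suc m) * y
    0≤B : 0ℚ ≤ B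
    0≤B = h (suc m) ℕ.≤-refl
    lem₁ : ∀ a b c → a * (b * c) ≡ (a * b) * c
    lem₁ = solve-∀ ring
    lem₂ : ∀ n m y p → (1ℚ + (1ℚ + m) * y) * p * (1ℚ - (1ℚ + n) * y)
                        + (1ℚ + n) * (y * y) * (1ℚ + m) * (1ℚ + n - n) * p
                      ≡ (1ℚ + n) * (1ℚ + m * y) * p - n * ((1ℚ + (1ℚ + m) * y) * p)
    lem₂ = solve-∀ ring
    lem₃ : ∀ a b → a + b - b ≡ a
    lem₃ = solve-∀ ring
    -- Negative `y` does occur: it yields the bounds for `lam < 1`.
    0≤y² : 0ℚ ≤ y * y
    0≤y² with ℚ.≤-total 0ℚ y
    ... | inj₁ p = 0≤* p p
    ... | inj₂ p = subst (0ℚ ≤_) (neg y) (0≤* (0≤-diff p) (0≤-diff p))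
      where
      neg : ∀ y → (0ℚ - y) * (0ℚ - y) ≡ y * y
      neg = solve-∀ ring
    step : B ^ suc N * (1ℚ - x) ≤ A ^ suc N
    step = begin
      B ^ suc N * (1ℚ - x)
        ≡⟨ cong₂ (λ u v → u * B ^ N * (1ℚ - v)) (cong (λ z → 1ℚ + z * y) (#-suc m)) (trans eq (cong (_* y) (#-suc N))) ⟩
      (1ℚ + (1ℚ + # m) * y) * B ^ N * (1ℚ - (1ℚ + # N) * y)
        ≤⟨ ≤-by _ (0≤* (0≤* (0≤* (0≤* (0≤+ 0≤1 (0≤# N)) 0≤y²) (0≤+ 0≤1 (0≤# m)))
             (0≤-diff (≤-by 1ℚ 0≤1 (ℚ.+-comm (# N) 1ℚ)))) (0≤^ N 0≤B)) (lem₂ (# N) (# m) y (B ^ N)) ⟩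
      (1ℚ + # N) * A * B ^ N - # N * ((1ℚ + (1ℚ + # m) * y) * B ^ N)
        ≡⟨ cong₂ (λ u v → u * A * B ^ N - # N * (v * B ^ N)) (sym (#-suc N)) (cong (λ z → 1ℚ + z * y) (sym (#-suc m))) ⟩
      # (suc N) * A * B ^ N - # N * B ^ suc N
        ≤⟨ ℚ.+-monoˡ-≤ _ (^-tangent N (h m (ℕ.n≤1+n m)) 0≤B) ⟩
      A ^ suc N + # N * B ^ suc N - # N * B ^ suc N
        ≡⟨ lem₃ _ (# N * B ^ suc N) ⟩
      A ^ suc N ∎

-- Finite expectations and failure bounds through Markov's inequality.

module Distributions where

  open import Defs using (Dist; point; _>>=_; uniform; mass; ProbAtLeast)
  open Rationals
  open import Data.Fin.Base using (Fin; zero; suc)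
  open import Data.Fin.Subset using (Subset; ∣_∣)
  open import Data.List.Base using (List; []; _∷_; _++_; length; map)
  open import Data.List.Relation.Unary.All using (All; []; _∷_)
  open import Data.Nat.Base using (zero; suc)
  open import Data.Rational.Base using (ℚ; 0ℚ; 1ℚ; _+_; _*_; _-_; -_; _≤_; _<_)
  open import Data.Vec.Base using ([]; _∷_)
  open import Tactic.RingSolver using (solve-∀)

  private variable
    A B : Set

  ΣL : List A → (A → ℚ) → ℚ
  ΣL []       f = 0ℚ
  ΣL (x ∷ xs) f = f x + ΣL xs f

  𝔼 : Dist A → (A → ℚ) → ℚ
  𝔼 μ f = ΣL μ (λ (p , a) → p * f a)

  ΣL-cong : (xs : List A) {f g : A → ℚ} → (∀ x → f x ≡ g x) → ΣL xs f ≡ ΣL xs g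
  ΣL-cong []       _  = refl
  ΣL-cong (x ∷ xs) eq = cong₂ _+_ (eq x) (ΣL-cong xs eq)

  ΣL-mono : {xs : List A} {f g : A → ℚ} → All (λ x → f x ≤ g x) xs → ΣL xs f ≤ ΣL xs g
  ΣL-mono []       = ℚ.≤-refl
  ΣL-mono (p ∷ ps) = ℚ.+-mono-≤ p (ΣL-mono ps)

  ΣL-* : ∀ c (xs : List A) (f : A → ℚ) → ΣL xs (λ x → c * f x) ≡ c * ΣL xs f
  ΣL-* c []       f = sym (ℚ.*-zeroʳ c)
  ΣL-* c (x ∷ xs) f = trans (cong (c * f x +_) (ΣL-* c xs f)) (sym (ℚ.*-distribˡ-+ c (f x) _))

  ΣL-+ : (xs : List A) (f g : A → ℚ) → ΣL xs (λ x → f x + g x) ≡ ΣL xs f + ΣL xs g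
  ΣL-+ []       f g = refl
  ΣL-+ (x ∷ xs) f g = trans (cong (f x + g x +_) (ΣL-+ xs f g)) (lem (f x) (g x) (ΣL xs f) (ΣL xs g))
    where
    lem : ∀ a b c d → (a + b) + (c + d) ≡ (a + c) + (b + d)
    lem = solve-∀ ring

  ΣL-const : ∀ c (xs : List A) → ΣL xs (λ _ → c) ≡ # (length xs) * c
  ΣL-const c []       = sym (ℚ.*-zeroˡ c)
  ΣL-const c (x ∷ xs) = begin
    c + ΣL xs (λ _ → c)       ≡⟨ cong (c +_) (ΣL-const c xs) ⟩
    c + # (length xs) * c     ≡⟨ lem c (# (length xs)) ⟩
    (1ℚ + # (length xs)) * c  ≡⟨ cong (_* c) (#-suc (length xs)) ⟨
    # (suc (length xs)) * c   ∎
    where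
    open ≡-Reasoning
    lem : ∀ c n → c + n * c ≡ (1ℚ + n) * c
    lem = solve-∀ ring

  ΣL-++ : (xs ys : List A) (f : A → ℚ) → ΣL (xs ++ ys) f ≡ ΣL xs f + ΣL ys f
  ΣL-++ []       ys f = sym (ℚ.+-identityˡ _)
  ΣL-++ (x ∷ xs) ys f = trans (cong (f x +_) (ΣL-++ xs ys f)) (sym (ℚ.+-assoc (f x) _ _))

  ΣL-map : (h : A → B) (xs : List A) (f : B → ℚ) → ΣL (map h xs) f ≡ ΣL xs (f ∘ h)
  ΣL-map h []       f = refl
  ΣL-map h (x ∷ xs) f = cong (f (h x) +_) (ΣL-map h xs f)

  𝔼->>= : (μ : Dist A) (k : A → Dist B) (f : B → ℚ) → 𝔼 (μ >>= k) f ≡ 𝔼 μ (λ a → 𝔼 (k a) f)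
  𝔼->>= []            k f = refl
  𝔼->>= ((p , a) ∷ μ) k f = trans
    (ΣL-++ (map (λ (q , b) → p * q , b) (k a)) _ (λ (q , b) → q * f b))
    (cong₂ _+_ scale (𝔼->>= μ k f))
    where
    scale : ΣL (map (λ (q , b) → p * q , b) (k a)) (λ (q , b) → q * f b) ≡ p * 𝔼 (k a) f
    scale = trans (ΣL-map _ (k a) _)
      (trans (ΣL-cong (k a) (λ (q , b) → ℚ.*-assoc p q (f b))) (ΣL-* p (k a) (λ (q , b) → q * f b)))

  𝔼-point : (a : A) (f : A → ℚ) → 𝔼 (point a) f ≡ f a
  𝔼-point a f = trans (ℚ.+-identityʳ _) (ℚ.*-identityˡ (f a))

  𝔼-uniform : (xs : List A) (f : A → ℚ) → # (length xs) * 𝔼 (uniform xs) f ≡ ΣL xs f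
  𝔼-uniform []            f = ℚ.*-zeroˡ 0ℚ
  𝔼-uniform xs@(_ ∷ xs′) f = begin
    # (length xs) * 𝔼 (uniform xs) f              ≡⟨ cong (# (length xs) *_) (ΣL-map (inv (length xs) ,_) xs (λ (q , b) → q * f b)) ⟩
    # (length xs) * ΣL xs (λ x → inv (length xs) * f x) ≡⟨ cong (# (length xs) *_) (ΣL-* (inv (length xs)) xs f) ⟩
    # (length xs) * (inv (length xs) * ΣL xs f)   ≡⟨ ℚ.*-assoc (# (length xs)) _ _ ⟨
    # (length xs) * inv (length xs) * ΣL xs f     ≡⟨ cong (_* ΣL xs f) (#*inv (length xs′)) ⟩
    1ℚ * ΣL xs f                                  ≡⟨ ℚ.*-identityˡ _ ⟩
    ΣL xs f                                       ∎
    where open ≡-Reasoning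

  𝔼-mono : {μ : Dist A} {f g : A → ℚ} → All (λ (p , a) → 0ℚ ≤ p × f a ≤ g a) μ → 𝔼 μ f ≤ 𝔼 μ g
  𝔼-mono h = ΣL-mono (All.map (λ {(p , a)} (0≤p , fa≤ga) → *-monoˡ p 0≤p fa≤ga) h)

  𝔼-+ : (μ : Dist A) (f g : A → ℚ) → 𝔼 μ (λ a → f a + g a) ≡ 𝔼 μ f + 𝔼 μ g
  𝔼-+ μ f g = trans (ΣL-cong μ (λ (p , a) → ℚ.*-distribˡ-+ p (f a) (g a))) (ΣL-+ μ (λ (p , a) → p * f a) (λ (p , a) → p * g a))

  𝔼-cong : (μ : Dist A) {f g : A → ℚ} → (∀ a → f a ≡ g a) → 𝔼 μ f ≡ 𝔼 μ g
  𝔼-cong μ eq = ΣL-cong μ (λ (p , a) → cong (p *_) (eq a))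

  𝔼-* : ∀ c (μ : Dist A) (f : A → ℚ) → 𝔼 μ (λ a → c * f a) ≡ c * 𝔼 μ f
  𝔼-* c μ f = trans (ΣL-cong μ (λ (p , a) → lem p c (f a))) (ΣL-* c μ (λ (p , a) → p * f a))
    where
    lem : ∀ p c x → p * (c * x) ≡ c * (p * x)
    lem = solve-∀ ring

  -- By Markov's inequality E then fails with probability at most δ.
  record FailsWithin (μ : Dist A) (δ : ℚ) (E : A → Set) : Set where
    constructor certificate
    field
      penalty : A → ℚ
      nonNeg  : ∀ a → 0ℚ ≤ penalty a
      sound   : ∀ a → penalty a < 1ℚ → E a
      bound   : 𝔼 μ penalty ≤ δ

  module _ {μ : Dist A} where

    weaken : ∀ {δ δ′} {E E′ : A → Set} → δ ≤ δ′ → (∀ a → E a → E′ a) →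
             FailsWithin μ δ E → FailsWithin μ δ′ E′
    weaken δ≤ E⊆ (certificate f f≥0 s b) =
      certificate f f≥0 (λ a h → E⊆ a (s a h)) (ℚ.≤-trans b δ≤)

    always : {E : A → Set} → (∀ a → E a) → FailsWithin μ 0ℚ E
    always e = certificate (λ _ → 0ℚ) (λ _ → ℚ.≤-refl) (λ a _ → e a)
      (ℚ.≤-reflexive (trans (ΣL-cong μ (λ (p , _) → ℚ.*-zeroʳ p))
        (trans (ΣL-const 0ℚ μ) (ℚ.*-zeroʳ (# (length μ))))))

    both : ∀ {δ₁ δ₂} {E₁ E₂ : A → Set} → FailsWithin μ δ₁ E₁ → FailsWithin μ δ₂ E₂ →
           FailsWithin μ (δ₁ + δ₂) (λ a → E₁ a × E₂ a)
    both (certificate f f≥0 sf bf) (certificate g g≥0 sg bg) = certificate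
      (λ a → f a + g a)
      (λ a → 0≤+ (f≥0 a) (g≥0 a))
      (λ a h → sf a (ℚ.≤-<-trans (≤-by (g a) (g≥0 a) refl) h)
             , sg a (ℚ.≤-<-trans (≤-by (f a) (f≥0 a) (ℚ.+-comm (g a) (f a))) h))
      (ℚ.≤-trans (ℚ.≤-reflexive (𝔼-+ μ f g)) (ℚ.+-mono-≤ bf bg))

    forallFin : ∀ k {δ} {E : Fin k → A → Set} → (∀ i → FailsWithin μ δ (E i)) →
                FailsWithin μ (# k * δ) (λ a → ∀ i → E i a)
    forallFin zero    {δ} h = weaken (ℚ.≤-reflexive (sym (ℚ.*-zeroˡ δ))) (λ _ _ ()) (always {E = λ _ → ⊤} (λ _ → tt))
    forallFin (suc k) {δ} h = weaken
      (ℚ.≤-reflexive (trans (lem δ (# k)) (cong (_* δ) (sym (#-suc k)))))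
      (λ { a (e , es) zero → e ; a (e , es) (suc i) → es i })
      (both (h zero) (forallFin k (λ i → h (suc i))))
      where
      lem : ∀ d k → d + k * d ≡ (1ℚ + k) * d
      lem = solve-∀ ring

    -- The bound is the sum of c y^|X| over all X ⊆ {1, …, k}.
    forallSubset : ∀ k {c y} {E : Subset k → A → Set} → 
                   (∀ X → FailsWithin μ (c * y ^ ∣ X ∣) (E X)) →
                   FailsWithin μ (c * (1ℚ + y) ^ k) (λ a → ∀ X → E X a)
    forallSubset zero    h = weaken ℚ.≤-refl (λ { a e [] → e }) (h [])
    forallSubset (suc k) {c} {y} h = weaken
      (ℚ.≤-reflexive (lem c y ((1ℚ + y) ^ k)))
      (λ { a (e , es) (true ∷ X) → e X ; a (e , es) (false ∷ X) → es X })
      (both (forallSubset k {c * y} {y} (λ X → weaken (ℚ.≤-reflexive (assoc c y (y ^ ∣ X ∣))) (λ _ e → e) (h (true ∷ X))))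
            (forallSubset k {c} {y} (λ X → h (false ∷ X))))
      where
      lem : ∀ c y p → c * y * p + c * p ≡ c * ((1ℚ + y) * p)
      lem = solve-∀ ring
      assoc : ∀ c y p → c * (y * p) ≡ c * y * p
      assoc = solve-∀ ring

    -- The decidable witness asks for `C` and for a penalty below `1`. `C` holds on the whole
    -- support, so it costs no probability, and it lets `E⇒` use facts, such as nestedness, that are
    -- true only of outcomes of the process. Elsewhere on the support the penalty is at least `1`,
    -- so its mean bounds the mass lost.
    probAtLeast : ∀ {δ} {E E′ C : A → Set} → FailsWithin μ δ E → (C? : ∀ a → Dec (C a)) →
                  All (λ (p , a) → 0ℚ ≤ p × C a) μ → 𝔼 μ (λ _ → 1ℚ) ≡ 1ℚ →
                  (∀ a → C a → E a → E′ a) → ProbAtLeast μ E′ (1ℚ - δ)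
    probAtLeast {δ} {E} {E′} {C} (certificate f f≥0 s b) C? supp total E⇒ =
      S , sound , (begin
        1ℚ - δ           ≤⟨ ℚ.+-monoʳ-≤ 1ℚ (ℚ.neg-antimono-≤ b) ⟩
        1ℚ - 𝔼 μ f       ≡⟨ cong (_- 𝔼 μ f) total ⟨
        𝔼 μ (λ _ → 1ℚ) - 𝔼 μ f ≤⟨ ℚ.+-monoˡ-≤ (- 𝔼 μ f) (go supp) ⟩
        mass μ S + 𝔼 μ f - 𝔼 μ f ≡⟨ lem (mass μ S) (𝔼 μ f) ⟩
        mass μ S         ∎)
      where
      open ℚ.≤-Reasoning
      S : A → Bool
      S a = does (C? a) ∧ does (f a ℚ.<? 1ℚ)
      sound : ∀ a → T (S a) → E′ a
      sound a t = pick (C? a) (f a ℚ.<? 1ℚ) t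
        where
        pick : (c? : Dec (C a)) (l? : Dec (f a < 1ℚ)) → T (does c? ∧ does l?) → E′ a
        pick (yes c) (yes l) _ = E⇒ a c (s a l)
        pick (yes _) (no _)  ()
        pick (no _)  _       ()
      lem : ∀ a b → a + b - b ≡ a
      lem = solve-∀ ring
      swap : ∀ a b c d → (a + b) + (c + d) ≡ (a + c) + (b + d)
      swap = solve-∀ ring
      one : ∀ p a → 0ℚ ≤ p → C a → (c? : Dec (C a)) (l? : Dec (f a < 1ℚ)) →
            p * 1ℚ ≤ (if does c? ∧ does l? then p else 0ℚ) + p * f a
      one p a 0≤p c (no ¬c) _       = contradiction c ¬c
      one p a 0≤p c (yes _) (yes _) = subst (_≤ p + p * f a) (sym (ℚ.*-identityʳ p)) (≤-by (p * f a) (0≤* 0≤p (f≥0 a)) refl)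
      one p a 0≤p c (yes _) (no ¬l) = subst (p * 1ℚ ≤_) (sym (ℚ.+-identityˡ _)) (*-monoˡ p 0≤p (ℚ.≮⇒≥ ¬l))
      go : ∀ {ν} → All (λ (p , a) → 0ℚ ≤ p × C a) ν → 𝔼 ν (λ _ → 1ℚ) ≤ mass ν S + 𝔼 ν f
      go [] = ℚ.≤-refl
      go {(p , a) ∷ ν} ((0≤p , c) ∷ h) = ℚ.≤-trans (ℚ.+-mono-≤ (one p a 0≤p c (C? a) (f a ℚ.<? 1ℚ)) (go h))
        (ℚ.≤-reflexive (swap (if S a then p else 0ℚ) (p * f a) (mass ν S) (𝔼 ν f)))

-- Counting vertices and unordered pairs.

module Counting where

  open import Defs
  open import Data.Bool.Properties using (∧-comm)
  open import Data.Fin.Base using (Fin; zero; suc)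
  open import Data.Fin.Properties using (_≟_; _<?_)
  open import Data.Fin.Subset using (∣_∣)
  open import Data.Nat.Base using (ℕ; zero; suc; _+_; _*_; _≤_; _<_; z≤n)
  open import Data.Nat.Combinatorics using (_C_; nCk+nC[k+1]≡[n+1]C[k+1]; nC1≡n)
  open import Data.Nat.Tactic.RingSolver using (solve-∀)
  open import Data.Vec.Base using (tabulate)
  open import Algebra.Properties.Semiring.Sum ℕ.+-*-semiring public
    using (sum; sum-cong-≗; ∑-distrib-+; ∑-comm; *-distribˡ-sum; *-distribʳ-sum)

  𝟙 : Bool → ℕ
  𝟙 true  = 1
  𝟙 false = 0

  𝟙-∧ : ∀ a b → 𝟙 (a ∧ b) ≡ 𝟙 a * 𝟙 b
  𝟙-∧ true  b = sym (ℕ.+-identityʳ (𝟙 b))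
  𝟙-∧ false b = refl

  sum-mono : ∀ {n} {f g : Fin n → ℕ} → (∀ i → f i ≤ g i) → sum f ≤ sum g
  sum-mono {zero}  h = z≤n
  sum-mono {suc n} h = ℕ.+-mono-≤ (h zero) (sum-mono (h ∘ suc))

  sum-zero : ∀ n → sum {n} (λ _ → 0) ≡ 0
  sum-zero zero    = refl
  sum-zero (suc n) = sum-zero n

  sum-const : ∀ n c → sum {n} (λ _ → c) ≡ n * c
  sum-const zero    c = refl
  sum-const (suc n) c = cong (c +_) (sum-const n c)

  sum-δ : ∀ {n} a (h : Fin n → ℕ) → sum (λ u → 𝟙 (does (a ≟ u)) * h u) ≡ h a
  sum-δ {suc n} zero    h = trans (cong (h zero + 0 +_) (sum-zero n)) (trans (ℕ.+-identityʳ _) (ℕ.+-identityʳ _))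
  sum-δ {suc n} (suc a) h = sum-δ a (h ∘ suc)

  size : ∀ {n} → (Fin n → Bool) → ℕ
  size S = sum (λ v → 𝟙 (S v))

  size-tabulate : ∀ {n} (S : Fin n → Bool) → ∣ tabulate S ∣ ≡ size S
  size-tabulate {zero}  S = refl
  size-tabulate {suc n} S with S zero
  ... | true  = cong suc (size-tabulate (S ∘ suc))
  ... | false = size-tabulate (S ∘ suc)

  size-not : ∀ {n} (S : Fin n → Bool) → size S + size (not ∘ S) ≡ n
  size-not {n} S = begin
    size S + size (not ∘ S)                 ≡⟨ ∑-distrib-+ (𝟙 ∘ S) (𝟙 ∘ not ∘ S) ⟨
    sum (λ v → 𝟙 (S v) + 𝟙 (not (S v)))     ≡⟨ sum-cong-≗ (λ v → lem (S v)) ⟩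
    sum {n} (λ _ → 1)                       ≡⟨ sum-const n 1 ⟩
    n * 1                                   ≡⟨ ℕ.*-identityʳ n ⟩
    n                                       ∎
    where
    open ≡-Reasoning
    lem : ∀ b → 𝟙 b + 𝟙 (not b) ≡ 1
    lem true  = refl
    lem false = refl

  Pairs : ℕ → Set
  Pairs n = Fin n → Fin n → Bool

  lt : ∀ {n} → Fin n → Fin n → ℕ
  lt a b = 𝟙 (does (a <? b))

  -- The weight `lt` counts each unordered pair once, in the orientation `a < b` in which an `Edge`
  -- stores it.
  pairs : ∀ {n} → Pairs n → ℕ
  pairs p = sum (λ a → sum (λ b → lt a b * 𝟙 (p a b)))

  sum²-cong : ∀ {n} {f g : Fin n → Fin n → ℕ} → (∀ a b → f a b ≡ g a b) →
              sum (λ a → sum (f a)) ≡ sum (λ a → sum (g a))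
  sum²-cong h = sum-cong-≗ (λ a → sum-cong-≗ (h a))

  sum²-+ : ∀ {n} (f g : Fin n → Fin n → ℕ) →
           sum (λ a → sum (λ b → f a b + g a b)) ≡ sum (λ a → sum (f a)) + sum (λ a → sum (g a))
  sum²-+ f g = trans (sum-cong-≗ (λ a → ∑-distrib-+ (f a) (g a))) (∑-distrib-+ (λ a → sum (f a)) (λ a → sum (g a)))

  lt-yes : ∀ {n} {a b : Fin n} → a Fin.< b → lt a b ≡ 1
  lt-yes {a = a} {b} a<b = cong 𝟙 (dec-true (a <? b) a<b)

  lt-no : ∀ {n} {a b : Fin n} → b Fin.≤ a → lt a b ≡ 0
  lt-no {a = a} {b} b≤a = cong 𝟙 (dec-false (a <? b) (ℕ.≤⇒≯ b≤a))

  lt-cong : ∀ {n} (a b : Fin n) {x y : ℕ} → (a Fin.< b → x ≡ y) → lt a b * x ≡ lt a b * y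
  lt-cong a b {x} {y} h with a <? b
  ... | yes a<b = cong (lt a b *_) (h a<b)
  ... | no  a≮b = trans (cong (_* x) l≡0) (cong (_* y) (sym l≡0))
    where
    l≡0 : lt a b ≡ 0
    l≡0 = lt-no {a = a} (ℕ.≮⇒≥ a≮b)

  -- Off the diagonal a pair is increasing or decreasing, and exchanging the two sums reverses the
  -- decreasing ones. This converts sums over vertices of neighbour counts into edge counts.
  ordered≡pairs : ∀ {n} (p : Pairs n) → (∀ a → p a a ≡ false) →
                  sum (λ a → sum (λ b → 𝟙 (p a b)))
                  ≡ sum (λ a → sum (λ b → lt a b * (𝟙 (p a b) + 𝟙 (p b a))))
  ordered≡pairs p irr = begin
    sum (λ a → sum (λ b → 𝟙 (p a b)))
      ≡⟨ sum²-cong split ⟩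
    sum (λ a → sum (λ b → lt a b * 𝟙 (p a b) + lt b a * 𝟙 (p a b)))
      ≡⟨ sum²-+ (λ a b → lt a b * 𝟙 (p a b)) (λ a b → lt b a * 𝟙 (p a b)) ⟩
    pairs p + sum (λ a → sum (λ b → lt b a * 𝟙 (p a b)))
      ≡⟨ cong (pairs p +_) (∑-comm (λ a b → lt b a * 𝟙 (p a b))) ⟩
    pairs p + sum (λ a → sum (λ b → lt a b * 𝟙 (p b a)))
      ≡⟨ sum²-+ (λ a b → lt a b * 𝟙 (p a b)) (λ a b → lt a b * 𝟙 (p b a)) ⟨
    sum (λ a → sum (λ b → lt a b * 𝟙 (p a b) + lt a b * 𝟙 (p b a)))
      ≡⟨ sum²-cong (λ a b → ℕ.*-distribˡ-+ (lt a b) (𝟙 (p a b)) (𝟙 (p b a))) ⟨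
    sum (λ a → sum (λ b → lt a b * (𝟙 (p a b) + 𝟙 (p b a)))) ∎
    where
    open ≡-Reasoning
    one : ∀ x → x ≡ 1 * x + 0 * x
    one = solve-∀
    one′ : ∀ x → x ≡ 0 * x + 1 * x
    one′ = solve-∀
    split : ∀ a b → 𝟙 (p a b) ≡ lt a b * 𝟙 (p a b) + lt b a * 𝟙 (p a b)
    split a b with Fin.<-cmp a b
    ... | tri< a<b _ _ = trans (one (𝟙 (p a b)))
      (sym (cong₂ (λ x y → x * 𝟙 (p a b) + y * 𝟙 (p a b)) (lt-yes a<b) (lt-no {a = b} {a} (ℕ.<⇒≤ a<b))))
    ... | tri≈ _ refl _ = trans (cong 𝟙 (irr a))
      (sym (trans (cong (λ z → lt a a * 𝟙 z + lt a a * 𝟙 z) (irr a))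
        (cong₂ _+_ (ℕ.*-zeroʳ (lt a a)) (ℕ.*-zeroʳ (lt a a)))))
    ... | tri> _ _ b<a = trans (one′ (𝟙 (p a b)))
      (sym (cong₂ (λ x y → x * 𝟙 (p a b) + y * 𝟙 (p a b)) (lt-no {a = a} {b} (ℕ.<⇒≤ b<a)) (lt-yes b<a)))

  pairs-cong : ∀ {n} {p q : Pairs n} → (∀ a b → a Fin.< b → p a b ≡ q a b) → pairs p ≡ pairs q
  pairs-cong h = sum²-cong (λ a b → lt-cong a b (λ a<b → cong 𝟙 (h a b a<b)))

  pairs-split : ∀ {n} (p q : Pairs n) →
                pairs (λ a b → p a b ∧ q a b) + pairs (λ a b → p a b ∧ not (q a b)) ≡ pairs p
  pairs-split p q = trans (sym (sum²-+ (λ a b → lt a b * 𝟙 (p a b ∧ q a b)) (λ a b → lt a b * 𝟙 (p a b ∧ not (q a b)))))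
    (sum²-cong (λ a b → trans (sym (ℕ.*-distribˡ-+ (lt a b) (𝟙 (p a b ∧ q a b)) (𝟙 (p a b ∧ not (q a b)))))
      (cong (lt a b *_) (bool (p a b) (q a b)))))
    where
    bool : ∀ a b → 𝟙 (a ∧ b) + 𝟙 (a ∧ not b) ≡ 𝟙 a
    bool true  true  = refl
    bool true  false = refl
    bool false _     = refl

  symmetric-pairs : ∀ {n} (p : Pairs n) → (∀ a b → p a b ≡ p b a) → (∀ a → p a a ≡ false) →
                    sum (λ a → sum (λ b → 𝟙 (p a b))) ≡ 2 * pairs p
  symmetric-pairs p symm irr = trans (ordered≡pairs p irr)
    (trans (sum²-cong (λ a b → trans (cong (λ z → lt a b * (𝟙 (p a b) + 𝟙 z)) (symm b a)) (double (lt a b) (𝟙 (p a b)))))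
      (trans (sum²-+ (λ a b → lt a b * 𝟙 (p a b)) (λ a b → lt a b * 𝟙 (p a b))) (cong (pairs p +_) (sym (ℕ.+-identityʳ _)))))
    where
    double : ∀ l x → l * (x + x) ≡ l * x + l * x
    double = solve-∀

  2*C2 : ∀ n → 2 * (n C 2) + n ≡ n * n
  2*C2 zero    = refl
  2*C2 (suc n) = begin
    2 * (suc n C 2) + suc n       ≡⟨ cong (λ z → 2 * z + suc n) (nCk+nC[k+1]≡[n+1]C[k+1] n 1) ⟨
    2 * (n C 1 + n C 2) + suc n   ≡⟨ cong (λ z → 2 * (z + n C 2) + suc n) (nC1≡n n) ⟩
    2 * (n + n C 2) + suc n       ≡⟨ lem₁ n (n C 2) ⟩
    (2 * (n C 2) + n) + (n + suc n) ≡⟨ cong (_+ (n + suc n)) (2*C2 n) ⟩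
    n * n + (n + suc n)           ≡⟨ lem₂ n ⟩
    suc n * suc n                 ∎
    where
    open ≡-Reasoning
    lem₁ : ∀ n c → 2 * (n + c) + suc n ≡ (2 * c + n) + (n + suc n)
    lem₁ = solve-∀
    lem₂ : ∀ n → n * n + (n + suc n) ≡ suc n * suc n
    lem₂ = solve-∀

  ≟-refl : ∀ {n} (a : Fin n) → does (a ≟ a) ≡ true
  ≟-refl a = dec-true (a ≟ a) refl

  ≟-sym : ∀ {n} (a b : Fin n) → does (a ≟ b) ≡ does (b ≟ a)
  ≟-sym a b with a ≟ b | b ≟ a
  ... | yes _ | yes _ = refl
  ... | no _  | no _  = refl
  ... | yes p | no ¬q = contradiction (sym p) ¬q
  ... | no ¬p | yes q = contradiction (sym q) ¬p

  ≟-< : ∀ {n} {a b : Fin n} → a Fin.< b → does (a ≟ b) ≡ false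
  ≟-< {a = a} {b} a<b = dec-false (a ≟ b) (Fin.<⇒≢ a<b)

  internal : ∀ {n} → (Fin n → Bool) → Pairs n
  internal S u v = S u ∧ S v

  cut : ∀ {n} → (Fin n → Bool) → Pairs n
  cut S u v = S u xor S v

  product : ∀ {n} (S S′ : Fin n → Bool) → sum (λ a → sum (λ b → 𝟙 (S a ∧ S′ b))) ≡ size S * size S′
  product S S′ = begin
    sum (λ a → sum (λ b → 𝟙 (S a ∧ S′ b)))     ≡⟨ sum²-cong (λ a b → 𝟙-∧ (S a) (S′ b)) ⟩
    sum (λ a → sum (λ b → 𝟙 (S a) * 𝟙 (S′ b))) ≡⟨ sum-cong-≗ (λ a → *-distribˡ-sum (𝟙 (S a)) (𝟙 ∘ S′)) ⟨
    sum (λ a → 𝟙 (S a) * size S′)              ≡⟨ *-distribʳ-sum (size S′) (𝟙 ∘ S) ⟨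
    size S * size S′                           ∎
    where open ≡-Reasoning

  -- The summand `size S` is the diagonal, which `pairs` omits; kept on the left, it avoids halving
  -- and truncated subtraction.
  internal-pairs : ∀ {n} (S : Fin n → Bool) → 2 * pairs (internal S) + size S ≡ size S * size S
  internal-pairs {n} S = begin
    2 * pairs (internal S) + size S
      ≡⟨ cong (λ z → 2 * z + size S) (pairs-cong off) ⟩
    2 * pairs p + size S
      ≡⟨ cong₂ _+_ (sym (symmetric-pairs p psym irr)) (sum-cong-≗ diagonal) ⟩
    sum (λ a → sum (λ b → 𝟙 (p a b))) + sum (λ a → sum (λ b → 𝟙 (does (a ≟ b)) * 𝟙 (S a ∧ S b)))
      ≡⟨ sum²-+ (λ a b → 𝟙 (p a b)) (λ a b → 𝟙 (does (a ≟ b)) * 𝟙 (S a ∧ S b)) ⟨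
    sum (λ a → sum (λ b → 𝟙 (p a b) + 𝟙 (does (a ≟ b)) * 𝟙 (S a ∧ S b)))
      ≡⟨ sum²-cong (λ a b → merge (does (a ≟ b)) (S a ∧ S b)) ⟩
    sum (λ a → sum (λ b → 𝟙 (S a ∧ S b)))
      ≡⟨ product S S ⟩
    size S * size S ∎
    where
    open ≡-Reasoning
    p : Pairs n
    p a b = not (does (a ≟ b)) ∧ (S a ∧ S b)
    off : ∀ a b → a Fin.< b → internal S a b ≡ p a b
    off a b a<b = cong (λ z → not z ∧ (S a ∧ S b)) (sym (≟-< a<b))
    psym : ∀ a b → p a b ≡ p b a
    psym a b = cong₂ (λ x y → not x ∧ y) (≟-sym a b) (∧-comm (S a) (S b))
    irr : ∀ a → p a a ≡ false
    irr a = cong (λ z → not z ∧ (S a ∧ S a)) (≟-refl a)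
    idem : ∀ b → 𝟙 b ≡ 𝟙 (b ∧ b)
    idem true  = refl
    idem false = refl
    diagonal : ∀ a → 𝟙 (S a) ≡ sum (λ b → 𝟙 (does (a ≟ b)) * 𝟙 (S a ∧ S b))
    diagonal a = trans (idem (S a)) (sym (sum-δ a (λ b → 𝟙 (S a ∧ S b))))
    merge : ∀ d x → 𝟙 (not d ∧ x) + 𝟙 d * 𝟙 x ≡ 𝟙 x
    merge true  x = ℕ.+-identityʳ (𝟙 x)
    merge false x = ℕ.+-identityʳ (𝟙 x)

  pairs-all : ∀ n → pairs {n} (λ _ _ → true) ≡ n C 2
  pairs-all n = ℕ.*-cancelˡ-≡ _ _ 2 (ℕ.+-cancelʳ-≡ n _ _ (begin
    2 * pairs {n} (λ _ _ → true) + n              ≡⟨ cong (2 * pairs {n} (λ _ _ → true) +_) (sym all) ⟩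
    2 * pairs {n} (internal (λ _ → true)) + size {n} (λ _ → true) ≡⟨ internal-pairs {n} (λ _ → true) ⟩
    size {n} (λ _ → true) * size {n} (λ _ → true) ≡⟨ cong₂ _*_ all all ⟩
    n * n                                         ≡⟨ 2*C2 n ⟨
    2 * (n C 2) + n                               ∎))
    where
    open ≡-Reasoning
    all : size {n} (λ _ → true) ≡ n
    all = trans (sum-const n 1) (ℕ.*-identityʳ n)

  cut-sum : ∀ {n} (S : Fin n → Bool) (q : Pairs n) → (∀ a b → q a b ≡ q b a) →
            pairs (λ a b → cut S a b ∧ q a b) ≡ sum (λ a → sum (λ b → 𝟙 (S a ∧ (not (S b) ∧ q a b))))
  cut-sum S q qsym = trans (sum²-cong (λ a b → cong (lt a b *_)
      (trans (bool (S a) (S b) (q a b)) (cong (λ z → 𝟙 (S a ∧ (not (S b) ∧ q a b)) + 𝟙 (S b ∧ (not (S a) ∧ z))) (qsym a b)))))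
    (sym (ordered≡pairs (λ a b → S a ∧ (not (S b) ∧ q a b)) (λ a → irr (S a) (q a a))))
    where
    irr : ∀ s x → s ∧ (not s ∧ x) ≡ false
    irr true  x = refl
    irr false x = refl
    bool : ∀ s t x → 𝟙 ((s xor t) ∧ x) ≡ 𝟙 (s ∧ (not t ∧ x)) + 𝟙 (t ∧ (not s ∧ x))
    bool true  true  x = refl
    bool true  false true  = refl
    bool true  false false = refl
    bool false true  x = refl
    bool false false x = refl

  ∧-true : ∀ b → b ∧ true ≡ b
  ∧-true true  = refl
  ∧-true false = refl

  cut-pairs : ∀ {n} (S : Fin n → Bool) → pairs (cut S) ≡ size S * size (not ∘ S)
  cut-pairs S = begin
    pairs (cut S)                                          ≡⟨ pairs-cong (λ a b _ → ∧-true (cut S a b)) ⟨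
    pairs (λ a b → cut S a b ∧ true)                       ≡⟨ cut-sum S (λ _ _ → true) (λ _ _ → refl) ⟩
    sum (λ a → sum (λ b → 𝟙 (S a ∧ (not (S b) ∧ true))))  ≡⟨ sum²-cong (λ a b → cong (λ z → 𝟙 (S a ∧ z)) (∧-true (not (S b)))) ⟩
    sum (λ a → sum (λ b → 𝟙 (S a ∧ not (S b))))           ≡⟨ product S (not ∘ S) ⟩
    size S * size (not ∘ S)                                ∎
    where open ≡-Reasoning

-- The law of the random graph process.

module Process where

  open import Defs
  open Rationals
  open Distributions
  open Counting
  open import Data.Fin.Base using (Fin; zero; suc; toℕ)
  open import Data.List.Base using (List; []; _∷_; _++_; allFin; concatMap; filter; length)
  open import Data.List.Relation.Unary.All using (All; []; _∷_)
  open import Data.Nat.Base using (ℕ; zero; suc; z≤n; s≤s)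
  open import Data.Nat.Combinatorics using (_C_)
  open import Data.Rational.Base using (ℚ; 0ℚ; 1ℚ; _+_; _*_; _-_; -_; _≤_; _<_)
  open import Data.Vec.Base using (Vec; []; _∷_; _∷ʳ_; last; lookup)
  open import Data.Vec.Properties using (last-∷ʳ)
  open import Tactic.RingSolver using (solve-∀)

  private variable
    A : Set
    n : ℕ

  sumL : List A → (A → ℕ) → ℕ
  sumL []       h = 0
  sumL (x ∷ xs) h = h x ℕ.+ sumL xs h

  sumL-++ : (xs ys : List A) (h : A → ℕ) → sumL (xs ++ ys) h ≡ sumL xs h ℕ.+ sumL ys h
  sumL-++ []       ys h = refl
  sumL-++ (x ∷ xs) ys h = trans (cong (h x ℕ.+_) (sumL-++ xs ys h)) (sym (ℕ.+-assoc (h x) _ _))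

  sumL-concatMap : ∀ {B : Set} (xs : List B) (f : B → List A) (h : A → ℕ) →
                   sumL (concatMap f xs) h ≡ sumL xs (λ x → sumL (f x) h)
  sumL-concatMap []       f h = refl
  sumL-concatMap (x ∷ xs) f h =
    trans (sumL-++ (f x) (concatMap f xs) h) (cong (sumL (f x) h ℕ.+_) (sumL-concatMap xs f h))

  sumL-tabulate : ∀ k (f : Fin k → A) (h : A → ℕ) → sumL (List.tabulate f) h ≡ sum (h ∘ f)
  sumL-tabulate zero    f h = refl
  sumL-tabulate (suc k) f h = cong (h (f zero) ℕ.+_) (sumL-tabulate k (f ∘ suc) h)

  sumL-filter : ∀ {P : A → Set} (P? : ∀ a → Dec (P a)) (xs : List A) (h : A → ℕ) →
                sumL (filter P? xs) h ≡ sumL xs (λ x → 𝟙 (does (P? x)) ℕ.* h x)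
  sumL-filter P? []       h = refl
  sumL-filter P? (x ∷ xs) h with does (P? x)
  ... | true  = cong₂ ℕ._+_ (sym (ℕ.+-identityʳ (h x))) (sumL-filter P? xs h)
  ... | false = sumL-filter P? xs h

  sumL-length : (xs : List A) → sumL xs (λ _ → 1) ≡ length xs
  sumL-length []       = refl
  sumL-length (x ∷ xs) = cong suc (sumL-length xs)

  on : (Fin n → Fin n → A) → Edge n → A
  on h ((a , b) , _) = h a b

  -- Gives access to the list-valued function that is local to the definition of edges.
  edges-by-rows : ∀ n → Σ[ f ∈ (Fin n → Fin n → List (Edge n)) ]
    edges n ≡ concatMap (λ a → concatMap (f a) (allFin n)) (allFin n)
  edges-by-rows n = _ , refl

  edge-sum : (h : Fin n → Fin n → ℕ) (a b : Fin n) → sumL (proj₁ (edges-by-rows n) a b) (on h) ≡ lt a b ℕ.* h a b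
  edge-sum h a b with a Fin.<? b
  ... | yes a<b = trans (ℕ.+-identityʳ (h a b)) (sym (trans (cong (λ z → z ℕ.* h a b) (lt-yes a<b)) (ℕ.*-identityˡ (h a b))))
  ... | no  a≮b = sym (cong (λ z → z ℕ.* h a b) l≡0)
    where
    l≡0 : lt a b ≡ 0
    l≡0 = lt-no {a = a} (ℕ.≮⇒≥ a≮b)

  edges-sum : (h : Fin n → Fin n → ℕ) → sumL (edges n) (on h) ≡ sum (λ a → sum (λ b → lt a b ℕ.* h a b))
  edges-sum {n} h = trans (sumL-concatMap (allFin n) _ (on h)) (trans (sumL-tabulate n id _)
    (sum-cong-≗ (λ a → trans (sumL-concatMap (allFin n) _ (on h)) (trans (sumL-tabulate n id _)
      (sum-cong-≗ (edge-sum h a))))))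

  present absent : Pairs n → Graph n → ℕ
  present F G = pairs (λ a b → F a b ∧ adj G a b)
  absent  F G = pairs (λ a b → F a b ∧ not (adj G a b))

  present+absent : (F : Pairs n) (G : Graph n) → present F G ℕ.+ absent F G ≡ pairs F
  present+absent F G = pairs-split F (adj G)

  everything : Pairs n
  everything _ _ = true

  missing-sum : (F : Pairs n) (G : Graph n) → sumL (missing G) (on (λ a b → 𝟙 (F a b))) ≡ absent F G
  missing-sum {n} F G = begin
    sumL (missing G) (on (λ a b → 𝟙 (F a b)))
      ≡⟨ sumL-filter (λ ((a , b) , _) → adj G a b Bool.≟ false) (edges n) (on (λ a b → 𝟙 (F a b))) ⟩
    sumL (edges n) (on (λ a b → 𝟙 (does (adj G a b Bool.≟ false)) ℕ.* 𝟙 (F a b)))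
      ≡⟨ edges-sum (λ a b → 𝟙 (does (adj G a b Bool.≟ false)) ℕ.* 𝟙 (F a b)) ⟩
    sum (λ a → sum (λ b → lt a b ℕ.* (𝟙 (does (adj G a b Bool.≟ false)) ℕ.* 𝟙 (F a b))))
      ≡⟨ sum²-cong (λ a b → cong (lt a b ℕ.*_) (bool (adj G a b) (F a b))) ⟩
    absent F G ∎
    where
    open ≡-Reasoning
    bool : ∀ x f → 𝟙 (does (x Bool.≟ false)) ℕ.* 𝟙 f ≡ 𝟙 (f ∧ not x)
    bool true  true  = refl
    bool true  false = refl
    bool false true  = refl
    bool false false = refl

  missing-length : (G : Graph n) → length (missing G) ≡ absent everything G
  missing-length G = trans (sym (sumL-length (missing G))) (missing-sum everything G)

  missing-absent : (G : Graph n) → All (λ ((a , b) , _) → adj G a b ≡ false) (missing G)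
  missing-absent {n} G = All.all-filter (λ ((a , b) , _) → adj G a b Bool.≟ false) (edges n)

  module _ (F : Pairs n) (G : Graph n) {a b : Fin n} (a<b : a Fin.< b) (ab∉G : adj G a b ≡ false) where

    private
      e : Edge n
      e = (a , b) , a<b

      is : Fin n → Fin n → Bool
      is x y = does (x Fin.≟ y)

      δ : Fin n → Fin n → ℕ
      δ u v = 𝟙 (is a u) ℕ.* (𝟙 (is b v) ℕ.* 𝟙 (F u v))

      no-swap : ∀ u v → u Fin.< v → is b u ∧ is a v ≡ false
      no-swap u v u<v with b Fin.≟ u | a Fin.≟ v
      ... | yes refl | yes refl = contradiction u<v (ℕ.<-asym a<b)
      ... | yes _    | no _     = refl
      ... | no _     | _        = refl

      hit : ∀ u v → is a u ∧ is b v ≡ true → adj G u v ≡ false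
      hit u v h with a Fin.≟ u | b Fin.≟ v
      hit u v h  | yes refl | yes refl = ab∉G
      hit u v () | yes _    | no _
      hit u v () | no _     | _

      lt-δ : ∀ u v → lt u v ℕ.* δ u v ≡ δ u v
      lt-δ u v with a Fin.≟ u | b Fin.≟ v
      ... | yes refl | yes refl = trans (cong (ℕ._* (𝟙 (F u v) ℕ.+ 0 ℕ.+ 0)) (lt-yes a<b)) (ℕ.+-identityʳ _)
      ... | yes _    | no _     = ℕ.*-zeroʳ (lt u v)
      ... | no _     | _        = ℕ.*-zeroʳ (lt u v)

      δ-sum : sum (λ u → sum (δ u)) ≡ 𝟙 (F a b)
      δ-sum = trans (sum-cong-≗ (λ u → sym (*-distribˡ-sum (𝟙 (is a u)) (λ v → 𝟙 (is b v) ℕ.* 𝟙 (F u v)))))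
        (trans (sum-δ a (λ u → sum (λ v → 𝟙 (is b v) ℕ.* 𝟙 (F u v)))) (sum-δ b (λ v → 𝟙 (F a v))))

      boolX : ∀ f x d s t → s ≡ false → d ≡ 𝟙 t → (t ≡ true → x ≡ false) →
              𝟙 (f ∧ (x ∨ (t ∨ s))) ≡ 𝟙 (f ∧ x) ℕ.+ d ℕ.* 𝟙 f
      boolX true  true  _ _ true  refl refl h = contradiction (h refl) λ ()
      boolX true  true  _ _ false refl refl h = refl
      boolX true  false _ _ true  refl refl h = refl
      boolX true  false _ _ false refl refl h = refl
      boolX false _     _ _ true  refl refl h = refl
      boolX false _     _ _ false refl refl h = refl

      boolY : ∀ f x d s t → s ≡ false → d ≡ 𝟙 t → (t ≡ true → x ≡ false) →
              𝟙 (f ∧ not x) ≡ 𝟙 (f ∧ not (x ∨ (t ∨ s))) ℕ.+ d ℕ.* 𝟙 f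
      boolY true  true  _ _ true  refl refl h = contradiction (h refl) λ ()
      boolY true  true  _ _ false refl refl h = refl
      boolY true  false _ _ true  refl refl h = refl
      boolY true  false _ _ false refl refl h = refl
      boolY false _     _ _ true  refl refl h = refl
      boolY false _     _ _ false refl refl h = refl

      add : ∀ {f g : Fin n → Fin n → ℕ} →
            (∀ u v → u Fin.< v → f u v ≡ g u v ℕ.+ (𝟙 (is a u ∧ is b v)) ℕ.* 𝟙 (F u v)) →
            sum (λ u → sum (λ v → lt u v ℕ.* f u v)) ≡ sum (λ u → sum (λ v → lt u v ℕ.* g u v)) ℕ.+ 𝟙 (F a b)
      add {f} {g} h = trans (sum²-cong (λ u v → trans
          (lt-cong u v (λ u<v → trans (h u v u<v) (cong (g u v ℕ.+_)
            (trans (cong (ℕ._* 𝟙 (F u v)) (𝟙-∧ (is a u) (is b v))) (ℕ.*-assoc (𝟙 (is a u)) (𝟙 (is b v)) (𝟙 (F u v)))))))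
          (trans (ℕ.*-distribˡ-+ (lt u v) (g u v) (δ u v)) (cong (lt u v ℕ.* g u v ℕ.+_) (lt-δ u v)))))
        (trans (sum²-+ (λ u v → lt u v ℕ.* g u v) δ) (cong (sum (λ u → sum (λ v → lt u v ℕ.* g u v)) ℕ.+_) δ-sum))

    present-addEdge : present F (addEdge G e) ≡ present F G ℕ.+ 𝟙 (F a b)
    present-addEdge = add (λ u v u<v →
      boolX (F u v) (adj G u v) _ (is b u ∧ is a v) (is a u ∧ is b v) (no-swap u v u<v) refl (hit u v))

    absent-addEdge : absent F G ≡ absent F (addEdge G e) ℕ.+ 𝟙 (F a b)
    absent-addEdge = add (λ u v u<v →
      boolY (F u v) (adj G u v) _ (is b u ∧ is a v) (is a u ∧ is b v) (no-swap u v u<v) refl (hit u v))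

  ⊆-addEdge : (G : Graph n) (e : Edge n) → G ⊆ᴳ addEdge G e
  ⊆-addEdge G e u v t with adj G u v
  ... | true = tt

  -- An index past the end gives the last entry. A potential attached to a fixed time is therefore
  -- evaluated at the current graph until that time and stays frozen afterwards, by one formula.
  at : ∀ {k} → Vec A (suc k) → ℕ → A
  at (x ∷ [])     _       = x
  at (x ∷ y ∷ ys) zero    = x
  at (x ∷ y ∷ ys) (suc j) = at (y ∷ ys) j

  at-last : ∀ {k j} (xs : Vec A (suc k)) → k ℕ.≤ j → at xs j ≡ last xs
  at-last (x ∷ [])     _         = refl
  at-last (x ∷ y ∷ ys) (s≤s k≤j) = at-last (y ∷ ys) k≤j

  at-∷ʳ : ∀ {k j} (xs : Vec A (suc k)) x → j ℕ.≤ k → at (xs ∷ʳ x) j ≡ at xs j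
  at-∷ʳ (y ∷ [])     x z≤n       = refl
  at-∷ʳ (y ∷ z ∷ zs) x z≤n       = refl
  at-∷ʳ (y ∷ z ∷ zs) x (s≤s j≤k) = at-∷ʳ (z ∷ zs) x j≤k

  at-∷ʳ-last : ∀ {k j} (xs : Vec A (suc k)) x → k ℕ.< j → at (xs ∷ʳ x) j ≡ x
  at-∷ʳ-last xs x k<j = trans (at-last (xs ∷ʳ x) k<j) (last-∷ʳ x xs)

  lookup≡at : ∀ {k} (xs : Vec A (suc k)) i → lookup xs i ≡ at xs (toℕ i)
  lookup≡at (x ∷ [])     zero    = refl
  lookup≡at (x ∷ y ∷ ys) zero    = refl
  lookup≡at (x ∷ y ∷ ys) (suc i) = lookup≡at (y ∷ ys) i

  Increasing : ∀ {k} → Vec (Graph n) (suc k) → Set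
  Increasing (G ∷ [])     = ⊤
  Increasing (G ∷ H ∷ Gs) = G ⊆ᴳ H × Increasing (H ∷ Gs)

  increasing? : ∀ {k} (Gs : Vec (Graph n) (suc k)) → Dec (Increasing Gs)
  increasing? (G ∷ [])     = yes tt
  increasing? (G ∷ H ∷ Gs) =
    Fin.all? (λ u → Fin.all? (λ v → T? (adj G u v) →-dec T? (adj H u v))) ×-dec increasing? (H ∷ Gs)

  increasing-∷ʳ : ∀ {k} (Gs : Vec (Graph n) (suc k)) {H} → Increasing Gs → last Gs ⊆ᴳ H → Increasing (Gs ∷ʳ H)
  increasing-∷ʳ (G ∷ [])      _          l = l , tt
  increasing-∷ʳ (G ∷ G′ ∷ Gs) (s , inc) l = s , increasing-∷ʳ (G′ ∷ Gs) inc l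

  at-mono : ∀ {k i j} (Gs : Vec (Graph n) (suc k)) → Increasing Gs → i ℕ.≤ j → at Gs i ⊆ᴳ at Gs j
  at-mono (G ∷ [])     _         _                       u v t = t
  at-mono (G ∷ H ∷ Gs) _         (z≤n {zero})            u v t = t
  at-mono (G ∷ H ∷ Gs) (s , inc) (z≤n {suc j})           u v t =
    at-mono {i = 0} {j} (H ∷ Gs) inc z≤n u v (subst (λ K → T (adj K u v)) (at-0 (H ∷ Gs)) (s u v t))
    where
    at-0 : ∀ {k} (Ks : Vec (Graph n) (suc k)) → Data.Vec.Base.head Ks ≡ at Ks 0
    at-0 (K ∷ [])    = refl
    at-0 (K ∷ _ ∷ _) = refl
  at-mono (G ∷ H ∷ Gs) (_ , inc) (s≤s i≤j)               u v t = at-mono (H ∷ Gs) inc i≤j u v t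

  Supported : ∀ {i} → Vec (Graph n) (suc i) → Set
  Supported {n} {i} Gs = length (missing (last Gs)) ℕ.+ i ≡ n C 2 × Increasing Gs

  missing-addEdge : (G : Graph n) → All (λ e → length (missing G) ≡ suc (length (missing (addEdge G e)))) (missing G)
  missing-addEdge G = All.map (λ {((a , b) , a<b)} ab∉G → begin
    length (missing G)                                  ≡⟨ missing-length G ⟩
    absent everything G                                 ≡⟨ absent-addEdge everything G a<b ab∉G ⟩
    absent everything (addEdge G ((a , b) , a<b)) ℕ.+ 1 ≡⟨ ℕ.+-comm _ 1 ⟩
    suc (absent everything (addEdge G ((a , b) , a<b))) ≡⟨ cong suc (missing-length (addEdge G ((a , b) , a<b))) ⟨
    suc (length (missing (addEdge G ((a , b) , a<b))))  ∎) (missing-absent G)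
    where open ≡-Reasoning

  Law : (A → Set) → Dist A → Set
  Law S = All (λ (p , a) → 0ℚ ≤ p × S a)

  law->>= : ∀ {B : Set} {S : A → Set} {R : B → Set} {μ : Dist A} {k : A → Dist B} →
            Law S μ → (∀ a → S a → Law R (k a)) → Law R (μ >>= k)
  law->>= []                    h = []
  law->>= ((0≤p , s) ∷ law) h =
    All.++⁺ (All.map⁺ (All.map (λ (0≤q , r) → 0≤* 0≤p 0≤q , r) (h _ s))) (law->>= law h)

  law-uniform : ∀ {S : A → Set} {xs : List A} → All S xs → Law S (uniform xs)
  law-uniform []             = []
  law-uniform {xs = xs} ss@(_ ∷ _) = All.map⁺ (All.map (0≤inv (length xs) ,_) ss)

  law-process : ∀ n i → i ℕ.≤ n C 2 → Law Supported (processUpTo n i)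
  law-process n zero    _   = (0≤1 , trans (ℕ.+-identityʳ _) (trans (missing-length (empty n)) (pairs-all n)) , tt) ∷ []
  law-process n (suc i) i<N = law->>= {μ = processUpTo n i} (law-process n i (ℕ.<⇒≤ i<N))
    (λ Gs (len , inc) → law->>= {μ = uniform (missing (last Gs))} (law-uniform (missing-addEdge (last Gs)))
      (λ e eq → (0≤1 , support Gs e len inc eq) ∷ []))
    where
    support : ∀ Gs e → length (missing (last Gs)) ℕ.+ i ≡ n C 2 → Increasing Gs →
              length (missing (last Gs)) ≡ suc (length (missing (addEdge (last Gs) e))) →
              Supported (Gs ∷ʳ addEdge (last Gs) e)
    support Gs e len inc eq = trans (cong (λ G → length (missing G) ℕ.+ suc i) (last-∷ʳ (addEdge (last Gs) e) Gs))
        (trans (ℕ.+-suc _ i) (trans (cong (ℕ._+ i) (sym eq)) len))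
      , increasing-∷ʳ Gs inc (⊆-addEdge (last Gs) e)

  average : ∀ {i} (Gs : Vec (Graph n) (suc i)) → (Vec (Graph n) (suc (suc i)) → ℚ) → ℚ
  average Gs f = 𝔼 (uniform (missing (last Gs))) (λ e → f (Gs ∷ʳ addEdge (last Gs) e))

  𝔼-process : ∀ n i f → 𝔼 (processUpTo n (suc i)) f ≡ 𝔼 (processUpTo n i) (λ Gs → average Gs f)
  𝔼-process n i f = trans (𝔼->>= (processUpTo n i) _ f) (𝔼-cong (processUpTo n i) (λ Gs →
    trans (𝔼->>= (uniform (missing (last Gs))) (λ e → point (Gs ∷ʳ addEdge (last Gs) e)) f)
      (𝔼-cong (uniform (missing (last Gs))) (λ e → 𝔼-point (Gs ∷ʳ addEdge (last Gs) e) f))))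

  some-missing : ∀ {i l N} → l ℕ.+ i ≡ N → i ℕ.< N → 1 ℕ.≤ l
  some-missing {l = zero}  refl i<N = contradiction i<N (ℕ.<-irrefl refl)
  some-missing {l = suc _} _    _   = s≤s z≤n

  -- The step hypothesis is multiplied by the number of missing edges, which turns the uniform
  -- average into a plain sum; `some-missing` allows dividing by it again.
  supermartingale : ∀ {n} (ψ : ∀ i → Vec (Graph n) (suc i) → ℚ) →
    (∀ i Gs → i ℕ.< n C 2 → Supported {n} {i} Gs →
       ΣL (missing (last Gs)) (λ e → ψ (suc i) (Gs ∷ʳ addEdge (last Gs) e)) ≤ # (length (missing (last Gs))) * ψ i Gs) →
    ∀ i → i ℕ.≤ n C 2 → 𝔼 (processUpTo n i) (ψ i) ≤ ψ 0 (empty n ∷ [])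
  supermartingale {n} ψ step zero    _   = ℚ.≤-reflexive (𝔼-point _ (ψ 0))
  supermartingale {n} ψ step (suc i) i<N = begin
    𝔼 (processUpTo n (suc i)) (ψ (suc i))           ≡⟨ 𝔼-process n i (ψ (suc i)) ⟩
    𝔼 (processUpTo n i) (λ Gs → average Gs (ψ (suc i))) ≤⟨ 𝔼-mono (All.map (λ {(p , Gs)} (0≤p , s) → 0≤p , one Gs s) (law-process n i (ℕ.<⇒≤ i<N))) ⟩
    𝔼 (processUpTo n i) (ψ i)                       ≤⟨ supermartingale ψ step i (ℕ.<⇒≤ i<N) ⟩
    ψ 0 (empty n ∷ [])                              ∎
    where
    open ℚ.≤-Reasoning
    one : ∀ Gs → Supported Gs → average Gs (ψ (suc i)) ≤ ψ i Gs
    one Gs s = *-cancelˡ (# (length (missing (last Gs)))) (0<#′ (some-missing (proj₁ s) i<N))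
      (ℚ.≤-trans (ℚ.≤-reflexive (𝔼-uniform (missing (last Gs)) _)) (step i Gs i<N s))

  -- The constants `1` and `- 1` both satisfy the supermartingale condition, which gives the two
  -- inequalities.
  𝔼-process-1 : ∀ n i → i ℕ.≤ n C 2 → 𝔼 (processUpTo n i) (λ _ → 1ℚ) ≡ 1ℚ
  𝔼-process-1 n i i≤N = ℚ.≤-antisym
    (supermartingale (λ _ _ → 1ℚ) (λ _ Gs _ _ → ℚ.≤-reflexive (ΣL-const 1ℚ (missing (last Gs)))) i i≤N)
    (subst (_≤ 𝔼 (processUpTo n i) (λ _ → 1ℚ)) refl (neg (subst₂ _≤_ (minus (processUpTo n i)) refl
      (supermartingale (λ _ _ → - 1ℚ) (λ _ Gs _ _ → ℚ.≤-reflexive (ΣL-const (- 1ℚ) (missing (last Gs)))) i i≤N))))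
    where
    minus : ∀ {B : Set} (μ : Dist B) → 𝔼 μ (λ _ → - 1ℚ) ≡ - 𝔼 μ (λ _ → 1ℚ)
    minus μ = trans (𝔼-* (- 1ℚ) μ (λ _ → 1ℚ)) (lem (𝔼 μ (λ _ → 1ℚ)))
      where
      lem : ∀ x → (- 1ℚ) * x ≡ - x
      lem = solve-∀ ring
    neg : ∀ {a} → - a ≤ - 1ℚ → 1ℚ ≤ a
    neg {a} h = subst₂ _≤_ refl (lem a) (ℚ.neg-antimono-≤ h)
      where
      lem : ∀ a → - (- a) ≡ a
      lem = solve-∀ ring

-- The potential of a set of pairs and its one-step inequality.

module Potentials where

  open import Defs
  open Rationals
  open Distributions
  open Counting
  open Process
  open import Data.Fin.Base using (zero; suc)
  open import Data.List.Base using (List; []; _∷_; length)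
  open import Data.List.Relation.Unary.All using (All; []; _∷_)
  open import Data.Nat.Base using (ℕ; zero; suc; _∸_; z≤n; s≤s)
  open import Data.Rational.Base using (ℚ; 0ℚ; 1ℚ; _+_; _*_; _-_; -_; _≤_)
  open import Tactic.RingSolver using (solve-∀)

  private variable
    A : Set
    n : ℕ

  -- The elements outside `P` number `length xs` minus those inside; the subtracted part is moved to
  -- the left to keep the identity additive.
  ΣL-if : (xs : List A) (P : A → Bool) (f : A → ℚ) (α β : ℚ) →
          All (λ x → f x ≡ (if P x then α else β)) xs →
          ΣL xs f + # (sumL xs (𝟙 ∘ P)) * β ≡ # (sumL xs (𝟙 ∘ P)) * α + # (length xs) * β
  ΣL-if []       P f α β _ = trans (lem β) (sym (lem′ α β))
    where
    lem : ∀ β → 0ℚ + 0ℚ * β ≡ 0ℚ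
    lem = solve-∀ ring
    lem′ : ∀ α β → 0ℚ * α + 0ℚ * β ≡ 0ℚ
    lem′ = solve-∀ ring
  ΣL-if (x ∷ xs) P f α β (eq ∷ eqs) = go (P x) (f x) eq
    where
    open ≡-Reasoning
    S c l : ℚ
    S = ΣL xs f
    c = # (sumL xs (𝟙 ∘ P))
    l = # (length xs)
    ih : S + c * β ≡ c * α + l * β
    ih = ΣL-if xs P f α β eqs
    lem₁ : ∀ α β S c → (α + S) + (1ℚ + c) * β ≡ (S + c * β) + (α + β)
    lem₁ = solve-∀ ring
    lem₂ : ∀ α β c l → (c * α + l * β) + (α + β) ≡ (1ℚ + c) * α + (1ℚ + l) * β
    lem₂ = solve-∀ ring
    lem₃ : ∀ β S c → (β + S) + c * β ≡ (S + c * β) + β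
    lem₃ = solve-∀ ring
    lem₄ : ∀ α β c l → (c * α + l * β) + β ≡ c * α + (1ℚ + l) * β
    lem₄ = solve-∀ ring
    go : ∀ p y → y ≡ (if p then α else β) →
         (y + S) + # (𝟙 p ℕ.+ sumL xs (𝟙 ∘ P)) * β ≡ # (𝟙 p ℕ.+ sumL xs (𝟙 ∘ P)) * α + # (suc (length xs)) * β
    go true  y refl = begin
      (α + S) + # (suc (sumL xs (𝟙 ∘ P))) * β ≡⟨ cong (λ z → (α + S) + z * β) (#-suc (sumL xs (𝟙 ∘ P))) ⟩
      (α + S) + (1ℚ + c) * β      ≡⟨ lem₁ α β S c ⟩
      (S + c * β) + (α + β)       ≡⟨ cong (_+ (α + β)) ih ⟩
      (c * α + l * β) + (α + β)   ≡⟨ lem₂ α β c l ⟩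
      (1ℚ + c) * α + (1ℚ + l) * β ≡⟨ cong₂ (λ y z → y * α + z * β) (#-suc (sumL xs (𝟙 ∘ P))) (#-suc (length xs)) ⟨
      # (suc (sumL xs (𝟙 ∘ P))) * α + # (suc (length xs)) * β ∎
    go false y refl = begin
      (β + S) + c * β             ≡⟨ lem₃ β S c ⟩
      (S + c * β) + β             ≡⟨ cong (_+ β) ih ⟩
      (c * α + l * β) + β         ≡⟨ lem₄ α β c l ⟩
      c * α + (1ℚ + l) * β        ≡⟨ cong (λ z → c * α + z * β) (#-suc (length xs)) ⟨
      c * α + # (suc (length xs)) * β ∎

  module Potential (F : Pairs n) (lam : ℚ) (c : ℚ) where

    pot : Graph n → ℚ
    pot G = lam ^ present F G * c ^ absent F G

    private
      after : (G : Graph n) → All (λ e → pot (addEdge G e) ≡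
                (if on F e then lam ^ suc (present F G) * c ^ (absent F G ∸ 1)
                           else lam ^ present F G * c ^ absent F G)) (missing G)
      after G = All.map (λ {((a , b) , a<b)} ab∉G →
          go (F a b) (present-addEdge F G a<b ab∉G) (absent-addEdge F G a<b ab∉G)) (missing-absent G)
        where
        go : ∀ p {x y x′ y′} → x′ ≡ x ℕ.+ 𝟙 p → y ≡ y′ ℕ.+ 𝟙 p →
             lam ^ x′ * c ^ y′ ≡ (if p then lam ^ suc x * c ^ (y ∸ 1) else lam ^ x * c ^ y)
        go true {x} {y′ = y′} refl refl = cong₂ (λ u v → lam ^ u * c ^ v) (ℕ.+-comm x 1) (sym (cong (_∸ 1) (ℕ.+-comm y′ 1)))
        go false {x} {y′ = y′} refl refl = cong₂ (λ u v → lam ^ u * c ^ v) (ℕ.+-identityʳ x) (sym (ℕ.+-identityʳ y′))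

    -- Choosing a missing pair of `F` trades one factor `c` for `lam`. If `F` has no missing pair,
    -- the truncated exponent `absent F G ∸ 1` is harmless because its coefficient is `0`.
    pot-sum : (G : Graph n) →
      ΣL (missing G) (pot ∘ addEdge G) + # (absent F G) * (lam ^ present F G * c ^ absent F G)
      ≡ # (absent F G) * (lam ^ suc (present F G) * c ^ (absent F G ∸ 1))
        + # (length (missing G)) * (lam ^ present F G * c ^ absent F G)
    pot-sum G = subst (λ z → ΣL (missing G) (pot ∘ addEdge G) + # z * β ≡ # z * α + # (length (missing G)) * β)
      (missing-sum F G) (ΣL-if (missing G) (on F) (pot ∘ addEdge G) α β (after G))
      where
      α β : ℚ
      α = lam ^ suc (present F G) * c ^ (absent F G ∸ 1)
      β = lam ^ present F G * c ^ absent F G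

    module _ (0≤lam : 0ℚ ≤ lam) (0≤c : 0ℚ ≤ c) where

      0≤pot : ∀ G → 0ℚ ≤ pot G
      0≤pot G = 0≤* (0≤^ (present F G) 0≤lam) (0≤^ (absent F G) 0≤c)

      pot-monotone : (lam ≤ c → (G : Graph n) → All (λ e → pot (addEdge G e) ≤ pot G) (missing G))
      pot-monotone lam≤c G = All.map (λ {((a , b) , a<b)} ab∉G →
          go (F a b) (present-addEdge F G a<b ab∉G) (absent-addEdge F G a<b ab∉G)) (missing-absent G)
        where
        lem : ∀ l p q → (l * p) * q ≡ (p * l) * q
        lem = solve-∀ ring
        go : ∀ p {x y x′ y′} → x′ ≡ x ℕ.+ 𝟙 p → y ≡ y′ ℕ.+ 𝟙 p → lam ^ x′ * c ^ y′ ≤ lam ^ x * c ^ y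
        go false {x} {y′ = y′} refl refl = ℚ.≤-reflexive (cong₂ (λ u v → lam ^ u * c ^ v) (ℕ.+-identityʳ x) (sym (ℕ.+-identityʳ y′)))
        go true {x} {y′ = y′} refl refl = subst₂ (λ u v → lam ^ u * c ^ y′ ≤ lam ^ x * c ^ v) (ℕ.+-comm 1 x) (ℕ.+-comm 1 y′)
          (begin
            lam * lam ^ x * c ^ y′ ≡⟨ lem lam (lam ^ x) (c ^ y′) ⟩
            lam ^ x * lam * c ^ y′ ≡⟨ ℚ.*-assoc (lam ^ x) lam (c ^ y′) ⟩
            lam ^ x * (lam * c ^ y′) ≤⟨ *-monoˡ _ (0≤^ x 0≤lam) (*-monoʳ _ (0≤^ y′ 0≤c) lam≤c) ⟩
            lam ^ x * (c * c ^ y′) ∎)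
          where open ℚ.≤-Reasoning

      pot-antitone : (c ≤ lam → (G : Graph n) → All (λ e → pot G ≤ pot (addEdge G e)) (missing G))
      pot-antitone c≤lam G = All.map (λ {((a , b) , a<b)} ab∉G →
          go (F a b) (present-addEdge F G a<b ab∉G) (absent-addEdge F G a<b ab∉G)) (missing-absent G)
        where
        lem : ∀ l p q → p * (l * q) ≡ l * p * q
        lem = solve-∀ ring
        go : ∀ p {x y x′ y′} → x′ ≡ x ℕ.+ 𝟙 p → y ≡ y′ ℕ.+ 𝟙 p → lam ^ x * c ^ y ≤ lam ^ x′ * c ^ y′
        go false {x} {y′ = y′} refl refl = ℚ.≤-reflexive (sym (cong₂ (λ u v → lam ^ u * c ^ v) (ℕ.+-identityʳ x) (sym (ℕ.+-identityʳ y′))))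
        go true {x} {y′ = y′} refl refl = subst₂ (λ u v → lam ^ x * c ^ v ≤ lam ^ u * c ^ y′) (ℕ.+-comm 1 x) (ℕ.+-comm 1 y′)
          (begin
            lam ^ x * (c * c ^ y′)   ≤⟨ *-monoˡ _ (0≤^ x 0≤lam) (*-monoʳ _ (0≤^ y′ 0≤c) c≤lam) ⟩
            lam ^ x * (lam * c ^ y′) ≡⟨ lem lam (lam ^ x) (c ^ y′) ⟩
            lam * lam ^ x * c ^ y′   ∎)
          where open ℚ.≤-Reasoning

  open Potential public using (pot; pot-sum; 0≤pot; pot-monotone; pot-antitone)

  -- 1 + (λ − 1) k / r is the expectation of λ^[e chosen] when a missing edge e
  -- is still to be chosen with probability k / r.
  rate : ℚ → ℕ → ℕ → ℚ
  rate lam k r = 1ℚ + (lam - 1ℚ) * (# k * inv r)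

  rate-zero : ∀ lam r → rate lam 0 r ≡ 1ℚ
  rate-zero lam r = lem lam (inv r)
    where
    lem : ∀ l i → 1ℚ + (l - 1ℚ) * (0ℚ * i) ≡ 1ℚ
    lem = solve-∀ ring

  #*rate : ∀ lam {k r} → k ℕ.≤ r → # r * rate lam k r ≡ # r + (lam - 1ℚ) * # k
  #*rate lam {zero} {zero} z≤n = lem lam
    where
    lem : ∀ l → 0ℚ * (1ℚ + (l - 1ℚ) * (0ℚ * 0ℚ)) ≡ 0ℚ + (l - 1ℚ) * 0ℚ
    lem = solve-∀ ring
  #*rate lam {k} {suc r} _ = trans (lem (# (suc r)) lam (# k) (inv (suc r)))
    (trans (cong (λ z → # (suc r) + (lam - 1ℚ) * (# k * z)) (#*inv r)) (cong (λ z → # (suc r) + (lam - 1ℚ) * z) (ℚ.*-identityʳ (# k))))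
    where
    lem : ∀ r l k i → r * (1ℚ + (l - 1ℚ) * (k * i)) ≡ r + (l - 1ℚ) * (k * (r * i))
    lem = solve-∀ ring

  fraction≤1 : ∀ {k r} → k ℕ.≤ r → # k * inv r ≤ 1ℚ
  fraction≤1 {zero}  {r}     _   = subst (_≤ 1ℚ) (sym (ℚ.*-zeroˡ (inv r))) 0≤1
  fraction≤1 {suc k} {suc r} k≤r = subst (# (suc k) * inv (suc r) ≤_) (#*inv r)
    (*-monoʳ (inv (suc r)) (0≤inv (suc r)) (#-mono k≤r))

  0≤fraction : ∀ k r → 0ℚ ≤ # k * inv r
  0≤fraction k r = 0≤* (0≤# k) (0≤inv r)

  0≤rate : ∀ {lam k r} → 0ℚ ≤ lam → k ℕ.≤ r → 0ℚ ≤ rate lam k r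
  0≤rate {lam} {k} {r} 0≤lam k≤r = subst (0ℚ ≤_) (lem lam (# k * inv r))
    (0≤+ (0≤-diff (fraction≤1 k≤r)) (0≤* 0≤lam (0≤fraction k r)))
    where
    lem : ∀ l x → (1ℚ - x) + l * x ≡ 1ℚ + (l - 1ℚ) * x
    lem = solve-∀ ring

  lam≤rate : ∀ {lam k r} → lam ≤ 1ℚ → k ℕ.≤ r → lam ≤ rate lam k r
  lam≤rate {lam} {k} {r} lam≤1 k≤r = ≤-by _ (0≤* (0≤-diff lam≤1) (0≤-diff (fraction≤1 k≤r))) (lem lam (# k * inv r))
    where
    lem : ∀ l x → l + (1ℚ - l) * (1ℚ - x) ≡ 1ℚ + (l - 1ℚ) * x
    lem = solve-∀ ring

  -- Conditioning on the next step: a given missing edge is chosen now with probability `1 / suc r`,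
  -- contributing `lam`, and otherwise waits with `k` steps and `r` missing edges left. The identity
  -- is multiplied by `suc r`.
  rate-step : ∀ lam {k r} → k ℕ.≤ r → # (suc r) * rate lam (suc k) (suc r) ≡ lam + # r * rate lam k r
  rate-step lam {k} {r} k≤r = begin
    # (suc r) * rate lam (suc k) (suc r) ≡⟨ #*rate lam (s≤s k≤r) ⟩
    # (suc r) + (lam - 1ℚ) * # (suc k)   ≡⟨ cong₂ (λ u v → u + (lam - 1ℚ) * v) (#-suc r) (#-suc k) ⟩
    (1ℚ + # r) + (lam - 1ℚ) * (1ℚ + # k) ≡⟨ lem lam (# r) (# k) ⟩
    lam + (# r + (lam - 1ℚ) * # k)       ≡⟨ cong (lam +_) (#*rate lam k≤r) ⟨
    lam + # r * rate lam k r             ∎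
    where
    open ≡-Reasoning
    lem : ∀ l r k → (1ℚ + r) + (l - 1ℚ) * (1ℚ + k) ≡ l + (r + (l - 1ℚ) * k)
    lem = solve-∀ ring

  -- After substituting the relation for `suc r * c`, this is `suc r` times `^-tangent` for `c` and
  -- `c′`. It takes the place of negative correlation among the pairs of `F`.
  step-inequality : ∀ {lam c c′} r y → 0ℚ ≤ c → 0ℚ ≤ c′ → # (suc r) * c ≡ lam + # r * c′ →
    # y * (lam * c′ ^ (y ∸ 1)) + # (suc r) * c′ ^ y ≤ # (suc r) * c ^ y + # y * c′ ^ y
  step-inequality {lam} {c} {c′} r zero 0≤c 0≤c′ eq = ℚ.≤-reflexive (lem (lam * 1ℚ) (# (suc r)))
    where
    lem : ∀ a r → 0ℚ * a + r * 1ℚ ≡ r * 1ℚ + 0ℚ * 1ℚ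
    lem = solve-∀ ring
  step-inequality {lam} {c} {c′} r (suc w) 0≤c 0≤c′ eq = diff-0≤ (subst (0ℚ ≤_) same
      (0≤* (0≤# (suc r)) (0≤-diff (^-tangent w 0≤c 0≤c′))))
    where
    open ≡-Reasoning
    P Q : ℚ
    P = c ^ suc w
    Q = c′ ^ w
    lem₁ : ∀ r w c c′ P Q → (1ℚ + r) * ((P + w * (c′ * Q)) - (1ℚ + w) * c * Q)
         ≡ (1ℚ + r) * P + w * (1ℚ + r) * (c′ * Q) - (1ℚ + w) * ((1ℚ + r) * c) * Q
    lem₁ = solve-∀ ring
    lem₂ : ∀ l r w c′ P Q → (1ℚ + r) * P + w * (1ℚ + r) * (c′ * Q) - (1ℚ + w) * (l + r * c′) * Q
         ≡ ((1ℚ + r) * P + (1ℚ + w) * (c′ * Q)) - ((1ℚ + w) * (l * Q) + (1ℚ + r) * (c′ * Q))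
    lem₂ = solve-∀ ring
    same : # (suc r) * ((P + # w * (c′ * Q)) - # (suc w) * c * Q)
         ≡ (# (suc r) * P + # (suc w) * (c′ * Q)) - (# (suc w) * (lam * Q) + # (suc r) * (c′ * Q))
    same = begin
      # (suc r) * ((P + # w * (c′ * Q)) - # (suc w) * c * Q)
        ≡⟨ cong₂ (λ u v → u * ((P + # w * (c′ * Q)) - v * c * Q)) (#-suc r) (#-suc w) ⟩
      (1ℚ + # r) * ((P + # w * (c′ * Q)) - (1ℚ + # w) * c * Q)
        ≡⟨ lem₁ (# r) (# w) c c′ P Q ⟩
      (1ℚ + # r) * P + # w * (1ℚ + # r) * (c′ * Q) - (1ℚ + # w) * ((1ℚ + # r) * c) * Q
        ≡⟨ cong (λ z → (1ℚ + # r) * P + # w * (1ℚ + # r) * (c′ * Q) - (1ℚ + # w) * z * Q) (trans (cong (_* c) (sym (#-suc r))) eq) ⟩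
      (1ℚ + # r) * P + # w * (1ℚ + # r) * (c′ * Q) - (1ℚ + # w) * (lam + # r * c′) * Q
        ≡⟨ lem₂ lam (# r) (# w) c′ P Q ⟩
      ((1ℚ + # r) * P + (1ℚ + # w) * (c′ * Q)) - ((1ℚ + # w) * (lam * Q) + (1ℚ + # r) * (c′ * Q))
        ≡⟨ cong₂ (λ u v → (u * P + v * (c′ * Q)) - (v * (lam * Q) + u * (c′ * Q))) (#-suc r) (#-suc w) ⟨
      (# (suc r) * P + # (suc w) * (c′ * Q)) - (# (suc w) * (lam * Q) + # (suc r) * (c′ * Q)) ∎

  pot-step : (F : Pairs n) {lam c c′ : ℚ} (G : Graph n) → 0ℚ ≤ lam → 0ℚ ≤ c → 0ℚ ≤ c′ → ∀ {r} →
    length (missing G) ≡ suc r → # (suc r) * c ≡ lam + # r * c′ →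
    ΣL (missing G) (pot F lam c′ ∘ addEdge G) ≤ # (length (missing G)) * pot F lam c G
  pot-step F {lam} {c} {c′} G 0≤lam 0≤c 0≤c′ {r} len eq = diff-0≤ (subst (0ℚ ≤_) same
      (0≤* (0≤^ (present F G) 0≤lam) (0≤-diff (step-inequality {lam} {c} {c′} r (absent F G) 0≤c 0≤c′ eq))))
    where
    open ≡-Reasoning
    S L Y V V′ D R : ℚ
    S  = ΣL (missing G) (pot F lam c′ ∘ addEdge G)
    L  = lam ^ present F G
    Y  = # (absent F G)
    V  = c ^ absent F G
    V′ = c′ ^ absent F G
    D  = c′ ^ (absent F G ∸ 1)
    R  = # (suc r)
    lem₁ : ∀ l L Y V V′ D R → L * ((R * V + Y * V′) - (Y * (l * D) + R * V′))
                              ≡ R * (L * V) - ((Y * (l * L * D) + R * (L * V′)) - Y * (L * V′))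
    lem₁ = solve-∀ ring
    lem₂ : ∀ a b → a + b - b ≡ a
    lem₂ = solve-∀ ring
    same : L * ((R * V + Y * V′) - (Y * (lam * D) + R * V′)) ≡ # (length (missing G)) * (L * V) - S
    same = begin
      L * ((R * V + Y * V′) - (Y * (lam * D) + R * V′))
        ≡⟨ lem₁ lam L Y V V′ D R ⟩
      R * (L * V) - ((Y * (lam * L * D) + R * (L * V′)) - Y * (L * V′))
        ≡⟨ cong (λ z → # z * (L * V) - ((Y * (lam * L * D) + # z * (L * V′)) - Y * (L * V′))) len ⟨
      # (length (missing G)) * (L * V) - ((Y * (lam * L * D) + # (length (missing G)) * (L * V′)) - Y * (L * V′))
        ≡⟨ cong (λ z → # (length (missing G)) * (L * V) - (z - Y * (L * V′))) (pot-sum F lam c′ G) ⟨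
      # (length (missing G)) * (L * V) - ((S + Y * (L * V′)) - Y * (L * V′))
        ≡⟨ cong (λ z → # (length (missing G)) * (L * V) - z) (lem₂ S (Y * (L * V′))) ⟩
      # (length (missing G)) * (L * V) - S ∎

-- Chernoff bounds at one time and at two times.

module Concentration where

  open import Defs
  open Rationals
  open Distributions
  open Counting
  open Process
  open Potentials
  open import Data.List.Base using (List; length)
  open import Data.List.Relation.Unary.All using (All)
  open import Data.Nat.Base using (ℕ; zero; suc; _∸_; z≤n; s≤s)
  open import Data.Nat.Combinatorics using (_C_)
  open import Data.Rational.Base using (ℚ; 0ℚ; 1ℚ; _+_; _*_; _-_; -_; _≤_; _<_)
  open import Data.Vec.Base using (Vec; _∷ʳ_; last)
  open import Tactic.RingSolver using (solve-∀)

  private variable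
    n : ℕ

  ΣL-const′ : ∀ {A : Set} (xs : List A) {f : A → ℚ} {c} → (∀ x → f x ≡ c) → ΣL xs f ≡ # (length xs) * c
  ΣL-const′ xs {c = c} eq = trans (ΣL-cong xs eq) (ΣL-const c xs)

  2ℚ : ℚ
  2ℚ = # 2

  -- `A k` and `B k` are potentials with `k` steps to go. Before `m₀` only their product has to
  -- decrease on average. Between `m₀` and `m₁` the value of `A 0` is frozen and acts as a
  -- nonnegative constant; after `m₁` nothing changes. Truncated subtraction keeps the step counts
  -- at `0` once a time has passed.
  module _ {n m₀ m₁ : ℕ} (A B : ℕ → Graph n → ℚ) (m₀≤m₁ : m₀ ℕ.≤ m₁) (0≤A : ∀ G → 0ℚ ≤ A 0 G)
    (joint : ∀ i G → i ℕ.< m₀ → i ℕ.< n C 2 → length (missing G) ℕ.+ i ≡ n C 2 →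
      ΣL (missing G) (λ e → A (m₀ ∸ suc i) (addEdge G e) * B (m₁ ∸ suc i) (addEdge G e))
      ≤ # (length (missing G)) * (A (m₀ ∸ i) G * B (m₁ ∸ i) G))
    (later : ∀ i G → i ℕ.< m₁ → i ℕ.< n C 2 → length (missing G) ℕ.+ i ≡ n C 2 →
      ΣL (missing G) (λ e → B (m₁ ∸ suc i) (addEdge G e)) ≤ # (length (missing G)) * B (m₁ ∸ i) G) where

    private
      ψ : ∀ i → Vec (Graph n) (suc i) → ℚ
      ψ i Gs = A (m₀ ∸ i) (at Gs m₀) * B (m₁ ∸ i) (at Gs m₁)

      fresh : ∀ {i m} (Gs : Vec (Graph n) (suc i)) (Z : ℕ → Graph n → ℚ) e → i ℕ.< m →
              Z (m ∸ suc i) (at (Gs ∷ʳ addEdge (last Gs) e) m) ≡ Z (m ∸ suc i) (addEdge (last Gs) e)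
      fresh {i} {m} Gs Z e i<m = cong (Z (m ∸ suc i)) (at-∷ʳ-last Gs _ i<m)

      frozen : ∀ {i m} (Gs : Vec (Graph n) (suc i)) (Z : ℕ → Graph n → ℚ) e → m ℕ.≤ i →
               Z (m ∸ suc i) (at (Gs ∷ʳ addEdge (last Gs) e) m) ≡ Z (m ∸ i) (at Gs m)
      frozen {i} {m} Gs Z e m≤i = cong₂ Z
        (trans (ℕ.m≤n⇒m∸n≡0 (ℕ.m≤n⇒m≤1+n m≤i)) (sym (ℕ.m≤n⇒m∸n≡0 m≤i))) (at-∷ʳ Gs _ m≤i)

      current : ∀ {i m} (Gs : Vec (Graph n) (suc i)) (Z : ℕ → Graph n → ℚ) → i ℕ.< m → Z (m ∸ i) (last Gs) ≡ Z (m ∸ i) (at Gs m)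
      current {i} {m} Gs Z i<m = cong (Z (m ∸ i)) (sym (at-last Gs (ℕ.<⇒≤ i<m)))

      step : ∀ i Gs → i ℕ.< n C 2 → Supported {n} {i} Gs →
             ΣL (missing (last Gs)) (λ e → ψ (suc i) (Gs ∷ʳ addEdge (last Gs) e)) ≤ # (length (missing (last Gs))) * ψ i Gs
      step i Gs i<N (len , _) = go (i ℕ.<? m₀) (i ℕ.<? m₁)
        where
        go : Dec (i ℕ.< m₀) → Dec (i ℕ.< m₁) →
             ΣL (missing (last Gs)) (λ e → ψ (suc i) (Gs ∷ʳ addEdge (last Gs) e)) ≤ # (length (missing (last Gs))) * ψ i Gs
        go (yes i<m₀) (yes i<m₁) = begin
          ΣL M (λ e → ψ (suc i) (Gs ∷ʳ addEdge (last Gs) e))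
            ≡⟨ ΣL-cong M (λ e → cong₂ _*_ (fresh Gs A e i<m₀) (fresh Gs B e i<m₁)) ⟩
          ΣL M (λ e → A (m₀ ∸ suc i) (addEdge (last Gs) e) * B (m₁ ∸ suc i) (addEdge (last Gs) e))
            ≤⟨ joint i (last Gs) i<m₀ i<N len ⟩
          # (length M) * (A (m₀ ∸ i) (last Gs) * B (m₁ ∸ i) (last Gs))
            ≡⟨ cong (# (length M) *_) (cong₂ _*_ (current Gs A i<m₀) (current Gs B i<m₁)) ⟩
          # (length M) * ψ i Gs ∎
          where
          open ℚ.≤-Reasoning
          M = missing (last Gs)
        go (yes i<m₀) (no i≮m₁) = contradiction (ℕ.<-≤-trans i<m₀ m₀≤m₁) i≮m₁
        go (no i≮m₀) (yes i<m₁) = begin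
          ΣL M (λ e → ψ (suc i) (Gs ∷ʳ addEdge (last Gs) e))
            ≡⟨ ΣL-cong M (λ e → cong₂ _*_ (frozen Gs A e (ℕ.≮⇒≥ i≮m₀)) (fresh Gs B e i<m₁)) ⟩
          ΣL M (λ e → a * B (m₁ ∸ suc i) (addEdge (last Gs) e))
            ≡⟨ ΣL-* a M _ ⟩
          a * ΣL M (λ e → B (m₁ ∸ suc i) (addEdge (last Gs) e))
            ≤⟨ *-monoˡ a 0≤a (later i (last Gs) i<m₁ i<N len) ⟩
          a * (# (length M) * B (m₁ ∸ i) (last Gs))
            ≡⟨ lem a (# (length M)) _ ⟩
          # (length M) * (a * B (m₁ ∸ i) (last Gs))
            ≡⟨ cong (λ z → # (length M) * (a * z)) (current Gs B i<m₁) ⟩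
          # (length M) * ψ i Gs ∎
          where
          open ℚ.≤-Reasoning
          M = missing (last Gs)
          a = A (m₀ ∸ i) (at Gs m₀)
          0≤a : 0ℚ ≤ a
          0≤a = subst (λ k → 0ℚ ≤ A k (at Gs m₀)) (sym (ℕ.m≤n⇒m∸n≡0 (ℕ.≮⇒≥ i≮m₀))) (0≤A (at Gs m₀))
          lem : ∀ a l b → a * (l * b) ≡ l * (a * b)
          lem = solve-∀ ring
        go (no i≮m₀) (no i≮m₁) = ℚ.≤-reflexive (ΣL-const′ (missing (last Gs))
          (λ e → cong₂ _*_ (frozen Gs A e (ℕ.≮⇒≥ i≮m₀)) (frozen Gs B e (ℕ.≮⇒≥ i≮m₁))))

    two-times : m₁ ℕ.≤ n C 2 →
      𝔼 (process n) (λ Gs → A 0 (at Gs m₀) * B 0 (at Gs m₁)) ≤ A m₀ (empty n) * B m₁ (empty n)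
    two-times m₁≤N = subst₂ (λ k l → 𝔼 (process n) (λ Gs → A k (at Gs m₀) * B l (at Gs m₁)) ≤ A m₀ (empty n) * B m₁ (empty n))
      (ℕ.m≤n⇒m∸n≡0 (ℕ.≤-trans m₀≤m₁ m₁≤N)) (ℕ.m≤n⇒m∸n≡0 m₁≤N)
      (supermartingale ψ step (n C 2) ℕ.≤-refl)

  one-time : ∀ {n m} (B : ℕ → Graph n → ℚ) →
    (∀ i G → i ℕ.< m → i ℕ.< n C 2 → length (missing G) ℕ.+ i ≡ n C 2 →
      ΣL (missing G) (λ e → B (m ∸ suc i) (addEdge G e)) ≤ # (length (missing G)) * B (m ∸ i) G) →
    m ℕ.≤ n C 2 → 𝔼 (process n) (λ Gs → B 0 (at Gs m)) ≤ B m (empty n)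
  one-time {n} {m} B later m≤N = subst₂ _≤_ (𝔼-cong (process n) (λ Gs → ℚ.*-identityˡ (B 0 (at Gs m)))) (ℚ.*-identityˡ _)
    (two-times (λ _ _ → 1ℚ) B z≤n (λ _ → 0≤1) (λ _ _ ()) later m≤N)

  present-empty : (F : Pairs n) → present F (empty n) ≡ 0
  present-empty {n} F = trans (sum²-cong (λ a b → trans (cong (λ z → lt a b ℕ.* 𝟙 z) (Bool.∧-zeroʳ (F a b))) (ℕ.*-zeroʳ (lt a b))))
    (trans (sum-cong-≗ {n} (λ _ → sum-zero n)) (sum-zero n))

  absent-empty : (F : Pairs n) → absent F (empty n) ≡ pairs F
  absent-empty {n} F = trans (cong (ℕ._+ absent F (empty n)) (sym (present-empty F))) (present+absent F (empty n))

  pot-empty : (F : Pairs n) (lam c : ℚ) → pot F lam c (empty n) ≡ c ^ pairs F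
  pot-empty {n} F lam c = trans (cong₂ (λ x y → lam ^ x * c ^ y) (present-empty F) (absent-empty F)) (ℚ.*-identityˡ _)

  missing-empty : ∀ n → length (missing (empty n)) ≡ n C 2
  missing-empty n = trans (missing-length (empty n)) (trans (absent-empty {n} everything) (pairs-all n))

  remaining : ∀ {i m} → i ℕ.< m → m ∸ i ≡ suc (m ∸ suc i)
  remaining {i} {m} i<m = ℕ.+-∸-assoc 1 i<m

  remaining-missing : ∀ {i l m N} → l ℕ.+ i ≡ N → i ℕ.< m → m ℕ.≤ N → Σ[ r ∈ ℕ ] l ≡ suc r × m ∸ suc i ℕ.≤ r
  remaining-missing {i} {zero}  {m} refl i<m m≤N = contradiction (ℕ.<-≤-trans i<m m≤N) (ℕ.<-irrefl refl)
  remaining-missing {i} {suc r} {m} refl i<m m≤N = r , refl ,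
    ℕ.≤-trans (ℕ.∸-monoˡ-≤ (suc i) m≤N) (ℕ.≤-reflexive (trans (cong (_∸ suc i) (sym (ℕ.+-suc r i))) (ℕ.m+n∸n≡m r (suc i))))

  module _ (F : Pairs n) (lam : ℚ) (0≤lam : 0ℚ ≤ lam) where

    rated : ℕ → Graph n → ℚ
    rated k G = pot F lam (rate lam k (length (missing G))) G

    rated-sum : ∀ k {r} G → length (missing G) ≡ suc r →
      All (λ e → rated k (addEdge G e) ≡ pot F lam (rate lam k r) (addEdge G e)) (missing G)
    rated-sum k {r} G len = All.map (λ {e} eq → cong (λ z → pot F lam (rate lam k z) (addEdge G e))
      (ℕ.suc-injective (trans (sym eq) len))) (missing-addEdge G)

    rated-step : ∀ {m} → m ℕ.≤ n C 2 → ∀ i G → i ℕ.< m → i ℕ.< n C 2 → length (missing G) ℕ.+ i ≡ n C 2 →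
      ΣL (missing G) (λ e → rated (m ∸ suc i) (addEdge G e)) ≤ # (length (missing G)) * rated (m ∸ i) G
    rated-step {m} m≤N i G i<m _ eq = let r , len , k≤r = remaining-missing eq i<m m≤N in ℚ.≤-trans
      (ΣL-mono (All.map ℚ.≤-reflexive (rated-sum (m ∸ suc i) G len)))
      (subst₂ (λ k l → ΣL (missing G) (pot F lam (rate lam (m ∸ suc i) r) ∘ addEdge G) ≤ # (length (missing G)) * pot F lam (rate lam k l) G)
        (sym (remaining i<m)) (sym len)
        (pot-step F G 0≤lam (0≤rate 0≤lam (s≤s k≤r)) (0≤rate 0≤lam k≤r) len (rate-step lam k≤r)))

    rated-end : ∀ G → rated 0 G ≡ lam ^ present F G
    rated-end G = trans (cong (λ c → pot F lam c G) (rate-zero lam (length (missing G))))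
      (trans (cong (lam ^ present F G *_) (1^ (absent F G))) (ℚ.*-identityʳ _))

    rated-start : ∀ m → rated m (empty n) ≡ rate lam m (n C 2) ^ pairs F
    rated-start m = trans (pot-empty F lam _) (cong (λ z → rate lam m z ^ pairs F) (missing-empty n))

    -- With no step to go the rate is `1`, so the potential ends as `lam ^ present F`; with nothing
    -- present it starts as a pure power of the rate. The bound equals the generating function of
    -- independent pairs, each present with probability `m / N`.
    chernoff : ∀ {m} → m ℕ.≤ n C 2 →
      𝔼 (process n) (λ Gs → lam ^ present F (at Gs m)) ≤ rate lam m (n C 2) ^ pairs F
    chernoff {m} m≤N = subst₂ _≤_ (𝔼-cong (process n) (λ Gs → rated-end (at Gs m))) (rated-start m)
      (one-time rated (rated-step m≤N) m≤N)

  -- Few edges of F at time m₀, yet all edges of R at time m₁.  The events are of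
  -- opposite monotonicity, so the product of the two potentials gains a factor of
  -- at most 2 per step on the R side.
  module _ (F R : Pairs n) (lam β : ℚ) {m₀ m₁ : ℕ} (0≤lam : 0ℚ ≤ lam) (lam≤1 : lam ≤ 1ℚ) (0≤β : 0ℚ ≤ β)
    (m₀≤m₁ : m₀ ℕ.≤ m₁) (m₁≤N : m₁ ℕ.≤ n C 2) (m₁β≤1 : # m₁ * β ≤ 1ℚ) (2≤Nβ : 2ℚ ≤ # (n C 2 ∸ m₁) * β)
    (small : 2 ℕ.* pairs F ℕ.≤ n C 2 ∸ m₁) where

    private
      -- Each absent pair of `R` weighs `l β`, an upper bound for its chance to be chosen within `l`
      -- steps. At `l = 0` this becomes `0 ^ absent`, the indicator that all of `R` is present.
      B : ℕ → Graph n → ℚ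
      B l = pot R 1ℚ (# l * β)

      pot-1 : ∀ b G → pot R 1ℚ b G ≡ b ^ absent R G
      pot-1 b G = trans (cong (_* b ^ absent R G) (1^ (present R G))) (ℚ.*-identityˡ _)

      B-sum : ∀ b G → 0ℚ ≤ b → ΣL (missing G) (pot R 1ℚ b ∘ addEdge G)
              ≤ # (length (missing G)) * b ^ absent R G + # (absent R G) * b ^ (absent R G ∸ 1)
      B-sum b G 0≤b = ≤-by (# (absent R G) * (1ℚ ^ present R G * b ^ absent R G))
        (0≤* (0≤# (absent R G)) (0≤* (0≤^ (present R G) 0≤1) (0≤^ (absent R G) 0≤b)))
        (trans (pot-sum R 1ℚ b G) (trans (cong (λ z → # (absent R G) * (1ℚ * z * b ^ (absent R G ∸ 1))
            + # (length (missing G)) * (z * b ^ absent R G)) (1^ (present R G)))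
          (lem (# (absent R G)) (b ^ (absent R G ∸ 1)) (# (length (missing G))) (b ^ absent R G))))
        where
        lem : ∀ y p l q → y * (1ℚ * 1ℚ * p) + l * (1ℚ * q) ≡ l * q + y * p
        lem = solve-∀ ring

      tangent : ∀ b j → 0ℚ ≤ b → b ^ j + # j * β * b ^ (j ∸ 1) ≤ (b + β) ^ j
      tangent b zero    0≤b = ℚ.≤-reflexive (lem β)
        where
        lem : ∀ β → 1ℚ + 0ℚ * β * 1ℚ ≡ 1ℚ
        lem = solve-∀ ring
      tangent b (suc j) 0≤b = diff-0≤ (subst (0ℚ ≤_)
        (trans (cong (λ z → ((b + β) ^ suc j + # j * b ^ suc j) - z * (b + β) * b ^ j) (#-suc j))
          (trans (lem ((b + β) ^ suc j) (# j) b (b ^ j) β) (cong (λ z → (b + β) ^ suc j - (b * b ^ j + z * β * b ^ j)) (sym (#-suc j)))))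
        (0≤-diff (^-tangent j (0≤+ 0≤b 0≤β) 0≤b)))
        where
        lem : ∀ P j b q β → (P + j * (b * q)) - (1ℚ + j) * (b + β) * q ≡ P - (b * q + (1ℚ + j) * β * q)
        lem = solve-∀ ring

      #sucβ : ∀ l → # (suc l) * β ≡ # l * β + β
      #sucβ l = trans (cong (_* β) (#-suc l)) (lem (# l) β)
        where
        lem : ∀ l β → (1ℚ + l) * β ≡ l * β + β
        lem = solve-∀ ring

      2≤lenβ : ∀ {i l} → l ℕ.+ i ≡ n C 2 → i ℕ.< m₁ → 2ℚ ≤ # l * β
      2≤lenβ {i} {l} eq i<m₁ = ℚ.≤-trans 2≤Nβ (*-monoʳ β 0≤β (#-mono (N∸m₁≤ eq i<m₁)))
        where
        N∸m₁≤ : l ℕ.+ i ≡ n C 2 → i ℕ.< m₁ → n C 2 ∸ m₁ ℕ.≤ l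
        N∸m₁≤ eq i<m₁ = ℕ.≤-trans (ℕ.∸-monoʳ-≤ (n C 2) (ℕ.<⇒≤ i<m₁))
          (ℕ.≤-reflexive (trans (cong (_∸ i) (sym eq)) (ℕ.m+n∸n≡m l i)))

      later : ∀ i G → i ℕ.< m₁ → i ℕ.< n C 2 → length (missing G) ℕ.+ i ≡ n C 2 →
        ΣL (missing G) (λ e → B (m₁ ∸ suc i) (addEdge G e)) ≤ # (length (missing G)) * B (m₁ ∸ i) G
      later i G i<m₁ _ eq = begin
        ΣL (missing G) (pot R 1ℚ b ∘ addEdge G)       ≤⟨ B-sum b G 0≤b ⟩
        L * b ^ j + # j * b ^ (j ∸ 1)                 ≤⟨ ≤-by ((L * β - 1ℚ) * (# j * b ^ (j ∸ 1)))
          (0≤* (0≤-diff (ℚ.≤-trans (#-mono {1} {2} (s≤s z≤n)) (2≤lenβ eq i<m₁))) (0≤* (0≤# j) (0≤^ (j ∸ 1) 0≤b)))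
          (lem L (b ^ j) (# j) (b ^ (j ∸ 1)) β) ⟩
        L * (b ^ j + # j * β * b ^ (j ∸ 1))           ≤⟨ *-monoˡ L (0≤# (length (missing G))) (tangent b j 0≤b) ⟩
        L * (b + β) ^ j                               ≡⟨ cong (λ z → L * z ^ j) (trans (cong (λ k → # k * β) (remaining i<m₁)) (#sucβ l)) ⟨
        L * (# (m₁ ∸ i) * β) ^ j                      ≡⟨ cong (L *_) (pot-1 (# (m₁ ∸ i) * β) G) ⟨
        L * B (m₁ ∸ i) G                              ∎
        where
        open ℚ.≤-Reasoning
        l j : ℕ
        l = m₁ ∸ suc i
        j = absent R G
        b L : ℚ
        b = # l * β
        L = # (length (missing G))
        0≤b : 0ℚ ≤ b
        0≤b = 0≤* (0≤# l) 0≤β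
        lem : ∀ L q j p β → (L * q + j * p) + (L * β - 1ℚ) * (j * p) ≡ L * (q + j * β * p)
        lem = solve-∀ ring

      -- `^-tangent` and the recursion for `c` give `(r + 1) c^y ≥ (r + 1 − y) c′^y`, so the loss is
      -- at most a factor `2` while `y` is at most half of the missing pairs. This is the purpose of
      -- `small`.
      halving : ∀ {c c′} r y → 2 ℕ.* y ℕ.≤ suc r → 0ℚ ≤ c → 0ℚ ≤ c′ → # (suc r) * c ≡ lam + # r * c′ → c′ ^ y ≤ 2ℚ * c ^ y
      halving r zero    _     _   _    _  = #-mono {1} {2} (s≤s z≤n)
      halving {c} {c′} r (suc w) 2y≤r 0≤c 0≤c′ eq = *-cancelˡ (# (suc r)) (0<# r) (diff-0≤ (subst (0ℚ ≤_) same
        (0≤+ (0≤* (0≤# 2) (0≤+ (0≤* (0≤# (suc r)) (0≤-diff (^-tangent w 0≤c 0≤c′))) (0≤* (0≤* (0≤# (suc w)) 0≤lam) (0≤^ w 0≤c′))))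
             (0≤* (0≤-diff (#-mono 2y≤r)) (0≤^ (suc w) 0≤c′)))))
        where
        open ≡-Reasoning
        P Q : ℚ
        P = c ^ suc w
        Q = c′ ^ w
        lem₁ : ∀ r w c c′ P Q l m →
          2ℚ * ((1ℚ + r) * ((P + w * (c′ * Q)) - (1ℚ + w) * c * Q) + (1ℚ + w) * l * Q) + ((1ℚ + r) - m) * (c′ * Q)
          ≡ 2ℚ * ((1ℚ + r) * (P + w * (c′ * Q)) - (1ℚ + w) * ((1ℚ + r) * c) * Q + (1ℚ + w) * l * Q) + ((1ℚ + r) - m) * (c′ * Q)
        lem₁ = solve-∀ ring
        lem₂ : ∀ r w c′ P Q l →
          2ℚ * ((1ℚ + r) * (P + w * (c′ * Q)) - (1ℚ + w) * (l + r * c′) * Q + (1ℚ + w) * l * Q) + ((1ℚ + r) - 2ℚ * (1ℚ + w)) * (c′ * Q)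
          ≡ (1ℚ + r) * (2ℚ * P) - (1ℚ + r) * (c′ * Q)
        lem₂ = solve-∀ ring
        same : 2ℚ * (# (suc r) * ((P + # w * (c′ * Q)) - # (suc w) * c * Q) + # (suc w) * lam * Q)
                 + (# (suc r) - # (2 ℕ.* suc w)) * (c′ * Q)
               ≡ # (suc r) * (2ℚ * P) - # (suc r) * (c′ * Q)
        same = begin
          _ ≡⟨ cong₂ (λ u v → 2ℚ * (u * ((P + # w * (c′ * Q)) - v * c * Q) + v * lam * Q) + (u - # (2 ℕ.* suc w)) * (c′ * Q)) (#-suc r) (#-suc w) ⟩
          2ℚ * ((1ℚ + # r) * ((P + # w * (c′ * Q)) - (1ℚ + # w) * c * Q) + (1ℚ + # w) * lam * Q) + ((1ℚ + # r) - # (2 ℕ.* suc w)) * (c′ * Q)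
            ≡⟨ lem₁ (# r) (# w) c c′ P Q lam (# (2 ℕ.* suc w)) ⟩
          2ℚ * ((1ℚ + # r) * (P + # w * (c′ * Q)) - (1ℚ + # w) * ((1ℚ + # r) * c) * Q + (1ℚ + # w) * lam * Q) + ((1ℚ + # r) - # (2 ℕ.* suc w)) * (c′ * Q)
            ≡⟨ cong₂ (λ u v → 2ℚ * ((1ℚ + # r) * (P + # w * (c′ * Q)) - (1ℚ + # w) * u * Q + (1ℚ + # w) * lam * Q) + ((1ℚ + # r) - v) * (c′ * Q))
                 (trans (cong (_* c) (sym (#-suc r))) eq) (trans (#-* 2 (suc w)) (cong (2ℚ *_) (#-suc w))) ⟩
          2ℚ * ((1ℚ + # r) * (P + # w * (c′ * Q)) - (1ℚ + # w) * (lam + # r * c′) * Q + (1ℚ + # w) * lam * Q) + ((1ℚ + # r) - 2ℚ * (1ℚ + # w)) * (c′ * Q)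
            ≡⟨ lem₂ (# r) (# w) c′ P Q lam ⟩
          (1ℚ + # r) * (2ℚ * P) - (1ℚ + # r) * (c′ * Q)
            ≡⟨ cong (λ u → u * (2ℚ * P) - u * (c′ * Q)) (#-suc r) ⟨
          # (suc r) * (2ℚ * P) - # (suc r) * (c′ * Q) ∎

      joint : ∀ i G → i ℕ.< m₀ → i ℕ.< n C 2 → length (missing G) ℕ.+ i ≡ n C 2 →
        ΣL (missing G) (λ e → rated F lam 0≤lam (m₀ ∸ suc i) (addEdge G e) * B (m₁ ∸ suc i) (addEdge G e))
        ≤ # (length (missing G)) * (rated F lam 0≤lam (m₀ ∸ i) G * B (m₁ ∸ i) G)
      joint i G i<m₀ i<N eq = begin
        ΣL M (λ e → rated F lam 0≤lam k (addEdge G e) * B l (addEdge G e))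
          -- A new edge can only lower the potential of `F` below `a′` and raise that of `R` above
          -- `b₀`. So `(a′ - x) * (y - b₀)` is nonnegative, and discarding it makes the product
          -- linear in the two potentials.
          ≤⟨ ΣL-mono (All.map (λ {(eq , (a≤ , b≥)) → cross eq a≤ b≥})
               (All.zip (rated-sum F lam 0≤lam k G len ,
                 All.zip (pot-monotone F lam c′ 0≤lam 0≤c′ (lam≤rate lam≤1 k≤r) G , pot-antitone R 1ℚ b 0≤1 0≤b b≤1 G)))) ⟩
        ΣL M (λ e → (b₀ * pot F lam c′ (addEdge G e) + a′ * B l (addEdge G e)) + - (a′ * b₀))
          ≡⟨ trans (ΣL-+ M (λ e → b₀ * pot F lam c′ (addEdge G e) + a′ * B l (addEdge G e)) (λ _ → - (a′ * b₀)))
               (cong₂ _+_ (trans (ΣL-+ M (λ e → b₀ * pot F lam c′ (addEdge G e)) (λ e → a′ * B l (addEdge G e)))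
                 (cong₂ _+_ (ΣL-* b₀ M (pot F lam c′ ∘ addEdge G)) (ΣL-* a′ M (B l ∘ addEdge G)))) (ΣL-const (- (a′ * b₀)) M)) ⟩
        (b₀ * ΣL M (pot F lam c′ ∘ addEdge G) + a′ * ΣL M (B l ∘ addEdge G)) + L * - (a′ * b₀)
          ≤⟨ ℚ.+-monoˡ-≤ _ (ℚ.+-mono-≤ (*-monoˡ b₀ 0≤b₀ (pot-step F G 0≤lam 0≤c 0≤c′ len (rate-step lam k≤r)))
               (*-monoˡ a′ 0≤a′ (B-sum b G 0≤b))) ⟩
        (b₀ * (L * a) + a′ * (L * b ^ j + # j * b ^ (j ∸ 1))) + L * - (a′ * b₀)
          ≡⟨ trans (cong (λ z → (z * (L * a) + a′ * (L * b ^ j + # j * b ^ (j ∸ 1))) + L * - (a′ * z)) (pot-1 b G))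
               (lem₁ (b ^ j) L a a′ (# j * b ^ (j ∸ 1))) ⟩
        L * a * b ^ j + a′ * (# j * b ^ (j ∸ 1))
          -- The increase on the `R` side carries the factor `a′` instead of `a`. `halving` replaces
          -- it by `2 a`, and `2 ≤ L β` pays for the `2`.
          ≤⟨ ℚ.+-monoʳ-≤ (L * a * b ^ j) (*-monoʳ _ (0≤* (0≤# j) (0≤^ (j ∸ 1) 0≤b)) a′≤2a) ⟩
        L * a * b ^ j + 2ℚ * a * (# j * b ^ (j ∸ 1))
          ≤⟨ ≤-by ((L * β - 2ℚ) * a * (# j * b ^ (j ∸ 1)))
               (0≤* (0≤* (0≤-diff (2≤lenβ eq i<m₁)) 0≤a) (0≤* (0≤# j) (0≤^ (j ∸ 1) 0≤b)))
               (lem₂ L a (b ^ j) (# j) (b ^ (j ∸ 1)) β) ⟩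
        L * (a * (b ^ j + # j * β * b ^ (j ∸ 1)))
          ≤⟨ *-monoˡ L (0≤# (length (missing G))) (*-monoˡ a 0≤a (tangent b j 0≤b)) ⟩
        L * (a * (b + β) ^ j)
          ≡⟨ cong₂ (λ u v → L * (u * v)) (cong₂ (λ u v → pot F lam (rate lam u v) G) (remaining i<m₀) len)
               (trans (pot-1 (# (m₁ ∸ i) * β) G) (cong (_^ j) (trans (cong (λ k → # k * β) (remaining i<m₁)) (#sucβ l)))) ⟨
        L * (rated F lam 0≤lam (m₀ ∸ i) G * B (m₁ ∸ i) G) ∎
        where
        open ℚ.≤-Reasoning
        M = missing G
        found = remaining-missing eq i<m₀ (ℕ.≤-trans m₀≤m₁ m₁≤N)
        r = proj₁ found
        len = proj₁ (proj₂ found)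
        k≤r = proj₂ (proj₂ found)
        i<m₁ : i ℕ.< m₁
        i<m₁ = ℕ.<-≤-trans i<m₀ m₀≤m₁
        k l j : ℕ
        k = m₀ ∸ suc i
        l = m₁ ∸ suc i
        j = absent R G
        b L c c′ a a′ b₀ : ℚ
        b  = # l * β
        L  = # (length (missing G))
        c  = rate lam (suc k) (suc r)
        c′ = rate lam k r
        a  = pot F lam c G
        a′ = pot F lam c′ G
        b₀ = B l G
        0≤b : 0ℚ ≤ b
        0≤b = 0≤* (0≤# l) 0≤β
        0≤c : 0ℚ ≤ c
        0≤c = 0≤rate 0≤lam (s≤s k≤r)
        0≤c′ : 0ℚ ≤ c′
        0≤c′ = 0≤rate 0≤lam k≤r
        0≤a : 0ℚ ≤ a
        0≤a = 0≤pot F lam c 0≤lam 0≤c G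
        0≤a′ : 0ℚ ≤ a′
        0≤a′ = 0≤pot F lam c′ 0≤lam 0≤c′ G
        0≤b₀ : 0ℚ ≤ b₀
        0≤b₀ = 0≤pot R 1ℚ b 0≤1 0≤b G
        b≤1 : b ≤ 1ℚ
        b≤1 = ℚ.≤-trans (*-monoʳ β 0≤β (#-mono (ℕ.m∸n≤m m₁ (suc i)))) m₁β≤1
        y≤ : 2 ℕ.* absent F G ℕ.≤ suc r
        y≤ = ℕ.≤-trans (ℕ.*-monoʳ-≤ 2 (ℕ.≤-trans (ℕ.m≤n+m (absent F G) (present F G)) (ℕ.≤-reflexive (present+absent F G))))
          (ℕ.≤-trans small (ℕ.≤-trans (ℕ.∸-monoʳ-≤ (n C 2) (ℕ.<⇒≤ i<m₁))
            (ℕ.≤-reflexive (trans (cong (_∸ i) (sym eq)) (trans (ℕ.m+n∸n≡m _ i) len)))))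
        a′≤2a : a′ ≤ 2ℚ * a
        a′≤2a = ℚ.≤-trans (*-monoˡ _ (0≤^ (present F G) 0≤lam) (halving r (absent F G) y≤ 0≤c 0≤c′ (rate-step lam k≤r)))
          (ℚ.≤-reflexive (comm (lam ^ present F G) (c ^ absent F G)))
          where
          comm : ∀ p q → p * (2ℚ * q) ≡ 2ℚ * (p * q)
          comm = solve-∀ ring
        cross : ∀ {x x′ y} → x ≡ x′ → x′ ≤ a′ → b₀ ≤ y → x * y ≤ (b₀ * x′ + a′ * y) + - (a′ * b₀)
        cross {x} {y = y} refl x≤ y≥ = ≤-by _ (0≤* (0≤-diff x≤) (0≤-diff y≥)) (lem x y a′ b₀)
          where
          lem : ∀ x y a b → x * y + (a - x) * (y - b) ≡ (b * x + a * y) + - (a * b)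
          lem = solve-∀ ring
        lem₁ : ∀ q L a a′ p → (q * (L * a) + a′ * (L * q + p)) + L * - (a′ * q) ≡ L * a * q + a′ * p
        lem₁ = solve-∀ ring
        lem₂ : ∀ L a q j p β → (L * a * q + 2ℚ * a * (j * p)) + (L * β - 2ℚ) * a * (j * p) ≡ L * (a * (q + j * β * p))
        lem₂ = solve-∀ ring

    few-then-all :
      𝔼 (process n) (λ Gs → lam ^ present F (at Gs m₀) * 0ℚ ^ absent R (at Gs m₁))
      ≤ rate lam m₀ (n C 2) ^ pairs F * (# m₁ * β) ^ pairs R
    few-then-all = subst₂ _≤_
      (𝔼-cong (process n) (λ Gs → cong₂ _*_ (rated-end F lam 0≤lam (at Gs m₀))
        (trans (pot-1 (# 0 * β) (at Gs m₁)) (cong (_^ absent R (at Gs m₁)) (ℚ.*-zeroˡ β)))))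
      (cong₂ _*_ (rated-start F lam 0≤lam m₀) (pot-empty R 1ℚ (# m₁ * β)))
      (two-times (rated F lam 0≤lam) B m₀≤m₁
        (λ G → subst (0ℚ ≤_) (sym (rated-end F lam 0≤lam G)) (0≤^ (present F G) 0≤lam)) joint later m₁≤N)

-- From expansion to resilience of a component.

module Connectivity where

  open import Defs
  open Counting
  open Process using (present)
  open import Data.Fin.Base using (Fin; zero; suc)
  open import Data.Fin.Subset using (Subset; ∣_∣; inside; outside; _∈_)
  open import Data.Nat.Base using (ℕ; zero; suc; _+_; _*_; _≤_; _<_; z≤n; s≤s; s≤s⁻¹; NonZero)
  open import Data.Nat.Tactic.RingSolver using (solve-∀)
  open import Data.Vec.Base using ([]; _∷_; lookup; here; there)
  open import Relation.Binary.Construct.Closure.ReflexiveTransitive using (ε; _◅_; _◅◅_)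

  private variable
    n : ℕ

  T⇒≡ : ∀ {b} → T b → b ≡ true
  T⇒≡ {true} _ = refl

  ≡⇒T : ∀ {b} → b ≡ true → T b
  ≡⇒T refl = tt

  remove : Fin n → (Fin n → Bool) → Fin n → Bool
  remove a P v = P v ∧ not (does (a Fin.≟ v))

  size-remove : (a : Fin n) (P : Fin n → Bool) → size (remove a P) + 𝟙 (P a) ≡ size P
  size-remove a P = begin
    size (remove a P) + 𝟙 (P a)
      ≡⟨ cong (size (remove a P) +_) (sum-δ a (𝟙 ∘ P)) ⟨
    size (remove a P) + sum (λ v → 𝟙 (does (a Fin.≟ v)) * 𝟙 (P v))
      ≡⟨ ∑-distrib-+ (𝟙 ∘ remove a P) (λ v → 𝟙 (does (a Fin.≟ v)) * 𝟙 (P v)) ⟨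
    sum (λ v → 𝟙 (P v ∧ not (does (a Fin.≟ v))) + 𝟙 (does (a Fin.≟ v)) * 𝟙 (P v))
      ≡⟨ sum-cong-≗ (λ v → bool (P v) (does (a Fin.≟ v))) ⟩
    size P ∎
    where
    open ≡-Reasoning
    bool : ∀ p d → 𝟙 (p ∧ not d) + 𝟙 d * 𝟙 p ≡ 𝟙 p
    bool true  true  = refl
    bool true  false = refl
    bool false true  = refl
    bool false false = refl

  some : ∀ {n} (P : Fin n → Bool) → 1 ≤ size P → ∃[ a ] P a ≡ true
  some {zero}  P ()
  some {suc n} P h = go (P zero) refl h
    where
    go : ∀ b → P zero ≡ b → 1 ≤ 𝟙 b + size (P ∘ suc) → ∃[ a ] P a ≡ true
    go true  eq _ = zero , eq
    go false _  h = let a , p = some (P ∘ suc) h in suc a , p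

  size-pos : (P : Fin n → Bool) (a : Fin n) → P a ≡ true → 1 ≤ size P
  size-pos P a p = ℕ.≤-trans (ℕ.≤-reflexive (cong 𝟙 (sym p)))
    (ℕ.≤-trans (ℕ.m≤n+m (𝟙 (P a)) (size (remove a P))) (ℕ.≤-reflexive (size-remove a P)))

  pick : ∀ {k} (P : Fin n → Bool) → suc k ≤ size P → ∃[ a ] P a ≡ true × k ≤ size (remove a P)
  pick {k = k} P h = let a , p = some P (ℕ.≤-trans (s≤s z≤n) h) in a , p ,
    s≤s⁻¹ (ℕ.≤-trans h (ℕ.≤-reflexive (trans (sym (size-remove a P)) (trans (cong (λ z → size (remove a P) + 𝟙 z) p) (ℕ.+-comm _ 1)))))

  ∧-trueˡ : ∀ {a b} → a ∧ b ≡ true → a ≡ true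
  ∧-trueˡ {true} _ = refl

  ∧-trueʳ : ∀ {a b} → a ∧ b ≡ true → b ≡ true
  ∧-trueʳ {true} h = h

  remove-sound : (a b : Fin n) {P : Fin n → Bool} → remove a P b ≡ true → P b ≡ true × a ≢ b
  remove-sound a b {P} h = ∧-trueˡ h , λ a≡b →
    contradiction (trans (sym (∧-trueʳ {P b} h)) (cong not (dec-true (a Fin.≟ b) a≡b))) λ ()

  two-members : (P : Fin n → Bool) → 2 ≤ size P → ∃[ a ] ∃[ b ] (a ≢ b × P a ≡ true × P b ≡ true)
  two-members P h =
    let a , pa , h₁ = pick P h
        b , pb , _  = pick (remove a P) h₁
        pb′ , a≢b   = remove-sound a b {P} pb
    in a , b , a≢b , pa , pb′

  three-members : (P : Fin n → Bool) → 3 ≤ size P →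
    ∃[ a ] ∃[ b ] ∃[ c ] (a ≢ b × a ≢ c × b ≢ c × P a ≡ true × P b ≡ true × P c ≡ true)
  three-members P h =
    let a , pa , h₁ = pick P h
        b , c , b≢c , pb , pc = two-members (remove a P) h₁
        pb′ , a≢b = remove-sound a b {P} pb
        pc′ , a≢c = remove-sound a c {P} pc
    in a , b , c , a≢b , a≢c , b≢c , pa , pb′ , pc′

  size-mono : {P Q : Fin n → Bool} → (∀ v → P v ≡ true → Q v ≡ true) → size P ≤ size Q
  size-mono {P = P} {Q} h = sum-mono (λ v → go (P v) (Q v) (h v))
    where
    go : ∀ p q → (p ≡ true → q ≡ true) → 𝟙 p ≤ 𝟙 q
    go false q _ = z≤n
    go true  q h = ℕ.≤-reflexive (cong 𝟙 (sym (h refl)))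

  nb : Graph n → Fin n → (Fin n → Bool) → ℕ
  nb G v S = size (λ u → S u ∧ adj G v u)

  nb-split : (G : Graph n) (v : Fin n) (S Q : Fin n → Bool) →
             nb G v (λ u → S u ∧ Q u) + nb G v (λ u → S u ∧ not (Q u)) ≡ nb G v S
  nb-split G v S Q = trans (sym (∑-distrib-+ (λ u → 𝟙 ((S u ∧ Q u) ∧ adj G v u)) (λ u → 𝟙 ((S u ∧ not (Q u)) ∧ adj G v u))))
    (sum-cong-≗ (λ u → bool (S u) (Q u) (adj G v u)))
    where
    bool : ∀ s q x → 𝟙 ((s ∧ q) ∧ x) + 𝟙 ((s ∧ not q) ∧ x) ≡ 𝟙 (s ∧ x)
    bool true  true  x = ℕ.+-identityʳ (𝟙 x)
    bool true  false x = refl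
    bool false _     x = refl

  deg≡nb : (G : Graph n) (v : Fin n) (S : Fin n → Bool) → deg G v ≡ nb G v S + nb G v (not ∘ S)
  deg≡nb G v S = trans (size-tabulate (adj G v)) (sym (nb-split G v (λ _ → true) S))

  internal-present : (G : Graph n) (S : Fin n → Bool) →
                   sum (λ v → 𝟙 (S v) * nb G v S) ≡ 2 * present (internal S) G
  internal-present G S = trans
    (sum-cong-≗ (λ a → trans (*-distribˡ-sum (𝟙 (S a)) (λ b → 𝟙 (S b ∧ adj G a b)))
      (sum-cong-≗ (λ b → trans (sym (𝟙-∧ (S a) (S b ∧ adj G a b))) (cong 𝟙 (sym (Bool.∧-assoc (S a) (S b) (adj G a b))))))))
    (symmetric-pairs (λ a b → (S a ∧ S b) ∧ adj G a b)
      (λ a b → cong₂ _∧_ (Bool.∧-comm (S a) (S b)) (symmetric G a b))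
      (λ a → trans (cong ((S a ∧ S a) ∧_) (irreflexive G a)) (Bool.∧-zeroʳ (S a ∧ S a))))

  cut-present : (G : Graph n) (S : Fin n → Bool) →
                sum (λ v → 𝟙 (S v) * nb G v (not ∘ S)) ≡ present (cut S) G
  cut-present G S = trans
    (sum-cong-≗ (λ a → trans (*-distribˡ-sum (𝟙 (S a)) (λ b → 𝟙 (not (S b) ∧ adj G a b)))
      (sum-cong-≗ (λ b → sym (𝟙-∧ (S a) (not (S b) ∧ adj G a b))))))
    (sym (cut-sum S (adj G) (symmetric G)))

  -- Necessary for S to be cut off by deleting at most a fraction 1/2 − 1/q of the edges at each vertex.
  Weak : ℕ → Graph n → (Fin n → Bool) → Set
  Weak q G S = ∀ v → S v ≡ true → 2 * q * nb G v (not ∘ S) + 2 * deg G v ≤ q * deg G v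

  -- `cluster` treats both forbidden patterns at once: three low neighbours of `x`, or, with
  -- `d = x`, a low vertex with two low neighbours. `expand` is a subtraction-free form of
  -- `(q − 2) 2 e(S) < (q + 2) e(S, Sᶜ)`.
  record Expanding (q m c Γ : ℕ) (G : Graph n) : Set where
    field
      low     : Fin n → Bool
      high    : ∀ v → low v ≡ false → m ≤ c * deg G v
      cluster : ∀ x a b d → a ≢ b → a ≢ d → b ≢ d →
                low a ≡ true → low b ≡ true → low d ≡ true →
                adj G x a ≡ true → adj G x b ≡ true → x ≡ d ⊎ adj G x d ≡ true → ⊥
      sparse  : ∀ X → 1 ≤ size X → Γ * size X ≤ n → 8 * c * present (internal X) G < m * size X
      expand  : ∀ S → n < Γ * size S → 2 * size S ≤ n →
                q * (2 * present (internal S) G) < (q + 2) * present (cut S) G + 2 * (2 * present (internal S) G)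

  module _ {q m c Γ : ℕ} {{_ : NonZero q}} (8c≤m : 8 * c ≤ m) {G : Graph n} (exp : Expanding q m c Γ G) where

    open Expanding exp

    weak⇒half : ∀ {S} → Weak q G S → ∀ v → S v ≡ true → deg G v ≤ 2 * nb G v S
    weak⇒half {S} weak v v∈S = ℕ.+-cancelʳ-≤ (deg G v) _ _ (begin
      deg G v + deg G v                          ≡⟨ cong₂ _+_ (deg≡nb G v S) (deg≡nb G v S) ⟩
      (nb G v S + o) + (nb G v S + o)            ≡⟨ lem (nb G v S) o ⟩
      2 * nb G v S + 2 * o                       ≤⟨ ℕ.+-monoʳ-≤ (2 * nb G v S) 2o≤deg ⟩
      2 * nb G v S + deg G v                     ∎)
      where
      open ℕ.≤-Reasoning
      o = nb G v (not ∘ S)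
      lem : ∀ a o → (a + o) + (a + o) ≡ 2 * a + 2 * o
      lem = solve-∀
      comm : ∀ q o → q * (2 * o) ≡ 2 * q * o
      comm = solve-∀
      2o≤deg : 2 * o ≤ deg G v
      2o≤deg = ℕ.*-cancelˡ-≤ q (ℕ.≤-trans (ℕ.≤-reflexive (comm q o)) (ℕ.≤-trans (ℕ.m≤m+n _ _) (weak v v∈S)))

    few-low : ∀ v (S : Fin n → Bool) → nb G v (λ u → S u ∧ low u) ≤ 2
    few-low v S with nb G v (λ u → S u ∧ low u) ℕ.≤? 2
    ... | yes p = p
    ... | no ¬p = let a , b , d , a≢b , a≢d , b≢d , pa , pb , pd = three-members (λ u → (S u ∧ low u) ∧ adj G v u) (ℕ.≰⇒> ¬p) in
      ⊥-elim (cluster v a b d a≢b a≢d b≢d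
        (∧-trueʳ {S a} (∧-trueˡ pa)) (∧-trueʳ {S b} (∧-trueˡ pb)) (∧-trueʳ {S d} (∧-trueˡ pd))
        (∧-trueʳ {S a ∧ low a} pa) (∧-trueʳ {S b ∧ low b} pb) (inj₂ (∧-trueʳ {S d ∧ low d} pd)))

    -- An isolated vertex is weak, so an edge leaving `S` is essential; it settles the case in which
    -- `S` consists of low vertices. Otherwise the high part of `S` contradicts `sparse`.
    weak⇒large : ∀ {S} → Weak q G S → ∀ {u v} → S u ≡ true → S v ≡ false → adj G u v ≡ true → n < Γ * size S
    weak⇒large {S} weak {u} {v} u∈S v∉S uv = ℕ.≰⇒> λ small → go small (Fin.any? (λ x → S′ x Bool.≟ true))
      where
      S′ : Fin n → Bool
      S′ x = S x ∧ not (low x)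
      go : Γ * size S ≤ n → Dec (∃[ x ] S′ x ≡ true) → ⊥
      go small (yes (x , x∈S′)) = ℕ.<⇒≱ (sparse S′ (size-pos S′ x x∈S′)
          (ℕ.≤-trans (ℕ.*-monoʳ-≤ Γ (size-mono {P = S′} {S} (λ _ → ∧-trueˡ))) small)) (begin
        m * size S′
          ≡⟨ *-distribˡ-sum m (𝟙 ∘ S′) ⟩
        sum (λ y → m * 𝟙 (S′ y))
          ≤⟨ sum-mono (λ y → each y (S′ y) refl) ⟩
        sum (λ y → 4 * c * (𝟙 (S′ y) * nb G y S′))
          ≡⟨ *-distribˡ-sum (4 * c) (λ y → 𝟙 (S′ y) * nb G y S′) ⟨
        4 * c * sum (λ y → 𝟙 (S′ y) * nb G y S′)
          ≡⟨ cong (4 * c *_) (internal-present G S′) ⟩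
        4 * c * (2 * present (internal S′) G)
          ≡⟨ lem c (present (internal S′) G) ⟩
        8 * c * present (internal S′) G ∎)
        where
        open ℕ.≤-Reasoning
        lem : ∀ c e → 4 * c * (2 * e) ≡ 8 * c * e
        lem = solve-∀
        lem₁ : ∀ c a → c * (2 * (2 + a)) ≡ 4 * c + 2 * c * a
        lem₁ = solve-∀
        lem₂ : ∀ m → m + m ≡ 2 * m
        lem₂ = solve-∀
        lem₃ : ∀ c a → 2 * (4 * c + 2 * c * a) ≡ 4 * c * a + 8 * c
        lem₃ = solve-∀
        -- A high vertex keeps half of its neighbours in `S`, at most two of them low, so
        -- `m ≤ 4 c + 2 c nb`. The term `4 c` is at most `m / 2`, which leaves `m ≤ 4 c nb`.
        bound : ∀ y → S′ y ≡ true → m ≤ 4 * c * nb G y S′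
        bound y y∈S′ = ℕ.+-cancelʳ-≤ m _ _ (begin
          m + m                             ≡⟨ lem₂ m ⟩
          2 * m                             ≤⟨ ℕ.*-monoʳ-≤ 2 (high y (not-true (∧-trueʳ {S y} y∈S′))) ⟩
          2 * (c * deg G y)                 ≤⟨ ℕ.*-monoʳ-≤ 2 (ℕ.*-monoʳ-≤ c (weak⇒half weak y (∧-trueˡ y∈S′))) ⟩
          2 * (c * (2 * nb G y S))          ≡⟨ cong (λ z → 2 * (c * (2 * z))) (nb-split G y S low) ⟨
          2 * (c * (2 * (nb G y (λ x → S x ∧ low x) + nb G y S′)))
            ≤⟨ ℕ.*-monoʳ-≤ 2 (ℕ.*-monoʳ-≤ c (ℕ.*-monoʳ-≤ 2 (ℕ.+-monoˡ-≤ _ (few-low y S)))) ⟩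
          2 * (c * (2 * (2 + nb G y S′)))   ≡⟨ cong (2 *_) (lem₁ c (nb G y S′)) ⟩
          2 * (4 * c + 2 * c * nb G y S′)   ≡⟨ lem₃ c (nb G y S′) ⟩
          4 * c * nb G y S′ + 8 * c         ≤⟨ ℕ.+-monoʳ-≤ _ 8c≤m ⟩
          4 * c * nb G y S′ + m             ∎)
          where
          not-true : ∀ {b} → not b ≡ true → b ≡ false
          not-true {false} _ = refl
        each : ∀ y b → S′ y ≡ b → m * 𝟙 b ≤ 4 * c * (𝟙 b * nb G y S′)
        each y true  eq = subst₂ _≤_ (sym (ℕ.*-identityʳ m)) (cong (4 * c *_) (sym (ℕ.+-identityʳ (nb G y S′)))) (bound y eq)
        each y false eq = ℕ.≤-trans (ℕ.≤-reflexive (ℕ.*-zeroʳ m)) z≤n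
      -- All of `S` is low. The extra `2 * deg` in `Weak` makes `2 o < deg G u` strict, so `u` has
      -- more neighbours inside `S` than outside, hence at least two because `v` lies outside.
      go small (no none) = cluster-at two
        where
        o = nb G u (not ∘ S)
        all-low : ∀ x → S x ≡ true → low x ≡ true
        all-low x x∈S = low? (low x) refl
          where
          low? : ∀ b → low x ≡ b → low x ≡ true
          low? true  eq = eq
          low? false eq = contradiction (x , cong₂ _∧_ x∈S (cong not eq)) none
        1≤o : 1 ≤ o
        1≤o = size-pos (λ y → not (S y) ∧ adj G u y) v (cong₂ _∧_ (cong not v∉S) uv)
        lem : ∀ q o → q * (2 * o) ≡ 2 * q * o
        lem = solve-∀
        lem₂ : ∀ o → o + o ≡ 2 * o
        lem₂ = solve-∀
        2o<deg : 2 * o < deg G u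
        2o<deg = ℕ.*-cancelˡ-< q _ _ (ℕ.<-≤-trans (ℕ.≤-<-trans (ℕ.≤-reflexive (lem q o))
          (ℕ.m<m+n (2 * q * o) (ℕ.≤-trans (s≤s z≤n) (ℕ.*-monoʳ-≤ 2 1≤deg)))) (weak u u∈S))
          where
          1≤deg : 1 ≤ deg G u
          1≤deg = ℕ.≤-trans 1≤o (ℕ.≤-trans (ℕ.m≤n+m o (nb G u S)) (ℕ.≤-reflexive (sym (deg≡nb G u S))))
        two : 2 ≤ nb G u S
        two = ℕ.≤-trans (s≤s 1≤o) (ℕ.+-cancelʳ-< o _ _
          (subst₂ _<_ (sym (lem₂ o)) (deg≡nb G u S) 2o<deg))
        off : ∀ {a} → adj G u a ≡ true → a ≢ u
        off ua refl = contradiction (trans (sym ua) (irreflexive G u)) λ ()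
        cluster-at : 2 ≤ nb G u S → ⊥
        cluster-at two = let a , b , a≢b , pa , pb = two-members (λ y → S y ∧ adj G u y) two in
          cluster u a b u a≢b (off (∧-trueʳ {S a} pa)) (off (∧-trueʳ {S b} pb))
            (all-low a (∧-trueˡ pa)) (all-low b (∧-trueˡ pb)) (all-low u u∈S)
            (∧-trueʳ {S a} pa) (∧-trueʳ {S b} pb) (inj₁ refl)

    -- Summing `Weak` over `S`, with `I` twice the internal edges and `C` the cut, gives
    -- `2 q C + 2 (I + C) ≤ q (I + C)`. Cancelling `q C` leaves the negation of `expand`.
    weak⇒not-half : ∀ {S} → Weak q G S → n < Γ * size S → 2 * size S ≤ n → ⊥
    weak⇒not-half {S} weak large half = ℕ.<⇒≱ (expand S large half) (ℕ.+-cancelʳ-≤ (q * C) _ _ (begin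
      ((q + 2) * C + 2 * I) + q * C              ≡⟨ lem₁ q C I ⟩
      2 * q * C + 2 * (I + C)                    ≡⟨ cong₂ (λ x y → 2 * q * x + 2 * y) (cut-present G S) D≡ ⟨
      2 * q * sum (λ v → 𝟙 (S v) * nb G v (not ∘ S)) + 2 * sum (λ v → 𝟙 (S v) * deg G v)
        ≡⟨ cong₂ _+_ (*-distribˡ-sum (2 * q) (λ v → 𝟙 (S v) * nb G v (not ∘ S))) (*-distribˡ-sum 2 (λ v → 𝟙 (S v) * deg G v)) ⟩
      sum (λ v → 2 * q * (𝟙 (S v) * nb G v (not ∘ S))) + sum (λ v → 2 * (𝟙 (S v) * deg G v))
        ≡⟨ ∑-distrib-+ (λ v → 2 * q * (𝟙 (S v) * nb G v (not ∘ S))) (λ v → 2 * (𝟙 (S v) * deg G v)) ⟨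
      sum (λ v → 2 * q * (𝟙 (S v) * nb G v (not ∘ S)) + 2 * (𝟙 (S v) * deg G v))
        ≤⟨ sum-mono (λ v → each v (S v) refl) ⟩
      sum (λ v → q * (𝟙 (S v) * deg G v))
        ≡⟨ *-distribˡ-sum q (λ v → 𝟙 (S v) * deg G v) ⟨
      q * sum (λ v → 𝟙 (S v) * deg G v)          ≡⟨ cong (q *_) D≡ ⟩
      q * (I + C)                                ≡⟨ ℕ.*-distribˡ-+ q I C ⟩
      q * I + q * C                              ∎))
      where
      open ℕ.≤-Reasoning
      I C : ℕ
      I = 2 * present (internal S) G
      C = present (cut S) G
      lem₁ : ∀ q C I → ((q + 2) * C + 2 * I) + q * C ≡ 2 * q * C + 2 * (I + C)
      lem₁ = solve-∀
      D≡ : sum (λ v → 𝟙 (S v) * deg G v) ≡ I + C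
      D≡ = trans (sum-cong-≗ (λ v → trans (cong (𝟙 (S v) *_) (deg≡nb G v S)) (ℕ.*-distribˡ-+ (𝟙 (S v)) (nb G v S) (nb G v (not ∘ S)))))
        (trans (∑-distrib-+ (λ v → 𝟙 (S v) * nb G v S) (λ v → 𝟙 (S v) * nb G v (not ∘ S)))
          (cong₂ _+_ (internal-present G S) (cut-present G S)))
      each : ∀ v b → S v ≡ b → 2 * q * (𝟙 b * nb G v (not ∘ S)) + 2 * (𝟙 b * deg G v) ≤ q * (𝟙 b * deg G v)
      each v true  eq = subst₂ _≤_ (cong₂ (λ x y → 2 * q * x + 2 * y) (sym (ℕ.+-identityʳ _)) (sym (ℕ.+-identityʳ (deg G v))))
        (cong (q *_) (sym (ℕ.+-identityʳ (deg G v)))) (weak v eq)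
      each v false eq = ℕ.≤-trans (ℕ.≤-reflexive (cong (_+ 0) (ℕ.*-zeroʳ (2 * q)))) z≤n

  module _ (G : Graph n) (u : Fin n) where

    Closed : (Fin n → Bool) → Set
    Closed R = ∀ x y → R x ≡ true → R y ≡ false → adj G x y ≡ false

    private
      reach : ∀ f (R : Fin n → Bool) → size (not ∘ R) ≤ f → R u ≡ true → (∀ x → R x ≡ true → Reachable G u x) →
              ∃[ R ] (R u ≡ true × (∀ x → R x ≡ true → Reachable G u x) × Closed R)
      reach f R size≤ u∈R sound = go f size≤ (Fin.any? (λ x → Fin.any? (λ y → (R x Bool.≟ true) ×-dec (R y Bool.≟ false) ×-dec (adj G x y Bool.≟ true))))
        where
        go : ∀ f → size (not ∘ R) ≤ f → Dec (∃[ x ] ∃[ y ] (R x ≡ true × R y ≡ false × adj G x y ≡ true)) →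
             ∃[ R ] (R u ≡ true × (∀ x → R x ≡ true → Reachable G u x) × Closed R)
        go f _ (no none) = R , u∈R , sound , closed
          where
          closed : Closed R
          closed x y x∈R y∉R = Bool.¬-not λ xy → none (x , y , x∈R , y∉R , xy)
        go zero size≤ (yes (x , y , x∈R , y∉R , xy)) =
          contradiction (ℕ.≤-trans (size-pos (not ∘ R) y (cong not y∉R)) size≤) λ ()
        go (suc f) size≤ (yes (x , y , x∈R , y∉R , xy)) = reach f R′ smaller (cong (_∨ does (y Fin.≟ u)) u∈R) sound′
          where
          R′ : Fin n → Bool
          R′ z = R z ∨ does (y Fin.≟ z)
          smaller : size (not ∘ R′) ≤ f
          smaller = s≤s⁻¹ (ℕ.≤-trans (ℕ.≤-reflexive (trans (ℕ.+-comm 1 _)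
            (trans (cong₂ _+_ (sum-cong-≗ (λ z → cong 𝟙 (bool (R z) (does (y Fin.≟ z))))) (cong (𝟙 ∘ not) (sym y∉R)))
              (size-remove y (not ∘ R))))) size≤)
            where
            bool : ∀ r d → not (r ∨ d) ≡ not r ∧ not d
            bool true  d = refl
            bool false d = refl
          sound′ : ∀ z → R′ z ≡ true → Reachable G u z
          sound′ z z∈R′ = by (R z) refl (y Fin.≟ z)
            where
            by : ∀ b → R z ≡ b → Dec (y ≡ z) → Reachable G u z
            by true  eq _ = sound z eq
            by false eq (yes refl) = sound x x∈R ◅◅ (≡⇒T xy ◅ ε)
            by false eq (no y≢z) = contradiction (trans (sym z∈R′) (cong₂ _∨_ eq (dec-false (y Fin.≟ z) y≢z))) λ ()

    -- A path must be exhibited, so the vertices reached from `u` are collected in a Boolean set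
    -- that grows by one vertex at a time; the size of its complement is the fuel. If the closed set
    -- misses `v`, it is a separation that can be counted.
    reachable-or-separated : ∀ v → Reachable G u v ⊎ ∃[ R ] (R u ≡ true × R v ≡ false × Closed R)
    reachable-or-separated v = let R , u∈R , sound , closed = reach n start (ℕ.≤-trans (ℕ.m≤n+m _ (size start)) (ℕ.≤-reflexive (size-not start)))
                                     (dec-true (u Fin.≟ u) refl) (λ x x∈ → by x (u Fin.≟ x) x∈)
                               in decide R u∈R sound closed (R v) refl
      where
      start : Fin n → Bool
      start x = does (u Fin.≟ x)
      by : ∀ x (d : Dec (u ≡ x)) → does d ≡ true → Reachable G u x
      by x (yes refl) _ = ε
      by x (no _) ()
      decide : ∀ R → R u ≡ true → (∀ x → R x ≡ true → Reachable G u x) → Closed R → ∀ b → R v ≡ b →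
               Reachable G u v ⊎ ∃[ R ] (R u ≡ true × R v ≡ false × Closed R)
      decide R u∈R sound closed true  eq = inj₁ (sound v eq)
      decide R u∈R sound closed false eq = inj₂ (R , u∈R , eq , closed)

  element-∈ : ∀ {n} (V : Subset n) i → element V i ∈ V
  element-∈ (inside  ∷ V) zero    = here
  element-∈ (inside  ∷ V) (suc i) = there (element-∈ V i)
  element-∈ (outside ∷ V) i       = there (element-∈ V i)

  ∈-element : ∀ {n} (V : Subset n) {v} → v ∈ V → ∃[ i ] element V i ≡ v
  ∈-element (inside  ∷ V) here      = zero , refl
  ∈-element (inside  ∷ V) (there p) = let i , eq = ∈-element V p in suc i , cong suc eq
  ∈-element (outside ∷ V) (there p) = let i , eq = ∈-element V p in i , cong suc eq

  extend : ∀ {n} (V : Subset n) → (Fin ∣ V ∣ → Bool) → Fin n → Bool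
  extend (inside  ∷ V) R zero    = R zero
  extend (inside  ∷ V) R (suc v) = extend V (R ∘ suc) v
  extend (outside ∷ V) R zero    = false
  extend (outside ∷ V) R (suc v) = extend V R v

  extend-element : ∀ {n} (V : Subset n) R i → extend V R (element V i) ≡ R i
  extend-element (inside  ∷ V) R zero    = refl
  extend-element (inside  ∷ V) R (suc i) = extend-element V (R ∘ suc) i
  extend-element (outside ∷ V) R i       = extend-element V R i

  extend-sound : ∀ {n} (V : Subset n) R v → extend V R v ≡ true → ∃[ i ] (element V i ≡ v × R i ≡ true)
  extend-sound (inside  ∷ V) R zero    h = zero , refl , h
  extend-sound (inside  ∷ V) R (suc v) h = let i , eq , p = extend-sound V (R ∘ suc) v h in suc i , cong suc eq , p
  extend-sound (outside ∷ V) R (suc v) h = let i , eq , p = extend-sound V R v h in i , cong suc eq , p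

  sum-element : ∀ {n} (V : Subset n) (h : Fin n → ℕ) → sum (h ∘ element V) ≡ sum (λ v → 𝟙 (lookup V v) * h v)
  sum-element []            h = refl
  sum-element (inside  ∷ V) h = cong₂ _+_ (sym (ℕ.+-identityʳ (h zero))) (sum-element V (h ∘ suc))
  sum-element (outside ∷ V) h = sum-element V (h ∘ suc)

  lookup-∈ : ∀ {n} (V : Subset n) {v} → v ∈ V → lookup V v ≡ true
  lookup-∈ (_ ∷ V) here      = refl
  lookup-∈ (_ ∷ V) (there p) = lookup-∈ V p

  extend-disjoint : ∀ {n} (V : Subset n) R → size (extend V R) + size (extend V (not ∘ R)) ≤ n
  extend-disjoint V R = ℕ.≤-trans (ℕ.+-monoʳ-≤ (size (extend V R)) (size-mono {P = extend V (not ∘ R)} {not ∘ extend V R} disjoint)) (ℕ.≤-reflexive (size-not (extend V R)))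
    where
    disjoint : ∀ v → extend V (not ∘ R) v ≡ true → not (extend V R v) ≡ true
    disjoint v h = let i , eq , p = extend-sound V (not ∘ R) v h in
      trans (cong (not ∘ extend V R) (sym eq)) (trans (cong not (extend-element V R i)) p)

  module _ {q m c Γ : ℕ} {{_ : NonZero q}} (8c≤m : 8 * c ≤ m) {G : Graph n} (exp : Expanding q m c Γ G)
    (V : Subset n) (component : IsComponent G V) (H : Graph ∣ V ∣)
    (few : ∀ i → 2 * q * deg H i + 2 * deg (induced G V) i ≤ q * deg (induced G V) i) where

    private
      G′ : Graph ∣ V ∣
      G′ = induced G V

      stays : ∀ {x y} → x ∈ V → adj G x y ≡ true → y ∈ V
      stays {x} {y} x∈V xy = Equivalence.from (proj₂ component x x∈V y) (≡⇒T xy ◅ ε)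

      -- A neighbour of a vertex of the component lies in the component, so nothing is lost by
      -- summing over `V` alone; in particular, degrees in the induced graph are full degrees.
      within : ∀ i (P : Fin n → Bool) →
               sum (λ j → 𝟙 (P (element V j) ∧ adj G (element V i) (element V j))) ≡ nb G (element V i) P
      within i P = trans (sum-element V (λ v → 𝟙 (P v ∧ adj G (element V i) v)))
        (sum-cong-≗ (λ v → by v (adj G (element V i) v) refl))
        where
        by : ∀ v b → adj G (element V i) v ≡ b → 𝟙 (lookup V v) * 𝟙 (P v ∧ b) ≡ 𝟙 (P v ∧ b)
        by v true  eq = trans (cong (λ z → 𝟙 z * 𝟙 (P v ∧ true)) (lookup-∈ V (stays (element-∈ V i) eq))) (ℕ.+-identityʳ _)
        by v false eq = trans (cong (λ z → 𝟙 (lookup V v) * 𝟙 z) (Bool.∧-zeroʳ (P v)))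
          (trans (ℕ.*-zeroʳ (𝟙 (lookup V v))) (sym (cong 𝟙 (Bool.∧-zeroʳ (P v)))))

      deg-induced : ∀ i → deg G′ i ≡ deg G (element V i)
      deg-induced i = trans (size-tabulate (adj G′ i)) (trans (within i (λ _ → true)) (sym (size-tabulate (adj G (element V i)))))

      Separates : (Fin ∣ V ∣ → Bool) → Set
      Separates R = ∀ i j → R i ≡ true → R j ≡ false → adj G′ i j ≡ true → adj H i j ≡ true

      weak : ∀ R → Separates R → Weak q G (extend V R)
      weak R sep v v∈ = let i , eq , i∈R = extend-sound V R v v∈ in
        subst (λ v → 2 * q * nb G v (not ∘ extend V R) + 2 * deg G v ≤ q * deg G v) eq (at i i∈R)
        where
        open ℕ.≤-Reasoning
        at : ∀ i → R i ≡ true → 2 * q * nb G (element V i) (not ∘ extend V R) + 2 * deg G (element V i) ≤ q * deg G (element V i)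
        at i i∈R = begin
          2 * q * nb G (element V i) (not ∘ extend V R) + 2 * deg G (element V i)
            ≤⟨ ℕ.+-monoˡ-≤ _ (ℕ.*-monoʳ-≤ (2 * q) loss) ⟩
          2 * q * deg H i + 2 * deg G (element V i)
            ≡⟨ cong (λ z → 2 * q * deg H i + 2 * z) (deg-induced i) ⟨
          2 * q * deg H i + 2 * deg G′ i
            ≤⟨ few i ⟩
          q * deg G′ i
            ≡⟨ cong (q *_) (deg-induced i) ⟩
          q * deg G (element V i) ∎
          where
          loss : nb G (element V i) (not ∘ extend V R) ≤ deg H i
          loss = begin
            nb G (element V i) (not ∘ extend V R)
              ≡⟨ within i (not ∘ extend V R) ⟨
            size (λ j → not (extend V R (element V j)) ∧ adj G′ i j)
              ≤⟨ size-mono {P = λ j → not (extend V R (element V j)) ∧ adj G′ i j} {adj H i} (λ j p → sep i j i∈R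
                   (not-true (trans (cong not (sym (extend-element V R j))) (∧-trueˡ p))) (∧-trueʳ {not (extend V R (element V j))} p)) ⟩
            size (adj H i)
              ≡⟨ size-tabulate (adj H i) ⟨
            deg H i ∎
            where
            not-true : ∀ {b} → not b ≡ true → b ≡ false
            not-true {false} _ = refl

      -- Before the deletion `V` is connected, so a path between the two sides contains an edge that
      -- joins them. It supplies the edge leaving `S` that `weak⇒large` asks for.
      crossing : ∀ R {x y} i j → element V i ≡ x → element V j ≡ y → R i ≡ true → R j ≡ false → Reachable G x y →
                 ∃[ i ] ∃[ j ] (R i ≡ true × R j ≡ false × adj G′ i j ≡ true)
      crossing R i j refl eq i∈R j∉R ε = contradiction (trans (sym i∈R) (trans (sym (extend-element V R i))
        (trans (cong (extend V R) (sym eq)) (trans (extend-element V R j) j∉R)))) λ ()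
      crossing R i j refl eq i∈R j∉R (_◅_ {j = z} xz path) =
        let k , k≡z = ∈-element V (stays (element-∈ V i) (T⇒≡ xz)) in
        go k k≡z (R k) refl
        where
        go : ∀ k → element V k ≡ z → ∀ b → R k ≡ b → ∃[ i ] ∃[ j ] (R i ≡ true × R j ≡ false × adj G′ i j ≡ true)
        go k k≡z true  k∈R = crossing R k j k≡z eq k∈R j∉R path
        go k k≡z false k∉R = i , k , i∈R , k∉R , trans (cong (adj G (element V i)) k≡z) (T⇒≡ xz)

    -- Since `H` is symmetric, both sides of a separation are weak, and one crossing edge shows both
    -- to be large. They are disjoint, so the smaller one has at most `n / 2` vertices.
    survives : ∀ u v → Reachable (G′ ∖ H) u v
    survives u v = go (reachable-or-separated (G′ ∖ H) u v)
      where
      go : Reachable (G′ ∖ H) u v ⊎ ∃[ R ] (R u ≡ true × R v ≡ false × Closed (G′ ∖ H) u R) → Reachable (G′ ∖ H) u v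
      go (inj₁ p) = p
      go (inj₂ (R , u∈R , v∉R , closed)) = ⊥-elim (clash (crossing R u v refl refl u∈R v∉R
          (Equivalence.to (proj₂ component (element V u) (element-∈ V u) (element V v)) (element-∈ V v))))
        where
        deleted : ∀ x y → x ∧ not y ≡ false → x ≡ true → y ≡ true
        deleted true true  _ _ = refl
        flip : ∀ {b} → not b ≡ true → b ≡ false
        flip {false} _ = refl
        flip′ : ∀ {b} → not b ≡ false → b ≡ true
        flip′ {true} _ = refl
        sep : Separates R
        sep i j i∈R j∉R ij = deleted (adj G′ i j) (adj H i j) (closed i j i∈R j∉R) ij
        sep′ : Separates (not ∘ R)
        sep′ i j i∉R j∈R ij = trans (symmetric H i j) (sep j i (flip′ j∈R) (flip i∉R) (trans (symmetric G′ j i) ij))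
        S S′ : Fin n → Bool
        S  = extend V R
        S′ = extend V (not ∘ R)
        clash : ∃[ i ] ∃[ j ] (R i ≡ true × R j ≡ false × adj G′ i j ≡ true) → ⊥
        clash (i , j , i∈R , j∉R , ij) = by (ℕ.≤-total (size S) (size S′))
          where
          large : n < Γ * size S
          large = weak⇒large 8c≤m exp (weak R sep) (trans (extend-element V R i) i∈R) (trans (extend-element V R j) j∉R) ij
          large′ : n < Γ * size S′
          large′ = weak⇒large 8c≤m exp (weak (not ∘ R) sep′) (trans (extend-element V (not ∘ R) j) (cong not j∉R))
            (trans (extend-element V (not ∘ R) i) (cong not i∈R)) (trans (symmetric G′ j i) ij)
          double : ∀ a → 2 * a ≡ a + a
          double = solve-∀
          by : size S ≤ size S′ ⊎ size S′ ≤ size S → ⊥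
          by (inj₁ p) = weak⇒not-half 8c≤m exp (weak R sep) large
            (ℕ.≤-trans (ℕ.≤-reflexive (double (size S))) (ℕ.≤-trans (ℕ.+-monoʳ-≤ (size S) p) (extend-disjoint V R)))
          by (inj₂ p) = weak⇒not-half 8c≤m exp (weak (not ∘ R) sep′) large′
            (ℕ.≤-trans (ℕ.≤-reflexive (double (size S′))) (ℕ.≤-trans (ℕ.+-monoˡ-≤ (size S′) p) (extend-disjoint V R)))

-- Tail bounds for degrees and for edges inside small sets.

module Tails where

  open import Defs
  open Rationals
  open Distributions
  open Counting
  open Process
  open Potentials
  open Concentration
  open Connectivity using (nb; deg≡nb; cut-present)
  open import Data.Fin.Base using (Fin)
  open import Data.Nat.Base using (ℕ; zero; suc; _∸_; z≤n; s≤s)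
  open import Data.Nat.Combinatorics using (_C_)
  open import Data.Rational.Base using (ℚ; 0ℚ; 1ℚ; ½; _+_; _*_; _-_; -_; _≤_; _<_)
  open import Tactic.RingSolver using (solve-∀)

  private variable
    n : ℕ

  move-power : ∀ {x α a} k → 0ℚ ≤ a → α * a ≡ 1ℚ → x * α ^ k ≤ 1ℚ → x ≤ a ^ k
  move-power {x} {α} {a} k 0≤a α*a h = begin
    x                    ≡⟨ ℚ.*-identityʳ x ⟨
    x * 1ℚ               ≡⟨ cong (x *_) (trans (sym (^-distrib-* α a k)) (trans (cong (_^ k) α*a) (1^ k))) ⟨
    x * (α ^ k * a ^ k)  ≡⟨ ℚ.*-assoc x _ _ ⟨
    x * α ^ k * a ^ k    ≤⟨ *-monoʳ (a ^ k) (0≤^ k 0≤a) h ⟩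
    1ℚ * a ^ k           ≡⟨ ℚ.*-identityˡ _ ⟩
    a ^ k                ∎
    where open ℚ.≤-Reasoning

  -- The two bases of a Chernoff bound: `lam = a` for lower tails and `lam = α` for upper tails, the
  -- other one normalising at the threshold. Keeping both avoids division.
  record Inverse (α a : ℚ) : Set where
    field
      1≤α : 1ℚ ≤ α
      0≤a : 0ℚ ≤ a
      α*a : α * a ≡ 1ℚ

    0≤α : 0ℚ ≤ α
    0≤α = ℚ.≤-trans 0≤1 1≤α

    a≤1 : a ≤ 1ℚ
    a≤1 = subst₂ _≤_ (ℚ.*-identityˡ a) α*a (*-monoʳ a 0≤a 1≤α)

    α^*a^ : ∀ k → α ^ k * a ^ k ≡ 1ℚ
    α^*a^ k = trans (sym (^-distrib-* α a k)) (trans (cong (_^ k) α*a) (1^ k))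

    α^*a^≤1 : ∀ {k l} → k ℕ.≤ l → α ^ k * a ^ l ≤ 1ℚ
    α^*a^≤1 {k} {l} k≤l = ℚ.≤-trans (*-monoˡ (α ^ k) (0≤^ k 0≤α) (^-anti-exp 0≤a a≤1 k≤l)) (ℚ.≤-reflexive (α^*a^ k))

    1≤α^*a^ : ∀ {k l} → l ℕ.≤ k → 1ℚ ≤ α ^ k * a ^ l
    1≤α^*a^ {k} {l} l≤k = ℚ.≤-trans (ℚ.≤-reflexive (sym (α^*a^ l))) (*-monoʳ (a ^ l) (0≤^ l 0≤a) (^-mono-exp 1≤α l≤k))

    move : ∀ {x} k → x * α ^ k ≤ 1ℚ → x ≤ a ^ k
    move k h = move-power k 0≤a α*a h

  inverse-two : Inverse 2ℚ ½
  inverse-two = record { 1≤α = #-mono {1} {2} (s≤s z≤n) ; 0≤a = from-yes (0ℚ ℚ.≤? ½) ; α*a = refl }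

  module Two = Inverse inverse-two

  ^-cancel-≤1 : ∀ {a} k → 1 ℕ.≤ k → a ^ k ≤ 1ℚ → a ≤ 1ℚ
  ^-cancel-≤1 {a} (suc k) _ h = ^-cancel-≤ k 0≤1 (subst (a ^ suc k ≤_) (sym (1^ (suc k))) h)

  -- A rate is close to `1`, and `compound` controls only its `N`-th power, so the inequality is
  -- proved after raising it to that power. The further exponent `k` clears the denominators that
  -- arise in comparing exponents.
  root : ∀ {c G s} N k f → 1 ℕ.≤ N → 1 ℕ.≤ k → 0ℚ ≤ c → 0ℚ ≤ s → c ^ N ≤ G → (G ^ f * s ^ N) ^ k ≤ 1ℚ → c ^ f * s ≤ 1ℚ
  root {c} {G} {s} N k f 1≤N 1≤k 0≤c 0≤s c≤G h = ^-cancel-≤1 N 1≤N (^-cancel-≤1 k 1≤k (begin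
    ((c ^ f * s) ^ N) ^ k        ≡⟨ cong (_^ k) (^-distrib-* (c ^ f) s N) ⟩
    ((c ^ f) ^ N * s ^ N) ^ k    ≡⟨ cong (λ z → (z * s ^ N) ^ k) (trans (^-assocʳ c f N) (trans (cong (c ^_) (ℕ.*-comm f N)) (sym (^-assocʳ c N f)))) ⟩
    ((c ^ N) ^ f * s ^ N) ^ k    ≤⟨ ^-mono k (0≤* (0≤^ f (0≤^ N 0≤c)) (0≤^ N 0≤s)) (*-monoʳ (s ^ N) (0≤^ N 0≤s) (^-mono f (0≤^ N 0≤c) c≤G)) ⟩
    (G ^ f * s ^ N) ^ k          ≤⟨ h ⟩
    1ℚ                           ∎))
    where open ℚ.≤-Reasoning

  flatten : ∀ g u v m f t w N k →
            ((g ^ m) ^ f * (u ^ t * v ^ w) ^ N) ^ k ≡ g ^ (m ℕ.* f ℕ.* k) * (u ^ (t ℕ.* N ℕ.* k) * v ^ (w ℕ.* N ℕ.* k))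
  flatten g u v m f t w N k = begin
    ((g ^ m) ^ f * (u ^ t * v ^ w) ^ N) ^ k
      ≡⟨ ^-distrib-* ((g ^ m) ^ f) _ k ⟩
    ((g ^ m) ^ f) ^ k * ((u ^ t * v ^ w) ^ N) ^ k
      ≡⟨ cong₂ (λ x y → x ^ k * y ^ k) (^-assocʳ g m f) (^-distrib-* (u ^ t) (v ^ w) N) ⟩
    (g ^ (m ℕ.* f)) ^ k * ((u ^ t) ^ N * (v ^ w) ^ N) ^ k
      ≡⟨ cong₂ _*_ (^-assocʳ g (m ℕ.* f) k) (^-distrib-* ((u ^ t) ^ N) ((v ^ w) ^ N) k) ⟩
    g ^ (m ℕ.* f ℕ.* k) * (((u ^ t) ^ N) ^ k * ((v ^ w) ^ N) ^ k)
      ≡⟨ cong₂ (λ x y → g ^ (m ℕ.* f ℕ.* k) * (x ^ k * y ^ k)) (^-assocʳ u t N) (^-assocʳ v w N) ⟩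
    g ^ (m ℕ.* f ℕ.* k) * ((u ^ (t ℕ.* N)) ^ k * (v ^ (w ℕ.* N)) ^ k)
      ≡⟨ cong₂ (λ x y → g ^ (m ℕ.* f ℕ.* k) * (x * y)) (^-assocʳ u (t ℕ.* N) k) (^-assocʳ v (w ℕ.* N) k) ⟩
    g ^ (m ℕ.* f ℕ.* k) * (u ^ (t ℕ.* N ℕ.* k) * v ^ (w ℕ.* N ℕ.* k)) ∎
    where open ≡-Reasoning

  -- The freedom in writing `(lam - 1) * m` as `m′ * x` serves two ends: it keeps `1 - x` positive
  -- when `lam` is large, and it lets `1 - x` be a prescribed base when `lam < 1`.
  rate-compound : ∀ {lam m N x} m′ → 1 ℕ.≤ N → m ℕ.≤ N → 0ℚ ≤ lam → (lam - 1ℚ) * # m ≡ # m′ * x → x ≤ 1ℚ →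
                  rate lam m N ^ N * (1ℚ - x) ^ m′ ≤ 1ℚ
  rate-compound {lam} {m} {N} {x} m′ 1≤N m≤N 0≤lam eq x≤1 = subst (λ z → z ^ N * (1ℚ - x) ^ m′ ≤ 1ℚ) (sym rate≡)
    (compound m′ 1≤N (sym (trans (lem₂ (# N) x (inv N)) (trans (cong (_* x) (#*inv′ 1≤N)) (ℚ.*-identityˡ x)))) x≤1 nonNeg)
    where
    lem₂ : ∀ n x i → n * (x * i) ≡ (n * i) * x
    lem₂ = solve-∀ ring
    lem₃ : ∀ l m i → 1ℚ + (l - 1ℚ) * (m * i) ≡ 1ℚ + ((l - 1ℚ) * m) * i
    lem₃ = solve-∀ ring
    rate≡ : rate lam m N ≡ 1ℚ + # m′ * (x * inv N)
    rate≡ = trans (lem₃ lam (# m) (inv N)) (cong (1ℚ +_) (trans (cong (_* inv N) eq) (ℚ.*-assoc (# m′) x (inv N))))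
    nonNeg : ∀ k → k ℕ.≤ m′ → 0ℚ ≤ 1ℚ + # k * (x * inv N)
    nonNeg k k≤m′ with ℚ.≤-total 0ℚ x
    ... | inj₁ 0≤x = 0≤+ 0≤1 (0≤* (0≤# k) (0≤* 0≤x (0≤inv N)))
    ... | inj₂ x≤0 = ℚ.≤-trans (subst (0ℚ ≤_) rate≡ (0≤rate 0≤lam m≤N))
      (≤-by ((# m′ - # k) * ((0ℚ - x) * inv N)) (0≤* (0≤-diff (#-mono k≤m′)) (0≤* (0≤-diff x≤0) (0≤inv N)))
        (lem (# m′) (# k) x (inv N)))
      where
      lem : ∀ m k x i → 1ℚ + m * (x * i) + (m - k) * ((0ℚ - x) * i) ≡ 1ℚ + k * (x * i)
      lem = solve-∀ ring

  module _ (F : Pairs n) {m : ℕ} (m≤N : m ℕ.≤ n C 2) where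

    many : ∀ {α a} → Inverse α a → ∀ t → FailsWithin (process n) (rate a m (n C 2) ^ pairs F * α ^ t) (λ Gs → t ℕ.< present F (at Gs m))
    many {α} {a} I t = certificate (λ Gs → α ^ t * a ^ present F (at Gs m))
      (λ Gs → 0≤* (0≤^ t 0≤α) (0≤^ (present F (at Gs m)) 0≤a))
      (λ Gs h → ℕ.≰⇒> λ X≤t → ℚ.<-irrefl refl (ℚ.<-≤-trans h (1≤α^*a^ X≤t)))
      (ℚ.≤-trans (ℚ.≤-reflexive (𝔼-* (α ^ t) (process n) (λ Gs → a ^ present F (at Gs m))))
        (ℚ.≤-trans (*-monoˡ (α ^ t) (0≤^ t 0≤α) (chernoff F a 0≤a m≤N)) (ℚ.≤-reflexive (ℚ.*-comm (α ^ t) _))))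
      where open Inverse I

    few : ∀ {α a} → Inverse α a → ∀ t → FailsWithin (process n) (rate α m (n C 2) ^ pairs F * a ^ t) (λ Gs → present F (at Gs m) ℕ.< t)
    few {α} {a} I t = certificate (λ Gs → a ^ t * α ^ present F (at Gs m))
      (λ Gs → 0≤* (0≤^ t 0≤a) (0≤^ (present F (at Gs m)) 0≤α))
      (λ Gs h → ℕ.≰⇒> λ t≤X → ℚ.<-irrefl refl (ℚ.<-≤-trans h (ℚ.≤-trans (1≤α^*a^ t≤X) (ℚ.≤-reflexive (ℚ.*-comm (α ^ present F (at Gs m)) (a ^ t))))))
      (ℚ.≤-trans (ℚ.≤-reflexive (𝔼-* (a ^ t) (process n) (λ Gs → α ^ present F (at Gs m))))
        (ℚ.≤-trans (*-monoˡ (a ^ t) (0≤^ t 0≤a) (chernoff F α 0≤α m≤N)) (ℚ.≤-reflexive (ℚ.*-comm (a ^ t) _))))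
      where open Inverse I

  1≤C2 : ∀ {n} → 2 ℕ.≤ n → 1 ℕ.≤ n C 2
  1≤C2 {n} 2≤n = positive (n C 2) (2*C2 n)
    where
    positive : ∀ c → 2 ℕ.* c ℕ.+ n ≡ n ℕ.* n → 1 ℕ.≤ c
    positive (suc c) _  = s≤s z≤n
    positive zero    eq = contradiction (ℕ.≤-trans (ℕ.*-monoˡ-≤ n 2≤n) (ℕ.≤-reflexive (sym eq)))
      (ℕ.<⇒≱ (ℕ.m<m+n n (ℕ.≤-trans (ℕ.≤-trans (s≤s z≤n) 2≤n) (ℕ.≤-reflexive (sym (ℕ.+-identityʳ n))))))

  2C2≡ : ∀ n → 2 ℕ.* (n C 2) ≡ n ℕ.* (n ∸ 1)
  2C2≡ zero    = refl
  2C2≡ (suc n) = ℕ.+-cancelʳ-≡ (suc n) _ _ (trans (2*C2 (suc n)) (lem n))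
    where
    lem : ∀ n → suc n ℕ.* suc n ≡ suc n ℕ.* n ℕ.+ suc n
    lem = ℕ-Solver.solve-∀

  single : Fin n → Fin n → Bool
  single v u = Relation.Nullary.does (v Fin.≟ u)

  size-single : (v : Fin n) → size (single v) ≡ 1
  size-single v = trans (sum-cong-≗ (λ u → sym (ℕ.*-identityʳ (𝟙 (single v u))))) (sum-δ v (λ _ → 1))

  pairs-single : (v : Fin n) → pairs (cut (single v)) ≡ n ∸ 1
  pairs-single {n} v = trans (cut-pairs (single v)) (trans (cong (ℕ._* size (not ∘ single v)) (size-single v))
    (trans (ℕ.*-identityˡ _) (trans (sym (ℕ.m+n∸m≡n 1 _)) (cong (_∸ 1) (trans (cong (ℕ._+ size (not ∘ single v)) (sym (size-single v))) (size-not (single v)))))))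

  present-single : (G : Graph n) (v : Fin n) → present (cut (single v)) G ℕ.≤ deg G v
  present-single G v = ℕ.≤-trans (ℕ.≤-reflexive (trans (sym (cut-present G (single v))) (sum-δ v (λ u → nb G u (not ∘ single v)))))
    (ℕ.≤-trans (ℕ.m≤n+m _ (nb G v (single v))) (ℕ.≤-reflexive (sym (deg≡nb G v (single v)))))

  -- With `lam = ½` the `N`-th power of the rate is at most `(2/3)^m`. As `(2/3)² ≤ ½` and
  -- `2 N = n (n − 1)`, the `n − 1` pairs at `v` give `2^(−m/n)`, and `m / n` covers both `t` and
  -- `w`.
  large-degree : ∀ {n m} (v : Fin n) t w → 2 ℕ.≤ n → m ℕ.≤ n C 2 → (t ℕ.+ w) ℕ.* n ℕ.≤ m →
    FailsWithin (process n) (½ ^ w) (λ Gs → t ℕ.< deg (at Gs m) v)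
  large-degree {n} {m} v t w 2≤n m≤N hyp = weaken
    (Two.move w (ℚ.≤-trans (ℚ.≤-reflexive (ℚ.*-assoc (c ^ f) _ _))
      (root N 2 f (1≤C2 2≤n) (s≤s z≤n) 0≤c (0≤* (0≤^ t Two.0≤α) (0≤^ w Two.0≤α)) c≤ final)))
    (λ Gs h → ℕ.<-≤-trans h (present-single (at Gs m) v))
    (many (cut (single v)) m≤N inverse-two t)
    where
    open ℚ.≤-Reasoning
    N f : ℕ
    N = n C 2
    f = pairs (cut (single v))
    c g : ℚ
    c = rate ½ m N
    g = # 2 * inv 3
    0≤c : 0ℚ ≤ c
    0≤c = 0≤rate Two.0≤a m≤N
    0≤g : 0ℚ ≤ g
    0≤g = from-yes (0ℚ ℚ.≤? g)
    inverse : Inverse (1ℚ - (- ½)) g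
    inverse = record { 1≤α = from-yes (1ℚ ℚ.≤? (1ℚ - (- ½))) ; 0≤a = 0≤g ; α*a = refl }
    c≤ : c ^ N ≤ g ^ m
    c≤ = Inverse.move inverse m (rate-compound m (1≤C2 2≤n) m≤N Two.0≤a (lem (# m)) (from-yes (- ½ ℚ.≤? 1ℚ)))
      where
      lem : ∀ m → (½ - 1ℚ) * m ≡ m * (- ½)
      lem m = trans (cong (_* m) {½ - 1ℚ} { (- ½)} refl) (ℚ.*-comm (- ½) m)
    exponents : t ℕ.* N ℕ.* 2 ℕ.+ w ℕ.* N ℕ.* 2 ℕ.≤ m ℕ.* f
    exponents = ℕ.≤-trans (ℕ.≤-reflexive (trans (lem₁ t w N) (trans (cong ((t ℕ.+ w) ℕ.*_) (2C2≡ n)) (sym (ℕ.*-assoc (t ℕ.+ w) n (n ∸ 1))))))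
      (ℕ.≤-trans (ℕ.*-monoˡ-≤ (n ∸ 1) hyp) (ℕ.≤-reflexive (cong (m ℕ.*_) (sym (pairs-single v)))))
      where
      lem₁ : ∀ t w N → t ℕ.* N ℕ.* 2 ℕ.+ w ℕ.* N ℕ.* 2 ≡ (t ℕ.+ w) ℕ.* (2 ℕ.* N)
      lem₁ = ℕ-Solver.solve-∀
    final : ((g ^ m) ^ f * (2ℚ ^ t * 2ℚ ^ w) ^ N) ^ 2 ≤ 1ℚ
    final = begin
      ((g ^ m) ^ f * (2ℚ ^ t * 2ℚ ^ w) ^ N) ^ 2
        ≡⟨ flatten g 2ℚ 2ℚ m f t w N 2 ⟩
      g ^ (m ℕ.* f ℕ.* 2) * (2ℚ ^ (t ℕ.* N ℕ.* 2) * 2ℚ ^ (w ℕ.* N ℕ.* 2))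
        ≡⟨ cong₂ _*_ (trans (cong (g ^_) (ℕ.*-comm (m ℕ.* f) 2)) (sym (^-assocʳ g 2 (m ℕ.* f)))) (sym (^-homo-* 2ℚ (t ℕ.* N ℕ.* 2) (w ℕ.* N ℕ.* 2))) ⟩
      (g ^ 2) ^ (m ℕ.* f) * 2ℚ ^ (t ℕ.* N ℕ.* 2 ℕ.+ w ℕ.* N ℕ.* 2)
        ≤⟨ *-monoʳ _ (0≤^ (t ℕ.* N ℕ.* 2 ℕ.+ w ℕ.* N ℕ.* 2) Two.0≤α) (^-mono (m ℕ.* f) (0≤^ 2 0≤g) (from-yes ((g ^ 2) ℚ.≤? ½))) ⟩
      ½ ^ (m ℕ.* f) * 2ℚ ^ (t ℕ.* N ℕ.* 2 ℕ.+ w ℕ.* N ℕ.* 2)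
        ≡⟨ ℚ.*-comm (½ ^ (m ℕ.* f)) _ ⟩
      2ℚ ^ (t ℕ.* N ℕ.* 2 ℕ.+ w ℕ.* N ℕ.* 2) * ½ ^ (m ℕ.* f)
        ≤⟨ Two.α^*a^≤1 exponents ⟩
      1ℚ ∎

  -- Here `lam = 2^L`, and `(2^L − 1) m` is split with `x = ½`. In the hypothesis the first term
  -- bounds the growth of the rate, the second is the demanded tail, and the right side is the
  -- saving of `2^(−L)` for each of `t` edges.
  few-internal : ∀ {n m} (X : Fin n → Bool) t w L → 2 ℕ.≤ n → m ℕ.≤ n C 2 →
    2 ℕ.* 2 ℕ.^ L ℕ.* m ℕ.* (size X ℕ.* size X) ℕ.+ w ℕ.* (2 ℕ.* (n C 2)) ℕ.≤ L ℕ.* t ℕ.* (2 ℕ.* (n C 2)) →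
    FailsWithin (process n) (½ ^ w) (λ Gs → present (internal X) (at Gs m) ℕ.< t)
  few-internal {n} {m} X t w L 2≤n m≤N hyp = weaken
    (Two.move w (ℚ.≤-trans (ℚ.≤-reflexive (ℚ.*-assoc (c ^ f) _ _))
      (root N 2 f (1≤C2 2≤n) (s≤s z≤n) 0≤c (0≤* (0≤^ t (0≤^ L Two.0≤a)) (0≤^ w Two.0≤α)) c≤ final)))
    (λ Gs h → h)
    (few (internal X) m≤N inverse t)
    where
    open ℚ.≤-Reasoning
    N f m′ : ℕ
    N = n C 2
    f = pairs (internal X)
    m′ = 2 ℕ.* (2 ℕ.^ L ∸ 1) ℕ.* m
    inverse : Inverse (2ℚ ^ L) (½ ^ L)
    inverse = record { 1≤α = 1≤^ L Two.1≤α ; 0≤a = 0≤^ L Two.0≤a ; α*a = Two.α^*a^ L }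
    c : ℚ
    c = rate (2ℚ ^ L) m N
    0≤c : 0ℚ ≤ c
    0≤c = 0≤rate (0≤^ L Two.0≤α) m≤N
    c≤ : c ^ N ≤ 2ℚ ^ m′
    c≤ = move-power m′ Two.0≤α refl
      (rate-compound {x = ½} m′ (1≤C2 2≤n) m≤N (0≤^ L Two.0≤α) exact (from-yes (½ ℚ.≤? 1ℚ)))
      where
      lem : ∀ p m → p * m ≡ p * m * (2ℚ * ½)
      lem p m = sym (ℚ.*-identityʳ (p * m))
      lem₂ : ∀ p m t h → p * m * (t * h) ≡ t * p * m * h
      lem₂ = solve-∀ ring
      exact : (2ℚ ^ L - 1ℚ) * # m ≡ # m′ * ½
      exact = trans (lem (2ℚ ^ L - 1ℚ) (# m)) (trans (lem₂ (2ℚ ^ L - 1ℚ) (# m) 2ℚ ½) (cong (_* ½) (sym (trans (#-* (2 ℕ.* (2 ℕ.^ L ∸ 1)) m)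
        (cong (_* # m) (trans (#-* 2 (2 ℕ.^ L ∸ 1)) (cong (2ℚ *_) (trans (#-∸ (ℕ.m^n>0 2 L)) (cong (_- 1ℚ) (#-^ 2 L))))))))))
    exponents : m′ ℕ.* f ℕ.* 2 ℕ.+ w ℕ.* N ℕ.* 2 ℕ.≤ L ℕ.* (t ℕ.* N ℕ.* 2)
    exponents = ℕ.≤-trans (ℕ.+-mono-≤ (ℕ.≤-trans (ℕ.≤-reflexive (lem₁ m′ f))
        (ℕ.*-mono-≤ (ℕ.*-monoˡ-≤ m (ℕ.*-monoʳ-≤ 2 (ℕ.m∸n≤m (2 ℕ.^ L) 1)))
          (ℕ.≤-trans (ℕ.m≤m+n (2 ℕ.* f) (size X)) (ℕ.≤-reflexive (internal-pairs X)))))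
        (ℕ.≤-reflexive (lem₂ w N)))
      (ℕ.≤-trans hyp (ℕ.≤-reflexive (lem₃ L t N)))
      where
      lem₁ : ∀ m f → m ℕ.* f ℕ.* 2 ≡ m ℕ.* (2 ℕ.* f)
      lem₁ = ℕ-Solver.solve-∀
      lem₂ : ∀ w N → w ℕ.* N ℕ.* 2 ≡ w ℕ.* (2 ℕ.* N)
      lem₂ = ℕ-Solver.solve-∀
      lem₃ : ∀ L t N → L ℕ.* t ℕ.* (2 ℕ.* N) ≡ L ℕ.* (t ℕ.* N ℕ.* 2)
      lem₃ = ℕ-Solver.solve-∀
    swap : ∀ a b c → a * (b * c) ≡ (a * c) * b
    swap = solve-∀ ring
    final : ((2ℚ ^ m′) ^ f * ((½ ^ L) ^ t * 2ℚ ^ w) ^ N) ^ 2 ≤ 1ℚ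
    final = begin
      ((2ℚ ^ m′) ^ f * ((½ ^ L) ^ t * 2ℚ ^ w) ^ N) ^ 2
        ≡⟨ flatten 2ℚ (½ ^ L) 2ℚ m′ f t w N 2 ⟩
      2ℚ ^ (m′ ℕ.* f ℕ.* 2) * ((½ ^ L) ^ (t ℕ.* N ℕ.* 2) * 2ℚ ^ (w ℕ.* N ℕ.* 2))
        ≡⟨ swap (2ℚ ^ (m′ ℕ.* f ℕ.* 2)) _ _ ⟩
      (2ℚ ^ (m′ ℕ.* f ℕ.* 2) * 2ℚ ^ (w ℕ.* N ℕ.* 2)) * (½ ^ L) ^ (t ℕ.* N ℕ.* 2)
        ≡⟨ cong₂ _*_ (sym (^-homo-* 2ℚ (m′ ℕ.* f ℕ.* 2) (w ℕ.* N ℕ.* 2))) (^-assocʳ ½ L (t ℕ.* N ℕ.* 2)) ⟩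
      2ℚ ^ (m′ ℕ.* f ℕ.* 2 ℕ.+ w ℕ.* N ℕ.* 2) * ½ ^ (L ℕ.* (t ℕ.* N ℕ.* 2))
        ≤⟨ Two.α^*a^≤1 exponents ⟩
      1ℚ ∎

-- Tail bounds near the mean and for clusters of low vertices.

module TailEvents where

  open import Defs
  open Rationals
  open Distributions
  open Counting
  open Process
  open Potentials
  open Concentration
  open Connectivity using (nb; deg≡nb; cut-present; remove)
  open Tails
  open import Data.Fin.Base using (Fin)
  open import Data.Nat.Base using (ℕ; suc; _∸_; z≤n; s≤s)
  open import Data.Nat.Combinatorics using (_C_)
  open import Data.Rational.Base using (ℚ; 0ℚ; 1ℚ; ½; _+_; _*_; _-_; -_; _≤_; _<_)
  open import Tactic.RingSolver using (solve-∀)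

  private variable
    n : ℕ

  module Near (k : ℕ) (5≤k : 5 ℕ.≤ k) where

    i up up⁻¹ down down⁻¹ : ℚ
    i = inv k
    up = 1ℚ + i
    up⁻¹ = # k * inv (suc k)
    down = 1ℚ - i
    down⁻¹ = # k * inv (k ∸ 1)

    private
      1≤k : 1 ℕ.≤ k
      1≤k = ℕ.≤-trans (s≤s z≤n) 5≤k

      0≤i : 0ℚ ≤ i
      0≤i = 0≤inv k

      k*i : # k * i ≡ 1ℚ
      k*i = #*inv′ 1≤k

      5i≤1 : # 5 * i ≤ 1ℚ
      5i≤1 = ℚ.≤-trans (*-monoʳ i 0≤i (#-mono 5≤k)) (ℚ.≤-reflexive k*i)

      i≤1 : i ≤ 1ℚ
      i≤1 = ℚ.≤-trans (subst (_≤ # 5 * i) (ℚ.*-identityˡ i) (*-monoʳ i 0≤i (#-mono {1} {5} (s≤s z≤n)))) 5i≤1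

      0≤down : 0ℚ ≤ down
      0≤down = 0≤-diff i≤1

      up*up⁻¹ : up * up⁻¹ ≡ 1ℚ
      up*up⁻¹ = trans (lem i (# k) (inv (suc k))) (trans (cong (λ z → (# k + z) * inv (suc k)) k*i)
        (trans (cong (_* inv (suc k)) (trans (ℚ.+-comm (# k) 1ℚ) (sym (#-suc k)))) (#*inv k)))
        where
        lem : ∀ i k j → (1ℚ + i) * (k * j) ≡ (k + k * i) * j
        lem = solve-∀ ring

      down⁻¹*down : down⁻¹ * down ≡ 1ℚ
      down⁻¹*down = trans (lem i (# k) (inv (k ∸ 1))) (trans (cong (λ z → (# k - z) * inv (k ∸ 1)) k*i)
        (trans (cong (_* inv (k ∸ 1)) (sym (#-∸ {k} {1} 1≤k))) (#*inv′ (ℕ.∸-monoˡ-≤ 1 (ℕ.≤-trans (s≤s (s≤s z≤n)) 5≤k)))))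
        where
        lem : ∀ i k j → (k * j) * (1ℚ - i) ≡ (k - k * i) * j
        lem = solve-∀ ring

    inverse-up : Inverse up up⁻¹
    inverse-up = record { 1≤α = ≤-by i 0≤i refl ; 0≤a = 0≤* (0≤# k) (0≤inv (suc k)) ; α*a = up*up⁻¹ }

    module Up = Inverse inverse-up

    0≤down⁻¹ : 0ℚ ≤ down⁻¹
    0≤down⁻¹ = 0≤* (0≤# k) (0≤inv (k ∸ 1))

    inverse-down : Inverse down⁻¹ down
    inverse-down = record
      { 1≤α = subst₂ _≤_ (trans (ℚ.*-comm down down⁻¹) down⁻¹*down) (ℚ.*-identityˡ down⁻¹)
          (*-monoʳ {down} {1ℚ} down⁻¹ 0≤down⁻¹ (≤-by i 0≤i (lem i)))
      ; 0≤a = 0≤down ; α*a = down⁻¹*down }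
      where
      lem : ∀ i → (1ℚ - i) + i ≡ 1ℚ
      lem = solve-∀ ring

    module Down = Inverse inverse-down

    private
      1≤mixed : ∀ j → j ℕ.≤ k → 1ℚ ≤ down ^ j * up ^ (j ℕ.+ 3)
      1≤mixed j j≤k = begin
        1ℚ                           ≤⟨ ≤-by (i * (2ℚ - # 3 * i)) (0≤* 0≤i (0≤-diff 3i≤2)) (lem₁ i) ⟩
        (1ℚ - i) * (1ℚ + # 3 * i)    ≤⟨ *-mono (0≤+ 0≤1 (0≤* (0≤# 3) 0≤i)) (0≤^ j 0≤prod) first (bernoulli {i} 3 Up.0≤α) ⟩
        (down * up) ^ j * up ^ 3     ≡⟨ cong (_* up ^ 3) (^-distrib-* down up j) ⟩
        down ^ j * up ^ j * up ^ 3   ≡⟨ ℚ.*-assoc (down ^ j) _ _ ⟩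
        down ^ j * (up ^ j * up ^ 3) ≡⟨ cong (down ^ j *_) (^-homo-* up j 3) ⟨
        down ^ j * up ^ (j ℕ.+ 3)    ∎
        where
        open ℚ.≤-Reasoning
        0≤prod : 0ℚ ≤ down * up
        0≤prod = 0≤* 0≤down Up.0≤α
        lem₁ : ∀ i → 1ℚ + i * (2ℚ - # 3 * i) ≡ (1ℚ - i) * (1ℚ + # 3 * i)
        lem₁ = solve-∀ ring
        3i≤2 : # 3 * i ≤ 2ℚ
        3i≤2 = ℚ.≤-trans (*-monoʳ i 0≤i (#-mono {3} {5} (s≤s (s≤s (s≤s z≤n))))) (ℚ.≤-trans 5i≤1 (#-mono {1} {2} (s≤s z≤n)))
        prod≡ : down * up ≡ 1ℚ + (- (i * i))
        prod≡ = lem i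
          where
          lem : ∀ i → (1ℚ - i) * (1ℚ + i) ≡ 1ℚ + (- (i * i))
          lem = solve-∀ ring
        first : 1ℚ - i ≤ (down * up) ^ j
        first = begin
          1ℚ - i                    ≤⟨ ≤-by ((# k - # j) * (i * i)) (0≤* (0≤-diff (#-mono j≤k)) (0≤* 0≤i 0≤i))
                                         (trans (lem (# k) (# j) i) (trans (cong (λ z → (1ℚ - i) + z * i - # j * (i * i)) k*i) (lem′ i (# j)))) ⟩
          1ℚ + # j * (- (i * i))    ≤⟨ bernoulli j (subst (0ℚ ≤_) prod≡ 0≤prod) ⟩
          (1ℚ + (- (i * i))) ^ j    ≡⟨ cong (_^ j) prod≡ ⟨
          (down * up) ^ j           ∎
          where
          lem : ∀ k j i → (1ℚ - i) + (k - j) * (i * i) ≡ (1ℚ - i) + (k * i) * i - j * (i * i)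
          lem = solve-∀ ring
          lem′ : ∀ i j → (1ℚ - i) + 1ℚ * i - j * (i * i) ≡ 1ℚ + j * (- (i * i))
          lem′ = solve-∀ ring

    -- The bases `1 − 1/k` and `1 + 1/k` nearly cancel: `(1 − 1/k²)^j ≥ 1 − 1/k` for `j ≤ k`. Three
    -- of the spare factors `up` repair this loss, and the fourth is the gain; hence the `4` in the
    -- thresholds below.
    mixed : ∀ j → j ℕ.≤ k → down⁻¹ ^ j * up⁻¹ ^ (j ℕ.+ 4) ≤ up⁻¹
    mixed j j≤k = begin
      down⁻¹ ^ j * up⁻¹ ^ (j ℕ.+ 4)
        ≡⟨ cong (λ z → down⁻¹ ^ j * up⁻¹ ^ z) (ℕ.+-suc j 3) ⟩
      down⁻¹ ^ j * (up⁻¹ * up⁻¹ ^ (j ℕ.+ 3))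
        ≡⟨ lem₁ (down⁻¹ ^ j) up⁻¹ (up⁻¹ ^ (j ℕ.+ 3)) ⟩
      up⁻¹ * (down⁻¹ ^ j * up⁻¹ ^ (j ℕ.+ 3)) * 1ℚ
        ≤⟨ *-monoˡ _ (0≤* Up.0≤a (0≤* (0≤^ j 0≤down⁻¹) (0≤^ (j ℕ.+ 3) Up.0≤a))) (1≤mixed j j≤k) ⟩
      up⁻¹ * (down⁻¹ ^ j * up⁻¹ ^ (j ℕ.+ 3)) * (down ^ j * up ^ (j ℕ.+ 3))
        ≡⟨ lem₂ up⁻¹ (down⁻¹ ^ j) (up⁻¹ ^ (j ℕ.+ 3)) (down ^ j) (up ^ (j ℕ.+ 3)) ⟩
      up⁻¹ * ((down⁻¹ ^ j * down ^ j) * (up ^ (j ℕ.+ 3) * up⁻¹ ^ (j ℕ.+ 3)))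
        ≡⟨ cong₂ (λ x y → up⁻¹ * (x * y)) (Down.α^*a^ j) (Up.α^*a^ (j ℕ.+ 3)) ⟩
      up⁻¹ * (1ℚ * 1ℚ)
        ≡⟨ ℚ.*-identityʳ up⁻¹ ⟩
      up⁻¹ ∎
      where
      open ℚ.≤-Reasoning
      lem₁ : ∀ d u v → d * (u * v) ≡ u * (d * v) * 1ℚ
      lem₁ = solve-∀ ring
      lem₂ : ∀ u d v e w → u * (d * v) * (e * w) ≡ u * ((d * e) * (w * v))
      lem₂ = solve-∀ ring

    2≤up^k : 2ℚ ≤ up ^ k
    2≤up^k = ℚ.≤-trans (ℚ.≤-reflexive (cong (1ℚ +_) (sym k*i))) (bernoulli {i} k Up.0≤α)

    private
      -- Each of the `Z` blocks gains one factor `up⁻¹` by `mixed`, and `k` such factors pay for one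
      -- factor `2`.
      combine : ∀ j Z W → j ℕ.≤ k → k ℕ.* W ℕ.≤ Z → down⁻¹ ^ (Z ℕ.* j) * (up⁻¹ ^ (Z ℕ.* (j ℕ.+ 4)) * 2ℚ ^ W) ≤ 1ℚ
      combine j Z W j≤k kW≤Z = begin
        down⁻¹ ^ (Z ℕ.* j) * (up⁻¹ ^ (Z ℕ.* (j ℕ.+ 4)) * 2ℚ ^ W)
          ≡⟨ ℚ.*-assoc (down⁻¹ ^ (Z ℕ.* j)) _ _ ⟨
        down⁻¹ ^ (Z ℕ.* j) * up⁻¹ ^ (Z ℕ.* (j ℕ.+ 4)) * 2ℚ ^ W
          ≡⟨ cong (_* 2ℚ ^ W) (trans (cong₂ _*_ (assoc′ down⁻¹ j) (assoc′ up⁻¹ (j ℕ.+ 4))) (sym (^-distrib-* (down⁻¹ ^ j) (up⁻¹ ^ (j ℕ.+ 4)) Z))) ⟩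
        (down⁻¹ ^ j * up⁻¹ ^ (j ℕ.+ 4)) ^ Z * 2ℚ ^ W
          ≤⟨ *-mono (0≤^ W Two.0≤α) (0≤^ Z Up.0≤a)
               (^-mono Z (0≤* (0≤^ j 0≤down⁻¹) (0≤^ (j ℕ.+ 4) Up.0≤a)) (mixed j j≤k)) (^-mono W Two.0≤α 2≤up^k) ⟩
        up⁻¹ ^ Z * (up ^ k) ^ W
          ≡⟨ trans (ℚ.*-comm (up⁻¹ ^ Z) _) (cong (_* up⁻¹ ^ Z) (^-assocʳ up k W)) ⟩
        up ^ (k ℕ.* W) * up⁻¹ ^ Z
          ≤⟨ Up.α^*a^≤1 kW≤Z ⟩
        1ℚ ∎
        where
        open ℚ.≤-Reasoning
        assoc′ : ∀ x j → x ^ (Z ℕ.* j) ≡ (x ^ j) ^ Z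
        assoc′ x j = trans (cong (x ^_) (ℕ.*-comm Z j)) (sym (^-assocʳ x j Z))

    module _ {n m : ℕ} (S : Fin n → Bool) (t w : ℕ) (2≤n : 2 ℕ.≤ n) (m≤N : m ℕ.≤ n C 2) where

      private
        N Y : ℕ
        N = n C 2
        Y = size S ℕ.* size (not ∘ S)

      -- Since `S` is at most half of the vertices, twice its internal pairs number at most `Y`. The
      -- threshold `t` is `(1 + 4/k) m Y / (2 N)` or more, and `lam = 1 + 1/k` detects the excess.
      few-internal-half : 2 ℕ.* size S ℕ.≤ n → m ℕ.* Y ℕ.* (k ℕ.+ 4) ℕ.≤ t ℕ.* N ℕ.* (2 ℕ.* k) →
        k ℕ.* (w ℕ.* N ℕ.* (2 ℕ.* k)) ℕ.≤ m ℕ.* Y →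
        FailsWithin (process n) (½ ^ w) (λ Gs → present (internal S) (at Gs m) ℕ.< t)
      few-internal-half half ht hw = weaken
        (Two.move w (ℚ.≤-trans (ℚ.≤-reflexive (ℚ.*-assoc (c ^ f) _ _))
          (root N (2 ℕ.* k) f (1≤C2 2≤n) (ℕ.≤-trans 1≤k (ℕ.m≤n*m k 2)) 0≤c (0≤* (0≤^ t Up.0≤a) (0≤^ w Two.0≤α)) c≤ final)))
        (λ Gs h → h)
        (few (internal S) m≤N inverse-up t)
        where
        open ℚ.≤-Reasoning
        f : ℕ
        f = pairs (internal S)
        c : ℚ
        c = rate up m N
        0≤c : 0ℚ ≤ c
        0≤c = 0≤rate Up.0≤α m≤N
        c≤ : c ^ N ≤ down⁻¹ ^ m
        c≤ = move-power m 0≤down⁻¹ (trans (ℚ.*-comm down down⁻¹) down⁻¹*down)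
          (rate-compound {x = i} m (1≤C2 2≤n) m≤N Up.0≤α (lem i (# m)) i≤1)
          where
          lem : ∀ i m → ((1ℚ + i) - 1ℚ) * m ≡ m * i
          lem = solve-∀ ring
        2f≤Y : 2 ℕ.* f ℕ.≤ Y
        2f≤Y = ℕ.≤-trans (ℕ.≤-trans (ℕ.m≤m+n (2 ℕ.* f) (size S)) (ℕ.≤-reflexive (internal-pairs S)))
          (ℕ.*-monoʳ-≤ (size S) (ℕ.+-cancelˡ-≤ (size S) _ _ (ℕ.≤-trans (ℕ.≤-reflexive (lem (size S))) (ℕ.≤-trans half (ℕ.≤-reflexive (sym (size-not S)))))))
          where
          lem : ∀ s → s ℕ.+ s ≡ 2 ℕ.* s
          lem = ℕ-Solver.solve-∀
        final : ((down⁻¹ ^ m) ^ f * (up⁻¹ ^ t * 2ℚ ^ w) ^ N) ^ (2 ℕ.* k) ≤ 1ℚ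
        final = begin
          ((down⁻¹ ^ m) ^ f * (up⁻¹ ^ t * 2ℚ ^ w) ^ N) ^ (2 ℕ.* k)
            ≡⟨ flatten down⁻¹ up⁻¹ 2ℚ m f t w N (2 ℕ.* k) ⟩
          down⁻¹ ^ (m ℕ.* f ℕ.* (2 ℕ.* k)) * (up⁻¹ ^ (t ℕ.* N ℕ.* (2 ℕ.* k)) * 2ℚ ^ W)
            ≤⟨ *-mono (0≤* (0≤^ (t ℕ.* N ℕ.* (2 ℕ.* k)) Up.0≤a) (0≤^ W Two.0≤α)) (0≤^ (m ℕ.* Y ℕ.* k) 0≤down⁻¹)
                 (^-mono-exp Down.1≤α (ℕ.≤-trans (ℕ.≤-reflexive (lem m f k)) (ℕ.*-monoˡ-≤ k (ℕ.*-monoʳ-≤ m 2f≤Y))))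
                 (*-monoʳ (2ℚ ^ W) (0≤^ W Two.0≤α) (^-anti-exp Up.0≤a Up.a≤1 ht)) ⟩
          down⁻¹ ^ (m ℕ.* Y ℕ.* k) * (up⁻¹ ^ (m ℕ.* Y ℕ.* (k ℕ.+ 4)) * 2ℚ ^ W)
            ≤⟨ combine k (m ℕ.* Y) W ℕ.≤-refl hw ⟩
          1ℚ ∎
          where
          W : ℕ
          W = w ℕ.* N ℕ.* (2 ℕ.* k)
          lem : ∀ m f k → m ℕ.* f ℕ.* (2 ℕ.* k) ≡ m ℕ.* (2 ℕ.* f) ℕ.* k
          lem = ℕ-Solver.solve-∀

      -- The mirror image with `lam = 1 − 1/k`: the threshold is at most `(1 − 4/k)` times the mean
      -- `m Y / N`, and `combine` is applied with `j = k ∸ 4`.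
      many-cut : t ℕ.* N ℕ.* k ℕ.≤ m ℕ.* Y ℕ.* (k ∸ 4) → k ℕ.* (w ℕ.* N ℕ.* k) ℕ.≤ m ℕ.* Y →
        FailsWithin (process n) (½ ^ w) (λ Gs → t ℕ.< present (cut S) (at Gs m))
      many-cut ht hw = weaken
        (Two.move w (ℚ.≤-trans (ℚ.≤-reflexive (ℚ.*-assoc (c ^ f) _ _))
          (root N k f (1≤C2 2≤n) 1≤k 0≤c (0≤* (0≤^ t 0≤down⁻¹) (0≤^ w Two.0≤α)) c≤ final)))
        (λ Gs h → h)
        (many (cut S) m≤N inverse-down t)
        where
        open ℚ.≤-Reasoning
        f W : ℕ
        f = pairs (cut S)
        W = w ℕ.* N ℕ.* k
        c : ℚ
        c = rate down m N
        0≤c : 0ℚ ≤ c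
        0≤c = 0≤rate Down.0≤a m≤N
        c≤ : c ^ N ≤ up⁻¹ ^ m
        c≤ = Up.move m (subst (λ z → c ^ N * z ^ m ≤ 1ℚ) (lem′ i)
          (rate-compound {x = - i} m (1≤C2 2≤n) m≤N Down.0≤a (lem i (# m)) (ℚ.≤-trans (ℚ.neg-antimono-≤ 0≤i) 0≤1)))
          where
          lem : ∀ i m → ((1ℚ - i) - 1ℚ) * m ≡ m * (- i)
          lem = solve-∀ ring
          lem′ : ∀ i → 1ℚ - (- i) ≡ 1ℚ + i
          lem′ = solve-∀ ring
        4+ : k ∸ 4 ℕ.+ 4 ≡ k
        4+ = ℕ.m∸n+n≡m (ℕ.≤-trans (ℕ.n≤1+n 4) 5≤k)
        final : ((up⁻¹ ^ m) ^ f * (down⁻¹ ^ t * 2ℚ ^ w) ^ N) ^ k ≤ 1ℚ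
        final = begin
          ((up⁻¹ ^ m) ^ f * (down⁻¹ ^ t * 2ℚ ^ w) ^ N) ^ k
            ≡⟨ flatten up⁻¹ down⁻¹ 2ℚ m f t w N k ⟩
          up⁻¹ ^ (m ℕ.* f ℕ.* k) * (down⁻¹ ^ (t ℕ.* N ℕ.* k) * 2ℚ ^ W)
            ≡⟨ lem (up⁻¹ ^ (m ℕ.* f ℕ.* k)) (down⁻¹ ^ (t ℕ.* N ℕ.* k)) (2ℚ ^ W) ⟩
          down⁻¹ ^ (t ℕ.* N ℕ.* k) * (up⁻¹ ^ (m ℕ.* f ℕ.* k) * 2ℚ ^ W)
            ≤⟨ *-monoʳ _ (0≤* (0≤^ (m ℕ.* f ℕ.* k) Up.0≤a) (0≤^ W Two.0≤α)) (^-mono-exp Down.1≤α ht) ⟩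
          down⁻¹ ^ (m ℕ.* Y ℕ.* (k ∸ 4)) * (up⁻¹ ^ (m ℕ.* f ℕ.* k) * 2ℚ ^ W)
            ≡⟨ cong (λ z → down⁻¹ ^ (m ℕ.* Y ℕ.* (k ∸ 4)) * (up⁻¹ ^ z * 2ℚ ^ W)) (cong₂ (λ x y → m ℕ.* x ℕ.* y) (cut-pairs S) (sym 4+)) ⟩
          down⁻¹ ^ (m ℕ.* Y ℕ.* (k ∸ 4)) * (up⁻¹ ^ (m ℕ.* Y ℕ.* (k ∸ 4 ℕ.+ 4)) * 2ℚ ^ W)
            ≤⟨ combine (k ∸ 4) (m ℕ.* Y) W (ℕ.m∸n≤m k 4) hw ⟩
          1ℚ ∎
          where
          lem : ∀ a b c → a * (b * c) ≡ b * (a * c)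
          lem = solve-∀ ring

  among : Fin n → Fin n → Fin n → Fin n → Bool
  among a b d v = does (a Fin.≟ v) ∨ (does (b Fin.≟ v) ∨ does (d Fin.≟ v))

  among-sum : {a b d : Fin n} → a ≢ b → a ≢ d → b ≢ d → (h : Fin n → ℕ) →
              sum (λ v → 𝟙 (among a b d v) ℕ.* h v) ≡ h a ℕ.+ (h b ℕ.+ h d)
  among-sum {n} {a} {b} {d} a≢b a≢d b≢d h = begin
    sum (λ v → 𝟙 (among a b d v) ℕ.* h v)
      ≡⟨ sum-cong-≗ (λ v → trans (cong (ℕ._* h v) (split v)) (trans (ℕ.*-distribʳ-+ (h v) (is a v) _) (cong (is a v ℕ.* h v ℕ.+_) (ℕ.*-distribʳ-+ (h v) (is b v) (is d v))))) ⟩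
    sum (λ v → is a v ℕ.* h v ℕ.+ (is b v ℕ.* h v ℕ.+ is d v ℕ.* h v))
      ≡⟨ trans (∑-distrib-+ (λ v → is a v ℕ.* h v) (λ v → is b v ℕ.* h v ℕ.+ is d v ℕ.* h v))
           (cong (sum (λ v → is a v ℕ.* h v) ℕ.+_) (∑-distrib-+ (λ v → is b v ℕ.* h v) (λ v → is d v ℕ.* h v))) ⟩
    sum (λ v → is a v ℕ.* h v) ℕ.+ (sum (λ v → is b v ℕ.* h v) ℕ.+ sum (λ v → is d v ℕ.* h v))
      ≡⟨ cong₂ ℕ._+_ (sum-δ a h) (cong₂ ℕ._+_ (sum-δ b h) (sum-δ d h)) ⟩
    h a ℕ.+ (h b ℕ.+ h d) ∎
    where
    open ≡-Reasoning
    is : Fin n → Fin n → ℕ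
    is x v = 𝟙 (does (x Fin.≟ v))
    split : ∀ v → 𝟙 (among a b d v) ≡ is a v ℕ.+ (is b v ℕ.+ is d v)
    split v with a Fin.≟ v | b Fin.≟ v | d Fin.≟ v
    ... | yes refl | yes refl | _        = contradiction refl a≢b
    ... | yes refl | no _     | yes refl = contradiction refl a≢d
    ... | yes refl | no _     | no _     = refl
    ... | no _     | yes refl | yes refl = contradiction refl b≢d
    ... | no _     | yes refl | no _     = refl
    ... | no _     | no _     | yes refl = refl
    ... | no _     | no _     | no _     = refl

  -- Removing `x` covers the case in which the centre is itself one of the three low vertices.
  star : Fin n → (Fin n → Bool) → Pairs n
  star x P u v = (does (x Fin.≟ u) ∧ remove x P v) ∨ (does (x Fin.≟ v) ∧ remove x P u)

  star-pairs : (x : Fin n) (P : Fin n → Bool) (g : Pairs n) → (∀ u v → g u v ≡ g v u) →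
               pairs (λ u v → star x P u v ∧ g u v) ≡ size (λ v → remove x P v ∧ g x v)
  star-pairs {n} x P g gsym = begin
    pairs (λ u v → star x P u v ∧ g u v)
      ≡⟨ sum²-cong (λ u v → lt-cong u v (λ u<v → one u v u<v)) ⟩
    sum (λ u → sum (λ v → lt u v ℕ.* (𝟙 (r u v) ℕ.+ 𝟙 (r v u))))
      ≡⟨ ordered≡pairs r irr ⟨
    sum (λ u → sum (λ v → 𝟙 (r u v)))
      ≡⟨ sum-cong-≗ (λ u → trans (sum-cong-≗ (λ v → 𝟙-∧ (does (x Fin.≟ u)) (remove x P v ∧ g u v))) (sym (*-distribˡ-sum (𝟙 (does (x Fin.≟ u))) (λ v → 𝟙 (remove x P v ∧ g u v))))) ⟩
    sum (λ u → 𝟙 (does (x Fin.≟ u)) ℕ.* sum (λ v → 𝟙 (remove x P v ∧ g u v)))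
      ≡⟨ sum-δ x (λ u → sum (λ v → 𝟙 (remove x P v ∧ g u v))) ⟩
    size (λ v → remove x P v ∧ g x v) ∎
    where
    open ≡-Reasoning
    r : Pairs n
    r u v = does (x Fin.≟ u) ∧ (remove x P v ∧ g u v)
    irr : ∀ u → r u u ≡ false
    irr u = bool (does (x Fin.≟ u)) (P u) (g u u)
      where
      bool : ∀ d p y → d ∧ ((p ∧ not d) ∧ y) ≡ false
      bool true  true  y = refl
      bool true  false y = refl
      bool false _     y = refl
    one : ∀ u v → u Fin.< v → 𝟙 (star x P u v ∧ g u v) ≡ 𝟙 (r u v) ℕ.+ 𝟙 (r v u)
    one u v u<v = trans (bool (does (x Fin.≟ u)) (does (x Fin.≟ v)) (P u) (P v) (g u v) disjoint)
        (cong (λ z → 𝟙 (r u v) ℕ.+ 𝟙 (does (x Fin.≟ v) ∧ (remove x P u ∧ z))) (gsym u v))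
      where
      disjoint : does (x Fin.≟ u) ∧ does (x Fin.≟ v) ≡ false
      disjoint with x Fin.≟ u | x Fin.≟ v
      ... | yes refl | yes refl = contradiction u<v (ℕ.<-irrefl refl)
      ... | yes _    | no _     = refl
      ... | no _     | _        = refl
      bool : ∀ d e p q y → d ∧ e ≡ false →
             𝟙 (((d ∧ (q ∧ not e)) ∨ (e ∧ (p ∧ not d))) ∧ y) ≡ 𝟙 (d ∧ ((q ∧ not e) ∧ y)) ℕ.+ 𝟙 (e ∧ ((p ∧ not d) ∧ y))
      bool true  false p true  true  _ = refl
      bool true  false p true  false _ = refl
      bool true  false p false y     _ = refl
      bool false true  true  q true  _ = refl
      bool false true  true  q false _ = refl
      bool false true  false q y     _ = refl
      bool false false p q y _ = refl

  module Cluster (q : ℕ) (2≤q : 2 ℕ.≤ q) where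

    i b b⁻¹ : ℚ
    i = inv q
    b = 1ℚ + i * i
    b⁻¹ = # (q ℕ.* q) * inv (suc (q ℕ.* q))

    private
      1≤q : 1 ℕ.≤ q
      1≤q = ℕ.≤-trans (s≤s z≤n) 2≤q

      0≤i : 0ℚ ≤ i
      0≤i = 0≤inv q

      q*i : # q * i ≡ 1ℚ
      q*i = #*inv′ 1≤q

    inverse-q : Inverse (# q) i
    inverse-q = record { 1≤α = #-mono 1≤q ; 0≤a = 0≤i ; α*a = q*i }

    inverse-b : Inverse b b⁻¹
    inverse-b = record { 1≤α = ≤-by (i * i) (0≤* 0≤i 0≤i) refl ; 0≤a = 0≤* (0≤# (q ℕ.* q)) (0≤inv (suc (q ℕ.* q))) ; α*a = eq }
      where
      lem : ∀ q i j → (1ℚ + i * i) * (q * q * j) ≡ (q * q + (q * i) * (q * i)) * j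
      lem = solve-∀ ring
      eq : b * b⁻¹ ≡ 1ℚ
      eq = trans (cong (λ z → b * (z * inv (suc (q ℕ.* q)))) (#-* q q)) (trans (lem (# q) i (inv (suc (q ℕ.* q))))
        (trans (cong₂ (λ u v → (u + v * v) * inv (suc (q ℕ.* q))) (sym (#-* q q)) q*i)
          (trans (cong (_* inv (suc (q ℕ.* q))) (trans (ℚ.+-comm (# (q ℕ.* q)) 1ℚ) (sym (#-suc (q ℕ.* q))))) (#*inv (q ℕ.* q)))))

    module Q = Inverse inverse-q
    module B = Inverse inverse-b

    -- For `lam = 1/q` one has `(1 − lam) m = (q² − q) m / q²`, so `compound` gives a power of
    -- `b = 1 + 1/q²`, the base in which `n` itself is measured.
    rate-low : ∀ {n m} f E → 2 ℕ.≤ n → m ℕ.≤ n C 2 → E ℕ.* (n C 2) ℕ.≤ (q ℕ.* q ∸ q) ℕ.* m ℕ.* f →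
               rate i m (n C 2) ^ f ≤ b⁻¹ ^ E
    rate-low {n} {m} f E 2≤n m≤N hyp = B.move E (root {s = b ^ E} N 1 f (1≤C2 2≤n) (s≤s z≤n) (0≤rate 0≤i m≤N) (0≤^ E B.0≤α) c≤ (begin
        ((b⁻¹ ^ m′) ^ f * (b ^ E) ^ N) ^ 1  ≡⟨ ℚ.*-identityʳ _ ⟩
        (b⁻¹ ^ m′) ^ f * (b ^ E) ^ N        ≡⟨ cong₂ _*_ (^-assocʳ b⁻¹ m′ f) (^-assocʳ b E N) ⟩
        b⁻¹ ^ (m′ ℕ.* f) * b ^ (E ℕ.* N)    ≡⟨ ℚ.*-comm (b⁻¹ ^ (m′ ℕ.* f)) _ ⟩
        b ^ (E ℕ.* N) * b⁻¹ ^ (m′ ℕ.* f)    ≤⟨ B.α^*a^≤1 hyp ⟩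
        1ℚ                                  ∎))
      where
      open ℚ.≤-Reasoning
      N m′ : ℕ
      N = n C 2
      m′ = (q ℕ.* q ∸ q) ℕ.* m
      c≤ : rate i m N ^ N ≤ b⁻¹ ^ m′
      c≤ = B.move m′ (subst (λ z → rate i m N ^ N * z ^ m′ ≤ 1ℚ) (lem′ i)
        (rate-compound {x = - (i * i)} m′ (1≤C2 2≤n) m≤N 0≤i exact (ℚ.≤-trans (ℚ.neg-antimono-≤ (0≤* 0≤i 0≤i)) 0≤1)))
        where
        lem′ : ∀ i → 1ℚ - (- (i * i)) ≡ 1ℚ + i * i
        lem′ = solve-∀ ring
        lem : ∀ q i m → ((q * q - q) * m) * (- (i * i)) ≡ ((q * i) * i - (q * i) * (q * i)) * m
        lem = solve-∀ ring
        exact : (i - 1ℚ) * # m ≡ # m′ * (- (i * i))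
        exact = sym (trans (cong (_* (- (i * i))) (trans (#-* (q ℕ.* q ∸ q) m) (cong (_* # m) (trans (#-∸ (ℕ.m≤n*m q q {{ℕ.>-nonZero 1≤q}})) (cong (_- # q) (#-* q q))))))
          (trans (lem (# q) i (# m)) (cong (_* # m) (trans (cong₂ (λ u v → u * i - v * v) q*i q*i) (cong (_- 1ℚ * 1ℚ) (ℚ.*-identityˡ i))))))

    -- Three degrees of at most `D` leave at most `3 D` edges in the cut `F` of the three vertices;
    -- with `lam = 1/q` this costs the factor `q^(3 D)`. The exponent of `m₁ β` is the number of
    -- edges that `x` must have, three or, if `x` is one of the vertices, two.
    no-cluster : ∀ {n m₀ m₁} (β : ℚ) (D E : ℕ) (x a c d : Fin n) → a ≢ c → a ≢ d → c ≢ d → 2 ℕ.≤ n →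
      0ℚ ≤ β → m₀ ℕ.≤ m₁ → m₁ ℕ.≤ n C 2 → # m₁ * β ≤ 1ℚ → 2ℚ ≤ # (n C 2 ∸ m₁) * β →
      6 ℕ.* n ℕ.≤ n C 2 ∸ m₁ → E ℕ.* (n C 2) ℕ.≤ (q ℕ.* q ∸ q) ℕ.* m₀ ℕ.* (3 ℕ.* (n ∸ 3)) →
      FailsWithin (process n) (# q ^ (3 ℕ.* D) * (b⁻¹ ^ E * (# m₁ * β) ^ size (remove x (among a c d))))
        (λ Gs → deg (at Gs m₀) a ℕ.≤ D → deg (at Gs m₀) c ℕ.≤ D → deg (at Gs m₀) d ℕ.≤ D →
                (∀ v → remove x (among a c d) v ≡ true → adj (at Gs m₁) x v ≡ true) → ⊥)
    no-cluster {n} {m₀} {m₁} β D E x a c d a≢c a≢d c≢d 2≤n 0≤β m₀≤m₁ m₁≤N m₁β≤1 2≤Nβ 6n≤ hyp = certificate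
      (λ Gs → # q ^ (3 ℕ.* D) * (i ^ present F (at Gs m₀) * 0ℚ ^ absent R (at Gs m₁)))
      (λ Gs → 0≤* (0≤^ (3 ℕ.* D) Q.0≤α) (0≤* (0≤^ (present F (at Gs m₀)) 0≤i) (0≤^ (absent R (at Gs m₁)) ℚ.≤-refl)))
      (λ Gs h da dc dd all → ℚ.<-irrefl refl (ℚ.<-≤-trans h (ℚ.≤-trans (Q.1≤α^*a^ (X≤ (at Gs m₀) da dc dd))
        (ℚ.≤-reflexive (cong (# q ^ (3 ℕ.* D) *_) (trans (sym (ℚ.*-identityʳ _))
          (cong (λ z → i ^ present F (at Gs m₀) * 0ℚ ^ z) (sym (none (at Gs m₁) all)))))))))
      (ℚ.≤-trans (ℚ.≤-reflexive (𝔼-* (# q ^ (3 ℕ.* D)) (process n) (λ Gs → i ^ present F (at Gs m₀) * 0ℚ ^ absent R (at Gs m₁))))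
        (*-monoˡ _ (0≤^ (3 ℕ.* D) Q.0≤α) (ℚ.≤-trans
          (few-then-all F R i β 0≤i Q.a≤1 0≤β m₀≤m₁ m₁≤N m₁β≤1 2≤Nβ small)
          (ℚ.≤-trans (*-monoʳ _ (0≤^ (pairs R) (0≤* (0≤# m₁) 0≤β))
            (rate-low (pairs F) E 2≤n (ℕ.≤-trans m₀≤m₁ m₁≤N) (subst (λ z → E ℕ.* (n C 2) ℕ.≤ (q ℕ.* q ∸ q) ℕ.* m₀ ℕ.* z) (sym F≡) hyp)))
            (ℚ.≤-reflexive (cong (λ z → b⁻¹ ^ E * (# m₁ * β) ^ z) R≡))))))
      where
      P : Fin n → Bool
      P = among a c d
      F R : Pairs n
      F = cut P
      R = star x P
      size-P : size P ≡ 3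
      size-P = trans (sum-cong-≗ (λ v → sym (ℕ.*-identityʳ (𝟙 (P v))))) (among-sum a≢c a≢d c≢d (λ _ → 1))
      F≡ : pairs F ≡ 3 ℕ.* (n ∸ 3)
      F≡ = trans (cut-pairs P) (cong₂ ℕ._*_ size-P (trans (sym (ℕ.m+n∸m≡n 3 _))
        (cong (_∸ 3) (trans (cong (ℕ._+ size (not ∘ P)) (sym size-P)) (size-not P)))))
      R≡ : pairs R ≡ size (remove x P)
      R≡ = trans (pairs-cong (λ u v _ → sym (∧-true (R u v)))) (trans (star-pairs x P (λ _ _ → true) (λ _ _ → refl))
        (sum-cong-≗ (λ v → cong 𝟙 (∧-true (remove x P v)))))
      small : 2 ℕ.* pairs F ℕ.≤ n C 2 ∸ m₁
      small = ℕ.≤-trans (ℕ.≤-trans (ℕ.≤-reflexive (trans (cong (2 ℕ.*_) F≡) (sym (ℕ.*-assoc 2 3 (n ∸ 3)))))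
        (ℕ.*-monoʳ-≤ 6 (ℕ.m∸n≤m n 3))) 6n≤
      none : ∀ G → (∀ v → remove x P v ≡ true → adj G x v ≡ true) → absent R G ≡ 0
      none G all = trans (star-pairs x P (λ u v → not (adj G u v)) (λ u v → cong not (symmetric G u v)))
        (trans (sum-cong-≗ (λ v → zero-if (remove x P v) (adj G x v) (all v))) (sum-zero n))
        where
        zero-if : ∀ p y → (p ≡ true → y ≡ true) → 𝟙 (p ∧ not y) ≡ 0
        zero-if true  y h = cong (𝟙 ∘ not) (h refl)
        zero-if false y _ = refl
      X≤ : ∀ G → deg G a ℕ.≤ D → deg G c ℕ.≤ D → deg G d ℕ.≤ D → present F G ℕ.≤ 3 ℕ.* D
      X≤ G da dc dd = ℕ.≤-trans (ℕ.≤-reflexive (trans (sym (cut-present G P)) (among-sum a≢c a≢d c≢d (λ v → nb G v (not ∘ P)))))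
        (ℕ.≤-trans (ℕ.+-mono-≤ (nb≤ a da) (ℕ.+-mono-≤ (nb≤ c dc) (nb≤ d dd))) (ℕ.≤-reflexive (cong (λ z → D ℕ.+ (D ℕ.+ z)) (sym (ℕ.+-identityʳ D)))))
        where
        nb≤ : ∀ v → deg G v ℕ.≤ D → nb G v (not ∘ P) ℕ.≤ D
        nb≤ v h = ℕ.≤-trans (ℕ.≤-trans (ℕ.m≤n+m _ (nb G v P)) (ℕ.≤-reflexive (sym (deg≡nb G v P)))) h

-- Translating the hypotheses on reals into inequalities between integers.

module Logarithm where

  open import Defs using (ℝ; seq; _≤ᴿ_; _+ᴿ_; _-ᴿ_; _*ᴿ_; fromℚ; fromℕ; log; mercator)
  open Rationals
  open Tails
  open TailEvents
  open import Data.Nat.Base using (ℕ; zero; suc; _⊔_; z≤n; s≤s; s≤s⁻¹)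
  open import Data.Rational.Base using (ℚ; 0ℚ; 1ℚ; ½; _/_; mkℚ; toℚᵘ; _+_; _*_; _-_; -_; _≤_; _<_)
  open import Data.Rational.Unnormalised.Base using (mkℚᵘ)
  open import Tactic.RingSolver using (solve-∀)

  archimedean : ∀ {ε} → 0ℚ < ε → ∃[ M ] (1 ℕ.≤ M × 1ℚ ≤ # M * ε)
  archimedean {ε@(mkℚ (ℤ.+ suc a) d _)} _ = suc d , s≤s z≤n , subst (1ℚ ≤_) (sym eq) (1≤# a)
    where
    open import Relation.Binary.Reasoning.Setoid ℚᵘ.≃-setoid
    eq : # (suc d) * ε ≡ # (suc a)
    eq = ℚ.toℚᵘ-injective (begin
      toℚᵘ (# (suc d) * ε)                ≈⟨ ℚ.toℚᵘ-homo-* (# (suc d)) ε ⟩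
      toℚᵘ (# (suc d)) ℚᵘ.* mkℚᵘ (ℤ.+ suc a) d ≈⟨ ℚᵘ.*-congʳ {mkℚᵘ (ℤ.+ suc a) d} (ℚ.toℚᵘ-fromℚᵘ (mkℚᵘ (ℤ.+ suc d) 0)) ⟩
      mkℚᵘ (ℤ.+ suc d) 0 ℚᵘ.* mkℚᵘ (ℤ.+ suc a) d ≈⟨ ℚᵘ.*≡* (trans (ℤ.*-identityʳ _) (trans (ℤ.*-comm (ℤ.+ suc d) (ℤ.+ suc a))
                                                    (cong (λ z → ℤ.+ suc a ℤ.* ℤ.+ suc z) (sym (ℕ.+-identityʳ d))))) ⟩
      mkℚᵘ (ℤ.+ suc a) 0                  ≈⟨ ℚ.toℚᵘ-fromℚᵘ (mkℚᵘ (ℤ.+ suc a) 0) ⟨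
      toℚᵘ (# (suc a))                    ∎)
  archimedean {mkℚ (ℤ.+ zero) d _}   0<ε = ⊥-elim (ℤ.<-irrefl refl (ℚ.drop-*<* 0<ε))
  archimedean {mkℚ ℤ.-[1+ a ] d _}   0<ε with ℚ.drop-*<* 0<ε
  ... | ()

  mercator-mono : ∀ {s t} k → 0ℚ ≤ s → s ≤ t → mercator s k ≤ mercator t k
  mercator-mono zero    0≤s s≤t = ℚ.≤-refl
  mercator-mono (suc k) 0≤s s≤t = ℚ.+-mono-≤ (mercator-mono k 0≤s s≤t) (*-monoʳ (inv (suc k)) (0≤inv (suc k)) (^-mono (suc k) 0≤s s≤t))

  -- log 1/(1 − b) ≥ log 1/(1 − a) + z if 1 − b = (1 − z)(1 − a), up to the error a^k
  -- from the truncation of the series.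
  mercator-step : ∀ {a z} k → 0ℚ ≤ a → a ≤ 1ℚ → 0ℚ ≤ z →
                  mercator a k + z * (1ℚ - a ^ k) ≤ mercator (a + z * (1ℚ - a)) k
  mercator-step {a} {z} zero 0≤a a≤1 0≤z = ℚ.≤-reflexive (lem z)
    where
    lem : ∀ z → 0ℚ + z * (1ℚ - 1ℚ) ≡ 0ℚ
    lem = solve-∀ ring
  mercator-step {a} {z} (suc k) 0≤a a≤1 0≤z = begin
    (mercator a k + a ^ suc k * r) + z * (1ℚ - a ^ suc k)
      ≡⟨ lem₁ (mercator a k) a (a ^ k) r z ⟩
    (mercator a k + z * (1ℚ - a ^ k)) + (a ^ suc k * r + 1ℚ * (z * (1ℚ - a) * a ^ k))
      ≤⟨ ℚ.+-mono-≤ (mercator-step k 0≤a a≤1 0≤z) gain ⟩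
    mercator b k + b ^ suc k * r ∎
    where
    open ℚ.≤-Reasoning
    r b : ℚ
    r = inv (suc k)
    b = a + z * (1ℚ - a)
    0≤b : 0ℚ ≤ b
    0≤b = 0≤+ 0≤a (0≤* 0≤z (0≤-diff a≤1))
    lem₁ : ∀ m a p r z → (m + a * p * r) + z * (1ℚ - a * p) ≡ (m + z * (1ℚ - p)) + (a * p * r + 1ℚ * (z * (1ℚ - a) * p))
    lem₁ = solve-∀ ring
    lem₂ : ∀ a p r z n → r * ((1ℚ + n) * (a + z * (1ℚ - a)) * p - n * (a * p)) ≡ a * p * r + ((1ℚ + n) * r) * (z * (1ℚ - a) * p)
    lem₂ = solve-∀ ring
    lem₃ : ∀ x y → x + y - y ≡ x
    lem₃ = solve-∀ ring
    gain : a ^ suc k * r + 1ℚ * (z * (1ℚ - a) * a ^ k) ≤ b ^ suc k * r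
    gain = begin
      a ^ suc k * r + 1ℚ * (z * (1ℚ - a) * a ^ k)
        ≡⟨ cong (λ x → a ^ suc k * r + x * (z * (1ℚ - a) * a ^ k)) (trans (cong (_* r) (sym (#-suc k))) (#*inv k)) ⟨
      a ^ suc k * r + ((1ℚ + # k) * r) * (z * (1ℚ - a) * a ^ k)
        ≡⟨ lem₂ a (a ^ k) r z (# k) ⟨
      r * ((1ℚ + # k) * b * a ^ k - # k * a ^ suc k)
        ≡⟨ cong (λ x → r * (x * b * a ^ k - # k * a ^ suc k)) (#-suc k) ⟨
      r * (# (suc k) * b * a ^ k - # k * a ^ suc k)
        ≤⟨ *-monoˡ r (0≤inv (suc k)) (ℚ.≤-trans (ℚ.+-monoˡ-≤ (- (# k * a ^ suc k)) (^-tangent k 0≤b 0≤a)) (ℚ.≤-reflexive (lem₃ (b ^ suc k) (# k * a ^ suc k)))) ⟩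
      r * b ^ suc k
        ≡⟨ ℚ.*-comm r _ ⟩
      b ^ suc k * r ∎

  -- Along the points `1 − (1 − z)^j` each step multiplies the distance to `1` by `1 − z` and adds
  -- at least `z` to the logarithm, up to a truncation error that `t ^ k` bounds uniformly.
  -- Telescoping gives `l` such gains.
  mercator-lower : ∀ {t z} l k → 0ℚ ≤ z → z ≤ 1ℚ → t ≤ 1ℚ → 1ℚ - (1ℚ - z) ^ l ≤ t →
                   # l * (z * (1ℚ - t ^ k)) ≤ mercator t k
  mercator-lower {t} {z} l k 0≤z z≤1 t≤1 h = ℚ.≤-trans (go l h) (mercator-mono k (0≤a l) h)
    where
    open ℚ.≤-Reasoning
    a : ℕ → ℚ
    a j = 1ℚ - (1ℚ - z) ^ j
    0≤1-z : 0ℚ ≤ 1ℚ - z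
    0≤1-z = 0≤-diff z≤1
    1-z≤1 : 1ℚ - z ≤ 1ℚ
    1-z≤1 = ≤-by z 0≤z (lem z)
      where
      lem : ∀ z → (1ℚ - z) + z ≡ 1ℚ
      lem = solve-∀ ring
    0≤a : ∀ j → 0ℚ ≤ a j
    0≤a j = 0≤-diff (^≤1 j 0≤1-z 1-z≤1)
    a≤1 : ∀ j → a j ≤ 1ℚ
    a≤1 j = ≤-by ((1ℚ - z) ^ j) (0≤^ j 0≤1-z) (lem ((1ℚ - z) ^ j))
      where
      lem : ∀ z → (1ℚ - z) + z ≡ 1ℚ
      lem = solve-∀ ring
    next : ∀ j → a (suc j) ≡ a j + z * (1ℚ - a j)
    next j = lem z ((1ℚ - z) ^ j)
      where
      lem : ∀ z p → 1ℚ - (1ℚ - z) * p ≡ (1ℚ - p) + z * (1ℚ - (1ℚ - p))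
      lem = solve-∀ ring
    a-mono : ∀ j → a j ≤ a (suc j)
    a-mono j = ≤-by (z * (1ℚ - a j)) (0≤* 0≤z (0≤-diff (a≤1 j))) (sym (next j))
    zero-mercator : ∀ k → mercator 0ℚ k ≡ 0ℚ
    zero-mercator zero    = refl
    zero-mercator (suc k) = trans (cong (_+ 0ℚ * p * inv (suc k)) (zero-mercator k)) (lem p (inv (suc k)))
      where
      p = 0ℚ ^ k
      lem : ∀ p r → 0ℚ + 0ℚ * p * r ≡ 0ℚ
      lem = solve-∀ ring
    go : ∀ j → a j ≤ t → # j * (z * (1ℚ - t ^ k)) ≤ mercator (a j) k
    go zero    _ = ℚ.≤-reflexive (trans (ℚ.*-zeroˡ (z * (1ℚ - t ^ k))) (sym (zero-mercator k)))
    go (suc j) h = begin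
      # (suc j) * (z * (1ℚ - t ^ k))
        ≡⟨ trans (cong (_* (z * (1ℚ - t ^ k))) (#-suc j)) (lem (# j) (z * (1ℚ - t ^ k))) ⟩
      # j * (z * (1ℚ - t ^ k)) + z * (1ℚ - t ^ k)
        ≤⟨ ℚ.+-mono-≤ (go j aj≤t) (*-monoˡ z 0≤z (ℚ.+-monoʳ-≤ 1ℚ (ℚ.neg-antimono-≤ (^-mono k (0≤a j) aj≤t)))) ⟩
      mercator (a j) k + z * (1ℚ - a j ^ k)
        ≤⟨ mercator-step k (0≤a j) (a≤1 j) 0≤z ⟩
      mercator (a j + z * (1ℚ - a j)) k
        ≡⟨ cong (λ x → mercator x k) (next j) ⟨
      mercator (a (suc j)) k ∎
      where
      lem : ∀ j y → (1ℚ + j) * y ≡ j * y + y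
      lem = solve-∀ ring
      aj≤t : a j ≤ t
      aj≤t = ℚ.≤-trans (a-mono j) h

  module _ (p : ℕ) where

    private
      r t : ℚ
      r = inv (suc p)
      t = 1ℚ - r

      r≤1 : r ≤ 1ℚ
      r≤1 = subst₂ _≤_ (ℚ.*-identityˡ r) (#*inv p) (*-monoʳ r (0≤inv (suc p)) (1≤# p))

    -- `(1 + r) (1 − r) ≤ 1`, so it suffices that `(1 + r)^k` reaches `q`, which it does by
    -- Bernoulli once `k r ≥ q`.
    geometric-small : ∀ q k → suc p ℕ.* q ℕ.≤ k → # q * t ^ k ≤ 1ℚ
    geometric-small q k h = begin
      # q * t ^ k              ≤⟨ *-monoʳ (t ^ k) (0≤^ k 0≤t) q≤ ⟩
      (1ℚ + r) ^ k * t ^ k     ≡⟨ ^-distrib-* (1ℚ + r) t k ⟨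
      ((1ℚ + r) * t) ^ k       ≤⟨ ^≤1 k (0≤* (0≤+ 0≤1 0≤r) 0≤t) (≤-by (r * r) (0≤* 0≤r 0≤r) (lem r)) ⟩
      1ℚ                       ∎
      where
      open ℚ.≤-Reasoning
      0≤r : 0ℚ ≤ r
      0≤r = 0≤inv (suc p)
      0≤t : 0ℚ ≤ t
      0≤t = 0≤-diff r≤1
      lem : ∀ r → (1ℚ + r) * (1ℚ - r) + r * r ≡ 1ℚ
      lem = solve-∀ ring
      lem₂ : ∀ n q r → (n * q) * r ≡ q * (n * r)
      lem₂ = solve-∀ ring
      q≤ : # q ≤ (1ℚ + r) ^ k
      q≤ = begin
        # q                    ≡⟨ ℚ.*-identityʳ (# q) ⟨
        # q * 1ℚ               ≡⟨ cong (# q *_) (#*inv p) ⟨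
        # q * (# (suc p) * r)  ≡⟨ lem₂ (# (suc p)) (# q) r ⟨
        (# (suc p) * # q) * r  ≡⟨ cong (_* r) (#-* (suc p) q) ⟨
        # (suc p ℕ.* q) * r    ≤⟨ *-monoʳ r 0≤r (#-mono h) ⟩
        # k * r                ≤⟨ ≤-by 1ℚ 0≤1 (ℚ.+-comm (# k * r) 1ℚ) ⟩
        1ℚ + # k * r           ≤⟨ bernoulli k (0≤+ 0≤1 0≤r) ⟩
        (1ℚ + r) ^ k           ∎

  module _ (q : ℕ) (4≤q : 4 ℕ.≤ q) where

    private
      2≤q : 2 ℕ.≤ q
      2≤q = ℕ.≤-trans (s≤s (s≤s z≤n)) 4≤q
      module C = Cluster q 2≤q
      i z : ℚ
      i = inv q
      z = inv (suc (q ℕ.* q))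

      q*i : # q * i ≡ 1ℚ
      q*i = #*inv′ (ℕ.≤-trans (s≤s z≤n) 2≤q)

      z*s : # (suc (q ℕ.* q)) * z ≡ 1ℚ
      z*s = #*inv (q ℕ.* q)

      0≤i : 0ℚ ≤ i
      0≤i = 0≤inv q

      0≤z : 0ℚ ≤ z
      0≤z = 0≤inv (suc (q ℕ.* q))

      b⁻¹≡ : 1ℚ - z ≡ C.b⁻¹
      b⁻¹≡ = trans (cong (_- z) (sym z*s)) (trans (cong (λ x → x * z - z) (#-suc (q ℕ.* q))) (lem (# (q ℕ.* q)) z))
        where
        lem : ∀ s z → (1ℚ + s) * z - z ≡ s * z
        lem = solve-∀ ring

      i≤1 : i ≤ 1ℚ
      i≤1 = subst₂ _≤_ (ℚ.*-identityˡ i) q*i (*-monoʳ i 0≤i (#-mono (ℕ.≤-trans (s≤s z≤n) 2≤q)))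

    -- As log n ≥ 3 q⁴ D z (1 − 1/q) for the truncated series, this says that
    -- (1 + 10/q) n log n / 6 ≥ (q² + 5 q) n D / 2.
    constant : # (q ℕ.* q ℕ.+ 5 ℕ.* q) ≤ (1ℚ + # 10 * i) * (# (q ℕ.* q ℕ.* (q ℕ.* q)) * (z * (1ℚ - i)))
    constant = begin
      # (q ℕ.* q ℕ.+ 5 ℕ.* q)                              ≡⟨ ℚ.*-identityʳ _ ⟨
      # (q ℕ.* q ℕ.+ 5 ℕ.* q) * 1ℚ                         ≡⟨ cong (# (q ℕ.* q ℕ.+ 5 ℕ.* q) *_) z*s ⟨
      # (q ℕ.* q ℕ.+ 5 ℕ.* q) * (# (suc (q ℕ.* q)) * z)    ≡⟨ ℚ.*-assoc (# (q ℕ.* q ℕ.+ 5 ℕ.* q)) _ z ⟨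
      # (q ℕ.* q ℕ.+ 5 ℕ.* q) * # (suc (q ℕ.* q)) * z      ≡⟨ cong (_* z) (#-* (q ℕ.* q ℕ.+ 5 ℕ.* q) (suc (q ℕ.* q))) ⟨
      # ((q ℕ.* q ℕ.+ 5 ℕ.* q) ℕ.* suc (q ℕ.* q)) * z      ≤⟨ *-monoʳ z 0≤z (≤-by# ((q ℕ.* q ℕ.+ 5 ℕ.* q) ℕ.* suc (q ℕ.* q)) (10 ℕ.* (q ℕ.* q)) nat) ⟩
      (# (q ℕ.* q ℕ.* (q ℕ.* q) ℕ.+ 9 ℕ.* (q ℕ.* (q ℕ.* q))) - # (10 ℕ.* (q ℕ.* q))) * z ≡⟨ cong (_* z) exact ⟩
      (1ℚ + # 10 * i) * (Q4 * (1ℚ - i)) * z                ≡⟨ lem₂ (# 10) i Q4 z ⟩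
      (1ℚ + # 10 * i) * (Q4 * (z * (1ℚ - i)))              ∎
      where
      open ℚ.≤-Reasoning
      Q4 : ℚ
      Q4 = # (q ℕ.* q ℕ.* (q ℕ.* q))
      lem₂ : ∀ t i Q z → (1ℚ + t * i) * (Q * (1ℚ - i)) * z ≡ (1ℚ + t * i) * (Q * (z * (1ℚ - i)))
      lem₂ = solve-∀ ring
      ≤-by# : ∀ a {b} c → a ℕ.+ c ℕ.≤ b → # a ≤ # b - # c
      ≤-by# a {b} c h = subst (_≤ # b - # c) (trans (cong (_- # c) (#-+ a c)) (lem (# a) (# c))) (ℚ.+-monoˡ-≤ (- # c) (#-mono h))
        where
        lem : ∀ a c → a + c - c ≡ a
        lem = solve-∀ ring
      nat : (q ℕ.* q ℕ.+ 5 ℕ.* q) ℕ.* suc (q ℕ.* q) ℕ.+ 10 ℕ.* (q ℕ.* q) ℕ.≤ q ℕ.* q ℕ.* (q ℕ.* q) ℕ.+ 9 ℕ.* (q ℕ.* (q ℕ.* q))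
      nat = ℕ.≤-trans (ℕ.≤-reflexive (lem₁ q)) (ℕ.≤-trans (ℕ.+-monoʳ-≤ (q ℕ.* q ℕ.* (q ℕ.* q) ℕ.+ 5 ℕ.* (q ℕ.* (q ℕ.* q)))
          (ℕ.≤-trans (ℕ.+-monoʳ-≤ (11 ℕ.* (q ℕ.* q)) (ℕ.*-monoʳ-≤ 5 (ℕ.m≤m*n q q {{ℕ.>-nonZero (ℕ.≤-trans (s≤s z≤n) 2≤q)}})))
          (ℕ.≤-trans (ℕ.≤-reflexive (lem₃ q)) (ℕ.*-monoʳ-≤ 4 (ℕ.*-monoˡ-≤ (q ℕ.* q) 4≤q)))))
        (ℕ.≤-reflexive (lem₄ q)))
        where
        lem₁ : ∀ q → (q ℕ.* q ℕ.+ 5 ℕ.* q) ℕ.* suc (q ℕ.* q) ℕ.+ 10 ℕ.* (q ℕ.* q)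
                     ≡ (q ℕ.* q ℕ.* (q ℕ.* q) ℕ.+ 5 ℕ.* (q ℕ.* (q ℕ.* q))) ℕ.+ (11 ℕ.* (q ℕ.* q) ℕ.+ 5 ℕ.* q)
        lem₁ = ℕ-Solver.solve-∀
        lem₃ : ∀ q → 11 ℕ.* (q ℕ.* q) ℕ.+ 5 ℕ.* (q ℕ.* q) ≡ 4 ℕ.* (4 ℕ.* (q ℕ.* q))
        lem₃ = ℕ-Solver.solve-∀
        lem₄ : ∀ q → (q ℕ.* q ℕ.* (q ℕ.* q) ℕ.+ 5 ℕ.* (q ℕ.* (q ℕ.* q))) ℕ.+ 4 ℕ.* (q ℕ.* (q ℕ.* q))
                     ≡ q ℕ.* q ℕ.* (q ℕ.* q) ℕ.+ 9 ℕ.* (q ℕ.* (q ℕ.* q))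
        lem₄ = ℕ-Solver.solve-∀
      exact : # (q ℕ.* q ℕ.* (q ℕ.* q) ℕ.+ 9 ℕ.* (q ℕ.* (q ℕ.* q))) - # (10 ℕ.* (q ℕ.* q)) ≡ (1ℚ + # 10 * i) * (Q4 * (1ℚ - i))
      exact = trans (cong₂ _-_ (trans (#-+ (q ℕ.* q ℕ.* (q ℕ.* q)) _) (cong₂ _+_ Q4≡ (trans (#-* 9 (q ℕ.* (q ℕ.* q))) (cong (# 9 *_) (trans (#-* q (q ℕ.* q)) (cong (# q *_) (#-* q q)))))))
          (trans (#-* 10 (q ℕ.* q)) (cong (# 10 *_) (#-* q q))))
        (trans (sym reduce) (cong (λ x → (1ℚ + # 10 * i) * (x * (1ℚ - i))) (sym Q4≡)))
        where
        Q4≡ : Q4 ≡ # q * # q * (# q * # q)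
        Q4≡ = trans (#-* (q ℕ.* q) (q ℕ.* q)) (cong₂ _*_ (#-* q q) (#-* q q))
        lem : ∀ q i → (1ℚ + # 10 * i) * (q * q * (q * q) * (1ℚ - i))
                      ≡ q * q * (q * q) + # 9 * ((q * i) * (q * (q * q))) - # 10 * ((q * i) * (q * i) * (q * q))
        lem = solve-∀ ring
        reduce : (1ℚ + # 10 * i) * (# q * # q * (# q * # q) * (1ℚ - i))
                 ≡ # q * # q * (# q * # q) + # 9 * (# q * (# q * # q)) - # 10 * (# q * # q)
        reduce = trans (lem (# q) i) (cong₂ (λ u v → # q * # q * (# q * # q) + # 9 * u - # 10 * v)
          (trans (cong (_* (# q * (# q * # q))) q*i) (ℚ.*-identityˡ (# q * (# q * # q))))
          (trans (cong (λ x → x * x * (# q * # q)) q*i) (ℚ.*-identityˡ (# q * # q))))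

    module _ (ε : ℝ) (N₀ : ℕ) (large : ∀ k → N₀ ℕ.≤ k → # 10 * i ≤ seq ε k) where

      -- All estimates are taken at one index `k`, late enough for the bound on `ε`, for the given
      -- inequality and for the error `t ^ k ≤ 1/q` of the truncated series. As `C.b⁻¹ = 1 − z`, the
      -- bound on `n` gives `(1 − z)^l ≥ 1/n`.
      threshold : ∀ {n D m} → C.b ^ (3 ℕ.* (q ℕ.* q ℕ.* (q ℕ.* q)) ℕ.* D) ≤ # n →
        fromℚ (ℤ.+ 1 / 6) *ᴿ (fromℚ 1ℚ +ᴿ ε) *ᴿ fromℕ n *ᴿ log n ≤ᴿ fromℕ m →
        (q ℕ.* q ℕ.+ 5 ℕ.* q) ℕ.* n ℕ.* D ℕ.≤ 2 ℕ.* m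
      threshold {zero}  {D} {m} b≤n h = ℕ.≤-trans (ℕ.≤-reflexive (cong (ℕ._* D) (ℕ.*-zeroʳ (q ℕ.* q ℕ.+ 5 ℕ.* q)))) z≤n
      threshold {suc p} {D} {m} b≤n h = s≤s⁻¹ (#-cancel-< (ℚ.≤-<-trans (below (proj₁ h′) (proj₂ h′)) slack))
        where
        open ℚ.≤-Reasoning
        n l : ℕ
        n = suc p
        l = 3 ℕ.* (q ℕ.* q ℕ.* (q ℕ.* q)) ℕ.* D
        t : ℚ
        t = 1ℚ - inv n
        -- The slack `1/4` becomes `1/2` on doubling `m`, which is below `1` and disappears for
        -- integers.
        h′ = h (½ * ½) (from-yes (0ℚ ℚ.<? ½ * ½))
        slack : # (2 ℕ.* m) + ½ < # (suc (2 ℕ.* m))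
        slack = subst (# (2 ℕ.* m) + ½ <_) (trans (ℚ.+-comm (# (2 ℕ.* m)) 1ℚ) (sym (#-suc (2 ℕ.* m)))) (ℚ.+-monoʳ-< (# (2 ℕ.* m)) (from-yes (½ ℚ.<? 1ℚ)))
        t≤1 : t ≤ 1ℚ
        t≤1 = ≤-by (inv n) (0≤inv n) (lem (inv n))
          where
          lem : ∀ z → (1ℚ - z) + z ≡ 1ℚ
          lem = solve-∀ ring
        enough : 1ℚ - (1ℚ - z) ^ l ≤ t
        enough = ℚ.+-monoʳ-≤ 1ℚ (ℚ.neg-antimono-≤ (subst (λ x → inv n ≤ x ^ l) (sym b⁻¹≡)
          (C.B.move l (ℚ.≤-trans (*-monoˡ (inv n) (0≤inv n) b≤n) (ℚ.≤-reflexive (trans (ℚ.*-comm (inv n) (# n)) (#*inv p)))))))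
        z≤1 : z ≤ 1ℚ
        z≤1 = subst₂ _≤_ (ℚ.*-identityˡ z) z*s (*-monoʳ z 0≤z (1≤# (q ℕ.* q)))
        arrange : ∀ s x n y → s * x * n * y + s * x * n * y ≡ (s + s) * (x * (n * y))
        arrange = solve-∀ ring
        arrange₂ : ∀ e x n Q D z j → e * (x * (n * ((# 3 * Q * D) * (z * j)))) ≡ (# 3 * e) * ((x * (Q * (z * j))) * n * D)
        arrange₂ = solve-∀ ring
        below : ∀ N₁ → (∀ k → N₁ ℕ.≤ k → ((ℤ.+ 1 / 6) * (1ℚ + seq ε k)) * # n * mercator t k ≤ # m + ½ * ½) →
                # ((q ℕ.* q ℕ.+ 5 ℕ.* q) ℕ.* n ℕ.* D) ≤ # (2 ℕ.* m) + ½
        below N₁ hyp = begin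
          # ((q ℕ.* q ℕ.+ 5 ℕ.* q) ℕ.* n ℕ.* D)
            ≡⟨ trans (#-* ((q ℕ.* q ℕ.+ 5 ℕ.* q) ℕ.* n) D) (cong (_* # D) (#-* (q ℕ.* q ℕ.+ 5 ℕ.* q) n)) ⟩
          # (q ℕ.* q ℕ.+ 5 ℕ.* q) * # n * # D
            ≤⟨ *-monoʳ (# D) (0≤# D) (*-monoʳ (# n) (0≤# n) constant) ⟩
          (1ℚ + # 10 * i) * (Q4 * (z * (1ℚ - i))) * # n * # D
            ≡⟨ ℚ.*-identityˡ _ ⟨
          1ℚ * ((1ℚ + # 10 * i) * (Q4 * (z * (1ℚ - i))) * # n * # D)
            ≡⟨ arrange₂ (s + s) (1ℚ + # 10 * i) (# n) Q4 (# D) z (1ℚ - i) ⟨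
          (s + s) * ((1ℚ + # 10 * i) * (# n * ((# 3 * Q4 * # D) * (z * (1ℚ - i)))))
            ≡⟨ cong (λ x → (s + s) * ((1ℚ + # 10 * i) * (# n * (x * (z * (1ℚ - i)))))) (sym (trans (#-* (3 ℕ.* (q ℕ.* q ℕ.* (q ℕ.* q))) D) (cong (_* # D) (#-* 3 (q ℕ.* q ℕ.* (q ℕ.* q)))))) ⟩
          (s + s) * ((1ℚ + # 10 * i) * (# n * (# l * (z * (1ℚ - i)))))
            ≤⟨ *-monoˡ (s + s) (from-yes (0ℚ ℚ.≤? s + s)) (*-mono (0≤* (0≤# n) (0≤* (0≤# l) (0≤* 0≤z (0≤-diff i≤1)))) (0≤+ 0≤1 0≤εk)
                 (ℚ.+-monoʳ-≤ 1ℚ (large k N₀≤k)) (*-monoˡ (# n) (0≤# n) merc)) ⟩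
          (s + s) * ((1ℚ + seq ε k) * (# n * mercator t k))
            ≡⟨ arrange s (1ℚ + seq ε k) (# n) (mercator t k) ⟨
          s * (1ℚ + seq ε k) * # n * mercator t k + s * (1ℚ + seq ε k) * # n * mercator t k
            ≤⟨ ℚ.+-mono-≤ (hyp k N₁≤k) (hyp k N₁≤k) ⟩
          (# m + ½ * ½) + (# m + ½ * ½)
            ≡⟨ lem (# m) (½ * ½) ⟩
          (1ℚ + 1ℚ) * # m + (½ * ½ + ½ * ½)
            ≡⟨ cong (_+ ½) (#-* 2 m) ⟨
          # (2 ℕ.* m) + ½ ∎
          where
          s Q4 : ℚ
          s = ℤ.+ 1 / 6
          Q4 = # (q ℕ.* q ℕ.* (q ℕ.* q))
          k : ℕ
          k = N₀ ⊔ (N₁ ⊔ n ℕ.* q)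
          N₀≤k : N₀ ℕ.≤ k
          N₀≤k = ℕ.m≤m⊔n N₀ _
          N₁≤k : N₁ ℕ.≤ k
          N₁≤k = ℕ.≤-trans (ℕ.m≤m⊔n N₁ _) (ℕ.m≤n⊔m N₀ _)
          nq≤k : n ℕ.* q ℕ.≤ k
          nq≤k = ℕ.≤-trans (ℕ.m≤n⊔m N₁ _) (ℕ.m≤n⊔m N₀ _)
          0≤εk : 0ℚ ≤ seq ε k
          0≤εk = ℚ.≤-trans (0≤* (0≤# 10) 0≤i) (large k N₀≤k)
          lem : ∀ m e → (m + e) + (m + e) ≡ (1ℚ + 1ℚ) * m + (e + e)
          lem = solve-∀ ring
          tk≤i : t ^ k ≤ i
          tk≤i = *-cancelˡ (# q) (0<#′ (ℕ.≤-trans (s≤s z≤n) 2≤q)) (ℚ.≤-trans (geometric-small p q k nq≤k) (ℚ.≤-reflexive (sym q*i)))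
          merc : # l * (z * (1ℚ - i)) ≤ mercator t k
          merc = ℚ.≤-trans (*-monoˡ (# l) (0≤# l) (*-monoˡ z 0≤z (ℚ.+-monoʳ-≤ 1ℚ (ℚ.neg-antimono-≤ tk≤i))))
            (mercator-lower l k 0≤z z≤1 t≤1 enough)

      -- As `ε` is eventually at least `10 / q`, multiplying by `2 q` produces `20 * e` on the left,
      -- of which `2 * e` is kept.
      loss : ∀ {d e} → fromℕ d ≤ᴿ (fromℚ ½ -ᴿ ε) *ᴿ fromℕ e → 2 ℕ.* q ℕ.* d ℕ.+ 2 ℕ.* e ℕ.≤ q ℕ.* e
      loss {d} {e} h = ℕ.≤-trans (ℕ.+-monoʳ-≤ (2 ℕ.* q ℕ.* d) (ℕ.*-monoˡ-≤ e {2} {20} (s≤s (s≤s z≤n)))) (s≤s⁻¹ (#-cancel-<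
          (ℚ.≤-<-trans (below (proj₁ h′) (proj₂ h′)) slack)))
        where
        open ℚ.≤-Reasoning
        η : ℚ
        -- Chosen so that `2 q η = ½`, less than the distance between integers.
        η = ½ * ½ * i
        h′ = h η (ℚ.positive⁻¹ η {{ℚ.pos*pos⇒pos (½ * ½) i {{inv-pos}}}})
          where
          inv-pos : ℚ.Positive i
          inv-pos = ℚ.positive (ℚ.≰⇒> λ i≤0 → ℚ.<-irrefl refl (ℚ.<-≤-trans (from-yes (0ℚ ℚ.<? 1ℚ))
            (subst₂ _≤_ q*i (ℚ.*-zeroʳ (# q)) (*-monoˡ (# q) (0≤# q) i≤0))))
        slack : # (q ℕ.* e) + ½ < # (suc (q ℕ.* e))
        slack = subst (# (q ℕ.* e) + ½ <_) (trans (ℚ.+-comm (# (q ℕ.* e)) 1ℚ) (sym (#-suc (q ℕ.* e)))) (ℚ.+-monoʳ-< (# (q ℕ.* e)) (from-yes (½ ℚ.<? 1ℚ)))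
        lem₁ : ∀ q i e → (1ℚ + 1ℚ) * q * ((½ - # 10 * i) * e + ½ * ½ * i) + # 20 * e
                       ≡ ((1ℚ + 1ℚ) * ½) * q * e - # 20 * ((q * i) * e) + # 20 * e + (1ℚ + 1ℚ) * (½ * ½) * (q * i)
        lem₁ = solve-∀ ring
        lem₂ : ∀ q e → 1ℚ * q * e - # 20 * (1ℚ * e) + # 20 * e + (1ℚ + 1ℚ) * (½ * ½) * 1ℚ ≡ q * e + ½
        lem₂ = solve-∀ ring
        below : ∀ N₁ → (∀ k → N₁ ℕ.≤ k → # d ≤ (½ + - seq ε k) * # e + η) →
                # (2 ℕ.* q ℕ.* d ℕ.+ 20 ℕ.* e) ≤ # (q ℕ.* e) + ½
        below N₁ hyp = begin
          # (2 ℕ.* q ℕ.* d ℕ.+ 20 ℕ.* e)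
            ≡⟨ trans (#-+ (2 ℕ.* q ℕ.* d) (20 ℕ.* e)) (cong₂ _+_ (trans (#-* (2 ℕ.* q) d) (cong (_* # d) (#-* 2 q))) (#-* 20 e)) ⟩
          (1ℚ + 1ℚ) * # q * # d + # 20 * # e
            ≤⟨ ℚ.+-monoˡ-≤ (# 20 * # e) (*-monoˡ ((1ℚ + 1ℚ) * # q) (0≤* (from-yes (0ℚ ℚ.≤? 1ℚ + 1ℚ)) (0≤# q))
                 (ℚ.≤-trans (hyp k (ℕ.m≤n⊔m N₀ N₁)) (ℚ.+-monoˡ-≤ η (*-monoʳ (# e) (0≤# e)
                   (ℚ.+-monoʳ-≤ ½ (ℚ.neg-antimono-≤ (large k (ℕ.m≤m⊔n N₀ N₁)))))))) ⟩
          (1ℚ + 1ℚ) * # q * ((½ - # 10 * i) * # e + η) + # 20 * # e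
            ≡⟨ lem₁ (# q) i (# e) ⟩
          ((1ℚ + 1ℚ) * ½) * # q * # e - # 20 * ((# q * i) * # e) + # 20 * # e + (1ℚ + 1ℚ) * (½ * ½) * (# q * i)
            ≡⟨ cong (λ x → 1ℚ * # q * # e - # 20 * (x * # e) + # 20 * # e + (1ℚ + 1ℚ) * (½ * ½) * x) q*i ⟩
          1ℚ * # q * # e - # 20 * (1ℚ * # e) + # 20 * # e + (1ℚ + 1ℚ) * (½ * ½) * 1ℚ
            ≡⟨ lem₂ (# q) (# e) ⟩
          # q * # e + ½
            ≡⟨ cong (_+ ½) (#-* q e) ⟨
          # (q ℕ.* e) + ½ ∎
          where
          k : ℕ
          k = N₀ ⊔ N₁

-- Constants, scales and the inequalities between exponents.

module Parameters where

  open Rationals renaming (_^_ to infixr 8 _^ℚ_)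
  open Concentration using (2ℚ)
  open Tails
  open TailEvents
  open import Data.Nat.Base using (ℕ; zero; suc; _∸_; _+_; _*_; _≤_; _<_; _^_; z≤n; s≤s; s≤s⁻¹)
  open import Data.Nat.Combinatorics using (_C_)
  open import Data.Nat.Tactic.RingSolver using (solve-∀)
  open import Data.Rational.Base using (ℚ; 0ℚ; 1ℚ; ½)
  open import Tactic.RingSolver using () renaming (solve-∀ to solve-∀-over)
  open Counting using (2*C2)

  ceiling : ∀ a b → 1 ≤ b → ∃[ t ] (a ≤ t * b × (∀ e → e < t → b * e < a))
  ceiling zero    b 1≤b = 0 , z≤n , λ _ ()
  ceiling (suc a) b 1≤b = let t , a≤ , least = ceiling a b 1≤b in go t a≤ least (suc a ℕ.≤? t * b)
    where
    go : ∀ t → a ≤ t * b → (∀ e → e < t → b * e < a) → Dec (suc a ≤ t * b) → ∃[ t ] (suc a ≤ t * b × (∀ e → e < t → b * e < suc a))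
    go t a≤ least (yes h) = t , h , λ e e<t → ℕ.<-trans (least e e<t) (ℕ.n<1+n a)
    go t a≤ least (no ¬h) = suc t , ℕ.+-mono-≤ 1≤b a≤ , λ e e<t → ℕ.≤-<-trans (ℕ.*-monoʳ-≤ b (s≤s⁻¹ e<t))
      (subst (_< suc a) (ℕ.*-comm t b) (ℕ.≰⇒> ¬h))

  floor : ∀ a b → 1 ≤ b → ∃[ t ] (t * b ≤ a × (∀ x → t < x → a < x * b))
  floor a b 1≤b = let t , a< , least = ceiling (suc a) b 1≤b in go t a< least
    where
    go : ∀ t → suc a ≤ t * b → (∀ e → e < t → b * e < suc a) → ∃[ t ] (t * b ≤ a × (∀ x → t < x → a < x * b))
    go (suc t) a< least = t , s≤s⁻¹ (subst (_< suc a) (ℕ.*-comm b t) (least t ℕ.≤-refl)) ,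
      λ x t<x → ℕ.≤-trans a< (ℕ.*-monoˡ-≤ b t<x)

  n<2^n : ∀ k → k < 2 ^ k
  n<2^n zero    = s≤s z≤n
  n<2^n (suc k) = ℕ.≤-trans (s≤s (n<2^n k)) (ℕ.≤-trans (ℕ.+-monoˡ-≤ (2 ^ k) (ℕ.m^n>0 2 k)) (ℕ.≤-reflexive (cong (2 ^ k +_) (sym (ℕ.+-identityʳ (2 ^ k))))))

  search : ∀ {P : ℕ → Set} → (∀ k → Dec (P k)) → P 0 → ∀ u → ¬ P u → ∃[ k ] (P k × ¬ P (suc k))
  search P? p0 zero    ¬p = contradiction p0 ¬p
  search {P} P? p0 (suc u) ¬p = go (P? u)
    where
    go : Dec (P u) → ∃[ k ] (P k × ¬ P (suc k))
    go (yes p) = u , p , ¬p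
    go (no ¬q) = search P? p0 u ¬q

  -- `compound` with two factors `1 − ½` and `n` factors `1 + 1/n`.
  compound≤4 : ∀ {x} n → 1 ≤ n → 0ℚ ℚ.≤ x → # n ℚ.* x ℚ.≤ 1ℚ → (1ℚ ℚ.+ x) ^ℚ n ℚ.≤ # 4
  compound≤4 {x} n 1≤n 0≤x nx≤1 = ℚ.≤-trans (^-mono n (0≤+ 0≤1 0≤x) (ℚ.+-monoʳ-≤ 1ℚ x≤)) (*-cancelˡ (½ ℚ.* ½) (from-yes (0ℚ ℚ.<? ½ ℚ.* ½))
      (ℚ.≤-trans (ℚ.≤-reflexive (trans (ℚ.*-comm (½ ℚ.* ½) B) (cong (B ℚ.*_) (cong (½ ℚ.*_) {½} {½ ℚ.* 1ℚ} refl))))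
        (subst (λ z → z ^ℚ n ℚ.* ½ ^ℚ 2 ℚ.≤ 1ℚ) half (compound {n} {½} {½ ℚ.* inv n} 2 1≤n eq (from-yes (½ ℚ.≤? 1ℚ)) nonNeg))))
    where
    B : ℚ
    B = (1ℚ ℚ.+ inv n) ^ℚ n
    x≤ : x ℚ.≤ inv n
    x≤ = *-cancelˡ (# n) (0<#′ 1≤n) (ℚ.≤-trans nx≤1 (ℚ.≤-reflexive (sym (#*inv′ 1≤n))))
    lem : ∀ n i → ½ ℚ.* (n ℚ.* i) ≡ n ℚ.* (½ ℚ.* i)
    lem = solve-∀-over ring
    eq : ½ ≡ # n ℚ.* (½ ℚ.* inv n)
    eq = trans (sym (trans (cong (½ ℚ.*_) (#*inv′ 1≤n)) (ℚ.*-identityʳ ½))) (lem (# n) (inv n))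
    half : 1ℚ ℚ.+ # 2 ℚ.* (½ ℚ.* inv n) ≡ 1ℚ ℚ.+ inv n
    half = cong (1ℚ ℚ.+_) (trans (sym (ℚ.*-assoc (# 2) ½ (inv n))) (ℚ.*-identityˡ (inv n)))
    nonNeg : ∀ k → k ≤ 2 → 0ℚ ℚ.≤ 1ℚ ℚ.+ # k ℚ.* (½ ℚ.* inv n)
    nonNeg k _ = 0≤+ 0≤1 (0≤* (0≤# k) (0≤* Two.0≤a (0≤inv n)))

  -- `Q` is such that `n ≤ 2 ^ (Q * D)`. At time `m₁ = K n D`, `K = 8 Q` makes room for a degree
  -- tail `2^(−4 Q D)`, enough for `n` vertices and at most `n²` times. `L` is the saving per edge
  -- inside a small set: `121` from `sparse-exponent` times `16 K` from the density threshold
  -- `m / (8 K n)`. `Γ = 2 · 2^L` offsets the growth of the rate at `lam = 2^L`.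
  module Numbers (q Q K L Γ : ℕ) (20≤q : 20 ≤ q) (Q≡ : Q ≡ 12 * (q * q)) (K≡ : K ≡ 8 * Q)
    (L≡ : L ≡ 121 * (16 * K)) (Γ≡ : Γ ≡ 2 * 2 ^ L) where

    2≤q : 2 ≤ q
    2≤q = ℕ.≤-trans (s≤s (s≤s z≤n)) 20≤q

    1≤q : 1 ≤ q
    1≤q = ℕ.≤-trans (s≤s z≤n) 2≤q

    open Cluster q 2≤q using (b; b⁻¹; i; inverse-b; inverse-q; module B; module Q) public

    exponent : ℕ
    exponent = 3 * (q * q * (q * q))

    1≤q² : 1 ≤ q * q
    1≤q² = ℕ.*-mono-≤ 1≤q 1≤q

    private
      q²i² : # (q * q) ℚ.* (i ℚ.* i) ≡ 1ℚ
      q²i² = trans (cong (ℚ._* (i ℚ.* i)) (#-* q q)) (trans (lem (# q) i) (cong (λ z → z ℚ.* z) (#*inv′ 1≤q)))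
        where
        lem : ∀ q i → q ℚ.* q ℚ.* (i ℚ.* i) ≡ (q ℚ.* i) ℚ.* (q ℚ.* i)
        lem = solve-∀-over ring

      0≤i² : 0ℚ ℚ.≤ i ℚ.* i
      0≤i² = 0≤* (0≤inv q) (0≤inv q)

    -- With the upper bound `4` this exchanges base `b` for base `2` up to a factor `2` in the
    -- exponent. Leading powers of `n` are compared in base `b` itself, where this factor would be
    -- too much.
    2≤b^q² : 2ℚ ℚ.≤ b ^ℚ (q * q)
    2≤b^q² = ℚ.≤-trans (ℚ.≤-reflexive (cong (1ℚ ℚ.+_) (sym q²i²))) (bernoulli {i ℚ.* i} (q * q) (0≤+ 0≤1 0≤i²))

    b^q²≤4 : b ^ℚ (q * q) ℚ.≤ 2ℚ ^ℚ 2
    b^q²≤4 = compound≤4 (q * q) 1≤q² 0≤i² (ℚ.≤-reflexive q²i²)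

    2^≤b^ : ∀ k → 2ℚ ^ℚ k ℚ.≤ b ^ℚ (q * q * k)
    2^≤b^ k = ℚ.≤-trans (^-mono k Two.0≤α 2≤b^q²) (ℚ.≤-reflexive (^-assocʳ b (q * q) k))

    b^≤2^ : ∀ k → b ^ℚ (q * q * k) ℚ.≤ 2ℚ ^ℚ (2 * k)
    b^≤2^ k = ℚ.≤-trans (ℚ.≤-reflexive (sym (^-assocʳ b (q * q) k))) (ℚ.≤-trans (^-mono k (0≤^ (q * q) B.0≤α) b^q²≤4) (ℚ.≤-reflexive (^-assocʳ 2ℚ 2 k)))

    exponent≡ : ∀ k → exponent * k ≡ q * q * (3 * (q * q) * k)
    exponent≡ k = lem (q * q) k
      where
      lem : ∀ s k → 3 * (s * s) * k ≡ s * (3 * s * k)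
      lem = solve-∀

    growth : ∀ {n D} → # n ℚ.≤ b ^ℚ (exponent * D) → n ≤ 2 ^ (6 * (q * q) * D)
    growth {n} {D} h = #-cancel (ℚ.≤-trans h (ℚ.≤-trans (ℚ.≤-reflexive (cong (b ^ℚ_) (exponent≡ D)))
      (ℚ.≤-trans (b^≤2^ (3 * (q * q) * D)) (ℚ.≤-reflexive (trans (cong (2ℚ ^ℚ_) (lem (q * q) D)) (sym (#-^ 2 (6 * (q * q) * D))))))))
      where
      lem : ∀ s D → 2 * (3 * s * D) ≡ 6 * s * D
      lem = solve-∀

    -- `1536 = 2 · 8 · 8 · 12` turns `q² n D ≤ 2 m` into `8 K n ≤ m`; `80 Γ` is what
    -- `expand-exponent` requires.
    module Scale {n D : ℕ} (lower : b ^ℚ (exponent * D) ℚ.≤ # n) (upper : # n ℚ.≤ b ^ℚ (exponent * suc D))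
      (1536≤D : 1536 ≤ D) (80Γ≤D : 80 * Γ ≤ D) where

      1≤D : 1 ≤ D
      1≤D = ℕ.≤-trans (s≤s z≤n) 1536≤D

      n≤2^ : n ≤ 2 ^ (Q * D)
      n≤2^ = ℕ.≤-trans (growth upper) (ℕ.^-monoʳ-≤ 2 (ℕ.≤-trans (ℕ.*-monoʳ-≤ (6 * (q * q)) (ℕ.+-monoˡ-≤ D 1≤D))
        (ℕ.≤-reflexive (trans (lem (q * q) D) (cong (_* D) (sym Q≡))))))
        where
        lem : ∀ s D → 6 * s * (D + D) ≡ 12 * s * D
        lem = solve-∀

      2^≤n : 2 ^ (3 * (q * q) * D) ≤ n
      2^≤n = #-cancel (ℚ.≤-trans (ℚ.≤-reflexive (#-^ 2 (3 * (q * q) * D))) (ℚ.≤-trans (2^≤b^ (3 * (q * q) * D))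
        (ℚ.≤-trans (ℚ.≤-reflexive (cong (b ^ℚ_) (sym (exponent≡ D)))) lower)))

      y : ℕ
      y = q * q * D

      -- `768 * y` is `8 * K * D`. The factors `1024 = 2^10 ≤ 2^(2 y)` and `y < 2^y` fit together
      -- into `2^(3 y) ≤ n`.
      768y<n : 768 * y < n
      768y<n = ℕ.≤-trans (s≤s (ℕ.*-monoˡ-≤ y {768} {1024} (from-yes (768 ℕ.≤? 1024)))) (ℕ.≤-trans
        (ℕ.+-monoˡ-≤ (1024 * y) {1} {1024} (s≤s z≤n)) (ℕ.≤-trans (ℕ.≤-reflexive (sym (ℕ.*-suc 1024 y)))
          (ℕ.≤-trans (ℕ.*-mono-≤ (ℕ.^-monoʳ-≤ 2 {10} {2 * y} (ℕ.*-monoʳ-≤ 2 {5} 5≤y)) (n<2^n y))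
            (ℕ.≤-trans (ℕ.≤-reflexive (trans (sym (ℕ.^-distribˡ-+-* 2 (2 * y) y)) (cong (2 ^_) (lem (q * q) D)))) 2^≤n))))
        where
        lem : ∀ s D → 2 * (s * D) + s * D ≡ 3 * s * D
        lem = solve-∀
        5≤y : 5 ≤ y
        5≤y = ℕ.≤-trans (ℕ.≤-trans (from-yes (5 ℕ.≤? 1536)) 1536≤D) (ℕ.m≤n*m D (q * q) {{ℕ.>-nonZero 1≤q²}})

      8KD<n : 8 * K * D < n
      8KD<n = subst (_< n) (trans (lem (q * q) D) (cong (λ z → 8 * z * D) (sym (trans K≡ (cong (8 *_) Q≡))))) 768y<n
        where
        lem : ∀ s D → 768 * (s * D) ≡ 8 * (8 * (12 * s)) * D
        lem = solve-∀

      y<n : y < n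
      y<n = ℕ.≤-<-trans (ℕ.m≤n*m y 768) 768y<n

      D<n : D < n
      D<n = ℕ.≤-<-trans (ℕ.m≤n*m D (q * q) {{ℕ.>-nonZero 1≤q²}}) y<n

      2≤n : 2 ≤ n
      2≤n = ℕ.≤-trans (s≤s 1≤D) D<n

      1≤n : 1 ≤ n
      1≤n = ℕ.≤-trans (s≤s z≤n) 2≤n

      N P : ℕ
      N = n C 2
      P = 2 * N

      P≡ : P ≡ n * (n ∸ 1)
      P≡ = 2C2≡ n

      P≤n² : P ≤ n * n
      P≤n² = ℕ.≤-trans (ℕ.≤-reflexive P≡) (ℕ.*-monoʳ-≤ n (ℕ.m∸n≤m n 1))

      n≤2[n-1] : n ≤ 2 * (n ∸ 1)
      n≤2[n-1] = go n 2≤n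
        where
        go : ∀ n → 2 ≤ n → n ≤ 2 * (n ∸ 1)
        go (suc zero) (s≤s ())
        go (suc (suc k)) _ = s≤s (ℕ.≤-trans (ℕ.m≤n+m (suc k) k) (ℕ.≤-reflexive (cong (k +_) (sym (ℕ.+-identityʳ (suc k))))))

      n²≤2P : n * n ≤ 2 * P
      n²≤2P = ℕ.≤-trans (ℕ.*-monoʳ-≤ n n≤2[n-1]) (ℕ.≤-reflexive (trans (lem n (n ∸ 1)) (cong (2 *_) (sym P≡))))
        where
        lem : ∀ n k → n * (2 * k) ≡ 2 * (n * k)
        lem = solve-∀

      N<n² : suc N ≤ n * n
      N<n² = ℕ.≤-trans (ℕ.≤-trans (ℕ.+-monoˡ-≤ N 1≤n) (ℕ.≤-trans (ℕ.m≤m+n (n + N) N) (ℕ.≤-reflexive (lem n N)))) (ℕ.≤-reflexive (2*C2 n))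
        where
        lem : ∀ n N → (n + N) + N ≡ 2 * N + n
        lem = solve-∀

      m₁ : ℕ
      m₁ = K * n * D

      4m₁≤N : 4 * m₁ ≤ N
      4m₁≤N = ℕ.*-cancelˡ-≤ 2 (ℕ.≤-trans (ℕ.≤-reflexive (lem K n D)) (ℕ.≤-trans (ℕ.*-monoʳ-≤ n (below n 8KD<n)) (ℕ.≤-reflexive (sym P≡))))
        where
        lem : ∀ K n D → 2 * (4 * (K * n * D)) ≡ n * (8 * K * D)
        lem = solve-∀
        below : ∀ {a} n → a < n → a ≤ n ∸ 1
        below (suc n) (s≤s h) = h

      m₁≤N : m₁ ≤ N
      m₁≤N = ℕ.≤-trans (ℕ.m≤n*m m₁ 4) 4m₁≤N

      3m₁≤N∸m₁ : 3 * m₁ ≤ N ∸ m₁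
      3m₁≤N∸m₁ = ℕ.≤-trans (ℕ.≤-reflexive (sym (trans (cong (_∸ m₁) (lem m₁)) (ℕ.m+n∸n≡m (3 * m₁) m₁)))) (ℕ.∸-monoˡ-≤ m₁ 4m₁≤N)
        where
        lem : ∀ m → 4 * m ≡ 3 * m + m
        lem = solve-∀

      2≤K : 2 ≤ K
      2≤K = ℕ.≤-trans (ℕ.≤-trans (from-yes (2 ℕ.≤? 96)) (ℕ.m≤m*n 96 (q * q) {{ℕ.>-nonZero 1≤q²}}))
        (ℕ.≤-reflexive (trans (lem (q * q)) (sym (trans K≡ (cong (8 *_) Q≡)))))
        where
        lem : ∀ s → 96 * s ≡ 8 * (12 * s)
        lem = solve-∀

      1≤K : 1 ≤ K
      1≤K = ℕ.≤-trans (s≤s z≤n) 2≤K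

      6n≤N∸m₁ : 6 * n ≤ N ∸ m₁
      6n≤N∸m₁ = ℕ.≤-trans (ℕ.≤-trans (ℕ.≤-reflexive (ℕ.*-assoc 3 2 n)) (ℕ.*-monoʳ-≤ 3 2n≤m₁)) 3m₁≤N∸m₁
        where
        2n≤m₁ : 2 * n ≤ m₁
        2n≤m₁ = ℕ.≤-trans (ℕ.*-monoˡ-≤ n 2≤K) (ℕ.m≤m*n (K * n) D {{ℕ.>-nonZero 1≤D}})

      -- The value `4 / N` meets both demands of the two-time bound: `4 m₁ ≤ N` gives `m₁ β ≤ 1`,
      -- and at least half of the pairs remain missing, which gives `2 ≤ (N − m₁) β`.
      β β₀ : ℚ
      β = # 4 ℚ.* inv N
      β₀ = # m₁ ℚ.* β

      1≤N : 1 ≤ N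
      1≤N = 1≤C2 2≤n

      0≤β : 0ℚ ℚ.≤ β
      0≤β = 0≤* (0≤# 4) (0≤inv N)

      0≤β₀ : 0ℚ ℚ.≤ β₀
      0≤β₀ = 0≤* (0≤# m₁) 0≤β

      private
        scaled : ∀ k → # k ℚ.* β ≡ # (4 * k) ℚ.* inv N
        scaled k = trans (lem (# k) (# 4) (inv N)) (cong (ℚ._* inv N) (sym (#-* 4 k)))
          where
          lem : ∀ k f i → k ℚ.* (f ℚ.* i) ≡ (f ℚ.* k) ℚ.* i
          lem = solve-∀-over ring

        scale-≤ : ∀ {a b} → a ≤ b * N → # a ℚ.* inv N ℚ.≤ # b
        scale-≤ {a} {b} h = ℚ.≤-trans (*-monoʳ (inv N) (0≤inv N) (#-mono h)) (ℚ.≤-reflexive (trans (cong (ℚ._* inv N) (#-* b N))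
          (trans (ℚ.*-assoc (# b) (# N) (inv N)) (trans (cong (# b ℚ.*_) (#*inv′ 1≤N)) (ℚ.*-identityʳ (# b))))))

        ≤-scale : ∀ {a b} → b * N ≤ a → # b ℚ.≤ # a ℚ.* inv N
        ≤-scale {a} {b} h = ℚ.≤-trans (ℚ.≤-reflexive (sym (trans (cong (ℚ._* inv N) (#-* b N))
          (trans (ℚ.*-assoc (# b) (# N) (inv N)) (trans (cong (# b ℚ.*_) (#*inv′ 1≤N)) (ℚ.*-identityʳ (# b))))))) (*-monoʳ (inv N) (0≤inv N) (#-mono h))

      β₀≤1 : β₀ ℚ.≤ 1ℚ
      β₀≤1 = ℚ.≤-trans (ℚ.≤-reflexive (scaled m₁)) (scale-≤ {b = 1} (ℕ.≤-trans 4m₁≤N (ℕ.≤-reflexive (sym (ℕ.*-identityˡ N)))))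

      2≤rest : 2ℚ ℚ.≤ # (N ∸ m₁) ℚ.* β
      2≤rest = ℚ.≤-trans (≤-scale {b = 2} two) (ℚ.≤-reflexive (sym (scaled (N ∸ m₁))))
        where
        lem₁ : ∀ a b → 2 * (a + b) ≡ 2 * a + 2 * b
        lem₁ = solve-∀
        lem₂ : ∀ a → 2 * a + 2 * a ≡ 4 * a
        lem₂ = solve-∀
        two : 2 * N ≤ 4 * (N ∸ m₁)
        two = ℕ.≤-trans (ℕ.≤-reflexive (trans (cong (2 *_) (sym (ℕ.m∸n+n≡m m₁≤N))) (lem₁ (N ∸ m₁) m₁)))
          (ℕ.≤-trans (ℕ.+-monoʳ-≤ (2 * (N ∸ m₁)) (ℕ.*-monoʳ-≤ 2 (ℕ.≤-trans (ℕ.m≤n*m m₁ 3) 3m₁≤N∸m₁))) (ℕ.≤-reflexive (lem₂ (N ∸ m₁))))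

      nβ₀≤ : # n ℚ.* β₀ ℚ.≤ # (16 * K * D)
      nβ₀≤ = ℚ.≤-trans (ℚ.≤-reflexive (trans (sym (ℚ.*-assoc (# n) (# m₁) β)) (trans (cong (ℚ._* β) (sym (#-* n m₁))) (scaled (n * m₁)))))
        (scale-≤ {b = 16 * K * D} (ℕ.≤-trans (ℕ.≤-reflexive (lem₁ n K D)) (ℕ.≤-trans (ℕ.*-monoʳ-≤ (4 * K * D) n²≤2P) (ℕ.≤-reflexive (lem₂ K D N)))))
        where
        lem₁ : ∀ n K D → 4 * (n * (K * n * D)) ≡ 4 * K * D * (n * n)
        lem₁ = solve-∀
        lem₂ : ∀ K D N → 4 * K * D * (2 * (2 * N)) ≡ 16 * K * D * N
        lem₂ = solve-∀

      module _ {m₀ : ℕ} (2m₀≡ : 2 * m₀ ≡ (q * q + 5 * q) * n * D) where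

        m₀≤m₁ : m₀ ≤ m₁
        m₀≤m₁ = ℕ.*-cancelˡ-≤ 2 (ℕ.≤-trans (ℕ.≤-reflexive 2m₀≡) (ℕ.≤-trans (ℕ.*-monoˡ-≤ D (ℕ.*-monoˡ-≤ n q²+5q≤2K)) (ℕ.≤-reflexive (lem K n D))))
          where
          lem : ∀ K n D → 2 * K * n * D ≡ 2 * (K * n * D)
          lem = solve-∀
          lem₂ : ∀ s → s + 5 * s + 186 * s ≡ 2 * (8 * (12 * s))
          lem₂ = solve-∀
          q²+5q≤2K : q * q + 5 * q ≤ 2 * K
          q²+5q≤2K = ℕ.≤-trans (ℕ.+-monoʳ-≤ (q * q) (ℕ.*-monoʳ-≤ 5 (ℕ.m≤m*n q q {{ℕ.>-nonZero 1≤q}})))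
            (ℕ.≤-trans (ℕ.m≤m+n _ (186 * (q * q))) (ℕ.≤-reflexive (trans (lem₂ (q * q)) (cong (2 *_) (sym (trans K≡ (cong (8 *_) Q≡)))))))

        -- 2 m₀ is chosen so that the expected degree of a vertex in G_m₀ makes
        -- three given vertices have low degree with probability n^(−1−2/q).
        cluster-exponent : (q + 2) * (3 * (q * (q * q))) * D * N ≤ (q * q ∸ q) * m₀ * (3 * (n ∸ 3))
        cluster-exponent = ℕ.*-cancelˡ-≤ 2 (go q n refl refl (ℕ.≤-trans (from-yes (4 ℕ.≤? 20)) 20≤q) 2q+11≤n)
          where
          2q+11≤n : 2 * q + 11 ≤ n
          2q+11≤n = ℕ.≤-trans (ℕ.≤-trans (ℕ.+-monoʳ-≤ (2 * q) (ℕ.≤-trans (from-yes (11 ℕ.≤? 20)) 20≤q))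
            (ℕ.≤-trans (ℕ.≤-reflexive (lem q)) (ℕ.≤-trans (ℕ.*-monoˡ-≤ q (ℕ.≤-trans (from-yes (3 ℕ.≤? 20)) 20≤q))
              (ℕ.m≤m*n (q * q) D {{ℕ.>-nonZero 1≤D}})))) (ℕ.<⇒≤ y<n)
            where
            lem : ∀ q → 2 * q + q ≡ 3 * q
            lem = solve-∀
          go : ∀ q′ n′ → q′ ≡ q → n′ ≡ n → 4 ≤ q′ → 2 * q′ + 11 ≤ n′ →
               2 * ((q + 2) * (3 * (q * (q * q))) * D * N) ≤ 2 * ((q * q ∸ q) * m₀ * (3 * (n ∸ 3)))
          go (suc p) (suc zero) _ _ _ h = contradiction (ℕ.≤-trans (ℕ.m≤n+m 11 (2 * suc p)) h) λ { (s≤s ()) }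
          go (suc p) (suc (suc zero)) _ _ _ h = contradiction (ℕ.≤-trans (ℕ.m≤n+m 11 (2 * suc p)) h) λ { (s≤s (s≤s ())) }
          go (suc p) (suc (suc (suc u))) refl refl (s≤s 3≤p) 2q+11≤n = begin
            2 * ((q + 2) * (3 * (q * (q * q))) * D * N)
              ≡⟨ lem₁ p D N ⟩
            (p + 3) * (3 * ((suc p) * ((suc p) * (suc p)))) * D * (2 * N)
              ≡⟨ cong ((p + 3) * (3 * ((suc p) * ((suc p) * (suc p)))) * D *_) P≡ ⟩
            (p + 3) * (3 * ((suc p) * ((suc p) * (suc p)))) * D * ((3 + u) * (2 + u))
              ≡⟨ lem₂ p D u ⟩
            3 * (suc p * suc p) * (3 + u) * D * ((p + 3) * (p + 1) * (2 + u))
              ≤⟨ ℕ.*-monoʳ-≤ (3 * (suc p * suc p) * (3 + u) * D) core ⟩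
            3 * (suc p * suc p) * (3 + u) * D * (p * (p + 6) * u)
              ≡⟨ lem₃ p D u ⟩
            (suc p * p) * ((suc p * suc p + 5 * suc p) * (3 + u) * D) * (3 * u)
              ≡⟨ cong (λ z → (suc p * p) * z * (3 * u)) 2m₀≡ ⟨
            (suc p * p) * (2 * m₀) * (3 * u)
              ≡⟨ lem₄ (suc p * p) m₀ u ⟩
            2 * ((suc p * p) * m₀ * (3 * u))
              ≡⟨ cong (λ z → 2 * (z * m₀ * (3 * u))) (sym q²-q) ⟩
            2 * ((q * q ∸ q) * m₀ * (3 * u)) ∎
            where
            open ℕ.≤-Reasoning
            q²-q : q * q ∸ q ≡ suc p * p
            q²-q = trans (cong (_∸ suc p) (ℕ.*-suc (suc p) p)) (ℕ.m+n∸m≡n (suc p) (suc p * p))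
            lem₁ : ∀ p D N → 2 * ((suc p + 2) * (3 * (suc p * (suc p * suc p))) * D * N) ≡ (p + 3) * (3 * ((suc p) * ((suc p) * (suc p)))) * D * (2 * N)
            lem₁ = solve-∀
            lem₂ : ∀ p D u → (p + 3) * (3 * ((suc p) * ((suc p) * (suc p)))) * D * ((3 + u) * (2 + u))
                           ≡ 3 * (suc p * suc p) * (3 + u) * D * ((p + 3) * (p + 1) * (2 + u))
            lem₂ = solve-∀
            lem₃ : ∀ p D u → 3 * (suc p * suc p) * (3 + u) * D * (p * (p + 6) * u)
                           ≡ (suc p * p) * ((suc p * suc p + 5 * suc p) * (3 + u) * D) * (3 * u)
            lem₃ = solve-∀
            lem₄ : ∀ a m u → a * (2 * m) * (3 * u) ≡ 2 * (a * m * (3 * u))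
            lem₄ = solve-∀
            lem₅ : ∀ p u → (p + 3) * (p + 1) * (2 + u) ≡ (p * p + 4 * p) * u + (3 * u + (2 * (p * p) + 8 * p + 6))
            lem₅ = solve-∀
            lem₆ : ∀ p u → (p * p + 4 * p) * u + (p * u + p * u) ≡ p * (p + 6) * u
            lem₆ = solve-∀
            lem₇ : ∀ p → 2 * suc p + 11 ≡ 3 + (2 * p + 10)
            lem₇ = solve-∀
            lem₈ : ∀ p → 2 * (p * p) + 8 * p + 2 * p ≡ p * (2 * p + 10)
            lem₈ = solve-∀
            u≥ : 2 * p + 10 ≤ u
            u≥ = ℕ.+-cancelˡ-≤ 3 _ _ (ℕ.≤-trans (ℕ.≤-reflexive (sym (lem₇ p))) 2q+11≤n)
            -- In terms of `q` and `n` this is `(q + 2) q (n − 1) ≤ (q − 1) (q + 5) (n − 3)`. The `5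
            -- q` in `m₀` makes the leading factor `q² + 4 q − 5` exceed `q² + 2 q`, and `n` is
            -- large enough to hide the shifts.
            core : (p + 3) * (p + 1) * (2 + u) ≤ p * (p + 6) * u
            core = begin
              (p + 3) * (p + 1) * (2 + u)
                ≡⟨ lem₅ p u ⟩
              (p * p + 4 * p) * u + (3 * u + (2 * (p * p) + 8 * p + 6))
                ≤⟨ ℕ.+-monoʳ-≤ ((p * p + 4 * p) * u) (ℕ.+-mono-≤ (ℕ.*-monoˡ-≤ u 3≤p)
                     (ℕ.≤-trans (ℕ.+-monoʳ-≤ (2 * (p * p) + 8 * p) (ℕ.*-monoʳ-≤ 2 3≤p)) (ℕ.≤-trans (ℕ.≤-reflexive (lem₈ p)) (ℕ.*-monoʳ-≤ p u≥)))) ⟩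
              (p * p + 4 * p) * u + (p * u + p * u)
                ≡⟨ lem₆ p u ⟩
              p * (p + 6) * u ∎

      module _ {m : ℕ} (m-large : (q * q + 5 * q) * n * D ≤ 2 * m) where

        q²nD≤2m : q * q * n * D ≤ 2 * m
        q²nD≤2m = ℕ.≤-trans (ℕ.*-monoˡ-≤ D (ℕ.*-monoˡ-≤ n (ℕ.m≤m+n (q * q) (5 * q)))) m-large

        8Kn≤m : 8 * (K * n) ≤ m
        8Kn≤m = ℕ.*-cancelˡ-≤ 2 (ℕ.≤-trans (ℕ.≤-reflexive (trans (cong (λ z → 2 * (8 * (z * n))) (trans K≡ (cong (8 *_) Q≡))) (lem (q * q) n)))
          (ℕ.≤-trans (ℕ.*-monoʳ-≤ (q * q * n) 1536≤D) q²nD≤2m))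
          where
          lem : ∀ s n → 2 * (8 * (8 * (12 * s) * n)) ≡ s * n * 1536
          lem = solve-∀

        -- The growth of the rate costs at most `m x n` because `Γ x ≤ n`; the union over sets and
        -- times costs at most `120 m x n` because `q² n D ≤ 2 m`. Together they fit into the
        -- saving, as `m x n ≤ 16 K t P`.
        sparse-exponent : ∀ {x t} → 1 ≤ x → Γ * x ≤ n → m * x ≤ t * (8 * (K * n)) →
          2 * 2 ^ L * m * (x * x) + (4 * (Q * D) + Q * D * x) * P ≤ L * t * P
        sparse-exponent {x} {t} 1≤x Γx≤n ht = begin
          2 * 2 ^ L * m * (x * x) + (4 * (Q * D) + Q * D * x) * P
            ≤⟨ ℕ.+-mono-≤ first second ⟩
          m * x * n + 120 * (m * x * n)
            ≡⟨ lem₁ (m * x * n) ⟩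
          121 * (m * x * n)
            ≤⟨ ℕ.*-monoʳ-≤ 121 third ⟩
          121 * (16 * K * t * P)
            ≡⟨ trans (lem₂ K t P) (cong (λ z → z * t * P) (sym L≡)) ⟩
          L * t * P ∎
          where
          open ℕ.≤-Reasoning
          lem₁ : ∀ a → a + 120 * a ≡ 121 * a
          lem₁ = solve-∀
          lem₂ : ∀ K t P → 121 * (16 * K * t * P) ≡ 121 * (16 * K) * t * P
          lem₂ = solve-∀
          lem₃ : ∀ g m x → g * m * (x * x) ≡ m * x * (g * x)
          lem₃ = solve-∀
          lem₄ : ∀ w x → 4 * w * x + w * x ≡ 5 * (w * x)
          lem₄ = solve-∀
          lem₅ : ∀ s D x n → 5 * (12 * s * D * x) * (n * n) ≡ 60 * (s * n * D) * (x * n)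
          lem₅ = solve-∀
          lem₆ : ∀ m x n → 60 * (2 * m) * (x * n) ≡ 120 * (m * x * n)
          lem₆ = solve-∀
          lem₇ : ∀ t K n → t * (8 * (K * n)) * n ≡ 8 * K * t * (n * n)
          lem₇ = solve-∀
          lem₈ : ∀ K t P → 8 * K * t * (2 * P) ≡ 16 * K * t * P
          lem₈ = solve-∀
          first : 2 * 2 ^ L * m * (x * x) ≤ m * x * n
          first = ℕ.≤-trans (ℕ.≤-reflexive (trans (lem₃ (2 * 2 ^ L) m x) (cong (λ z → m * x * (z * x)) (sym Γ≡)))) (ℕ.*-monoʳ-≤ (m * x) Γx≤n)
          second : (4 * (Q * D) + Q * D * x) * P ≤ 120 * (m * x * n)
          second = begin
            (4 * (Q * D) + Q * D * x) * P
              ≤⟨ ℕ.*-mono-≤ (ℕ.+-monoˡ-≤ (Q * D * x) (ℕ.m≤m*n (4 * (Q * D)) x {{ℕ.>-nonZero 1≤x}})) P≤n² ⟩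
            (4 * (Q * D) * x + Q * D * x) * (n * n)
              ≡⟨ cong (_* (n * n)) (lem₄ (Q * D) x) ⟩
            5 * (Q * D * x) * (n * n)
              ≡⟨ trans (cong (λ z → 5 * (z * D * x) * (n * n)) Q≡) (lem₅ (q * q) D x n) ⟩
            60 * (q * q * n * D) * (x * n)
              ≤⟨ ℕ.*-monoˡ-≤ (x * n) (ℕ.*-monoʳ-≤ 60 q²nD≤2m) ⟩
            60 * (2 * m) * (x * n)
              ≡⟨ lem₆ m x n ⟩
            120 * (m * x * n) ∎
          third : m * x * n ≤ 16 * K * t * P
          third = ℕ.≤-trans (ℕ.*-monoˡ-≤ n ht) (ℕ.≤-trans (ℕ.≤-reflexive (lem₇ t K n))
            (ℕ.≤-trans (ℕ.*-monoʳ-≤ (8 * K * t) n²≤2P) (ℕ.≤-reflexive (lem₈ K t P))))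

        -- A set above the size `n / Γ` and at most half has `s s′ ≥ n² / (2 Γ)`. Then `80 Γ ≤ D`
        -- makes the tail as small as `2^(−5 n)`.
        expand-exponent : ∀ {s s′} → s + s′ ≡ n → n < Γ * s → 2 * s ≤ n →
          2 * q * (5 * n * N * (2 * (2 * q))) ≤ m * (s * s′)
        expand-exponent {s} {s′} s+s′≡n n<Γs 2s≤n = ℕ.*-cancelˡ-≤ 2 (begin
          2 * (2 * q * (5 * n * N * (2 * (2 * q))))
            ≡⟨ lem₁ q n N ⟩
          40 * (q * q * n) * P
            ≤⟨ ℕ.*-monoʳ-≤ (40 * (q * q * n)) P≤ ⟩
          40 * (q * q * n) * (2 * Γ * (s * s′))
            ≡⟨ lem₂ (q * q * n) Γ (s * s′) ⟩
          q * q * n * (80 * Γ) * (s * s′)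
            ≤⟨ ℕ.*-monoˡ-≤ (s * s′) (ℕ.≤-trans (ℕ.*-monoʳ-≤ (q * q * n) 80Γ≤D) q²nD≤2m) ⟩
          2 * m * (s * s′)
            ≡⟨ ℕ.*-assoc 2 m (s * s′) ⟩
          2 * (m * (s * s′)) ∎)
          where
          open ℕ.≤-Reasoning
          lem₁ : ∀ q n N → 2 * (2 * q * (5 * n * N * (2 * (2 * q)))) ≡ 40 * (q * q * n) * (2 * N)
          lem₁ = solve-∀
          lem₂ : ∀ a g y → 40 * a * (2 * g * y) ≡ a * (80 * g) * y
          lem₂ = solve-∀
          lem₃ : ∀ s → s + s ≡ 2 * s
          lem₃ = solve-∀
          lem₄ : ∀ g s t → g * s * (t + t) ≡ 2 * g * (s * t)
          lem₄ = solve-∀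
          s≤s′ : s ≤ s′
          s≤s′ = ℕ.+-cancelˡ-≤ s _ _ (ℕ.≤-trans (ℕ.≤-reflexive (lem₃ s)) (ℕ.≤-trans 2s≤n (ℕ.≤-reflexive (sym s+s′≡n))))
          P≤ : P ≤ 2 * Γ * (s * s′)
          P≤ = ℕ.≤-trans P≤n² (ℕ.≤-trans (ℕ.*-mono-≤ (ℕ.<⇒≤ n<Γs) (ℕ.≤-trans (ℕ.≤-reflexive (sym s+s′≡n)) (ℕ.+-monoˡ-≤ s′ s≤s′)))
            (ℕ.≤-reflexive (lem₄ Γ s s′)))

      -- One half of `m` covers `t n`, since `K ≥ 2`, and the other half covers the tail, since
      -- `m₁ = 8 Q n D`.
      degree-exponent : ∀ {m t} → m₁ ≤ m → t * (K * n) ≤ m → (t + 4 * (Q * D)) * n ≤ m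
      degree-exponent {m} {t} m₁≤m ht = ℕ.*-cancelˡ-≤ 2 (begin
        2 * ((t + 4 * (Q * D)) * n)       ≡⟨ lem₁ t Q D n ⟩
        2 * (t * n) + 8 * Q * n * D       ≤⟨ ℕ.+-mono-≤ (ℕ.≤-trans (ℕ.≤-trans (ℕ.*-monoˡ-≤ (t * n) 2≤K) (ℕ.≤-reflexive (lem₂ K t n))) ht)
                                               (ℕ.≤-trans (ℕ.≤-reflexive (cong (λ z → z * n * D) (sym K≡))) m₁≤m) ⟩
        m + m                             ≡⟨ cong (m +_) (ℕ.+-identityʳ m) ⟨
        2 * m                             ∎)
        where
        open ℕ.≤-Reasoning
        lem₁ : ∀ t Q D n → 2 * ((t + 4 * (Q * D)) * n) ≡ 2 * (t * n) + 8 * Q * n * D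
        lem₁ = solve-∀
        lem₂ : ∀ K t n → K * (t * n) ≡ t * (K * n)
        lem₂ = solve-∀

-- Typical sequences and the probability that they fail.

module TypicalSequences where

  open import Defs
  open Rationals renaming (_^_ to infixr 8 _^ℚ_)
  open Distributions
  open Counting
  open Process
  open Concentration using (2ℚ)
  open Connectivity
  open Tails
  open TailEvents
  open Parameters
  open import Data.Fin.Base using (Fin; toℕ)
  open import Data.Fin.Subset using (Subset; ∣_∣)
  open import Data.Nat.Base using (ℕ; zero; suc; _∸_; _+_; _*_; _≤_; _<_; _^_; z≤n; s≤s; s≤s⁻¹)
  open import Data.Nat.Combinatorics using (_C_)
  open import Data.Nat.Tactic.RingSolver using (solve-∀)
  open import Data.Rational.Base using (ℚ; 0ℚ; 1ℚ; ½)
  open import Data.Vec.Base using (Vec; []; _∷_; lookup; tabulate)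
  open import Data.Vec.Properties using (lookup∘tabulate)
  open import Tactic.RingSolver using () renaming (solve-∀ to solve-∀-over)

  when : ∀ {A C : Set} {μ : Dist A} {δ} {E : A → Set} → 0ℚ ℚ.≤ δ → Dec C → (C → FailsWithin μ δ E) → FailsWithin μ δ (λ a → C → E a)
  when 0≤δ (yes c) f = weaken ℚ.≤-refl (λ _ e _ → e) (f c)
  when 0≤δ (no ¬c) f = weaken 0≤δ (λ _ e → e) (always (λ _ c → contradiction c ¬c))

  size-subset : ∀ {n} (X : Subset n) → size (lookup X) ≡ ∣ X ∣
  size-subset []          = refl
  size-subset (true ∷ X)  = cong suc (size-subset X)
  size-subset (false ∷ X) = size-subset X

  size-cong : ∀ {n} {S S′ : Fin n → Bool} → (∀ v → S v ≡ S′ v) → size S ≡ size S′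
  size-cong eq = sum-cong-≗ (λ v → cong 𝟙 (eq v))

  present-cong : ∀ {n} {F F′ : Pairs n} (G : Graph n) → (∀ a b → F a b ≡ F′ a b) → present F G ≡ present F′ G
  present-cong G eq = pairs-cong (λ a b _ → cong (_∧ adj G a b) (eq a b))

  deg-mono : ∀ {n} {G H : Graph n} → G ⊆ᴳ H → ∀ v → deg G v ≤ deg H v
  deg-mono {G = G} {H} G⊆H v = subst₂ _≤_ (sym (size-tabulate (adj G v))) (sym (size-tabulate (adj H v)))
    (size-mono {P = adj G v} {adj H v} (λ u h → T⇒≡ (G⊆H v u (≡⇒T h))))

  module Events (q Q K L Γ : ℕ) (20≤q : 20 ≤ q) (Q≡ : Q ≡ 12 * (q * q)) (K≡ : K ≡ 8 * Q)
    (L≡ : L ≡ 121 * (16 * K)) (Γ≡ : Γ ≡ 2 * 2 ^ L) where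

    open Numbers q Q K L Γ 20≤q Q≡ K≡ L≡ Γ≡ public

    1≤Q : 1 ≤ Q
    1≤Q = ℕ.≤-trans (ℕ.≤-trans 1≤q² (ℕ.m≤n*m (q * q) 12)) (ℕ.≤-reflexive (sym Q≡))

    module At {n D m₀ : ℕ} (lower : b ^ℚ (exponent * D) ℚ.≤ # n) (upper : # n ℚ.≤ b ^ℚ (exponent * suc D))
      (1536≤D : 1536 ≤ D) (80Γ≤D : 80 * Γ ≤ D) (2m₀≡ : 2 * m₀ ≡ (q * q + 5 * q) * n * D) where

      open Scale {n} {D} lower upper 1536≤D 80Γ≤D public

      c : ℕ
      c = K * n

      1≤c : 1 ≤ c
      1≤c = ℕ.*-mono-≤ 1≤K 1≤n

      half : ℕ → ℚ
      half k = ½ ^ℚ k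

      0≤half : ∀ k → 0ℚ ℚ.≤ half k
      0≤half k = 0≤^ k Two.0≤a

      #n≤ : # n ℚ.≤ 2ℚ ^ℚ (Q * D)
      #n≤ = ℚ.≤-trans (#-mono n≤2^) (ℚ.≤-reflexive (#-^ 2 (Q * D)))

      absorb : ∀ {x} a d e → x ℚ.≤ 2ℚ ^ℚ a → a + e ≤ d → x ℚ.* half d ℚ.≤ half e
      absorb {x} a d e h le = ℚ.≤-trans (*-monoʳ (half d) (0≤half d) h) (Two.move e (ℚ.≤-trans
        (ℚ.≤-reflexive (trans (swap (2ℚ ^ℚ a) (half d) (2ℚ ^ℚ e)) (cong (ℚ._* half d) (sym (^-homo-* 2ℚ a e))))) (Two.α^*a^≤1 le)))
        where
        swap : ∀ x y z → x ℚ.* y ℚ.* z ≡ (x ℚ.* z) ℚ.* y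
        swap = solve-∀-over ring

      -- `3 q³ (q + 2) = 3 q⁴ + 6 q³`, so `b^(−E)` is about `n^(−1 − 2/q)`.
      E : ℕ
      E = (q + 2) * (3 * (q * (q * q))) * D

      z : ℚ
      z = # q ^ℚ (3 * D) ℚ.* b⁻¹ ^ℚ E

      0≤z : 0ℚ ℚ.≤ z
      0≤z = 0≤* (0≤^ (3 * D) Q.0≤α) (0≤^ E B.0≤a)

      Unclustered : Fin n → Fin n → Fin n → Fin n → Vec (Graph n) (suc N) → Set
      Unclustered x a e d Gs = deg (at Gs m₀) a ≤ D → deg (at Gs m₀) e ≤ D → deg (at Gs m₀) d ≤ D →
        (∀ v → remove x (among a e d) v ≡ true → adj (at Gs m₁) x v ≡ true) → ⊥

      unclustered : ∀ x a e d → a ≢ e → a ≢ d → e ≢ d → ∀ {k} → size (remove x (among a e d)) ≡ k →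
               FailsWithin (process n) (z ℚ.* β₀ ^ℚ k) (Unclustered x a e d)
      unclustered x a e d a≢e a≢d e≢d refl = weaken (ℚ.≤-reflexive (sym (ℚ.*-assoc (# q ^ℚ (3 * D)) (b⁻¹ ^ℚ E) _))) (λ _ s → s)
        (Cluster.no-cluster q 2≤q β D E x a e d a≢e a≢d e≢d 2≤n 0≤β (m₀≤m₁ 2m₀≡) m₁≤N β₀≤1 2≤rest 6n≤N∸m₁ (cluster-exponent 2m₀≡))

      size-among : ∀ {a e d : Fin n} → a ≢ e → a ≢ d → e ≢ d → size (among a e d) ≡ 3
      size-among {a} {e} {d} a≢e a≢d e≢d = trans (sum-cong-≗ (λ v → sym (ℕ.*-identityʳ (𝟙 (among a e d v))))) (among-sum a≢e a≢d e≢d (λ _ → 1))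

      size-among-remove : ∀ {x a e d : Fin n} → a ≢ e → a ≢ d → e ≢ d → ∀ {p} → among a e d x ≡ p → size (remove x (among a e d)) + 𝟙 p ≡ 3
      size-among-remove {x} {a} {e} {d} a≢e a≢d e≢d refl = trans (size-remove x (among a e d)) (size-among a≢e a≢d e≢d)

      Distinct : Fin n → Fin n → Fin n → Set
      Distinct a e d = a ≢ e × a ≢ d × e ≢ d

      distinct? : ∀ a e d → Dec (Distinct a e d)
      distinct? a e d = ¬? (a Fin.≟ e) ×-dec ¬? (a Fin.≟ d) ×-dec ¬? (e Fin.≟ d)

      Outer Inner : Vec (Graph n) (suc N) → Set
      Outer Gs = ∀ x a e d → Distinct a e d × among a e d x ≡ false → Unclustered x a e d Gs
      Inner Gs = ∀ x a e → Distinct a e x → Unclustered x a e x Gs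

      outer : FailsWithin (process n) (# n ℚ.* (# n ℚ.* (# n ℚ.* (# n ℚ.* (z ℚ.* β₀ ^ℚ 3))))) Outer
      outer = forallFin n λ x → forallFin n λ a → forallFin n λ e → forallFin n λ d →
        when (0≤* 0≤z (0≤^ 3 0≤β₀)) (distinct? a e d ×-dec (among a e d x Bool.≟ false))
          λ ((a≢e , a≢d , e≢d) , out) → unclustered x a e d a≢e a≢d e≢d
            (trans (sym (ℕ.+-identityʳ _)) (size-among-remove {x} a≢e a≢d e≢d out))

      inner : FailsWithin (process n) (# n ℚ.* (# n ℚ.* (# n ℚ.* (z ℚ.* β₀ ^ℚ 2)))) Inner
      inner = forallFin n λ x → forallFin n λ a → forallFin n λ e →
        when (0≤* 0≤z (0≤^ 2 0≤β₀)) (distinct? a e x)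
          λ (a≢e , a≢x , e≢x) → unclustered x a e x a≢e a≢x e≢x
            (ℕ.suc-injective (trans (ℕ.+-comm 1 _) (size-among-remove {x} a≢e a≢x e≢x (member a e x))))
        where
        member : ∀ a e x → among a e x x ≡ true
        member a e x = trans (cong (λ y → does (a Fin.≟ x) ∨ (does (e Fin.≟ x) ∨ y)) (≟-refl x))
          (trans (cong (does (a Fin.≟ x) ∨_) (Bool.∨-zeroʳ (does (e Fin.≟ x)))) (Bool.∨-zeroʳ (does (a Fin.≟ x))))

      A₀ : ℕ
      A₀ = 2 ^ (6 * (q * q)) * (16 * K) ^ 3

      κ : ℚ
      κ = # (16 * K * D)

      1≤κ : 1ℚ ℚ.≤ κ
      1≤κ = #-mono {1} (ℕ.*-mono-≤ (ℕ.*-mono-≤ {1} {16} (s≤s z≤n) 1≤K) 1≤D)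

      -- `b^(−E)` is split into three: `b^(−3 q⁴ D)` cancels `n` up to a constant, one factor
      -- `b^(−h)` cancels `q^(3 D)`, and the other is the remaining gain.
      nz≤ : # n ℚ.* z ℚ.≤ 2ℚ ^ℚ (6 * (q * q)) ℚ.* half (3 * q * D)
      nz≤ = begin
        # n ℚ.* (Qp ℚ.* b⁻¹ ^ℚ E)
          ≡⟨ cong (λ k → # n ℚ.* (Qp ℚ.* b⁻¹ ^ℚ k)) (lem₁ q D) ⟩
        # n ℚ.* (Qp ℚ.* b⁻¹ ^ℚ (exponent * D + (h + h)))
          ≡⟨ cong (λ u → # n ℚ.* (Qp ℚ.* u)) (trans (^-homo-* b⁻¹ (exponent * D) (h + h)) (cong (b⁻¹ ^ℚ (exponent * D) ℚ.*_) (^-homo-* b⁻¹ h h))) ⟩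
        # n ℚ.* (Qp ℚ.* (b⁻¹ ^ℚ (exponent * D) ℚ.* (b⁻¹ ^ℚ h ℚ.* b⁻¹ ^ℚ h)))
          ≡⟨ lem₂ (# n) Qp (b⁻¹ ^ℚ (exponent * D)) (b⁻¹ ^ℚ h) ⟩
        (# n ℚ.* b⁻¹ ^ℚ (exponent * D)) ℚ.* ((Qp ℚ.* b⁻¹ ^ℚ h) ℚ.* b⁻¹ ^ℚ h)
          ≤⟨ *-mono (0≤* (0≤* (0≤^ (3 * D) Q.0≤α) 0≤bh) 0≤bh) (0≤^ (6 * (q * q)) Two.0≤α) first
               (*-mono 0≤bh 0≤1 second bh≤) ⟩
        2ℚ ^ℚ (6 * (q * q)) ℚ.* (1ℚ ℚ.* half (3 * q * D))
          ≡⟨ cong (2ℚ ^ℚ (6 * (q * q)) ℚ.*_) (ℚ.*-identityˡ (half (3 * q * D))) ⟩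
        2ℚ ^ℚ (6 * (q * q)) ℚ.* half (3 * q * D) ∎
        where
        open ℚ.≤-Reasoning
        h : ℕ
        h = q * q * (3 * q * D)
        Qp : ℚ
        Qp = # q ^ℚ (3 * D)
        0≤bh : 0ℚ ℚ.≤ b⁻¹ ^ℚ h
        0≤bh = 0≤^ h B.0≤a
        lem₁ : ∀ q D → (q + 2) * (3 * (q * (q * q))) * D ≡ 3 * (q * q * (q * q)) * D + (q * q * (3 * q * D) + q * q * (3 * q * D))
        lem₁ = solve-∀
        lem₂ : ∀ n p u v → n ℚ.* (p ℚ.* (u ℚ.* (v ℚ.* v))) ≡ (n ℚ.* u) ℚ.* ((p ℚ.* v) ℚ.* v)
        lem₂ = solve-∀-over ring
        lem₃ : ∀ s → s * (3 * s) ≡ 3 * (s * s)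
        lem₃ = solve-∀
        lem₄ : ∀ s → 2 * (3 * s) ≡ 6 * s
        lem₄ = solve-∀
        lem₅ : ∀ q D → q * (3 * D) ≡ 3 * q * D
        lem₅ = solve-∀
        bh≤ : b⁻¹ ^ℚ h ℚ.≤ half (3 * q * D)
        bh≤ = Two.move (3 * q * D) (ℚ.≤-trans (*-monoˡ (b⁻¹ ^ℚ h) 0≤bh (2^≤b^ (3 * q * D)))
          (ℚ.≤-reflexive (trans (ℚ.*-comm (b⁻¹ ^ℚ h) _) (B.α^*a^ h))))
        second : Qp ℚ.* b⁻¹ ^ℚ h ℚ.≤ 1ℚ
        second = ℚ.≤-trans (*-mono 0≤bh (0≤^ (3 * q * D) Two.0≤α)
            (ℚ.≤-trans (^-mono (3 * D) Q.0≤α (ℚ.≤-trans (#-mono (ℕ.<⇒≤ (n<2^n q))) (ℚ.≤-reflexive (#-^ 2 q))))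
              (ℚ.≤-reflexive (trans (^-assocʳ 2ℚ q (3 * D)) (cong (2ℚ ^ℚ_) (lem₅ q D))))) bh≤)
          (Two.α^*a^≤1 {3 * q * D} ℕ.≤-refl)
        first : # n ℚ.* b⁻¹ ^ℚ (exponent * D) ℚ.≤ 2ℚ ^ℚ (6 * (q * q))
        first = begin
          # n ℚ.* b⁻¹ ^ℚ (exponent * D)
            ≤⟨ *-monoʳ _ (0≤^ (exponent * D) B.0≤a) upper ⟩
          b ^ℚ (exponent * suc D) ℚ.* b⁻¹ ^ℚ (exponent * D)
            ≡⟨ cong (ℚ._* b⁻¹ ^ℚ (exponent * D)) (trans (cong (b ^ℚ_) (ℕ.*-suc exponent D)) (^-homo-* b exponent (exponent * D))) ⟩
          b ^ℚ exponent ℚ.* b ^ℚ (exponent * D) ℚ.* b⁻¹ ^ℚ (exponent * D)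
            ≡⟨ trans (ℚ.*-assoc (b ^ℚ exponent) _ _) (trans (cong (b ^ℚ exponent ℚ.*_) (B.α^*a^ (exponent * D))) (ℚ.*-identityʳ _)) ⟩
          b ^ℚ exponent
            ≡⟨ cong (b ^ℚ_) (lem₃ (q * q)) ⟨
          b ^ℚ (q * q * (3 * (q * q)))
            ≤⟨ b^≤2^ (3 * (q * q)) ⟩
          2ℚ ^ℚ (2 * (3 * (q * q)))
            ≡⟨ cong (2ℚ ^ℚ_) (lem₄ (q * q)) ⟩
          2ℚ ^ℚ (6 * (q * q)) ∎

      -- Using `D < 2^D`, the polynomial `κ³` costs only `2^(3 D)` beyond a constant, while the gain
      -- is `2^(−3 q D)`.
      nzκ³≤ : # n ℚ.* z ℚ.* κ ^ℚ 3 ℚ.≤ # A₀ ℚ.* half D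
      nzκ³≤ = begin
        # n ℚ.* z ℚ.* κ ^ℚ 3
          ≤⟨ *-mono (0≤^ 3 (0≤# (16 * K * D))) (0≤* (0≤^ (6 * (q * q)) Two.0≤α) (0≤half (3 * q * D))) nz≤ κ³≤ ⟩
        2ℚ ^ℚ (6 * (q * q)) ℚ.* half (3 * q * D) ℚ.* (# (16 * K) ^ℚ 3 ℚ.* 2ℚ ^ℚ (3 * D))
          ≡⟨ lem (2ℚ ^ℚ (6 * (q * q))) (half (3 * q * D)) (# (16 * K) ^ℚ 3) (2ℚ ^ℚ (3 * D)) ⟩
        2ℚ ^ℚ (6 * (q * q)) ℚ.* # (16 * K) ^ℚ 3 ℚ.* (2ℚ ^ℚ (3 * D) ℚ.* half (3 * q * D))
          ≤⟨ *-monoˡ (2ℚ ^ℚ (6 * (q * q)) ℚ.* # (16 * K) ^ℚ 3) (0≤* (0≤^ (6 * (q * q)) Two.0≤α) (0≤^ 3 (0≤# (16 * K))))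
               (absorb (3 * D) (3 * q * D) D ℚ.≤-refl 4D≤) ⟩
        2ℚ ^ℚ (6 * (q * q)) ℚ.* # (16 * K) ^ℚ 3 ℚ.* half D
          ≡⟨ cong (ℚ._* half D) (trans (#-* (2 ^ (6 * (q * q))) ((16 * K) ^ 3)) (cong₂ ℚ._*_ (#-^ 2 (6 * (q * q))) (#-^ (16 * K) 3))) ⟨
        # A₀ ℚ.* half D ∎
        where
        open ℚ.≤-Reasoning
        lem : ∀ a h k t → a ℚ.* h ℚ.* (k ℚ.* t) ≡ a ℚ.* k ℚ.* (t ℚ.* h)
        lem = solve-∀-over ring
        4D≤ : 3 * D + D ≤ 3 * q * D
        4D≤ = ℕ.≤-trans (ℕ.≤-reflexive (ℕ.+-comm (3 * D) D)) (ℕ.*-monoˡ-≤ D (ℕ.≤-trans (ℕ.≤-trans (from-yes (4 ℕ.≤? 20)) 20≤q) (ℕ.m≤n*m q 3)))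
        κ³≤ : κ ^ℚ 3 ℚ.≤ # (16 * K) ^ℚ 3 ℚ.* 2ℚ ^ℚ (3 * D)
        κ³≤ = ℚ.≤-trans (^-mono 3 (0≤# (16 * K * D)) (ℚ.≤-trans (ℚ.≤-reflexive (#-* (16 * K) D))
            (*-monoˡ (# (16 * K)) (0≤# (16 * K)) (ℚ.≤-trans (#-mono (ℕ.<⇒≤ (n<2^n D))) (ℚ.≤-reflexive (#-^ 2 D))))))
          (ℚ.≤-reflexive (trans (^-distrib-* (# (16 * K)) (2ℚ ^ℚ D) 3) (cong (# (16 * K) ^ℚ 3 ℚ.*_) (trans (^-assocʳ 2ℚ D 3) (cong (2ℚ ^ℚ_) (ℕ.*-comm D 3))))))

      -- Four free vertices and three edges regroup as `(n z) (n β₀)³`: one `n` is paid by the low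
      -- degrees, the others by the edges, whose expected number `n β₀` per vertex is of order `D`.
      outer≤ : # n ℚ.* (# n ℚ.* (# n ℚ.* (# n ℚ.* (z ℚ.* β₀ ^ℚ 3)))) ℚ.≤ # A₀ ℚ.* half D
      outer≤ = ℚ.≤-trans (ℚ.≤-reflexive (lem (# n) z β₀)) (ℚ.≤-trans
        (*-monoˡ (# n ℚ.* z) (0≤* (0≤# n) 0≤z) (^-mono 3 (0≤* (0≤# n) 0≤β₀) nβ₀≤)) nzκ³≤)
        where
        lem : ∀ n z b → n ℚ.* (n ℚ.* (n ℚ.* (n ℚ.* (z ℚ.* (b ℚ.* (b ℚ.* (b ℚ.* 1ℚ)))))))
                      ≡ n ℚ.* z ℚ.* ((n ℚ.* b) ℚ.* ((n ℚ.* b) ℚ.* ((n ℚ.* b) ℚ.* 1ℚ)))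
        lem = solve-∀-over ring

      inner≤ : # n ℚ.* (# n ℚ.* (# n ℚ.* (z ℚ.* β₀ ^ℚ 2))) ℚ.≤ # A₀ ℚ.* half D
      inner≤ = ℚ.≤-trans (ℚ.≤-reflexive (lem (# n) z β₀)) (ℚ.≤-trans
        (*-monoˡ (# n ℚ.* z) (0≤* (0≤# n) 0≤z) (ℚ.≤-trans (^-mono 2 (0≤* (0≤# n) 0≤β₀) nβ₀≤) (^-mono-exp 1≤κ (ℕ.n≤1+n 2)))) nzκ³≤)
        where
        lem : ∀ n z b → n ℚ.* (n ℚ.* (n ℚ.* (z ℚ.* (b ℚ.* (b ℚ.* 1ℚ)))))
                      ≡ n ℚ.* z ℚ.* ((n ℚ.* b) ℚ.* ((n ℚ.* b) ℚ.* 1ℚ))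
        lem = solve-∀-over ring

      Time : Set
      Time = Fin (suc N)

      time≤ : (m : Time) → toℕ m ≤ N
      time≤ m = s≤s⁻¹ (Fin.toℕ<n m)

      Late : ℕ → Set
      Late m = (q * q + 5 * q) * n * D ≤ 2 * m

      late? : ∀ m → Dec (Late m)
      late? m = ((q * q + 5 * q) * n * D) ℕ.≤? 2 * m

      DegreeAt : Time → Fin n → Vec (Graph n) (suc N) → Set
      DegreeAt m v Gs = m₁ ≤ toℕ m → toℕ m ≤ c * deg (at Gs (toℕ m)) v

      SparseAt ExpandAt : Time → Subset n → Vec (Graph n) (suc N) → Set
      SparseAt m X Gs = Late (toℕ m) × 1 ≤ size (lookup X) × Γ * size (lookup X) ≤ n →
        8 * c * present (internal (lookup X)) (at Gs (toℕ m)) < toℕ m * size (lookup X)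
      ExpandAt m X Gs = Late (toℕ m) × n < Γ * size (lookup X) × 2 * size (lookup X) ≤ n →
        q * (2 * present (internal (lookup X)) (at Gs (toℕ m)))
        < (q + 2) * present (cut (lookup X)) (at Gs (toℕ m)) + 2 * (2 * present (internal (lookup X)) (at Gs (toℕ m)))

      Degrees Sparse Expand : Vec (Graph n) (suc N) → Set
      Degrees Gs = ∀ m v → DegreeAt m v Gs
      Sparse  Gs = ∀ m X → SparseAt m X Gs
      Expand  Gs = ∀ m X → ExpandAt m X Gs

      degree-at : ∀ m v → FailsWithin (process n) (half (4 * (Q * D))) (DegreeAt m v)
      degree-at m v = when (0≤half (4 * (Q * D))) (m₁ ℕ.≤? toℕ m) λ m₁≤m → by m₁≤m (floor (toℕ m) c 1≤c)
        where
        by : m₁ ≤ toℕ m → ∃[ t ] (t * c ≤ toℕ m × (∀ x → t < x → toℕ m < x * c)) →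
             FailsWithin (process n) (half (4 * (Q * D))) (λ Gs → toℕ m ≤ c * deg (at Gs (toℕ m)) v)
        by m₁≤m (t , ht , above) = weaken ℚ.≤-refl
          (λ Gs t< → ℕ.≤-trans (ℕ.<⇒≤ (above (deg (at Gs (toℕ m)) v) t<)) (ℕ.≤-reflexive (ℕ.*-comm (deg (at Gs (toℕ m)) v) c)))
          (large-degree v t (4 * (Q * D)) 2≤n (time≤ m) (degree-exponent {t = t} m₁≤m ht))

      degrees : FailsWithin (process n) (# (suc N) ℚ.* (# n ℚ.* half (4 * (Q * D)))) Degrees
      degrees = forallFin (suc N) {# n ℚ.* half (4 * (Q * D))} {λ m Gs → ∀ v → DegreeAt m v Gs}
        (λ m → forallFin n {half (4 * (Q * D))} {DegreeAt m} (degree-at m))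

      -- The bound decays by `2^(−Q D) ≤ 1/n` for each element of `X`, so summing over all `X`
      -- multiplies `2^(−4 Q D)` by at most `(1 + 1/n)^n ≤ 4`.
      sparse-at : ∀ m X → FailsWithin (process n) (half (4 * (Q * D)) ℚ.* half (Q * D) ^ℚ ∣ X ∣) (SparseAt m X)
      sparse-at m X = when (0≤* (0≤half (4 * (Q * D))) (0≤^ ∣ X ∣ (0≤half (Q * D))))
        (late? (toℕ m) ×-dec (1 ℕ.≤? x) ×-dec (Γ * x ℕ.≤? n))
        λ h → by h (ceiling (toℕ m * x) (8 * c) (ℕ.*-mono-≤ {1} {8} (s≤s z≤n) 1≤c))
        where
        x : ℕ
        x = size (lookup X)
        bound : half (4 * (Q * D) + Q * D * x) ≡ half (4 * (Q * D)) ℚ.* half (Q * D) ^ℚ ∣ X ∣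
        bound = trans (^-homo-* ½ (4 * (Q * D)) (Q * D * x)) (cong (half (4 * (Q * D)) ℚ.*_)
          (trans (sym (^-assocʳ ½ (Q * D) x)) (cong (half (Q * D) ^ℚ_) (size-subset X))))
        by : Late (toℕ m) × 1 ≤ x × Γ * x ≤ n →
             ∃[ t ] (toℕ m * x ≤ t * (8 * c) × (∀ e → e < t → 8 * c * e < toℕ m * x)) →
             FailsWithin (process n) (half (4 * (Q * D)) ℚ.* half (Q * D) ^ℚ ∣ X ∣)
               (λ Gs → 8 * c * present (internal (lookup X)) (at Gs (toℕ m)) < toℕ m * x)
        by (late , 1≤x , Γx≤n) (t , ht , below) = weaken (ℚ.≤-reflexive bound)
          (λ Gs → below (present (internal (lookup X)) (at Gs (toℕ m))))
          (few-internal (lookup X) t (4 * (Q * D) + Q * D * x) L 2≤n (time≤ m) (sparse-exponent late 1≤x Γx≤n ht))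

      sparse : FailsWithin (process n) (# (suc N) ℚ.* (half (4 * (Q * D)) ℚ.* (1ℚ ℚ.+ half (Q * D)) ^ℚ n)) Sparse
      sparse = forallFin (suc N) {half (4 * (Q * D)) ℚ.* (1ℚ ℚ.+ half (Q * D)) ^ℚ n} {λ m Gs → ∀ X → SparseAt m X Gs}
        (λ m → forallSubset n {half (4 * (Q * D))} {half (Q * D)} {SparseAt m} (sparse-at m))

      5≤2q : 5 ≤ 2 * q
      5≤2q = ℕ.≤-trans (ℕ.≤-trans (from-yes (5 ℕ.≤? 20)) 20≤q) (ℕ.m≤n*m q 2)

      -- At `k = 2 q` the deviations are the factors `(q + 2)/q` above and `(q − 2)/q` below the
      -- mean. Their quotient is exactly the one in `expand`.
      expands : ∀ {e cutE M} → (2 * N * (2 * q)) * e < M * (2 * q + 4) → M * (2 * q ∸ 4) < cutE * (N * (2 * q)) →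
                q * (2 * e) < (q + 2) * cutE + 2 * (2 * e)
      expands {e} {cutE} {M} few many = ℕ.≰⇒> λ bad → go q refl (ℕ.≤-trans (from-yes (2 ℕ.≤? 20)) 20≤q) bad
        where
        go : ∀ q′ → q′ ≡ q → 2 ≤ q′ → (q + 2) * cutE + 2 * (2 * e) ≤ q * (2 * e) → ⊥
        go (suc zero) _ (s≤s ()) _
        go (suc (suc u)) refl _ bad = ℕ.<-irrefl refl (begin-strict
          (u + 4) * (M * (2 * q ∸ 4))          <⟨ ℕ.*-monoʳ-< (u + 4) {{ℕ.>-nonZero (ℕ.≤-trans (s≤s z≤n) (ℕ.m≤n+m 4 u))}} many ⟩
          (u + 4) * (cutE * (N * (2 * q)))     ≡⟨ lem₁ (u + 4) cutE (N * (2 * q)) ⟩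
          (u + 4) * cutE * (N * (2 * q))       ≤⟨ ℕ.*-monoˡ-≤ (N * (2 * q)) cut≤ ⟩
          2 * u * e * (N * (2 * q))            ≡⟨ lem₂ u e N q ⟩
          u * ((2 * N * (2 * q)) * e)          ≤⟨ ℕ.*-monoʳ-≤ u (ℕ.<⇒≤ few) ⟩
          u * (M * (2 * q + 4))                ≡⟨ lem₃ u M ⟩
          (u + 4) * (M * (2 * u))              ≡⟨ cong (λ k → (u + 4) * (M * k)) (sym 2q-4) ⟩
          (u + 4) * (M * (2 * q ∸ 4))          ∎)
          where
          open ℕ.≤-Reasoning
          lem₁ : ∀ a b c → a * (b * c) ≡ a * b * c
          lem₁ = solve-∀
          lem₂ : ∀ u e N q → 2 * u * e * (N * (2 * q)) ≡ u * ((2 * N * (2 * q)) * e)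
          lem₂ = solve-∀
          lem₃ : ∀ u M → u * (M * (2 * suc (suc u) + 4)) ≡ (u + 4) * (M * (2 * u))
          lem₃ = solve-∀
          lem₄ : ∀ u → 2 * suc (suc u) ≡ 4 + 2 * u
          lem₄ = solve-∀
          lem₅ : ∀ u e → suc (suc u) * (2 * e) ≡ 2 * u * e + 2 * (2 * e)
          lem₅ = solve-∀
          lem₆ : ∀ u x → (suc (suc u) + 2) * x ≡ (u + 4) * x
          lem₆ = solve-∀
          2q-4 : 2 * q ∸ 4 ≡ 2 * u
          2q-4 = trans (cong (_∸ 4) (lem₄ u)) (ℕ.m+n∸m≡n 4 (2 * u))
          cut≤ : (u + 4) * cutE ≤ 2 * u * e
          cut≤ = ℕ.+-cancelʳ-≤ (2 * (2 * e)) _ _ (ℕ.≤-trans (ℕ.≤-reflexive (cong (_+ 2 * (2 * e)) (sym (lem₆ u cutE)))) (ℕ.≤-trans bad (ℕ.≤-reflexive (lem₅ u e))))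

      -- The weight `5 n` pays `2 n` for the times, `n` for the subsets and `n` for the final
      -- `2^(−D)`, with one `n` to spare. The sum over subsets uses the trivial base `1`.
      expand-at : ∀ m X → FailsWithin (process n) ((half (5 * n) ℚ.+ half (5 * n)) ℚ.* 1ℚ ^ℚ ∣ X ∣) (ExpandAt m X)
      expand-at m X = weaken (ℚ.≤-reflexive unit) (λ _ e → e)
        (when (0≤+ (0≤half (5 * n)) (0≤half (5 * n)))
          (late? (toℕ m) ×-dec (suc n ℕ.≤? Γ * size S) ×-dec (2 * size S ℕ.≤? n))
          λ h → by h (ceiling (M * (2 * q + 4)) (2 * N * (2 * q)) (ℕ.*-mono-≤ (ℕ.*-mono-≤ {1} {2} (s≤s z≤n) 1≤N) 1≤2q))
                     (floor (M * (2 * q ∸ 4)) (N * (2 * q)) (ℕ.*-mono-≤ 1≤N 1≤2q)))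
        where
        S : Fin n → Bool
        S = lookup X
        M : ℕ
        M = toℕ m * (size S * size (not ∘ S))
        1≤2q : 1 ≤ 2 * q
        1≤2q = ℕ.≤-trans (s≤s z≤n) 5≤2q
        lem₁ : ∀ t N q → t * (2 * N * (2 * q)) ≡ t * N * (2 * (2 * q))
        lem₁ = solve-∀
        unit : half (5 * n) ℚ.+ half (5 * n) ≡ (half (5 * n) ℚ.+ half (5 * n)) ℚ.* 1ℚ ^ℚ ∣ X ∣
        unit = sym (trans (cong ((half (5 * n) ℚ.+ half (5 * n)) ℚ.*_) (1^ ∣ X ∣)) (ℚ.*-identityʳ (half (5 * n) ℚ.+ half (5 * n))))
        by : Late (toℕ m) × n < Γ * size S × 2 * size S ≤ n →
             ∃[ t ] (M * (2 * q + 4) ≤ t * (2 * N * (2 * q)) × (∀ e → e < t → 2 * N * (2 * q) * e < M * (2 * q + 4))) →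
             ∃[ t ] (t * (N * (2 * q)) ≤ M * (2 * q ∸ 4) × (∀ x → t < x → M * (2 * q ∸ 4) < x * (N * (2 * q)))) →
             FailsWithin (process n) (half (5 * n) ℚ.+ half (5 * n)) (λ Gs →
               q * (2 * present (internal S) (at Gs (toℕ m))) < (q + 2) * present (cut S) (at Gs (toℕ m)) + 2 * (2 * present (internal S) (at Gs (toℕ m))))
        by (late , n<Γs , 2s≤n) (t , ht , below) (t′ , ht′ , above) = weaken ℚ.≤-refl
          (λ Gs (f , g) → expands {present (internal S) (at Gs (toℕ m))} {present (cut S) (at Gs (toℕ m))} {M}
            (below (present (internal S) (at Gs (toℕ m))) f) (above (present (cut S) (at Gs (toℕ m))) g))
          (both (Near.few-internal-half (2 * q) 5≤2q S t (5 * n) 2≤n (time≤ m) 2s≤n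
                   (ℕ.≤-trans ht (ℕ.≤-reflexive (lem₁ t N q))) hw)
                (Near.many-cut (2 * q) 5≤2q S t′ (5 * n) 2≤n (time≤ m)
                   (ℕ.≤-trans (ℕ.≤-reflexive (ℕ.*-assoc t′ N (2 * q))) ht′)
                   (ℕ.≤-trans (ℕ.*-monoʳ-≤ (2 * q) (ℕ.*-monoʳ-≤ (5 * n * N) (ℕ.m≤n*m (2 * q) 2))) hw)))
          where
          hw : 2 * q * (5 * n * N * (2 * (2 * q))) ≤ toℕ m * (size S * size (not ∘ S))
          hw = expand-exponent {toℕ m} late (size-not S) n<Γs 2s≤n

      expand : FailsWithin (process n) (# (suc N) ℚ.* ((half (5 * n) ℚ.+ half (5 * n)) ℚ.* (1ℚ ℚ.+ 1ℚ) ^ℚ n)) Expand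
      expand = forallFin (suc N) {(half (5 * n) ℚ.+ half (5 * n)) ℚ.* (1ℚ ℚ.+ 1ℚ) ^ℚ n} {λ m Gs → ∀ X → ExpandAt m X Gs}
        (λ m → forallSubset n {half (5 * n) ℚ.+ half (5 * n)} {1ℚ} {ExpandAt m} (expand-at m))

      #N≤ : # (suc N) ℚ.≤ 2ℚ ^ℚ (2 * (Q * D))
      #N≤ = ℚ.≤-trans (#-mono N<n²) (ℚ.≤-trans (ℚ.≤-reflexive (#-* n n)) (ℚ.≤-trans (*-mono (0≤# n) (0≤^ (Q * D) Two.0≤α) #n≤ #n≤)
        (ℚ.≤-reflexive (trans (sym (^-homo-* 2ℚ (Q * D) (Q * D))) (cong (λ k → 2ℚ ^ℚ (Q * D + k)) (sym (ℕ.+-identityʳ (Q * D))))))))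

      D≤QD : D ≤ Q * D
      D≤QD = ℕ.m≤n*m D Q {{ℕ.>-nonZero 1≤Q}}

      degrees≤ : # (suc N) ℚ.* (# n ℚ.* half (4 * (Q * D))) ℚ.≤ half D
      degrees≤ = ℚ.≤-trans (ℚ.≤-reflexive (sym (ℚ.*-assoc (# (suc N)) (# n) (half (4 * (Q * D))))))
        (absorb (2 * (Q * D) + Q * D) (4 * (Q * D)) D
          (ℚ.≤-trans (*-mono (0≤# n) (0≤^ (2 * (Q * D)) Two.0≤α) #N≤ #n≤) (ℚ.≤-reflexive (sym (^-homo-* 2ℚ (2 * (Q * D)) (Q * D)))))
          (ℕ.≤-trans (ℕ.+-monoʳ-≤ (2 * (Q * D) + Q * D) D≤QD) (ℕ.≤-reflexive (lem (Q * D)))))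
        where
        lem : ∀ w → 2 * w + w + w ≡ 4 * w
        lem = solve-∀

      sparse≤ : # (suc N) ℚ.* (half (4 * (Q * D)) ℚ.* (1ℚ ℚ.+ half (Q * D)) ^ℚ n) ℚ.≤ # 4 ℚ.* half D
      sparse≤ = begin
        # (suc N) ℚ.* (half (4 * (Q * D)) ℚ.* (1ℚ ℚ.+ half (Q * D)) ^ℚ n)
          ≤⟨ *-monoˡ (# (suc N)) (0≤# (suc N)) (*-monoˡ (half (4 * (Q * D))) (0≤half (4 * (Q * D)))
               (compound≤4 n 1≤n (0≤half (Q * D)) (ℚ.≤-trans (*-monoʳ (half (Q * D)) (0≤half (Q * D)) #n≤) (Two.α^*a^≤1 {Q * D} ℕ.≤-refl)))) ⟩
        # (suc N) ℚ.* (half (4 * (Q * D)) ℚ.* # 4)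
          ≡⟨ lem (# (suc N)) (half (4 * (Q * D))) (# 4) ⟩
        # 4 ℚ.* (# (suc N) ℚ.* half (4 * (Q * D)))
          ≤⟨ *-monoˡ (# 4) (0≤# 4) (absorb (2 * (Q * D)) (4 * (Q * D)) D #N≤
               (ℕ.≤-trans (ℕ.+-monoʳ-≤ (2 * (Q * D)) D≤QD) (ℕ.≤-trans (ℕ.m≤m+n _ (Q * D)) (ℕ.≤-reflexive (lem₂ (Q * D)))))) ⟩
        # 4 ℚ.* half D ∎
        where
        open ℚ.≤-Reasoning
        lem : ∀ a b c → a ℚ.* (b ℚ.* c) ≡ c ℚ.* (a ℚ.* b)
        lem = solve-∀-over ring
        lem₂ : ∀ w → 2 * w + w + w ≡ 4 * w
        lem₂ = solve-∀

      expand≤ : # (suc N) ℚ.* ((half (5 * n) ℚ.+ half (5 * n)) ℚ.* (1ℚ ℚ.+ 1ℚ) ^ℚ n) ℚ.≤ # 2 ℚ.* half D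
      expand≤ = begin
        # (suc N) ℚ.* ((half (5 * n) ℚ.+ half (5 * n)) ℚ.* 2ℚ ^ℚ n)
          ≡⟨ lem (# (suc N)) (half (5 * n)) (2ℚ ^ℚ n) ⟩
        (1ℚ ℚ.+ 1ℚ) ℚ.* ((# (suc N) ℚ.* 2ℚ ^ℚ n) ℚ.* half (5 * n))
          ≤⟨ *-monoˡ 2ℚ Two.0≤α (absorb (2 * n + n) (5 * n) D
               (ℚ.≤-trans (*-monoʳ (2ℚ ^ℚ n) (0≤^ n Two.0≤α) N≤) (ℚ.≤-reflexive (sym (^-homo-* 2ℚ (2 * n) n))))
               (ℕ.≤-trans (ℕ.+-monoʳ-≤ (2 * n + n) (ℕ.<⇒≤ D<n)) (ℕ.≤-trans (ℕ.m≤m+n _ n) (ℕ.≤-reflexive (lem₂ n))))) ⟩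
        2ℚ ℚ.* half D ∎
        where
        open ℚ.≤-Reasoning
        lem : ∀ a b c → a ℚ.* ((b ℚ.+ b) ℚ.* c) ≡ (1ℚ ℚ.+ 1ℚ) ℚ.* ((a ℚ.* c) ℚ.* b)
        lem = solve-∀-over ring
        lem₂ : ∀ n → 2 * n + n + n + n ≡ 5 * n
        lem₂ = solve-∀
        n≤ : # n ℚ.≤ 2ℚ ^ℚ n
        n≤ = ℚ.≤-trans (#-mono (ℕ.<⇒≤ (n<2^n n))) (ℚ.≤-reflexive (#-^ 2 n))
        N≤ : # (suc N) ℚ.≤ 2ℚ ^ℚ (2 * n)
        N≤ = ℚ.≤-trans (#-mono N<n²) (ℚ.≤-trans (ℚ.≤-reflexive (#-* n n)) (ℚ.≤-trans (*-mono (0≤# n) (0≤^ n Two.0≤α) n≤ n≤)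
          (ℚ.≤-reflexive (trans (sym (^-homo-* 2ℚ n n)) (cong (λ k → 2ℚ ^ℚ (n + k)) (sym (ℕ.+-identityʳ n)))))))

      Typical : Vec (Graph n) (suc N) → Set
      Typical Gs = (Outer Gs × Inner Gs) × Degrees Gs × Sparse Gs × Expand Gs

      typical : FailsWithin (process n) (# (A₀ + A₀ + 7) ℚ.* half D) Typical
      typical = weaken
        (ℚ.≤-trans (ℚ.+-mono-≤ (ℚ.+-mono-≤ outer≤ inner≤) (ℚ.+-mono-≤ degrees≤ (ℚ.+-mono-≤ sparse≤ expand≤)))
          (ℚ.≤-reflexive (trans (lem (# A₀) (half D)) (cong (ℚ._* half D) (sym (trans (#-+ (A₀ + A₀) 7) (cong (ℚ._+ # 7) (#-+ A₀ A₀))))))))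
        (λ _ e → e)
        (both (both outer inner) (both degrees (both sparse expand)))
        where
        lem : ∀ a h → (a ℚ.* h ℚ.+ a ℚ.* h) ℚ.+ (h ℚ.+ (# 4 ℚ.* h ℚ.+ # 2 ℚ.* h)) ≡ (a ℚ.+ a ℚ.+ # 7) ℚ.* h
        lem = solve-∀-over ring

      module _ {Gs : Vec (Graph n) (suc N)} (increasing : Increasing Gs) (typ : Typical Gs) where

        private
          outer′   = proj₁ (proj₁ typ)
          inner′   = proj₂ (proj₁ typ)
          degrees′ = proj₁ (proj₂ typ)
          sparse′  = proj₁ (proj₂ (proj₂ typ))
          expand′  = proj₂ (proj₂ (proj₂ typ))

        module _ (m : Time) (late : Late (toℕ m)) where

          private
            G : Graph n
            G = at Gs (toℕ m)

            m₀≤m : m₀ ≤ toℕ m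
            m₀≤m = ℕ.*-cancelˡ-≤ 2 (ℕ.≤-trans (ℕ.≤-reflexive 2m₀≡) late)

            sparse″ : ∀ X → 1 ≤ size X → Γ * size X ≤ n → 8 * c * present (internal X) G < toℕ m * size X
            sparse″ X 1≤x Γx≤n = subst₂ (λ e s → 8 * c * e < toℕ m * s)
              (present-cong G (λ a b → cong₂ _∧_ (lookup∘tabulate X a) (lookup∘tabulate X b))) size≡
              (sparse′ m (tabulate X) (late , ℕ.≤-trans 1≤x (ℕ.≤-reflexive (sym size≡)) , ℕ.≤-trans (ℕ.≤-reflexive (cong (Γ *_) size≡)) Γx≤n))
              where
              size≡ : size (lookup (tabulate X)) ≡ size X
              size≡ = size-cong (lookup∘tabulate X)

            expand″ : ∀ S → n < Γ * size S → 2 * size S ≤ n →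
              q * (2 * present (internal S) G) < (q + 2) * present (cut S) G + 2 * (2 * present (internal S) G)
            expand″ S n<Γs 2s≤n = subst₂ (λ e d → q * (2 * e) < (q + 2) * d + 2 * (2 * e))
              (present-cong G (λ a b → cong₂ _∧_ (lookup∘tabulate S a) (lookup∘tabulate S b)))
              (present-cong G (λ a b → cong₂ Data.Bool.Base._xor_ (lookup∘tabulate S a) (lookup∘tabulate S b)))
              (expand′ m (tabulate S) (late , ℕ.≤-trans n<Γs (ℕ.≤-reflexive (cong (Γ *_) (sym size≡))) , ℕ.≤-trans (ℕ.≤-reflexive (cong (2 *_) size≡)) 2s≤n))
              where
              size≡ : size (lookup (tabulate S)) ≡ size S
              size≡ = size-cong (lookup∘tabulate S)

            -- Low means degree at most `D` at time `m₀`. Since `m₁ = c D` and degrees only grow,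
            -- other vertices satisfy `high` at every `m` up to `m₁`; edges only accumulate, so a
            -- cluster at time `m` persists to `m₁`, where it is excluded.
            early : toℕ m ≤ m₁ → Expanding q (toℕ m) c Γ G
            early m≤m₁ = record
              { low     = low
              ; high    = λ v h → ℕ.≤-trans m≤m₁ (ℕ.≤-trans (ℕ.*-monoʳ-≤ c (ℕ.<⇒≤ (ℕ.≰⇒> (high-sound v h))))
                            (ℕ.*-monoʳ-≤ c (deg-mono {G = at Gs m₀} {G} (at-mono Gs increasing m₀≤m) v)))
              ; cluster = λ x a e d a≢e a≢d e≢d la le ld xa xe → [ (λ { refl → inner-cluster x a e a≢e a≢d e≢d la le ld xa xe })
                                                               , outer-cluster x a e d a≢e a≢d e≢d la le ld xa xe ]′
              ; sparse  = sparse″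
              ; expand  = expand″
              }
              where
              low : Fin n → Bool
              low v = does (deg (at Gs m₀) v ℕ.≤? D)
              low-sound : ∀ v → low v ≡ true → deg (at Gs m₀) v ≤ D
              low-sound v h = by (deg (at Gs m₀) v ℕ.≤? D) h
                where
                by : (d : Dec (deg (at Gs m₀) v ≤ D)) → does d ≡ true → deg (at Gs m₀) v ≤ D
                by (yes p) _ = p
              high-sound : ∀ v → low v ≡ false → ¬ (deg (at Gs m₀) v ≤ D)
              high-sound v h = by (deg (at Gs m₀) v ℕ.≤? D) h
                where
                by : (d : Dec (deg (at Gs m₀) v ≤ D)) → does d ≡ false → ¬ (deg (at Gs m₀) v ≤ D)
                by (no ¬p) _ = ¬p
              later : ∀ {x v} → adj G x v ≡ true → adj (at Gs m₁) x v ≡ true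
              later {x} {v} xv = T⇒≡ (at-mono Gs increasing m≤m₁ x v (≡⇒T xv))
              cases : ∀ {a e d v} → among a e d v ≡ true → a ≡ v ⊎ e ≡ v ⊎ d ≡ v
              cases {a} {e} {d} {v} = by (a Fin.≟ v) (e Fin.≟ v) (d Fin.≟ v)
                where
                by : (p : Dec (a ≡ v)) (p′ : Dec (e ≡ v)) (p″ : Dec (d ≡ v)) →
                     does p ∨ (does p′ ∨ does p″) ≡ true → a ≡ v ⊎ e ≡ v ⊎ d ≡ v
                by (yes eq) _ _ _ = inj₁ eq
                by (no _) (yes eq) _ _ = inj₂ (inj₁ eq)
                by (no _) (no _) (yes eq) _ = inj₂ (inj₂ eq)
              inner-cluster : ∀ x a e → a ≢ e → a ≢ x → e ≢ x → low a ≡ true → low e ≡ true → low x ≡ true →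
                               adj G x a ≡ true → adj G x e ≡ true → ⊥
              inner-cluster x a e a≢e a≢x e≢x la le lx xa xe = inner′ x a e (a≢e , a≢x , e≢x)
                (low-sound a la) (low-sound e le) (low-sound x lx) λ v h →
                  let v∈ , x≢v = remove-sound x v {among a e x} h in
                  [ (λ { refl → later xa }) , [ (λ { refl → later xe }) , (λ x≡v → contradiction x≡v x≢v) ]′ ]′ (cases {a} {e} {x} v∈)
              outer-cluster : ∀ x a e d → a ≢ e → a ≢ d → e ≢ d → low a ≡ true → low e ≡ true → low d ≡ true →
                                adj G x a ≡ true → adj G x e ≡ true → adj G x d ≡ true → ⊥
              outer-cluster x a e d a≢e a≢d e≢d la le ld xa xe xd = outer′ x a e d ((a≢e , a≢d , e≢d) , Bool.¬-not out)
                (low-sound a la) (low-sound e le) (low-sound d ld) λ v h →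
                  neighbour v (proj₁ (remove-sound x v {among a e d} h))
                where
                neighbour : ∀ v → among a e d v ≡ true → adj (at Gs m₁) x v ≡ true
                neighbour v v∈ = [ (λ { refl → later xa }) , [ (λ { refl → later xe }) , (λ { refl → later xd }) ]′ ]′ (cases {a} {e} {d} v∈)
                -- Were `x` among its own low neighbours, it would be adjacent to itself in `G_m₁`;
                -- so the configuration really has three edges.
                out : among a e d x ≢ true
                out x∈ = contradiction (trans (sym (neighbour x x∈)) (irreflexive (at Gs m₁) x)) λ ()

            -- From `m₁` on the degree bound holds at every vertex, so an empty set of low vertices
            -- suffices.
            afterwards : m₁ ≤ toℕ m → Expanding q (toℕ m) c Γ G
            afterwards m₁≤m = record
              { low     = λ _ → false
              ; high    = λ v _ → degrees′ m v m₁≤m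
              ; cluster = λ _ _ _ _ _ _ _ ()
              ; sparse  = sparse″
              ; expand  = expand″
              }

          expanding : Expanding q (toℕ m) c Γ G
          expanding = [ early , afterwards ]′ (ℕ.≤-total (toℕ m) m₁)

-- The choice of `q` and of the scale `D`.

module Main where

  open import Defs
  open Rationals renaming (_^_ to infixr 8 _^ℚ_)
  open Distributions
  open Process
  open Concentration using (2ℚ)
  open Connectivity using (survives)
  open Tails using (module Two)
  open Logarithm
  open Parameters
  open TypicalSequences
  open import Data.Fin.Base using (Fin; toℕ)
  open import Data.List.Relation.Unary.All using (All)
  open import Data.Nat.Base using (ℕ; suc; _+_; _*_; _≤_; _^_; _⊔_; z≤n; s≤s)
  open import Data.Nat.Combinatorics using (_C_)
  open import Data.Nat.Tactic.RingSolver using (solve-∀)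
  open import Data.Rational.Base using (ℚ; 0ℚ; 1ℚ; ½; _/_)
  open import Data.Vec.Base using (lookup)
  open import Tactic.RingSolver using () renaming (solve-∀ to solve-∀-over)

  inverse-bound : ∀ {ε} M → 1 ≤ M → 1ℚ ℚ.≤ # M ℚ.* ε → # 10 ℚ.* inv (20 * M) ℚ.≤ ε
  inverse-bound {ε} M@(suc _) 1≤M h = begin
    # 10 ℚ.* inv (20 * M)                              ≤⟨ *-monoʳ (inv (20 * M)) (0≤inv (20 * M)) (#-mono {10} {20} (from-yes (10 ℕ.≤? 20))) ⟩
    # 20 ℚ.* inv (20 * M)                              ≡⟨ cong (ℚ._* inv (20 * M)) (ℚ.*-identityʳ (# 20)) ⟨
    # 20 ℚ.* 1ℚ ℚ.* inv (20 * M)                       ≤⟨ *-monoʳ (inv (20 * M)) (0≤inv (20 * M)) (*-monoˡ (# 20) (0≤# 20) h) ⟩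
    # 20 ℚ.* (# M ℚ.* ε) ℚ.* inv (20 * M)              ≡⟨ lem (# 20) (# M) ε (inv (20 * M)) ⟩
    ε ℚ.* (# 20 ℚ.* # M ℚ.* inv (20 * M))              ≡⟨ cong (λ z → ε ℚ.* (z ℚ.* inv (20 * M))) (#-* 20 M) ⟨
    ε ℚ.* (# (20 * M) ℚ.* inv (20 * M))                ≡⟨ cong (ε ℚ.*_) (#*inv′ {20 * M} (s≤s z≤n)) ⟩
    ε ℚ.* 1ℚ                                           ≡⟨ ℚ.*-identityʳ ε ⟩
    ε                                                  ∎
    where
    open ℚ.≤-Reasoning
    lem : ∀ t m e i → t ℚ.* (m ℚ.* e) ℚ.* i ≡ e ℚ.* (t ℚ.* m ℚ.* i)
    lem = solve-∀-over ring

  half-small : ∀ {δ} A M D → 1ℚ ℚ.≤ # M ℚ.* δ → A * M ≤ D → 0ℚ ℚ.≤ δ → # A ℚ.* ½ ^ℚ D ℚ.≤ δ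
  half-small {δ} A M D h AM≤D 0≤δ = begin
    # A ℚ.* ½ ^ℚ D                    ≡⟨ cong (ℚ._* ½ ^ℚ D) (ℚ.*-identityʳ (# A)) ⟨
    # A ℚ.* 1ℚ ℚ.* ½ ^ℚ D             ≤⟨ *-monoʳ (½ ^ℚ D) (0≤^ D Two.0≤a) (*-monoˡ (# A) (0≤# A) h) ⟩
    # A ℚ.* (# M ℚ.* δ) ℚ.* ½ ^ℚ D    ≡⟨ lem (# A) (# M) δ (½ ^ℚ D) ⟩
    δ ℚ.* (# A ℚ.* # M ℚ.* ½ ^ℚ D)    ≤⟨ *-monoˡ δ 0≤δ (*-monoʳ (½ ^ℚ D) (0≤^ D Two.0≤a) (ℚ.≤-trans (ℚ.≤-reflexive (sym (#-* A M)))
                                            (ℚ.≤-trans (#-mono (ℕ.≤-trans AM≤D (ℕ.<⇒≤ (n<2^n D)))) (ℚ.≤-reflexive (#-^ 2 D))))) ⟩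
    δ ℚ.* (2ℚ ^ℚ D ℚ.* ½ ^ℚ D)        ≡⟨ cong (δ ℚ.*_) (Two.α^*a^ D) ⟩
    δ ℚ.* 1ℚ                          ≡⟨ ℚ.*-identityʳ δ ⟩
    δ                                 ∎
    where
    open ℚ.≤-Reasoning
    lem : ∀ a m d h → a ℚ.* (m ℚ.* d) ℚ.* h ≡ d ℚ.* (a ℚ.* m ℚ.* h)
    lem = solve-∀-over ring

  module _ (M Q K L Γ : ℕ) (1≤M : 1 ≤ M) (Q≡ : Q ≡ 12 * (20 * M * (20 * M))) (K≡ : K ≡ 8 * Q)
    (L≡ : L ≡ 121 * (16 * K)) (Γ≡ : Γ ≡ 2 * 2 ^ L)
    (ε : ℝ) (N₀ : ℕ) (large : ∀ k → N₀ ≤ k → # 10 ℚ.* inv (20 * M) ℚ.≤ seq ε k) where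

    private
      -- A multiple of `20`: large enough for the numerical estimates, and even, so that
      -- `(q² + 5 q) n D / 2` is an integer.
      q : ℕ
      q = 20 * M

      20≤q : 20 ≤ q
      20≤q = ℕ.*-monoʳ-≤ 20 {1} {M} 1≤M

      module Ev = Events q Q K L Γ 20≤q Q≡ K≡ L≡ Γ≡

      4≤q : 4 ≤ q
      4≤q = ℕ.≤-trans (from-yes (4 ℕ.≤? 20)) 20≤q

      A : ℕ
      A = 2 ^ (6 * (q * q)) * (16 * K) ^ 3 + 2 ^ (6 * (q * q)) * (16 * K) ^ 3 + 7

    whp : WithHighProbability process (λ n Gs →
        (m : Fin (suc (n C 2))) →
        fromℚ (ℤ.+ 1 / 6) *ᴿ (fromℚ 1ℚ +ᴿ ε) *ᴿ fromℕ n *ᴿ log n ≤ᴿ fromℕ (toℕ m) →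
        ∀ V → IsGiant (lookup Gs m) V →
        Resilient (fromℚ ½ -ᴿ ε) connectivity (induced (lookup Gs m) V))
    whp δ 0<δ = suc (2 ^ (6 * (q * q) * D₀)) , λ n n-large → at-scale n n-large (scale n n-large)
      where
      Mδ D₀ : ℕ
      Mδ = proj₁ (archimedean 0<δ)
      -- Since `A * Mδ ≤ D < 2^D`, the last term brings the failure probability `A 2^(−D)` below
      -- `1 / Mδ ≤ δ`.
      D₀ = 1536 ⊔ (80 * Γ ⊔ A * Mδ)

      Bracket : ℕ → ℕ → Set
      Bracket n D = Ev.b ^ℚ (Ev.exponent * D) ℚ.≤ # n × # n ℚ.≤ Ev.b ^ℚ (Ev.exponent * suc D) × D₀ ≤ D

      -- The search ends because the power of `b` at `D = n` is at least `2^(3 q² n)`, which exceeds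
      -- `n`. By `growth`, a scale below `D₀` would make `n` too small.
      scale : ∀ n → suc (2 ^ (6 * (q * q) * D₀)) ≤ n → ∃[ D ] Bracket n D
      scale n n-large =
        let D , lower , ¬upper = search (λ k → Ev.b ^ℚ (Ev.exponent * k) ℚ.≤? # n)
              (subst (λ k → Ev.b ^ℚ k ℚ.≤ # n) (sym (ℕ.*-zeroʳ Ev.exponent)) (#-mono {1} (ℕ.≤-trans (s≤s z≤n) n-large)))
              n too-large
            upper = ℚ.<⇒≤ (ℚ.≰⇒> ¬upper)
        in D , lower , upper , ℕ.≮⇒≥ λ D<D₀ → ℕ.<⇒≱ n-large
             (ℕ.≤-trans (Ev.growth upper) (ℕ.^-monoʳ-≤ 2 (ℕ.*-monoʳ-≤ (6 * (q * q)) D<D₀)))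
        where
        too-large : Ev.b ^ℚ (Ev.exponent * n) ℚ.≤ # n → _
        too-large h = ℕ.<⇒≱ (n<2^n n) (ℕ.≤-trans (ℕ.^-monoʳ-≤ 2 (ℕ.m≤n*m n (3 * (q * q)) {{ℕ.>-nonZero (ℕ.*-mono-≤ {1} {3} (s≤s z≤n) Ev.1≤q²)}}))
          (#-cancel (ℚ.≤-trans (ℚ.≤-reflexive (#-^ 2 (3 * (q * q) * n))) (ℚ.≤-trans (Ev.2^≤b^ (3 * (q * q) * n))
            (ℚ.≤-trans (ℚ.≤-reflexive (cong (Ev.b ^ℚ_) (sym (Ev.exponent≡ n)))) h)))))

      m₀ : ℕ → ℕ → ℕ
      m₀ n D = (200 * (M * M) + 50 * M) * n * D

      2m₀≡ : ∀ n D → 2 * m₀ n D ≡ (q * q + 5 * q) * n * D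
      2m₀≡ n D = lem M n D
        where
        lem : ∀ M n D → 2 * ((200 * (M * M) + 50 * M) * n * D) ≡ (20 * M * (20 * M) + 5 * (20 * M)) * n * D
        lem = solve-∀

      at-scale : ∀ n → suc (2 ^ (6 * (q * q) * D₀)) ≤ n → ∃[ D ] Bracket n D → _
      at-scale n n-large (D , lower , upper , D₀≤D) = probAtLeast
        (weaken (half-small A Mδ D (proj₂ (proj₂ (archimedean 0<δ))) (ℕ.≤-trans (ℕ.m≤n⊔m (80 * Γ) (A * Mδ)) (ℕ.≤-trans (ℕ.m≤n⊔m 1536 (80 * Γ ⊔ A * Mδ)) D₀≤D)) (ℚ.<⇒≤ 0<δ))
          (λ _ e → e) Here.typical)
        increasing?
        (All.map (λ (0≤p , _ , inc) → 0≤p , inc) (law-process n (n C 2) ℕ.≤-refl))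
        (𝔼-process-1 n (n C 2) ℕ.≤-refl)
        (λ Gs inc typ m m-large V giant → subst (λ G → IsGiant G V → Resilient (fromℚ ½ -ᴿ ε) connectivity (induced G V)) (sym (lookup≡at Gs m))
          (λ giant H _ few →
            let late = threshold q 4≤q ε N₀ large {n} {D} {toℕ m} lower m-large in
            survives {{ℕ.>-nonZero Ev.1≤q}} (Here.8Kn≤m late) (Here.expanding inc typ m late) V (proj₁ giant) H
              (λ i → loss q 4≤q ε N₀ large (few i)))
          giant)
        where
        module Here = Ev.At {n} {D} {m₀ n D} lower upper (ℕ.≤-trans (ℕ.m≤m⊔n 1536 (80 * Γ ⊔ A * Mδ)) D₀≤D)
          (ℕ.≤-trans (ℕ.m≤m⊔n (80 * Γ) (A * Mδ)) (ℕ.≤-trans (ℕ.m≤n⊔m 1536 (80 * Γ ⊔ A * Mδ)) D₀≤D)) (2m₀≡ n D)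

  eventually : ∀ {ε : ℝ} {η N₀} → (∀ k → N₀ ≤ k → 0ℚ ℚ.+ η ℚ.≤ seq ε k) → ∀ M → 1 ≤ M → 1ℚ ℚ.≤ # M ℚ.* η →
               ∀ k → N₀ ≤ k → # 10 ℚ.* inv (20 * M) ℚ.≤ seq ε k
  eventually {ε} {η} η≤ε M 1≤M h k N₀≤k =
    ℚ.≤-trans (inverse-bound M 1≤M h) (subst (ℚ._≤ seq ε k) (ℚ.+-identityˡ η) (η≤ε k N₀≤k))

open import Defs
open import Data.Fin.Base using (Fin; toℕ)
open import Data.Integer.Base using (+_)
open import Data.Nat.Base using (ℕ; suc)
open import Data.Nat.Combinatorics using (_C_)
open import Data.Rational.Base using (0ℚ; 1ℚ; ½; _/_)
open import Data.Vec.Base using (lookup)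

theorem1p2 : (ε : ℝ) → fromℚ 0ℚ <ᴿ ε →
    WithHighProbability process (λ n Gs →
    (m : Fin (suc (n C 2))) →
    fromℚ (+ 1 / 6) *ᴿ (fromℚ 1ℚ +ᴿ ε) *ᴿ fromℕ n *ᴿ log n ≤ᴿ fromℕ (toℕ m) →
    ∀ V → IsGiant (lookup Gs m) V →
    Resilient (fromℚ ½ -ᴿ ε) connectivity (induced (lookup Gs m) V))
theorem1p2 ε (η , 0<η , N₀ , η≤ε) =
  let M , 1≤M , 1≤Mη = Logarithm.archimedean 0<η
  in Main.whp M _ _ _ _ 1≤M refl refl refl refl ε N₀ (Main.eventually {ε} η≤ε M 1≤M 1≤Mη)
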